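{- Let $q$ be a prime power and let $\mathcal{U}$ be a unital in the Desarguesian projective plane $\mathrm{PG}(2,q^2)$. Let $M$ be the group of projectivities of $\mathrm{PG}(2,q^2)$ (i.e. the subgroup of $\mathrm{PGL}(3,q^2)$) which preserve $\mathcal{U}$. If $\mathcal{U}$ has two distinct points $P,Q$ such that the stabiliser $G=M_{P,Q}$ (the subgroup of $M$ fixing both $P$ and $Q$) has order $q^2-1$, then $\mathcal{U}$ is classical.
   Context: A unital in $\mathrm{PG}(2,q^2)$ is a set of $q^3+1$ points meeting every line of $\mathrm{PG}(2,q^2)$ in either $1$ or $q+1$ points. A unital is classical (Hermitian) if it is the set of absolute points of a non-degenerate unitary polarity of $\mathrm{PG}(2,q^2)$, i.e. the set of $\mathrm{GF}(q^2)$-rational points of a non-degenerate Hermitian curve. -}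

module Defs where

open import Level using (0ℓ)
open import Data.Nat using (ℕ; zero; suc; _≥_; _^_) renaming (_+_ to _+ℕ_)
open import Data.Nat.Primality using (Prime)
open import Data.Fin using (Fin; zero; suc)
open import Data.Fin.Base using (toℕ)
open import Data.Vec using (Vec; []; _∷_; lookup; toList)
open import Data.List using (List; []; _∷_; _++_; map; concatMap; filter; length; allFin; concat)
open import Data.List.Relation.Unary.All using (All; all?)
open import Data.Sum using (_⊎_)
open import Data.Empty using (⊥-elim)
open import Data.Product using (Σ; _×_; _,_; ∃₂)
open import Relation.Nullary using (¬_; Dec; yes; no)
open import Relation.Nullary.Decidable using (¬?; _×-dec_)
open import Relation.Unary using (Pred; Decidable)
open import Relation.Binary.Definitions using (DecidableEquality)
open import Relation.Binary.PropositionalEquality using (_≡_; _≢_; refl; cong; cong₂)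
open import Algebra.Structures using (IsCommutativeRing)
open import Function.Bundles using (_↔_; _⇔_; mk⇔; Inverse; Equivalence)

IsPrimePower : ℕ → Set
IsPrimePower q = ∃₂ λ p k → Prime p × k ≥ 1 × q ≡ p ^ k

-- A finite field with exactly n elements (propositional equality).
-- Any such field with n = q^2 is (isomorphic to) GF(q^2).

record FiniteField (n : ℕ) : Set₁ where
  field
    Carrier    : Set
    _+_ _*_    : Carrier → Carrier → Carrier
    -_         : Carrier → Carrier
    0# 1#      : Carrier
    _⁻¹        : Carrier → Carrier
    isCommutativeRing : IsCommutativeRing _≡_ _+_ _*_ -_ 0# 1#
    0≢1        : 0# ≢ 1#
    ⁻¹-inverse : ∀ x → x ≢ 0# → x * (x ⁻¹) ≡ 1#
    _≟_        : DecidableEquality Carrier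
    enum       : Fin n ↔ Carrier

_⇔?_ : {A B : Set} → Dec A → Dec B → Dec (A ⇔ B)
yes a ⇔? yes b = yes (mk⇔ (λ _ → b) (λ _ → a))
yes a ⇔? no ¬b = no (λ e → ¬b (Equivalence.to e a))
no ¬a ⇔? yes b = no (λ e → ¬a (Equivalence.from e b))
no ¬a ⇔? no ¬b = yes (mk⇔ (λ a → ⊥-elim (¬a a)) (λ b → ⊥-elim (¬b b)))

vecsOver : {X : Set} → List X → (k : ℕ) → List (Vec X k)
vecsOver xs zero    = [] ∷ []
vecsOver xs (suc k) = concatMap (λ x → map (x ∷_) (vecsOver xs k)) xs

module _ {n : ℕ} (F : FiniteField n) where
  open FiniteField F
  private
    A = Carrier
    infixl 6 _⊕_
    infixl 7 _⊛_
    _⊕_ = _+_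
    _⊛_ = _*_

  elems : List A
  elems = map (Inverse.to enum) (allFin n)

  -- Points of PG(2,F), by their canonical homogeneous coordinates:
  --   pt₁ x y = (1 : x : y),  pt₂ x = (0 : 1 : x),  pt₃ = (0 : 0 : 1).
  data Point : Set where
    pt₁ : A → A → Point
    pt₂ : A → Point
    pt₃ : Point

  coords : Point → Fin 3 → A
  coords (pt₁ x y) zero = 1#
  coords (pt₁ x y) (suc zero) = x
  coords (pt₁ x y) (suc (suc zero)) = y
  coords (pt₂ x) zero = 0#
  coords (pt₂ x) (suc zero) = 1#
  coords (pt₂ x) (suc (suc zero)) = x
  coords pt₃ zero = 0#
  coords pt₃ (suc zero) = 0#
  coords pt₃ (suc (suc zero)) = 1#

  points : List Point
  points = concatMap (λ x → map (pt₁ x) elems) elems ++ map pt₂ elems ++ pt₃ ∷ []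

  _≟ₚ_ : DecidableEquality Point
  pt₁ x y ≟ₚ pt₁ x′ y′ with x ≟ x′ | y ≟ y′
  ... | yes refl | yes refl = yes refl
  ... | no ne | _ = no λ { refl → ne refl }
  ... | yes _ | no ne = no λ { refl → ne refl }
  pt₁ _ _ ≟ₚ pt₂ _ = no λ ()
  pt₁ _ _ ≟ₚ pt₃ = no λ ()
  pt₂ _ ≟ₚ pt₁ _ _ = no λ ()
  pt₂ x ≟ₚ pt₂ x′ with x ≟ x′
  ... | yes refl = yes refl
  ... | no ne = no λ { refl → ne refl }
  pt₂ _ ≟ₚ pt₃ = no λ ()
  pt₃ ≟ₚ pt₁ _ _ = no λ ()
  pt₃ ≟ₚ pt₂ _ = no λ ()
  pt₃ ≟ₚ pt₃ = yes refl

  sum3 : (Fin 3 → A) → A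
  sum3 f = f zero ⊕ f (suc zero) ⊕ f (suc (suc zero))

  -- Lines of PG(2,F) are given by canonical dual coordinates, i.e. again
  -- by elements of Point; line L is incident with point P iff L·P = 0.
  Line : Set
  Line = Point

  lines : List Line
  lines = points

  Incident : Line → Point → Set
  Incident L P = sum3 (λ i → coords L i ⊛ coords P i) ≡ 0#

  incident? : (L : Line) → Decidable (Incident L)
  incident? L P = sum3 (λ i → coords L i ⊛ coords P i) ≟ 0#

  normalize : (Fin 3 → A) → Point
  normalize v with v zero ≟ 0#
  ... | no _  = pt₁ (v (suc zero) ⊛ (v zero ⁻¹)) (v (suc (suc zero)) ⊛ (v zero ⁻¹))
  ... | yes _ with v (suc zero) ≟ 0#
  ...   | no _  = pt₂ (v (suc (suc zero)) ⊛ (v (suc zero) ⁻¹))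
  ...   | yes _ = pt₃

  Mat : Set
  Mat = Vec (Vec A 3) 3

  entry : Mat → Fin 3 → Fin 3 → A
  entry M i j = lookup (lookup M i) j

  det : Mat → A
  det M = a ⊛ (e ⊛ i ⊕ - (f ⊛ h)) ⊕ - (b ⊛ (d ⊛ i ⊕ - (f ⊛ g))) ⊕ c ⊛ (d ⊛ h ⊕ - (e ⊛ g))
    where
    a = entry M zero zero
    b = entry M zero (suc zero)
    c = entry M zero (suc (suc zero))
    d = entry M (suc zero) zero
    e = entry M (suc zero) (suc zero)
    f = entry M (suc zero) (suc (suc zero))
    g = entry M (suc (suc zero)) zero
    h = entry M (suc (suc zero)) (suc zero)
    i = entry M (suc (suc zero)) (suc (suc zero))

  act : Mat → Point → Point
  act M P = normalize (λ i → sum3 (λ j → entry M i j ⊛ coords P j))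

  -- Canonical representatives of the elements of PGL(3,F): a matrix is
  -- normalized when its first nonzero entry (row by row) equals 1.
  lead : List A → A
  lead [] = 0#
  lead (x ∷ xs) with x ≟ 0#
  ... | yes _ = lead xs
  ... | no _  = x

  entries : Mat → List A
  entries M = concat (map toList (toList M))

  Normalized : Mat → Set
  Normalized M = lead (entries M) ≡ 1#

  allMats : List Mat
  allMats = vecsOver (vecsOver elems 3) 3

  PointSet : Set₁
  PointSet = Pred Point 0ℓ

  lineCount : (S : PointSet) → Decidable S → Line → ℕ
  lineCount S S? L = length (filter (λ P → incident? L P ×-dec S? P) points)

  record IsUnital (q : ℕ) (U : PointSet) (U? : Decidable U) : Set where
    field
      size   : length (filter U? points) ≡ q ^ 3 +ℕ 1
      secant : ∀ L → lineCount U U? L ≡ 1 ⊎ lineCount U U? L ≡ q +ℕ 1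

  InStab : (U : PointSet) → Decidable U → Point → Point → Mat → Set
  InStab U U? P Q M =
    Normalized M × det M ≢ 0# × All (λ R → U R ⇔ U (act M R)) points
      × act M P ≡ P × act M Q ≡ Q

  inStab? : (U : PointSet) (U? : Decidable U) (P Q : Point) → Decidable (InStab U U? P Q)
  inStab? U U? P Q M =
    (lead (entries M) ≟ 1#) ×-dec ¬? (det M ≟ 0#)
      ×-dec all? (λ R → U? R ⇔? U? (act M R)) points
      ×-dec (act M P ≟ₚ P) ×-dec (act M Q ≟ₚ Q)

  stabOrder : (U : PointSet) → Decidable U → Point → Point → ℕ
  stabOrder U U? P Q = length (filter (inStab? U U? P Q) allMats)

  -- the involutory automorphism x ↦ x^q of GF(q²)
  pow : A → ℕ → A
  pow x zero = 1#
  pow x (suc k) = x ⊛ pow x k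

  IsHermitian : ℕ → Mat → Set
  IsHermitian q H = ∀ i j → entry H j i ≡ pow (entry H i j) q

  herm : ℕ → Mat → (Fin 3 → A) → A
  herm q H x = sum3 (λ i → sum3 (λ j → x i ⊛ entry H i j ⊛ pow (x j) q))

  IsClassical : ℕ → PointSet → Set
  IsClassical q U = Σ Mat λ H → IsHermitian q H × det H ≢ 0#
    × (∀ P → U P ⇔ herm q H (coords P) ≡ 0#)

{-# OPTIONS --safe #-}
module Submission where

-- Choose coordinates with P and Q on the line at infinity. The stabiliser of P and Q then consists of maps
-- (x, y) ↦ (ax + ξ, by + η), and it fixes the common point of the tangents at P and Q, which we take as origin.
-- Counting on the lines through the origin, the stabiliser contains (x, y) ↦ (ax, ay) exactly for the a of norm
-- N(a) = a^(q+1) = 1, and after a rescaling of y the points of U at infinity are those with slope in GF(q) ∪ {∞}.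
-- Hence U is given by N(x) = c(y/x) for a function c from F ∖ GF(q) to GF(q)*. The remaining lines y = αx + β say
-- that m ↦ c(m) N(m - α) takes each value in GF(q)* exactly q times if α ∈ GF(q), and exactly q + 1 times if
-- α ∉ GF(q), except for one value v(α) that is taken once.
--
-- Write z̄ = z^q. The polynomial ∏ (1 - c(m) N(m - z) Y) has no terms in Y^i for 0 < i < q - 1. Its logarithmic derivative in z
-- yields v(α) = c(ᾱ) N(ᾱ - α), and that the Fourier coefficient ∑ v(z) z^(-i) z̄^(-j) vanishes for 0 < i, j < q unless the
-- characteristic p divides both i and j. The conditions are invariant under (c , v) ↦ (1/v , 1/c), so 1/c has
-- the same sparse spectrum. Since v(z̄) / c(z) = - (z - z̄)², pairing the two functions shows that the coefficient (1, 0) of 1/c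
-- is not zero, hence 1/c is homogeneous of degree one over GF(q). Up to factors z and z̄, both functions are thus
-- polynomials in t = (z / z̄)^p whose product is a power of 1 - t, and therefore 1/c(z) = λ (z - z̄): the curve is
-- λ (x̄ y - x ȳ) = 1. For q = 2 this is immediate, since c is constant.

-- A polynomial is known here only through its values on the field, so a derivative can be inferred
-- only below degree q². The coefficients of Y^i with i < q obey this bound. That of Y^q, whose
-- values outside GF(q) are v, may have degree q(q+1); its derivative comes from the logarithmic
-- derivative instead, where it cancels because c(m) N(m - z), unless zero, has (q-1)-th power 1.
-- The vanishing coefficients are then integrals of derivatives, and the degree bound just misses
-- the index (1, 1). That one, and the mean value, come from the dual counts. The stabiliser yields
-- c(dm) = χ(d) c(m) on GF(q)* with an unknown multiplier; a nonzero coefficient (1, 0) is what pins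
-- it to 1/d. At the end z̄/z = t^(q/p), and by Frobenius (1 - t^(q/p))² is a power of the single
-- prime 1 - t, so that factors of degree at most q/p are forced. The identity is only known at the
-- q + 1 elements t of norm 1, which suffices as 2q/p ≤ q. For q = 2 the argument breaks down
-- because GF(q)* contains only 1, whose sum does not vanish.

-- Counting and iterated operations over duplicate-free lists

module ListCounting where

  open import Level using (Level)
  open import Algebra.Bundles using (CommutativeMonoid)
  open import Data.Nat using (ℕ; zero; suc; _≤_; z≤n; s≤s) renaming (_+_ to _+ℕ_; _*_ to _*ℕ_)
  import Data.Nat.Properties as ℕₚ
  open import Data.List using (List; []; _∷_; _++_; map; filter; length)
  import Data.List.Properties as Listₚ
  open import Data.List.Membership.Propositional using (_∈_; _∉_)
  open import Data.List.Membership.Propositional.Properties using (∈-map⁻; ∈-filter⁺; ∈-filter⁻; ∈-++⁺ˡ; ∈-++⁺ʳ; ∈-++⁻; ∈-∃++)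
  open import Data.List.Relation.Unary.Any using (here; there)
  open import Data.List.Relation.Unary.All as All using (All; []; _∷_)
  import Data.List.Relation.Unary.All.Properties as Allₚ
  open import Data.List.Relation.Unary.AllPairs using ([]; _∷_)
  open import Data.List.Relation.Unary.Unique.Propositional using (Unique)
  import Data.List.Relation.Unary.Unique.Propositional.Properties as Uniqₚ
  open import Data.Product using (∃; _×_; _,_; proj₁; proj₂)
  open import Data.Sum using (_⊎_; inj₁; inj₂)
  open import Data.Empty using (⊥-elim)
  open import Relation.Nullary using (Dec; yes; no)
  open import Relation.Unary using (Pred; Decidable)
  open import Relation.Binary.PropositionalEquality using (_≡_; _≢_; refl; sym; trans; cong; subst)
  open import Relation.Binary.Definitions using (DecidableEquality)

  private
    variable
      X Y : Set

  remove-mid : ∀ (x : X) ys₁ ys₂ {y} → y ≢ x → y ∈ ys₁ ++ x ∷ ys₂ → y ∈ ys₁ ++ ys₂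
  remove-mid x ys₁ ys₂ y≢x y∈ with ∈-++⁻ ys₁ y∈
  ... | inj₁ l = ∈-++⁺ˡ l
  ... | inj₂ (here e) = ⊥-elim (y≢x e)
  ... | inj₂ (there r) = ∈-++⁺ʳ ys₁ r

  unique-head∉ : {x : X} {xs : List X} → Unique (x ∷ xs) → x ∉ xs
  unique-head∉ (a ∷ _) x∈ = All.lookup a x∈ refl

  unique-tail : {x : X} {xs : List X} → Unique (x ∷ xs) → Unique xs
  unique-tail (_ ∷ u) = u

  -- Induction on `xs`: the head occurs in `ys`, and deleting that occurrence leaves the tail still
  -- included.
  length-⊆ : {xs ys : List X} → Unique xs → (∀ {z} → z ∈ xs → z ∈ ys) → length xs ≤ length ys
  length-⊆ {xs = []} u s = z≤n
  length-⊆ {xs = x ∷ xs} {ys} u s with ∈-∃++ (s (here refl))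
  ... | ys₁ , ys₂ , refl = subst (suc (length xs) ≤_) (sym len)
      (s≤s (length-⊆ (unique-tail u) (λ z∈ → remove-mid x ys₁ ys₂ (λ { refl → unique-head∉ u z∈ }) (s (there z∈)))))
    where
    len : length (ys₁ ++ x ∷ ys₂) ≡ suc (length (ys₁ ++ ys₂))
    len = trans (Listₚ.length-++ ys₁) (trans (ℕₚ.+-suc _ _) (cong suc (sym (Listₚ.length-++ ys₁))))

  module _ (_≟_ : DecidableEquality X) where
    open import Data.List.Membership.DecPropositional _≟_ using (_∈?_)

    -- Pigeonhole: a member of `ys` outside `xs` could be added to `xs`, giving a duplicate-free
    -- list that is too long. In this way an inclusion and a count become an equality, for instance
    -- between the homothety factors of the stabiliser and the elements of norm 1.
    ⊆-full : {xs ys : List X} → Unique xs → (∀ {z} → z ∈ xs → z ∈ ys) → length ys ≤ length xs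
           → ∀ {z} → z ∈ ys → z ∈ xs
    ⊆-full {xs} {ys} u s le {z} z∈ with z ∈? xs
    ... | yes p = p
    ... | no z∉ = ⊥-elim (ℕₚ.<-irrefl refl (ℕₚ.≤-trans (length-⊆ (Allₚ.¬Any⇒All¬ xs z∉ ∷ u) λ { (here refl) → z∈ ; (there m) → s m }) le))

  unique-map : {f : X → Y} {xs : List X} → Unique xs → (∀ {x y} → x ∈ xs → y ∈ xs → f x ≡ f y → x ≡ y) → Unique (map f xs)
  unique-map [] inj = []
  unique-map {f = f} {xs = x ∷ xs} (a ∷ u) inj =
    Allₚ.map⁺ (All.tabulate λ y∈ e → All.lookup a y∈ (inj (here refl) (there y∈) e)) ∷ unique-map u (λ p q → inj (there p) (there q))

  module _ {P : Pred X Level.zero} {Q : Pred Y Level.zero} (P? : Decidable P) (Q? : Decidable Q) where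

    count-inj : {xs : List X} {ys : List Y} → Unique xs → (f : X → Y)
      → (∀ {x} → x ∈ xs → P x → f x ∈ ys × Q (f x))
      → (∀ {x y} → x ∈ xs → y ∈ xs → P x → P y → f x ≡ f y → x ≡ y)
      → length (filter P? xs) ≤ length (filter Q? ys)
    count-inj {xs} {ys} u f m inj = subst (_≤ _) (Listₚ.length-map f (filter P? xs))
      (length-⊆ (unique-map (Uniqₚ.filter⁺ P? u) λ p q → inj (proj₁ (∈-filter⁻ P? p)) (proj₁ (∈-filter⁻ P? q)) (proj₂ (∈-filter⁻ P? {xs = xs} p)) (proj₂ (∈-filter⁻ P? {xs = xs} q)))
        λ z∈ → sub (∈-map⁻ f z∈))
      where
      sub : ∀ {z} → ∃ (λ x → x ∈ filter P? xs × z ≡ f x) → z ∈ filter Q? ys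
      sub (x , x∈ , refl) with ∈-filter⁻ P? {xs = xs} x∈
      ... | a , b = ∈-filter⁺ Q? (proj₁ (m a b)) (proj₂ (m a b))

  module _ {P : Pred X Level.zero} {Q : Pred Y Level.zero} (P? : Decidable P) (Q? : Decidable Q) where

    -- The maps need to be mutually inverse only where the predicates hold, so they may contain
    -- divisions that make sense only there.
    count-bij : {xs : List X} {ys : List Y} → Unique xs → Unique ys → (f : X → Y) (g : Y → X)
      → (∀ {x} → x ∈ xs → P x → f x ∈ ys × Q (f x) × g (f x) ≡ x)
      → (∀ {y} → y ∈ ys → Q y → g y ∈ xs × P (g y) × f (g y) ≡ y)
      → length (filter P? xs) ≡ length (filter Q? ys)
    count-bij ux uy f g fo ba = ℕₚ.≤-antisym
      (count-inj P? Q? ux f (λ x∈ px → proj₁ (fo x∈ px) , proj₁ (proj₂ (fo x∈ px)))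
         λ x∈ y∈ px py e → trans (sym (proj₂ (proj₂ (fo x∈ px)))) (trans (cong g e) (proj₂ (proj₂ (fo y∈ py)))))
      (count-inj Q? P? uy g (λ x∈ px → proj₁ (ba x∈ px) , proj₁ (proj₂ (ba x∈ px)))
         λ x∈ y∈ px py e → trans (sym (proj₂ (proj₂ (ba x∈ px)))) (trans (cong f e) (proj₂ (proj₂ (ba y∈ py)))))

  count-++ : {P : Pred X Level.zero} (P? : Decidable P) (xs ys : List X)
    → length (filter P? (xs ++ ys)) ≡ length (filter P? xs) +ℕ length (filter P? ys)
  count-++ P? xs ys = trans (cong length (Listₚ.filter-++ P? xs ys)) (Listₚ.length-++ (filter P? xs))

  ind : {A : Set} → Dec A → ℕ
  ind (yes _) = 1
  ind (no _) = 0

  -- One development serves sums of naturals, sums and products in the field, and products of power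
  -- series.
  module Big {c ℓ} (M : CommutativeMonoid c ℓ) where
    open CommutativeMonoid M renaming (refl to ≈refl; sym to ≈sym; trans to ≈trans)
    open import Relation.Binary.Reasoning.Setoid setoid
    open import Algebra.Properties.CommutativeSemigroup commutativeSemigroup using (interchange; x∙yz≈y∙xz)

    big : (X → Carrier) → List X → Carrier
    big f [] = ε
    big f (x ∷ xs) = f x ∙ big f xs

    big-cong∈ : {f g : X → Carrier} (xs : List X) → (∀ {x} → x ∈ xs → f x ≈ g x) → big f xs ≈ big g xs
    big-cong∈ [] h = ≈refl
    big-cong∈ (x ∷ xs) h = ∙-cong (h (here refl)) (big-cong∈ xs (λ m → h (there m)))

    big-cong : {f g : X → Carrier} (xs : List X) → (∀ x → f x ≈ g x) → big f xs ≈ big g xs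
    big-cong xs h = big-cong∈ xs (λ {x} _ → h x)

    big-ε : {f : X → Carrier} (xs : List X) → (∀ {x} → x ∈ xs → f x ≈ ε) → big f xs ≈ ε
    big-ε [] h = ≈refl
    big-ε (x ∷ xs) h = ≈trans (∙-cong (h (here refl)) (big-ε xs (λ m → h (there m)))) (identityˡ ε)

    big-∙ : (f g : X → Carrier) (xs : List X) → big (λ x → f x ∙ g x) xs ≈ big f xs ∙ big g xs
    big-∙ f g [] = ≈sym (identityˡ ε)
    big-∙ f g (x ∷ xs) = ≈trans (∙-congˡ (big-∙ f g xs)) (interchange _ _ _ _)

    big-map : (f : Y → Carrier) (g : X → Y) (xs : List X) → big f (map g xs) ≈ big (λ x → f (g x)) xs
    big-map f g [] = ≈refl
    big-map f g (x ∷ xs) = ∙-congˡ (big-map f g xs)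

    big-swap : (f : X → Y → Carrier) (xs : List X) (ys : List Y)
      → big (λ x → big (f x) ys) xs ≈ big (λ y → big (λ x → f x y) xs) ys
    big-swap f [] ys = ≈sym (big-ε ys (λ _ → ≈refl))
    big-swap f (x ∷ xs) ys = ≈trans (∙-congˡ (big-swap f xs ys)) (≈sym (big-∙ _ _ ys))

    big-mid : (f : X → Carrier) (x : X) (ys₁ ys₂ : List X) → big f (ys₁ ++ x ∷ ys₂) ≈ f x ∙ big f (ys₁ ++ ys₂)
    big-mid f x [] ys₂ = ≈refl
    big-mid f x (y ∷ ys₁) ys₂ = ≈trans (∙-congˡ (big-mid f x ys₁ ys₂)) (x∙yz≈y∙xz _ _ _)

    big-set : (f : X → Carrier) {xs ys : List X} → Unique xs → Unique ys
      → (∀ {z} → z ∈ xs → z ∈ ys) → (∀ {z} → z ∈ ys → z ∈ xs) → big f xs ≈ big f ys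
    big-set f {[]} {[]} ux uy s t = ≈refl
    big-set f {[]} {y ∷ ys} ux uy s t with t (here refl)
    ... | ()
    big-set f {x ∷ xs} {ys} ux uy s t with ∈-∃++ (s (here refl))
    ... | ys₁ , ys₂ , refl = begin
      f x ∙ big f xs ≈⟨ ∙-congˡ (big-set f (unique-tail ux) (uniq-mid ys₁ uy) s' t') ⟩
      f x ∙ big f (ys₁ ++ ys₂) ≈⟨ big-mid f x ys₁ ys₂ ⟨
      big f (ys₁ ++ x ∷ ys₂) ∎
      where
      uniq-mid : ∀ zs {x : X} {ws} → Unique (zs ++ x ∷ ws) → Unique (zs ++ ws)
      uniq-mid [] (_ ∷ u) = u
      uniq-mid (z ∷ zs) (a ∷ u) = Allₚ.++⁺ (Allₚ.++⁻ˡ zs a) (All.tail (Allₚ.++⁻ʳ zs a)) ∷ uniq-mid zs u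
      mid∉ : ∀ zs {x : X} {ws} → Unique (zs ++ x ∷ ws) → x ∉ zs ++ ws
      mid∉ [] u m = unique-head∉ u m
      mid∉ (z ∷ zs) (a ∷ u) (here refl) = All.lookup a (∈-++⁺ʳ zs (here refl)) refl
      mid∉ (z ∷ zs) (a ∷ u) (there m) = mid∉ zs u m
      s' : ∀ {z} → z ∈ xs → z ∈ ys₁ ++ ys₂
      s' z∈ = remove-mid x ys₁ ys₂ (λ { refl → unique-head∉ ux z∈ }) (s (there z∈))
      t' : ∀ {z} → z ∈ ys₁ ++ ys₂ → z ∈ xs
      t' {z} z∈ with t (ins (∈-++⁻ ys₁ z∈))
        where
        ins : z ∈ ys₁ ⊎ z ∈ ys₂ → z ∈ ys₁ ++ x ∷ ys₂
        ins (inj₁ l) = ∈-++⁺ˡ l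
        ins (inj₂ r) = ∈-++⁺ʳ ys₁ (there r)
      ... | here refl = ⊥-elim (mid∉ ys₁ uy z∈)
      ... | there m = m

    -- An injective self-map of a finite list is surjective by counting, so the terms are merely
    -- rearranged. Many vanishing sums below come from reindexing by a translation or a
    -- multiplication.
    big-perm : (f : X → Carrier) (σ : X → X) {xs : List X} → DecidableEquality X → Unique xs
      → (∀ {x} → x ∈ xs → σ x ∈ xs) → (∀ {x y} → x ∈ xs → y ∈ xs → σ x ≡ σ y → x ≡ y)
      → big (λ x → f (σ x)) xs ≈ big f xs
    big-perm f σ {xs} _≟_ u st inj = ≈trans (≈sym (big-map f σ xs)) (big-set f um u sub
        (⊆-full _≟_ um sub (ℕₚ.≤-reflexive (sym (Listₚ.length-map σ xs)))))
      where
      um : Unique (map σ xs)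
      um = unique-map u inj
      sub : ∀ {z} → z ∈ map σ xs → z ∈ xs
      sub z∈ with ∈-map⁻ σ z∈
      ... | x , x∈ , refl = st x∈

    big-single : (f : X → Carrier) {xs : List X} {x : X} → Unique xs → x ∈ xs
      → (∀ {y} → y ∈ xs → y ≢ x → f y ≈ ε) → big f xs ≈ f x
    big-single f {x ∷ xs} u (here refl) h = ≈trans (∙-congˡ (big-ε xs λ m → h (there m) λ { refl → unique-head∉ u m })) (identityʳ _)
    big-single f {y ∷ xs} u (there m) h = ≈trans (∙-cong (h (here refl) (λ { refl → unique-head∉ u m })) (big-single f (unique-tail u) m (λ p → h (there p)))) (identityˡ _)

    -- Extends a sum over a filtered list to the full list, so that sums with different conditions
    -- can be compared term by term.
    guard : {A : Set} → Dec A → Carrier → Carrier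
    guard (yes _) x = x
    guard (no _) x = ε

    big-filter : {P : Pred X Level.zero} (P? : Decidable P) (f : X → Carrier) (xs : List X)
      → big f (filter P? xs) ≈ big (λ x → guard (P? x) (f x)) xs
    big-filter P? f [] = ≈refl
    big-filter P? f (x ∷ xs) with P? x
    ... | yes _ = ∙-congˡ (big-filter P? f xs)
    ... | no _ = ≈trans (big-filter P? f xs) (≈sym (identityˡ _))

  module ℕΣ = Big ℕₚ.+-0-commutativeMonoid
  open ℕΣ public using () renaming (big to sumℕ)

  count-ind : {P : Pred X Level.zero} (P? : Decidable P) (xs : List X) → length (filter P? xs) ≡ sumℕ (λ x → ind (P? x)) xs
  count-ind P? [] = refl
  count-ind P? (x ∷ xs) with P? x
  ... | yes _ = cong suc (count-ind P? xs)
  ... | no _ = count-ind P? xs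

  sumℕ-*ˡ : ∀ n (f : X → ℕ) xs → sumℕ (λ x → n *ℕ f x) xs ≡ n *ℕ sumℕ f xs
  sumℕ-*ˡ n f [] = sym (ℕₚ.*-zeroʳ n)
  sumℕ-*ˡ n f (x ∷ xs) = trans (cong (n *ℕ f x +ℕ_) (sumℕ-*ˡ n f xs)) (sym (ℕₚ.*-distribˡ-+ n (f x) _))

  sumℕ-const : (k : ℕ) (xs : List X) → sumℕ (λ _ → k) xs ≡ length xs *ℕ k
  sumℕ-const k [] = refl
  sumℕ-const k (x ∷ xs) = cong (k +ℕ_) (sumℕ-const k xs)

  -- No term can fall short, since the others could not make up for it. Several exact counts below
  -- arise this way: an upper bound for each class and a known total.
  sumℕ-tight : (f : X → ℕ) (B : ℕ) (xs : List X) → (∀ {x} → x ∈ xs → f x ≤ B)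
    → length xs *ℕ B ≤ sumℕ f xs → ∀ {x} → x ∈ xs → f x ≡ B
  sumℕ-tight f B (x ∷ xs) le tot = λ { (here refl) → eqx ; (there m) → sumℕ-tight f B xs (λ p → le (there p)) tail m }
    where
    bound : ∀ ys → (∀ {y} → y ∈ ys → f y ≤ B) → sumℕ f ys ≤ length ys *ℕ B
    bound [] h = z≤n
    bound (y ∷ ys) h = ℕₚ.+-mono-≤ (h (here refl)) (bound ys (λ p → h (there p)))
    eqx : f x ≡ B
    eqx = ℕₚ.≤-antisym (le (here refl)) (ℕₚ.+-cancelʳ-≤ (length xs *ℕ B) B (f x)
      (ℕₚ.≤-trans tot (ℕₚ.+-monoʳ-≤ (f x) (bound xs (λ p → le (there p))))))
    tail : length xs *ℕ B ≤ sumℕ f xs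
    tail = ℕₚ.+-cancelˡ-≤ B _ _ (ℕₚ.≤-trans tot (ℕₚ.+-monoˡ-≤ (sumℕ f xs) (le (here refl))))

  -- Double counting: after exchanging the sums each selected `x` is counted once, at the value
  -- `h x`.
  count-fibres : {P : Pred X Level.zero} (P? : Decidable P) (_≟_ : DecidableEquality Y) (h : X → Y) (xs : List X) {ys : List Y} → Unique ys
    → (∀ {x} → x ∈ xs → P x → h x ∈ ys)
    → sumℕ (λ y → sumℕ (λ x → ℕΣ.guard (P? x) (ind (h x ≟ y))) xs) ys ≡ length (filter P? xs)
  count-fibres P? _≟_ h xs {ys} uy hin = trans (ℕΣ.big-swap _ ys xs) (trans (ℕΣ.big-cong∈ xs (λ {x} x∈ → one x∈ (P? x))) (sym (count-ind P? xs)))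
    where
    diag : ∀ y → ind (y ≟ y) ≡ 1
    diag y with y ≟ y
    ... | yes _ = refl
    ... | no ne = ⊥-elim (ne refl)
    off : ∀ {y z} → y ≢ z → ind (y ≟ z) ≡ 0
    off {y} {z} ne with y ≟ z
    ... | yes e = ⊥-elim (ne e)
    ... | no _ = refl
    one : ∀ {x} → x ∈ xs → (d : Dec _) → sumℕ (λ y → ℕΣ.guard d (ind (h x ≟ y))) ys ≡ ind d
    one {x} x∈ (yes p) = trans (ℕΣ.big-single _ uy (hin x∈ p) (λ _ ne → off (λ e → ne (sym e)))) (diag (h x))
    one {x} x∈ (no _) = ℕΣ.big-ε ys (λ _ → refl)

-- Integer ring solver, Frobenius map, formal power series

module RingTools where

  open import Level using (Level)
  open import Algebra.Bundles using (CommutativeRing; RawRing)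
  open import Data.Nat using (ℕ; zero; suc; _<_; z≤n; s≤s) renaming (_+_ to _+ℕ_; _*_ to _*ℕ_; _^_ to _^ℕ_)
  import Data.Nat.Properties as ℕₚ
  open import Data.Nat.Combinatorics using (_C_; nCn≡1; nCk+nC[k+1]≡[n+1]C[k+1]; k>n⇒nCk≡0)
  open import Data.Nat.Divisibility using (_∣_; divides; ∣⇒≤; m∣m*n)
  open import Data.Nat.Primality using (Prime; euclidsLemma; ¬prime[0])
  open import Data.Fin using (Fin; zero; suc; inject₁; fromℕ)
  import Data.Fin.Properties as Finₚ
  open import Data.Product using (_×_; _,_)
  open import Data.Sum using (inj₁; inj₂)
  open import Data.Maybe using (Maybe; just; nothing)
  open import Data.Empty using (⊥-elim)
  open import Relation.Nullary using (yes)
  import Relation.Binary.PropositionalEquality as ≡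
  open ≡ using (_≡_; _≢_)
  import Algebra.Solver.Ring.AlmostCommutativeRing as ACR
  import Algebra.Solver.Ring as RingSolver

  private
    -- Integers as normalised differences of naturals.
    ℤ² : Set
    ℤ² = ℕ × ℕ

    reduce : ℤ² → ℤ²
    reduce (suc a , suc b) = reduce (a , b)
    reduce (zero , b) = zero , b
    reduce (suc a , zero) = suc a , zero

    coeffs : RawRing Level.zero Level.zero
    coeffs = record
      { Carrier = ℤ² ; _≈_ = _≡_
      ; _+_ = λ { (a , b) (c , d) → reduce (a +ℕ c , b +ℕ d) }
      ; _*_ = λ { (a , b) (c , d) → reduce (a *ℕ c +ℕ b *ℕ d , a *ℕ d +ℕ b *ℕ c) }
      ; -_ = λ { (a , b) → b , a }
      ; 0# = 0 , 0 ; 1# = 1 , 0 }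

  -- The coefficients are integers rather than elements of `R`, so comparing them requires no
  -- decidable equality on `R`. This makes the solver usable for power series as well.
  module IntegerSolver {c ℓ} (R : CommutativeRing c ℓ) where
    open CommutativeRing R hiding (zero)
    open import Algebra.Properties.Semiring.Mult semiring using () renaming (_×_ to _·_; ×-homo-+ to ·-homo-+; ×1-homo-* to ·1-homo-*)
    open import Algebra.Properties.Ring ring using (-‿distribˡ-*; -‿distribʳ-*; -‿involutive; -‿+-comm)
    open import Algebra.Properties.AbelianGroup +-abelianGroup using (⁻¹-anti-homo‿-)
    open import Relation.Binary.Reasoning.Setoid setoid
    open import Algebra.Properties.CommutativeSemigroup +-commutativeSemigroup using (interchange)

    private
      N : ℕ → Carrier
      N n = n · 1#

      ⟪_⟫ : ℤ² → Carrier
      ⟪ a , b ⟫ = N a - N b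

      -- 0 and 1 are interpreted literally, so that they can occur in goals.
      ⟦_⟧ : ℤ² → Carrier
      ⟦ 0 , 0 ⟧ = 0#
      ⟦ 1 , 0 ⟧ = 1#
      ⟦ x ⟧ = ⟪ x ⟫

      ⟦⟧≈⟪⟫ : ∀ x → ⟦ x ⟧ ≈ ⟪ x ⟫
      ⟦⟧≈⟪⟫ (0 , 0) = sym (-‿inverseʳ 0#)
      ⟦⟧≈⟪⟫ (0 , suc b) = refl
      ⟦⟧≈⟪⟫ (1 , 0) = sym (trans (+-cong (+-identityʳ 1#) (trans (sym (+-identityˡ _)) (-‿inverseʳ 0#))) (+-identityʳ 1#))
      ⟦⟧≈⟪⟫ (1 , suc b) = refl
      ⟦⟧≈⟪⟫ (suc (suc a) , b) = refl

      ⟦reduce⟧ : ∀ a b → ⟪ reduce (a , b) ⟫ ≈ N a - N b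
      ⟦reduce⟧ zero b = refl
      ⟦reduce⟧ (suc a) zero = refl
      ⟦reduce⟧ (suc a) (suc b) = begin
        ⟪ reduce (a , b) ⟫ ≈⟨ ⟦reduce⟧ a b ⟩
        N a - N b ≈⟨ +-identityˡ _ ⟨
        0# + (N a - N b) ≈⟨ +-congʳ (-‿inverseʳ 1#) ⟨
        (1# - 1#) + (N a - N b) ≈⟨ interchange _ _ _ _ ⟩
        (1# + N a) + (- 1# - N b) ≈⟨ +-congˡ (-‿+-comm 1# (N b)) ⟩
        (1# + N a) - (1# + N b) ∎

      +-homo : ∀ x y → ⟪ RawRing._+_ coeffs x y ⟫ ≈ ⟪ x ⟫ + ⟪ y ⟫
      +-homo (a , b) (c , d) = begin
        ⟪ reduce (a +ℕ c , b +ℕ d) ⟫ ≈⟨ ⟦reduce⟧ (a +ℕ c) (b +ℕ d) ⟩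
        N (a +ℕ c) - N (b +ℕ d) ≈⟨ +-cong (·-homo-+ 1# a c) (-‿cong (·-homo-+ 1# b d)) ⟩
        (N a + N c) - (N b + N d) ≈⟨ +-congˡ (-‿+-comm (N b) (N d)) ⟨
        (N a + N c) + (- N b - N d) ≈⟨ interchange _ _ _ _ ⟩
        (N a - N b) + (N c - N d) ∎

      *-homo : ∀ x y → ⟪ RawRing._*_ coeffs x y ⟫ ≈ ⟪ x ⟫ * ⟪ y ⟫
      *-homo (a , b) (c , d) = begin
        ⟪ reduce (a *ℕ c +ℕ b *ℕ d , a *ℕ d +ℕ b *ℕ c) ⟫ ≈⟨ ⟦reduce⟧ (a *ℕ c +ℕ b *ℕ d) (a *ℕ d +ℕ b *ℕ c) ⟩
        N (a *ℕ c +ℕ b *ℕ d) - N (a *ℕ d +ℕ b *ℕ c) ≈⟨ +-cong (hom a c b d) (-‿cong (hom a d b c)) ⟩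
        (N a * N c + N b * N d) - (N a * N d + N b * N c) ≈⟨ +-congˡ (-‿+-comm _ _) ⟨
        (N a * N c + N b * N d) + (- (N a * N d) - (N b * N c)) ≈⟨ +-congˡ (+-comm _ _) ⟩
        (N a * N c + N b * N d) + (- (N b * N c) - (N a * N d)) ≈⟨ interchange _ _ _ _ ⟩
        (N a * N c - N b * N c) + (N b * N d - N a * N d) ≈⟨ +-cong (+-congˡ (-‿distribˡ-* _ _)) (+-comm _ _) ⟩
        (N a * N c + - N b * N c) + (- (N a * N d) + N b * N d) ≈⟨ +-cong (sym (distribʳ _ _ _)) (+-cong (-‿distribʳ-* _ _) (trans (*-congʳ (sym (-‿involutive _))) (trans (sym (-‿distribˡ-* _ _)) (-‿distribʳ-* _ _)))) ⟩
        (N a - N b) * N c + (N a * - N d + - N b * - N d) ≈⟨ +-congˡ (sym (distribʳ _ _ _)) ⟩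
        (N a - N b) * N c + (N a - N b) * - N d ≈⟨ distribˡ _ _ _ ⟨
        (N a - N b) * (N c - N d) ∎
        where
        hom : ∀ a c b d → N (a *ℕ c +ℕ b *ℕ d) ≈ N a * N c + N b * N d
        hom a c b d = trans (·-homo-+ 1# (a *ℕ c) (b *ℕ d)) (+-cong (·1-homo-* a c) (·1-homo-* b d))

      morphism : coeffs ACR.-Raw-AlmostCommutative⟶ ACR.fromCommutativeRing R
      morphism = record
        { ⟦_⟧ = ⟦_⟧ 
        ; +-homo = λ x y → trans (⟦⟧≈⟪⟫ (RawRing._+_ coeffs x y)) (trans (+-homo x y) (sym (+-cong (⟦⟧≈⟪⟫ x) (⟦⟧≈⟪⟫ y))))
        ; *-homo = λ x y → trans (⟦⟧≈⟪⟫ (RawRing._*_ coeffs x y)) (trans (*-homo x y) (sym (*-cong (⟦⟧≈⟪⟫ x) (⟦⟧≈⟪⟫ y))))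
        ; -‿homo = λ { (a , b) → trans (⟦⟧≈⟪⟫ (b , a)) (trans (sym (⁻¹-anti-homo‿- (N a) (N b))) (-‿cong (sym (⟦⟧≈⟪⟫ (a , b))))) }
        ; 0-homo = refl
        ; 1-homo = refl }

      _≟c_ : ∀ x y → Maybe (⟦ x ⟧ ≈ ⟦ y ⟧)
      (a , b) ≟c (c , d) with a ℕₚ.≟ c | b ℕₚ.≟ d
      ... | yes ≡.refl | yes ≡.refl = just refl
      ... | _ | _ = nothing

    open RingSolver coeffs (ACR.fromCommutativeRing R) morphism _≟c_ public
      using (Polynomial; solve; _:=_; _:+_; _:*_; _:-_; :-_; _:^_; con)

    :0 :1 : ∀ {n} → Polynomial n
    :0 = con (0 , 0)
    :1 = con (1 , 0)

  -- Induction with Pascal's rule. It exhibits p as a divisor of k C(p, k).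
  absorption : ∀ n k → suc k *ℕ (suc n C suc k) ≡ suc n *ℕ (n C k)
  absorption zero zero = ≡.refl
  absorption zero (suc k) = ≡.trans (≡.cong (suc (suc k) *ℕ_) (k>n⇒nCk≡0 {1} {suc (suc k)} (s≤s (s≤s z≤n)))) (ℕₚ.*-zeroʳ (suc (suc k)))
  absorption (suc n) zero = ≡.trans (ℕₚ.+-identityʳ _) (≡.trans (≡.sym (nCk+nC[k+1]≡[n+1]C[k+1] (suc n) 0))
    (≡.cong₂ _+ℕ_ ≡.refl (≡.trans (≡.sym (ℕₚ.+-identityʳ _)) (absorption n zero))))
  absorption (suc n) (suc k) = begin
    suc (suc k) *ℕ (suc (suc n) C suc (suc k)) ≡⟨ ≡.cong (suc (suc k) *ℕ_) (nCk+nC[k+1]≡[n+1]C[k+1] (suc n) (suc k)) ⟨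
    suc (suc k) *ℕ (c₁ +ℕ (suc n C suc (suc k))) ≡⟨ ℕₚ.*-distribˡ-+ (suc (suc k)) c₁ _ ⟩
    suc (suc k) *ℕ c₁ +ℕ suc (suc k) *ℕ (suc n C suc (suc k)) ≡⟨ ≡.cong (suc (suc k) *ℕ c₁ +ℕ_) (absorption n (suc k)) ⟩
    (c₁ +ℕ suc k *ℕ c₁) +ℕ suc n *ℕ (n C suc k) ≡⟨ ≡.cong (λ t → (c₁ +ℕ t) +ℕ suc n *ℕ (n C suc k)) (absorption n k) ⟩
    (c₁ +ℕ suc n *ℕ (n C k)) +ℕ suc n *ℕ (n C suc k) ≡⟨ ℕₚ.+-assoc c₁ _ _ ⟩
    c₁ +ℕ (suc n *ℕ (n C k) +ℕ suc n *ℕ (n C suc k)) ≡⟨ ≡.cong (c₁ +ℕ_) (ℕₚ.*-distribˡ-+ (suc n) (n C k) _) ⟨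
    c₁ +ℕ suc n *ℕ ((n C k) +ℕ (n C suc k)) ≡⟨ ≡.cong (λ t → c₁ +ℕ suc n *ℕ t) (nCk+nC[k+1]≡[n+1]C[k+1] n k) ⟩
    suc (suc n) *ℕ c₁ ∎
    where
    open ≡.≡-Reasoning
    c₁ : ℕ
    c₁ = suc n C suc k

  -- By `absorption` p divides k C(p, k), and it cannot divide the smaller number k.
  prime∣C : ∀ {p k} → Prime p → 0 < k → k < p → p ∣ (p C k)
  prime∣C {suc p} {suc k} pp _ k<p with euclidsLemma (suc k) (suc p C suc k) pp (≡.subst (suc p ∣_) (≡.sym (absorption p k)) (m∣m*n (p C k)))
  ... | inj₁ d = ⊥-elim (ℕₚ.<-irrefl ≡.refl (ℕₚ.≤-trans k<p (∣⇒≤ d)))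
  ... | inj₂ d = d

  -- Stated for commutative rings because it is applied both to the field and to its ring of power
  -- series.
  module Frobenius {c ℓ} (R : CommutativeRing c ℓ) where
    open CommutativeRing R hiding (zero)
    open import Algebra.Properties.Semiring.Mult semiring using (×-assocˡ; ×-assoc-*; ×-congʳ) renaming (_×_ to _·_)
    open import Algebra.Properties.Semiring.Exp semiring using (_^_; ^-congˡ; ^-assocʳ)
    open import Algebra.Properties.Monoid.Sum +-monoid using (sum; sum-init-last; sum-cong-≋; sum-replicate-zero)
    open import Algebra.Properties.CommutativeSemiring.Binomial commutativeSemiring using (theorem; binomialTerm)
    open import Relation.Binary.Reasoning.Setoid setoid

    private
      sum-0 : ∀ {n} (t : Fin n → Carrier) → (∀ i → t i ≈ 0#) → sum t ≈ 0#
      sum-0 {n} t h = trans (sum-cong-≋ h) (sum-replicate-zero n)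

      char-kills : ∀ {p n} → p · 1# ≈ 0# → p ∣ n → ∀ x → n · x ≈ 0#
      char-kills {p} ch (divides k ≡.refl) x = begin
        (k *ℕ p) · x ≈⟨ ×-assocˡ x k p ⟨
        k · (p · x) ≈⟨ ×-congʳ k (×-congʳ p (*-identityˡ x)) ⟨
        k · (p · (1# * x)) ≈⟨ ×-congʳ k (×-assoc-* p 1# x) ⟨
        k · ((p · 1#) * x) ≈⟨ ×-congʳ k (trans (*-congʳ ch) (zeroˡ x)) ⟩
        k · 0# ≈⟨ zs k ⟩
        0# ∎
        where
        zs : ∀ k → k · 0# ≈ 0#
        zs zero = refl
        zs (suc k) = trans (+-identityˡ _) (zs k)

    module _ {p : ℕ} (pp : Prime p) (char : p · 1# ≈ 0#) where

      frobenius-+ : ∀ x y → (x + y) ^ p ≈ x ^ p + y ^ p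
      -- The exponent is generalised to an `n` equal to `p`, so that it can be matched as a
      -- successor and the two outer binomial terms split off.
      frobenius-+ = go p ≡.refl
        where
        go : ∀ n → n ≡ p → ∀ x y → (x + y) ^ n ≈ x ^ n + y ^ n
        go zero e x y = ⊥-elim (¬prime[0] (≡.subst Prime (≡.sym e) pp))
        go (suc n) ≡.refl x y = begin
          (x + y) ^ suc n ≈⟨ theorem (suc n) x y ⟩
          sum (binomialTerm x y (suc n)) ≈⟨ +-congˡ (sum-init-last (λ i → binomialTerm x y (suc n) (suc i))) ⟩
          binomialTerm x y (suc n) zero + (sum (λ i → binomialTerm x y (suc n) (suc (inject₁ i))) + binomialTerm x y (suc n) (suc (fromℕ n)))
            ≈⟨ +-cong first (+-cong (sum-0 _ mid) lastt) ⟩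
          y ^ suc n + (0# + x ^ suc n) ≈⟨ +-congˡ (+-identityˡ _) ⟩
          y ^ suc n + x ^ suc n ≈⟨ +-comm _ _ ⟩
          x ^ suc n + y ^ suc n ∎
          where
          first : binomialTerm x y (suc n) zero ≈ y ^ suc n
          first = trans (+-identityʳ _) (*-identityˡ _)
          mid : ∀ i → binomialTerm x y (suc n) (suc (inject₁ i)) ≈ 0#
          mid i = char-kills char (prime∣C pp (s≤s z≤n) (s≤s (≡.subst (_< n) (≡.sym (Finₚ.toℕ-inject₁ i)) (Finₚ.toℕ<n i)))) _
          lastt : binomialTerm x y (suc n) (suc (fromℕ n)) ≈ x ^ suc n
          lastt rewrite Finₚ.toℕ-fromℕ n | nCn≡1 (suc n) | ℕₚ.n∸n≡0 n = trans (+-identityʳ _) (*-identityʳ _)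

      frobenius^-+ : ∀ k x y → (x + y) ^ (p ^ℕ k) ≈ x ^ (p ^ℕ k) + y ^ (p ^ℕ k)
      frobenius^-+ zero x y = trans (*-identityʳ _) (sym (+-cong (*-identityʳ _) (*-identityʳ _)))
      frobenius^-+ (suc k) x y = begin
        (x + y) ^ (p *ℕ p ^ℕ k) ≈⟨ ^-assocʳ (x + y) p (p ^ℕ k) ⟨
        ((x + y) ^ p) ^ (p ^ℕ k) ≈⟨ ^-congˡ (p ^ℕ k) (frobenius-+ x y) ⟩
        (x ^ p + y ^ p) ^ (p ^ℕ k) ≈⟨ frobenius^-+ k _ _ ⟩
        (x ^ p) ^ (p ^ℕ k) + (y ^ p) ^ (p ^ℕ k) ≈⟨ +-cong (^-assocʳ x p (p ^ℕ k)) (^-assocʳ y p (p ^ℕ k)) ⟩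
        x ^ (p *ℕ p ^ℕ k) + y ^ (p *ℕ p ^ℕ k) ∎

  module PowerSeries {c ℓ} (R : CommutativeRing c ℓ) where
    open CommutativeRing R hiding (zero)
    open import Relation.Binary.Reasoning.Setoid setoid
    open import Algebra.Properties.CommutativeSemigroup +-commutativeSemigroup using (interchange; x∙yz≈y∙xz)

    Series : Set c
    Series = ℕ → Carrier

    infix 4 _≋_
    _≋_ : Series → Series → Set ℓ
    f ≋ g = ∀ n → f n ≈ g n

    infixl 6 _⊞_
    infixl 7 _⊠_
    _⊞_ : Series → Series → Series
    (f ⊞ g) n = f n + g n

    tail : Series → Series
    tail f n = f (suc n)

    const : Carrier → Series
    const a zero = a
    const a (suc n) = 0#

    -- The Cauchy product, by recursion on f = f 0 + Y tail f.
    _⊠_ : Series → Series → Series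
    (f ⊠ g) zero = f 0 * g 0
    (f ⊠ g) (suc n) = f 0 * g (suc n) + (tail f ⊠ g) n

    private
      ⊠-cong : ∀ {f f' g g'} → f ≋ f' → g ≋ g' → f ⊠ g ≋ f' ⊠ g'
      ⊠-cong p q zero = *-cong (p 0) (q 0)
      ⊠-cong p q (suc n) = +-cong (*-cong (p 0) (q (suc n))) (⊠-cong (λ i → p (suc i)) q n)

      ⊠-distribʳ : ∀ h f g → (f ⊞ g) ⊠ h ≋ f ⊠ h ⊞ g ⊠ h
      ⊠-distribʳ h f g zero = distribʳ _ _ _
      ⊠-distribʳ h f g (suc n) = trans (+-cong (distribʳ _ _ _) (⊠-distribʳ h (tail f) (tail g) n)) (interchange _ _ _ _)

      -- The recursion on the right factor instead of the left one; with it commutativity becomes an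
      -- induction.
      ⊠-suc : ∀ f g n → (f ⊠ g) (suc n) ≈ f (suc n) * g 0 + (f ⊠ tail g) n
      ⊠-suc f g zero = +-comm _ _
      ⊠-suc f g (suc n) = trans (+-congˡ (⊠-suc (tail f) g n)) (x∙yz≈y∙xz _ _ _)

      ⊠-comm : ∀ f g → f ⊠ g ≋ g ⊠ f
      ⊠-comm f g zero = *-comm _ _
      ⊠-comm f g (suc n) = trans (+-cong (*-comm _ _) (⊠-comm (tail f) g n)) (sym (⊠-suc g f n))

      scale-⊠ : ∀ a f g → (λ n → a * f n) ⊠ g ≋ (λ n → a * (f ⊠ g) n)
      scale-⊠ a f g zero = *-assoc _ _ _
      scale-⊠ a f g (suc n) = trans (+-cong (*-assoc _ _ _) (scale-⊠ a (tail f) g n)) (sym (distribˡ _ _ _))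

      ⊠-assoc : ∀ f g h → (f ⊠ g) ⊠ h ≋ f ⊠ (g ⊠ h)
      ⊠-assoc f g h zero = *-assoc _ _ _
      ⊠-assoc f g h (suc n) = begin
        (f 0 * g 0) * h (suc n) + (((λ m → f 0 * tail g m) ⊞ tail f ⊠ g) ⊠ h) n ≈⟨ +-congˡ (⊠-distribʳ h (λ m → f 0 * tail g m) (tail f ⊠ g) n) ⟩
        (f 0 * g 0) * h (suc n) + (((λ m → f 0 * tail g m) ⊠ h) n + ((tail f ⊠ g) ⊠ h) n) ≈⟨ +-cong (*-assoc _ _ _) (+-cong (scale-⊠ (f 0) (tail g) h n) (⊠-assoc (tail f) g h n)) ⟩
        f 0 * (g 0 * h (suc n)) + (f 0 * (tail g ⊠ h) n + (tail f ⊠ (g ⊠ h)) n) ≈⟨ +-assoc _ _ _ ⟨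
        (f 0 * (g 0 * h (suc n)) + f 0 * (tail g ⊠ h) n) + (tail f ⊠ (g ⊠ h)) n ≈⟨ +-congʳ (distribˡ _ _ _) ⟨
        f 0 * (g ⊠ h) (suc n) + (tail f ⊠ (g ⊠ h)) n ∎

      zero-⊠ : ∀ f g → (∀ n → f n ≈ 0#) → ∀ n → (f ⊠ g) n ≈ 0#
      zero-⊠ f g h zero = trans (*-congʳ (h 0)) (zeroˡ _)
      zero-⊠ f g h (suc n) = trans (+-cong (trans (*-congʳ (h 0)) (zeroˡ _)) (zero-⊠ (tail f) g (λ n → h (suc n)) n)) (+-identityˡ _)

    const-⊠ : ∀ a g n → (const a ⊠ g) n ≈ a * g n
    const-⊠ a g zero = refl
    const-⊠ a g (suc n) = trans (+-congˡ (zero-⊠ (tail (const a)) g (λ _ → refl) n)) (+-identityʳ _)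

    seriesRing : CommutativeRing c ℓ
    seriesRing = record
      { Carrier = Series ; _≈_ = _≋_ ; _+_ = _⊞_ ; _*_ = _⊠_ ; -_ = λ f n → - f n ; 0# = λ _ → 0# ; 1# = const 1#
      ; isCommutativeRing = record
        { isRing = record
          { +-isAbelianGroup = record
            { isGroup = record
              { isMonoid = record
                { isSemigroup = record
                  { isMagma = record
                    { isEquivalence = record { refl = λ n → refl ; sym = λ p n → sym (p n) ; trans = λ p q n → trans (p n) (q n) }
                    ; ∙-cong = λ p q n → +-cong (p n) (q n) }
                  ; assoc = λ f g h n → +-assoc _ _ _ }
                ; identity = (λ f n → +-identityˡ _) , (λ f n → +-identityʳ _) }
              ; inverse = (λ f n → -‿inverseˡ _) , (λ f n → -‿inverseʳ _)
              ; ⁻¹-cong = λ p n → -‿cong (p n) }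
            ; comm = λ f g n → +-comm _ _ }
          ; *-cong = ⊠-cong
          ; *-assoc = ⊠-assoc
          ; *-identity = (λ f n → trans (const-⊠ 1# f n) (*-identityˡ _)) , (λ f n → trans (⊠-comm f (const 1#) n) (trans (const-⊠ 1# f n) (*-identityˡ _)))
          ; distrib = (λ f g h n → trans (⊠-comm f (g ⊞ h) n) (trans (⊠-distribʳ f g h n) (+-cong (⊠-comm g f n) (⊠-comm h f n)))) , ⊠-distribʳ }
        ; *-comm = ⊠-comm } }

-- Identities for vectors and determinants in dimension three

module Vectors where

  open RingTools
  open import Algebra.Bundles using (CommutativeRing)
  open import Data.Fin using (Fin; zero; suc)

  pattern i0 = zero
  pattern i1 = suc zero
  pattern i2 = suc (suc zero)

  module Determinants {c ℓ} (A : CommutativeRing c ℓ) where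
    open CommutativeRing A
    open IntegerSolver A
    open import Algebra.Properties.Ring ring using (-‿distribˡ-*)

    Vec3 : Set c
    Vec3 = Fin 3 → Carrier

    private
      :det : ∀ {n} → (a b c d e f g h i : Polynomial n) → Polynomial n
      :det a b c d e f g h i = (a :* (e :* i :- f :* h) :- b :* (d :* i :- f :* g)) :+ c :* (d :* h :- e :* g)

      :dot : ∀ {n} → (a b c x y z : Polynomial n) → Polynomial n
      :dot a b c x y z = (a :* x :+ b :* y) :+ c :* z

    dot : Vec3 → Vec3 → Carrier
    dot l v = (l i0 * v i0 + l i1 * v i1) + l i2 * v i2

    det₉ : (a b c d e f g h i : Carrier) → Carrier
    det₉ a b c d e f g h i = (a * (e * i - f * h) - b * (d * i - f * g)) + c * (d * h - e * g)

    det₃ : Vec3 → Vec3 → Vec3 → Carrier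
    det₃ p q e = det₉ (p i0) (p i1) (p i2) (q i0) (q i1) (q i2) (e i0) (e i1) (e i2)

    cross : Vec3 → Vec3 → Vec3
    cross p q i0 = p i1 * q i2 - p i2 * q i1
    cross p q i1 = p i2 * q i0 - p i0 * q i2
    cross p q i2 = p i0 * q i1 - p i1 * q i0

    dot-scale : ∀ l v t → dot l (λ i → t * v i) ≈ t * dot l v
    dot-scale l v t = solve 7 (λ a b c x y z t → (a :* (t :* x) :+ b :* (t :* y)) :+ c :* (t :* z) := t :* ((a :* x :+ b :* y) :+ c :* z)) refl (l i0) (l i1) (l i2) (v i0) (v i1) (v i2) t

    factor₃ : ∀ s x y z p q e → (s * x * p + s * y * q) + s * z * e ≈ s * ((x * p + y * q) + z * e)
    factor₃ = solve 7 (λ s x y z p q e → (s :* x :* p :+ s :* y :* q) :+ s :* z :* e := s :* ((x :* p :+ y :* q) :+ z :* e)) refl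

    dot-shear : ∀ x z m t v → dot (λ i → (x i - m * z i) * t) v ≈ (dot x v - m * dot z v) * t
    dot-shear x z m t v = solve 11 (λ x0 x1 x2 z0 z1 z2 m t v0 v1 v2 → :dot ((x0 :- m :* z0) :* t) ((x1 :- m :* z1) :* t) ((x2 :- m :* z2) :* t) v0 v1 v2
      := (:dot x0 x1 x2 v0 v1 v2 :- m :* :dot z0 z1 z2 v0 v1 v2) :* t) refl (x i0) (x i1) (x i2) (z i0) (z i1) (z i2) m t (v i0) (v i1) (v i2)

    dot-scaleˡ : ∀ l v t → dot (λ i → l i * t) v ≈ dot l v * t
    dot-scaleˡ l v t = solve 7 (λ a b c x y z t → :dot (a :* t) (b :* t) (c :* t) x y z := :dot a b c x y z :* t) refl (l i0) (l i1) (l i2) (v i0) (v i1) (v i2) t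

    dot-comb : ∀ l p q e x y z → dot l (λ i → (x * p i + y * q i) + z * e i) ≈ (x * dot l p + y * dot l q) + z * dot l e
    dot-comb l p q e x y z = solve 15 (λ a b c x y z p0 p1 p2 q0 q1 q2 e0 e1 e2
      → :dot a b c ((x :* p0 :+ y :* q0) :+ z :* e0) ((x :* p1 :+ y :* q1) :+ z :* e1) ((x :* p2 :+ y :* q2) :+ z :* e2)
      := (x :* :dot a b c p0 p1 p2 :+ y :* :dot a b c q0 q1 q2) :+ z :* :dot a b c e0 e1 e2) refl
      (l i0) (l i1) (l i2) x y z (p i0) (p i1) (p i2) (q i0) (q i1) (q i2) (e i0) (e i1) (e i2)

    det-cycle : ∀ p q e → det₃ q e p ≈ det₃ p q e
    det-cycle p q e = solve 9 (λ p0 p1 p2 q0 q1 q2 e0 e1 e2 → :det q0 q1 q2 e0 e1 e2 p0 p1 p2 := :det p0 p1 p2 q0 q1 q2 e0 e1 e2) refl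
      (p i0) (p i1) (p i2) (q i0) (q i1) (q i2) (e i0) (e i1) (e i2)

    dot-cross : ∀ p q e → dot (cross q e) p ≈ det₃ p q e
    dot-cross p q e = solve 9 (λ p0 p1 p2 q0 q1 q2 e0 e1 e2 → :dot (q1 :* e2 :- q2 :* e1) (q2 :* e0 :- q0 :* e2) (q0 :* e1 :- q1 :* e0) p0 p1 p2 := :det p0 p1 p2 q0 q1 q2 e0 e1 e2) refl
      (p i0) (p i1) (p i2) (q i0) (q i1) (q i2) (e i0) (e i1) (e i2)

    dot-crossˡ : ∀ q e → dot (cross q e) q ≈ 0#
    dot-crossˡ q e = solve 6 (λ q0 q1 q2 e0 e1 e2 → :dot (q1 :* e2 :- q2 :* e1) (q2 :* e0 :- q0 :* e2) (q0 :* e1 :- q1 :* e0) q0 q1 q2 := :0) refl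
      (q i0) (q i1) (q i2) (e i0) (e i1) (e i2)

    dot-crossʳ : ∀ q e → dot (cross q e) e ≈ 0#
    dot-crossʳ q e = solve 6 (λ q0 q1 q2 e0 e1 e2 → :dot (q1 :* e2 :- q2 :* e1) (q2 :* e0 :- q0 :* e2) (q0 :* e1 :- q1 :* e0) e0 e1 e2 := :0) refl
      (q i0) (q i1) (q i2) (e i0) (e i1) (e i2)

    private
      :cramer : ∀ {n} → (p0 p1 p2 q0 q1 q2 e0 e1 e2 v0 v1 v2 p q e v : Polynomial n) → _
      :cramer p0 p1 p2 q0 q1 q2 e0 e1 e2 v0 v1 v2 p q e v =
        (:dot (q1 :* e2 :- q2 :* e1) (q2 :* e0 :- q0 :* e2) (q0 :* e1 :- q1 :* e0) v0 v1 v2 :* p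
        :+ :dot (e1 :* p2 :- e2 :* p1) (e2 :* p0 :- e0 :* p2) (e0 :* p1 :- e1 :* p0) v0 v1 v2 :* q)
        :+ :dot (p1 :* q2 :- p2 :* q1) (p2 :* q0 :- p0 :* q2) (p0 :* q1 :- p1 :* q0) v0 v1 v2 :* e
        := :det p0 p1 p2 q0 q1 q2 e0 e1 e2 :* v

    -- Cramer's rule with the determinant kept on the right, so that it is an identity of
    -- polynomials.
    cramer : ∀ p q e v i → (dot (cross q e) v * p i + dot (cross e p) v * q i) + dot (cross p q) v * e i ≈ det₃ p q e * v i
    cramer p q e v i0 = solve 12 (λ p0 p1 p2 q0 q1 q2 e0 e1 e2 v0 v1 v2 → :cramer p0 p1 p2 q0 q1 q2 e0 e1 e2 v0 v1 v2 p0 q0 e0 v0) refl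
      (p i0) (p i1) (p i2) (q i0) (q i1) (q i2) (e i0) (e i1) (e i2) (v i0) (v i1) (v i2)
    cramer p q e v i1 = solve 12 (λ p0 p1 p2 q0 q1 q2 e0 e1 e2 v0 v1 v2 → :cramer p0 p1 p2 q0 q1 q2 e0 e1 e2 v0 v1 v2 p1 q1 e1 v1) refl
      (p i0) (p i1) (p i2) (q i0) (q i1) (q i2) (e i0) (e i1) (e i2) (v i0) (v i1) (v i2)
    cramer p q e v i2 = solve 12 (λ p0 p1 p2 q0 q1 q2 e0 e1 e2 v0 v1 v2 → :cramer p0 p1 p2 q0 q1 q2 e0 e1 e2 v0 v1 v2 p2 q2 e2 v2) refl
      (p i0) (p i1) (p i2) (q i0) (q i1) (q i2) (e i0) (e i1) (e i2) (v i0) (v i1) (v i2)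

    private
      :adjugate : ∀ {n} → (p0 p1 p2 q0 q1 q2 e0 e1 e2 v0 v1 v2 p q e v : Polynomial n) → _
      :adjugate p0 p1 p2 q0 q1 q2 e0 e1 e2 v0 v1 v2 p q e v =
        (:dot p0 p1 p2 v0 v1 v2 :* p :+ :dot q0 q1 q2 v0 v1 v2 :* q) :+ :dot e0 e1 e2 v0 v1 v2 :* e := :det p0 p1 p2 q0 q1 q2 e0 e1 e2 :* v

    -- It recovers `v` from its products with three rows; hence a matrix with nonzero determinant
    -- has trivial kernel.
    adjugate : ∀ p q e v i → (dot p v * cross q e i + dot q v * cross e p i) + dot e v * cross p q i ≈ det₃ p q e * v i
    adjugate p q e v i0 = solve 12 (λ p0 p1 p2 q0 q1 q2 e0 e1 e2 v0 v1 v2 → :adjugate p0 p1 p2 q0 q1 q2 e0 e1 e2 v0 v1 v2 (q1 :* e2 :- q2 :* e1) (e1 :* p2 :- e2 :* p1) (p1 :* q2 :- p2 :* q1) v0) refl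
      (p i0) (p i1) (p i2) (q i0) (q i1) (q i2) (e i0) (e i1) (e i2) (v i0) (v i1) (v i2)
    adjugate p q e v i1 = solve 12 (λ p0 p1 p2 q0 q1 q2 e0 e1 e2 v0 v1 v2 → :adjugate p0 p1 p2 q0 q1 q2 e0 e1 e2 v0 v1 v2 (q2 :* e0 :- q0 :* e2) (e2 :* p0 :- e0 :* p2) (p2 :* q0 :- p0 :* q2) v1) refl
      (p i0) (p i1) (p i2) (q i0) (q i1) (q i2) (e i0) (e i1) (e i2) (v i0) (v i1) (v i2)
    adjugate p q e v i2 = solve 12 (λ p0 p1 p2 q0 q1 q2 e0 e1 e2 v0 v1 v2 → :adjugate p0 p1 p2 q0 q1 q2 e0 e1 e2 v0 v1 v2 (q0 :* e1 :- q1 :* e0) (e0 :* p1 :- e1 :* p0) (p0 :* q1 :- p1 :* q0) v2) refl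
      (p i0) (p i1) (p i2) (q i0) (q i1) (q i2) (e i0) (e i1) (e i2) (v i0) (v i1) (v i2)

    det-product : ∀ a b c (u v w : Vec3)
      → det₉ (dot a u) (dot a v) (dot a w) (dot b u) (dot b v) (dot b w) (dot c u) (dot c v) (dot c w)
        ≈ det₃ a b c * det₉ (u i0) (v i0) (w i0) (u i1) (v i1) (w i1) (u i2) (v i2) (w i2)
    det-product a b c u v w = solve 18 (λ a0 a1 a2 b0 b1 b2 c0 c1 c2 u0 v0 w0 u1 v1 w1 u2 v2 w2
      → :det (:dot a0 a1 a2 u0 u1 u2) (:dot a0 a1 a2 v0 v1 v2) (:dot a0 a1 a2 w0 w1 w2)
             (:dot b0 b1 b2 u0 u1 u2) (:dot b0 b1 b2 v0 v1 v2) (:dot b0 b1 b2 w0 w1 w2)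
             (:dot c0 c1 c2 u0 u1 u2) (:dot c0 c1 c2 v0 v1 v2) (:dot c0 c1 c2 w0 w1 w2)
        := :det a0 a1 a2 b0 b1 b2 c0 c1 c2 :* :det u0 v0 w0 u1 v1 w1 u2 v2 w2) refl
      (a i0) (a i1) (a i2) (b i0) (b i1) (b i2) (c i0) (c i1) (c i2) (u i0) (v i0) (w i0) (u i1) (v i1) (w i1) (u i2) (v i2) (w i2)

    -- With primes read as conjugates this is the matrix of d (Y X̄ - X Ȳ) - Z Z̄ for three
    -- covectors X, Y, Z. The conjugates are free vectors here, so that everything about it is a
    -- polynomial identity.
    form : (d : Carrier) (X Y Z X' Y' Z' : Vec3) → Fin 3 → Fin 3 → Carrier
    form d X Y Z X' Y' Z' i j = (d * Y i * X' j - d * X i * Y' j) - Z i * Z' j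

    form-value : ∀ d X Y Z X' Y' Z' v w →
      dot v (λ i → dot (λ j → form d X Y Z X' Y' Z' i j) w) ≈ (d * dot Y v * dot X' w - d * dot X v * dot Y' w) - dot Z v * dot Z' w
    form-value d X Y Z X' Y' Z' v w = trans (+-cong (+-cong (*-congˡ (row i0)) (*-congˡ (row i1))) (*-congˡ (row i2)))
      (solve 16 (λ d x y z x0 x1 x2 y0 y1 y2 z0 z1 z2 v0 v1 v2 →
        :dot v0 v1 v2 ((d :* y0 :* x :- d :* x0 :* y) :- z0 :* z) ((d :* y1 :* x :- d :* x1 :* y) :- z1 :* z) ((d :* y2 :* x :- d :* x2 :* y) :- z2 :* z)
        := (d :* :dot y0 y1 y2 v0 v1 v2 :* x :- d :* :dot x0 x1 x2 v0 v1 v2 :* y) :- :dot z0 z1 z2 v0 v1 v2 :* z) refl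
        d (dot X' w) (dot Y' w) (dot Z' w) (X i0) (X i1) (X i2) (Y i0) (Y i1) (Y i2) (Z i0) (Z i1) (Z i2) (v i0) (v i1) (v i2))
      where
      row : ∀ i → dot (λ j → form d X Y Z X' Y' Z' i j) w ≈ (d * Y i * dot X' w - d * X i * dot Y' w) - Z i * dot Z' w
      row i = solve 16 (λ d x y z x0 x1 x2 y0 y1 y2 z0 z1 z2 w0 w1 w2 →
        :dot ((d :* y :* x0 :- d :* x :* y0) :- z :* z0) ((d :* y :* x1 :- d :* x :* y1) :- z :* z1) ((d :* y :* x2 :- d :* x :* y2) :- z :* z2) w0 w1 w2
        := (d :* y :* :dot x0 x1 x2 w0 w1 w2 :- d :* x :* :dot y0 y1 y2 w0 w1 w2) :- z :* :dot z0 z1 z2 w0 w1 w2) refl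
        d (X i) (Y i) (Z i) (X' i0) (X' i1) (X' i2) (Y' i0) (Y' i1) (Y' i2) (Z' i0) (Z' i1) (Z' i2) (w i0) (w i1) (w i2)

    -- Adding multiples of the third row changes nothing. It will cover the change to the centred
    -- and rescaled coordinates x - ν z and (y - μ z) / s.
    det-shear : ∀ s t m n x y z → det₃ (λ i → (x i - m * z i) * s) (λ i → (y i - n * z i) * t) z ≈ s * t * det₃ x y z
    det-shear s t m n x y z = solve 13 (λ s t m n x0 x1 x2 y0 y1 y2 z0 z1 z2 →
      :det ((x0 :- m :* z0) :* s) ((x1 :- m :* z1) :* s) ((x2 :- m :* z2) :* s) ((y0 :- n :* z0) :* t) ((y1 :- n :* z1) :* t) ((y2 :- n :* z2) :* t) z0 z1 z2
      := s :* t :* :det x0 x1 x2 y0 y1 y2 z0 z1 z2) refl s t m n (x i0) (x i1) (x i2) (y i0) (y i1) (y i2) (z i0) (z i1) (z i2)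

    -- The matrix factors as the one with columns d Y, - d X, - Z times the one with rows X', Y',
    -- Z'. So the form is non-degenerate as soon as the covectors are independent.
    form-det : ∀ d X Y Z X' Y' Z' → let h = form d X Y Z X' Y' Z' in
      det₉ (h i0 i0) (h i0 i1) (h i0 i2) (h i1 i0) (h i1 i1) (h i1 i2) (h i2 i0) (h i2 i1) (h i2 i2) ≈ - (d * d * det₃ X Y Z) * det₃ X' Y' Z'
    form-det d X Y Z X' Y' Z' = trans (det-cong (eq i0 i0) (eq i0 i1) (eq i0 i2) (eq i1 i0) (eq i1 i1) (eq i1 i2) (eq i2 i0) (eq i2 i1) (eq i2 i2))
      (trans (det-product (a i0) (a i1) (a i2) (u i0) (u i1) (u i2)) (*-congʳ (solve 10 (λ d x0 x1 x2 y0 y1 y2 z0 z1 z2 →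
        :det (d :* y0) (:- (d :* x0)) (:- z0) (d :* y1) (:- (d :* x1)) (:- z1) (d :* y2) (:- (d :* x2)) (:- z2)
        := :- (d :* d :* :det x0 x1 x2 y0 y1 y2 z0 z1 z2)) refl d (X i0) (X i1) (X i2) (Y i0) (Y i1) (Y i2) (Z i0) (Z i1) (Z i2))))
      where
      a u : Fin 3 → Vec3
      a i i0 = d * Y i
      a i i1 = - (d * X i)
      a i i2 = - Z i
      u j i0 = X' j
      u j i1 = Y' j
      u j i2 = Z' j
      eq : ∀ i j → form d X Y Z X' Y' Z' i j ≈ dot (a i) (u j)
      eq i j = +-cong (+-congˡ (-‿distribˡ-* _ _)) (-‿distribˡ-* _ _)
      det-cong : ∀ {a a' b b' c c' d d' e e' f f' g g' h h' i i'} → a ≈ a' → b ≈ b' → c ≈ c' → d ≈ d' → e ≈ e' → f ≈ f' → g ≈ g' → h ≈ h' → i ≈ i'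
        → det₉ a b c d e f g h i ≈ det₉ a' b' c' d' e' f' g' h' i'
      det-cong a b c d e f g h i = +-cong (+-cong (*-cong a (+-cong (*-cong e i) (-‿cong (*-cong f h)))) (-‿cong (*-cong b (+-cong (*-cong d i) (-‿cong (*-cong f g))))))
        (*-cong c (+-cong (*-cong d h) (-‿cong (*-cong e g))))

open ListCounting
open RingTools
open Vectors
open import Level using (Level)
open import Algebra.Bundles using (CommutativeRing)
open import Data.Empty using (⊥; ⊥-elim)
open import Data.Fin using (Fin; zero; suc)
open import Data.List using (List; []; _∷_; _++_; map; filter; length; allFin; concatMap; cartesianProductWith)
open import Data.List.Membership.Propositional using (_∈_; _∉_)
open import Data.List.Membership.Propositional.Properties using (∈-filter⁺; ∈-filter⁻; ∈-map⁺; ∈-map⁻; ∈-++⁺ˡ; ∈-++⁺ʳ; ∈-++⁻; ∈-allFin; ∈-cartesianProductWith⁺; ∈-cartesianProductWith⁻)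
import Data.List.Properties as Listₚ
open import Data.List.Relation.Unary.All as All using (All; []; _∷_)
open import Data.List.Relation.Unary.AllPairs using ([]; _∷_)
open import Data.List.Relation.Unary.Any using (here; there)
open import Data.List.Relation.Unary.Unique.Propositional using (Unique)
import Data.List.Relation.Unary.Unique.Propositional.Properties as Uniqₚ
open import Data.Nat using (ℕ; zero; suc; _≤_; _<_; z≤n; s≤s; _∸_; nonTrivial⇒n>1) renaming (_+_ to _+ℕ_; _*_ to _*ℕ_; _^_ to _^ℕ_)
open import Data.Nat.Coprimality using (prime⇒coprime; coprime-Bézout)
open import Data.Nat.GCD using (module Bézout)
open import Data.Nat.Primality using (Prime; prime⇒nonTrivial)
import Data.Nat.Properties as ℕₚ
import Data.Nat.Solver as ℕSolver
open import Data.Product using (∃; ∃₂; _×_; _,_; proj₁; proj₂)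
open import Data.Sum using (_⊎_; inj₁; inj₂)
open import Data.Unit using (⊤; tt)
open import Data.Vec as Vec using (Vec; []; _∷_; lookup)
import Data.Vec.Properties as Vecₚ
open import Function.Bundles using (_⇔_; mk⇔; Equivalence; Inverse)
open import Relation.Binary.PropositionalEquality using (_≡_; _≢_; refl; sym; trans; cong; cong₂; subst; subst₂; module ≡-Reasoning)
open import Relation.Nullary using (¬_; Dec; yes; no)
open import Relation.Nullary.Decidable using (¬?; _×-dec_)
open import Defs

-- Writing the order as q = r + 2 makes q, q - 1 and q + 1 successors by computation; q - 2 = r is
-- the exponent that recurs below.
module _ (r p k : ℕ) (pp : Prime p) (q≡p^k : suc (suc r) ≡ p ^ℕ suc k) (F : FiniteField (suc (suc r) ^ℕ 2)) where

  -- Arithmetic of GF(q²): conjugation, norm, polynomials, power sums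

  module FieldArithmetic where

    q q-1 q+1 : ℕ
    q = suc (suc r)
    q-1 = suc r
    q+1 = suc q

    abstract
      q² q²-1 : ℕ
      q² = q ^ℕ 2
      q²-1 = q-1 *ℕ q+1

      q²-def : q² ≡ q ^ℕ 2
      q²-def = refl

      q²-1-def : q²-1 ≡ q-1 *ℕ q+1
      q²-1-def = refl

      q²≡ : q² ≡ suc q²-1
      q²≡ = solve 1 (λ x → (con 2 :+ x) :* ((con 2 :+ x) :* con 1) := con 1 :+ (con 1 :+ x) :* (con 3 :+ x)) refl r
        where open ℕSolver.+-*-Solver

      q*q≡ : q *ℕ q ≡ q²
      q*q≡ = cong (q *ℕ_) (sym (ℕₚ.*-identityʳ q))

    FR : CommutativeRing Level.zero Level.zero
    FR = record { isCommutativeRing = FiniteField.isCommutativeRing F }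

    open FiniteField F public using (Carrier; _⁻¹; 0≢1; ⁻¹-inverse) renaming (_≟_ to infix 4 _≟_)
    open CommutativeRing FR public using (_+_; _*_; -_; 0#; 1#; _-_; +-assoc; +-comm; *-assoc; *-comm; +-identityˡ; +-identityʳ; *-identityˡ; *-identityʳ; zeroˡ; zeroʳ; distribˡ; distribʳ; -‿inverseˡ; -‿inverseʳ; ring; semiring; commutativeSemiring; +-commutativeMonoid; *-commutativeMonoid)
    open import Algebra.Properties.Ring ring public using (-‿distribˡ-*; -‿involutive; -‿+-comm; -0#≈0#)
    open import Algebra.Properties.Semiring.Mult semiring public using (×1-homo-*) renaming (_×_ to _·_; ×-homo-+ to ·-homo-+)
    open import Algebra.Properties.Semiring.Exp semiring public using (_^_; ^-homo-*; ^-assocʳ)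
    open import Algebra.Properties.CommutativeSemiring.Exp commutativeSemiring public using (^-distrib-*)
    open IntegerSolver FR public

    module FΣ = Big +-commutativeMonoid
    module FΠ = Big *-commutativeMonoid
    open FΣ public using () renaming (big to ∑)
    open FΠ public using () renaming (big to ∏)

    private
      variable
        X : Set

    1≢0 : 1# ≢ 0#
    1≢0 e = 0≢1 (sym e)

    inv-r : ∀ {x} → x ≢ 0# → x * x ⁻¹ ≡ 1#
    inv-r {x} = ⁻¹-inverse x

    inv-l : ∀ {x} → x ≢ 0# → x ⁻¹ * x ≡ 1#
    inv-l {x} ne = trans (*-comm _ _) (inv-r ne)

    domain : ∀ {x y} → x * y ≡ 0# → x ≢ 0# → y ≡ 0#
    domain {x} {y} e ne = begin
      y ≡⟨ *-identityˡ y ⟨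
      1# * y ≡⟨ cong (_* y) (inv-l ne) ⟨
      (x ⁻¹ * x) * y ≡⟨ *-assoc _ _ _ ⟩
      x ⁻¹ * (x * y) ≡⟨ cong (x ⁻¹ *_) e ⟩
      x ⁻¹ * 0# ≡⟨ zeroʳ _ ⟩
      0# ∎
      where open ≡-Reasoning

    *-≢0 : ∀ {x y} → x ≢ 0# → y ≢ 0# → x * y ≢ 0#
    *-≢0 nx ny e = ny (domain e nx)

    x-y≡0 : ∀ {x y} → x - y ≡ 0# → x ≡ y
    x-y≡0 {x} {y} e = trans (solve 2 (λ a b → a := (a :- b) :+ b) refl x y) (trans (cong (_+ y) e) (+-identityˡ y))

    x≢y⇒x-y≢0 : ∀ {x y} → x ≢ y → x - y ≢ 0#
    x≢y⇒x-y≢0 ne e = ne (x-y≡0 e)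

    *-cancelˡ : ∀ {a x y} → a ≢ 0# → a * x ≡ a * y → x ≡ y
    *-cancelˡ {a} {x} {y} ne e = x-y≡0 (domain (trans (solve 3 (λ a x y → a :* (x :- y) := a :* x :- a :* y) refl a x y) (trans (cong (_- a * y) e) (-‿inverseʳ _))) ne)

    inv≢0 : ∀ {x} → x ≢ 0# → x ⁻¹ ≢ 0#
    inv≢0 {x} ne e = 1≢0 (trans (sym (inv-r ne)) (trans (cong (x *_) e) (zeroʳ x)))

    inv-unique : ∀ {x y} → x * y ≡ 1# → y ≡ x ⁻¹
    inv-unique {x} {y} e = *-cancelˡ x≢0 (trans e (sym (inv-r x≢0)))
      where
      x≢0 : x ≢ 0#
      x≢0 z = 1≢0 (trans (sym e) (trans (cong (_* y) z) (zeroˡ y)))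

    neg≢0 : ∀ {x} → x ≢ 0# → - x ≢ 0#
    neg≢0 {x} ne e = ne (trans (sym (-‿involutive x)) (trans (cong -_ e) -0#≈0#))

    ^-≢0 : ∀ {x} n → x ≢ 0# → x ^ n ≢ 0#
    ^-≢0 zero ne = 1≢0
    ^-≢0 (suc n) ne = *-≢0 ne (^-≢0 n ne)

    1^ : ∀ n → 1# ^ n ≡ 1#
    1^ zero = refl
    1^ (suc n) = trans (*-identityˡ _) (1^ n)

    ^-≡0 : ∀ x n → x ^ n ≡ 0# → x ≡ 0#
    ^-≡0 x n e with x ≟ 0#
    ... | yes z = z
    ... | no ne = ⊥-elim (^-≢0 n ne e)

    ∑-*ˡ : (a : Carrier) (f : X → Carrier) (xs : List X) → a * ∑ f xs ≡ ∑ (λ x → a * f x) xs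
    ∑-*ˡ a f [] = zeroʳ a
    ∑-*ˡ a f (x ∷ xs) = trans (distribˡ _ _ _) (cong (a * f x +_) (∑-*ˡ a f xs))

    ∑-*ʳ : (a : Carrier) (f : X → Carrier) (xs : List X) → ∑ f xs * a ≡ ∑ (λ x → f x * a) xs
    ∑-*ʳ a f [] = zeroˡ a
    ∑-*ʳ a f (x ∷ xs) = trans (distribʳ _ _ _) (cong (f x * a +_) (∑-*ʳ a f xs))

    ∑-neg : (f : X → Carrier) (xs : List X) → - ∑ f xs ≡ ∑ (λ x → - f x) xs
    ∑-neg f [] = -0#≈0#
    ∑-neg f (x ∷ xs) = trans (sym (-‿+-comm _ _)) (cong (- f x +_) (∑-neg f xs))

    ∑-const : (a : Carrier) (xs : List X) → ∑ (λ _ → a) xs ≡ (length xs · 1#) * a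
    ∑-const a [] = sym (zeroˡ a)
    ∑-const a (x ∷ xs) = sym (trans (distribʳ _ _ _) (cong₂ _+_ (*-identityˡ a) (sym (∑-const a xs))))

    ∏-≢0 : (f : X → Carrier) (xs : List X) → (∀ {x} → x ∈ xs → f x ≢ 0#) → ∏ f xs ≢ 0#
    ∏-≢0 f [] h = 1≢0
    ∏-≢0 f (x ∷ xs) h = *-≢0 (h (here refl)) (∏-≢0 f xs (λ m → h (there m)))

    ∏-*ˡ : (a : Carrier) (f : X → Carrier) (xs : List X) → ∏ (λ x → a * f x) xs ≡ a ^ length xs * ∏ f xs
    ∏-*ˡ a f xs = trans (FΠ.big-∙ (λ _ → a) f xs) (cong (_* ∏ f xs) (const xs))
      where
      const : ∀ xs → ∏ (λ _ → a) xs ≡ a ^ length xs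
      const [] = refl
      const (x ∷ xs) = cong (a *_) (const xs)

    abstract
      el : List Carrier
      el = elems F

      el≡elems : el ≡ elems F
      el≡elems = refl

      el-complete : ∀ x → x ∈ el
      el-complete x = subst (_∈ el) (Inverse.inverseˡ (FiniteField.enum F) refl) (∈-map⁺ (Inverse.to (FiniteField.enum F)) (∈-allFin (Inverse.from (FiniteField.enum F) x)))

      el-unique : Unique el
      el-unique = Uniqₚ.map⁺ (λ {x} {y} h → trans (sym (Inverse.inverseʳ (FiniteField.enum F) refl)) (trans (cong (Inverse.from (FiniteField.enum F)) h) (Inverse.inverseʳ (FiniteField.enum F) refl))) (Uniqₚ.allFin⁺ (q ^ℕ 2))

      el-length : length el ≡ q²
      el-length = trans (Listₚ.length-map _ (allFin q²)) (Listₚ.length-tabulate {n = q²} (λ i → i))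

    nonzero? : (x : Carrier) → Dec (x ≢ 0#)
    nonzero? x = ¬? (x ≟ 0#)

    nz : List Carrier
    nz = filter nonzero? el

    nz-unique : Unique nz
    nz-unique = Uniqₚ.filter⁺ nonzero? el-unique

    ∈nz : ∀ {x} → x ≢ 0# → x ∈ nz
    ∈nz {x} ne = ∈-filter⁺ nonzero? (el-complete x) ne

    nz∈ : ∀ {x} → x ∈ nz → x ≢ 0#
    nz∈ m = proj₂ (∈-filter⁻ nonzero? {xs = el} m)

    nz-length : length nz ≡ q²-1
    nz-length = ℕₚ.suc-injective (trans (ℕₚ.≤-antisym (length-⊆ u1 (λ {z} _ → el-complete z)) (length-⊆ el-unique sub)) (trans el-length q²≡))
      where
      u1 : Unique (0# ∷ nz)
      u1 = All.tabulate (λ m e → nz∈ m (sym e)) ∷ nz-unique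
      sub : ∀ {z} → z ∈ el → z ∈ 0# ∷ nz
      sub {z} _ with z ≟ 0#
      ... | yes refl = here refl
      ... | no ne = there (∈nz ne)

    ∑el-0 : (f : Carrier → Carrier) → f 0# ≡ 0# → ∑ f el ≡ ∑ f nz
    ∑el-0 f z = sym (trans (FΣ.big-filter nonzero? f el) (FΣ.big-cong el h))
      where
      h : ∀ x → FΣ.guard (nonzero? x) (f x) ≡ f x
      h x with x ≟ 0#
      ... | yes refl = sym z
      ... | no _ = refl

    -- Multiplication by `a` permutes `xs`, so it does not change the product of `xs`. Only
    -- stability under `a` is asked for, because the lemma is also applied to sets of coordinates
    -- and of slopes that are not groups.
    lagrange : ∀ {a} {xs : List Carrier} → a ≢ 0# → Unique xs → (∀ {x} → x ∈ xs → x ≢ 0#) → (∀ {x} → x ∈ xs → a * x ∈ xs) → a ^ length xs ≡ 1#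
    lagrange {a} {xs} ane u nzs st = *-cancelˡ (∏-≢0 (λ x → x) xs nzs) (begin
      ∏ (λ x → x) xs * a ^ length xs ≡⟨ *-comm _ _ ⟩
      a ^ length xs * ∏ (λ x → x) xs ≡⟨ ∏-*ˡ a (λ x → x) xs ⟨
      ∏ (λ x → a * x) xs ≡⟨ FΠ.big-perm (λ x → x) (a *_) _≟_ u st (λ _ _ e → *-cancelˡ ane e) ⟩
      ∏ (λ x → x) xs ≡⟨ *-identityʳ _ ⟨
      ∏ (λ x → x) xs * 1# ∎)
      where open ≡-Reasoning

    fermat : ∀ {x} → x ≢ 0# → x ^ q²-1 ≡ 1#
    fermat ne = trans (cong (_ ^_) (sym nz-length)) (lagrange ne nz-unique nz∈ (λ m → ∈nz (*-≢0 ne (nz∈ m))))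

    fermat' : ∀ x → x ^ q² ≡ x
    fermat' x with x ≟ 0#
    ... | yes refl = trans (cong (0# ^_) q²≡) (zeroˡ _)
    ... | no ne = trans (cong (x ^_) q²≡) (trans (cong (x *_) (fermat ne)) (*-identityʳ x))

    -- Characteristic and the involution x ↦ x^q

    -- Translation by 1 permutes the field, so the sum of all x equals the sum of all 1 + x.
    q²·1≡0 : q² · 1# ≡ 0#
    q²·1≡0 = begin
      q² · 1# ≡⟨ cong (_· 1#) el-length ⟨
      length el · 1# ≡⟨ *-identityʳ _ ⟨
      (length el · 1#) * 1# ≡⟨ ∑-const 1# el ⟨
      ∑ (λ _ → 1#) el ≡⟨ solve 2 (λ a b → b := (b :+ a) :- a) refl (∑ (λ x → x) el) (∑ (λ _ → 1#) el) ⟩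
      (∑ (λ _ → 1#) el + ∑ (λ x → x) el) - ∑ (λ x → x) el ≡⟨ cong (_- ∑ (λ x → x) el) (FΣ.big-∙ (λ _ → 1#) (λ x → x) el) ⟨
      ∑ (λ x → 1# + x) el - ∑ (λ x → x) el ≡⟨ cong (_- ∑ (λ x → x) el) (FΣ.big-perm (λ x → x) (1# +_) _≟_ el-unique (λ _ → el-complete _) (λ {x} {y} _ _ e → x-y≡0 (trans (solve 2 (λ x y → x :- y := (:1 :+ x) :- (:1 :+ y)) refl x y) (trans (cong (_- (1# + y)) e) (-‿inverseʳ _))))) ⟩
      ∑ (λ x → x) el - ∑ (λ x → x) el ≡⟨ -‿inverseʳ _ ⟩
      0# ∎
      where open ≡-Reasoning

    ·1-^ : ∀ m n → (m ^ℕ n) · 1# ≡ (m · 1#) ^ n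
    ·1-^ m zero = +-identityʳ 1#
    ·1-^ m (suc n) = trans (×1-homo-* m (m ^ℕ n)) (cong ((m · 1#) *_) (·1-^ m n))

    -- q² is a power of p, and a field has no nonzero nilpotent elements.
    char-p : p · 1# ≡ 0#
    char-p = ^-≡0 (p · 1#) (suc k) (trans (sym (·1-^ p (suc k))) (trans (cong (_· 1#) (sym q≡p^k)) (^-≡0 (q · 1#) 2 (trans (sym (·1-^ q 2)) (trans (cong (_· 1#) (sym q²-def)) q²·1≡0)))))

    q·1≡0 : q · 1# ≡ 0#
    q·1≡0 = ^-≡0 (q · 1#) 2 (trans (sym (·1-^ q 2)) (trans (cong (_· 1#) (sym q²-def)) q²·1≡0))

    q-1·1 : q-1 · 1# ≡ - 1#
    q-1·1 = x-y≡0 (trans (solve 1 (λ n → n :- (:- :1) := :1 :+ n) refl (q-1 · 1#)) q·1≡0)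

    bar : Carrier → Carrier
    bar x = x ^ q

    bar-+ : ∀ x y → bar (x + y) ≡ bar x + bar y
    bar-+ x y = subst (λ n → (x + y) ^ n ≡ x ^ n + y ^ n) (sym q≡p^k) (Frobenius.frobenius^-+ FR pp char-p (suc k) x y)

    bar-* : ∀ x y → bar (x * y) ≡ bar x * bar y
    bar-* x y = ^-distrib-* x y q

    bar-0 : bar 0# ≡ 0#
    bar-0 = zeroˡ _

    bar-1 : bar 1# ≡ 1#
    bar-1 = 1^ q

    bar-neg : ∀ x → bar (- x) ≡ - bar x
    bar-neg x = x-y≡0 (trans (solve 2 (λ a b → a :- (:- b) := b :+ a) refl (bar (- x)) (bar x)) (trans (sym (bar-+ x (- x))) (trans (cong bar (-‿inverseʳ x)) bar-0)))

    bar-sub : ∀ x y → bar (x - y) ≡ bar x - bar y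
    bar-sub x y = trans (bar-+ x (- y)) (cong (bar x +_) (bar-neg y))

    bar-bar : ∀ x → bar (bar x) ≡ x
    bar-bar x = trans (^-assocʳ x q q) (trans (cong (x ^_) q*q≡) (fermat' x))

    bar-^ : ∀ x n → bar (x ^ n) ≡ bar x ^ n
    bar-^ x n = trans (^-assocʳ x n q) (trans (cong (x ^_) (ℕₚ.*-comm n q)) (sym (^-assocʳ x q n)))

    bar-≢0 : ∀ {x} → x ≢ 0# → bar x ≢ 0#
    bar-≢0 ne = ^-≢0 q ne

    bar-inv : ∀ {x} → x ≢ 0# → bar (x ⁻¹) ≡ (bar x) ⁻¹
    bar-inv {x} ne = inv-unique (trans (sym (bar-* x (x ⁻¹))) (trans (cong bar (inv-r ne)) bar-1))

    bar-inj : ∀ {x y} → bar x ≡ bar y → x ≡ y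
    bar-inj {x} {y} e = trans (sym (bar-bar x)) (trans (cong bar e) (bar-bar y))

    -- As the exponent is the successor of q, this unfolds to `x * bar x`.
    Nm : Carrier → Carrier
    Nm x = x ^ q+1

    Nm-* : ∀ x y → Nm (x * y) ≡ Nm x * Nm y
    Nm-* x y = ^-distrib-* x y q+1

    Nm-≢0 : ∀ {x} → x ≢ 0# → Nm x ≢ 0#
    Nm-≢0 = ^-≢0 q+1

    Nm-0 : Nm 0# ≡ 0#
    Nm-0 = zeroˡ _

    Nm-bar : ∀ x → bar (Nm x) ≡ Nm x
    Nm-bar x = trans (bar-* x (bar x)) (trans (cong (bar x *_) (bar-bar x)) (*-comm _ _))

    Real : Carrier → Set
    Real x = bar x ≡ x

    real? : (x : Carrier) → Dec (Real x)
    real? x = bar x ≟ x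

    nonreal? : (x : Carrier) → Dec (¬ Real x)
    nonreal? x = ¬? (real? x)

    -- The group GF(q)*. As the solution set of x^(q-1) = 1 it excludes 0 and is visibly closed
    -- under products.
    InD : Carrier → Set
    InD x = x ^ q-1 ≡ 1#

    inD? : (x : Carrier) → Dec (InD x)
    inD? x = x ^ q-1 ≟ 1#

    InD-≢0 : ∀ {x} → InD x → x ≢ 0#
    InD-≢0 d refl = 1≢0 (trans (sym d) (zeroˡ _))

    InD-real : ∀ {x} → InD x → Real x
    InD-real {x} d = trans (cong (x *_) d) (*-identityʳ x)

    real-InD : ∀ {x} → Real x → x ≢ 0# → InD x
    real-InD {x} e ne = *-cancelˡ ne (trans e (sym (*-identityʳ x)))

    InD-* : ∀ {x y} → InD x → InD y → InD (x * y)
    InD-* {x} {y} a b = trans (^-distrib-* x y q-1) (trans (cong₂ _*_ a b) (*-identityˡ 1#))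

    InD-inv : ∀ {x} → InD x → InD (x ⁻¹)
    InD-inv {x} d = real-InD (trans (bar-inv (InD-≢0 d)) (cong _⁻¹ (InD-real d))) (inv≢0 (InD-≢0 d))

    Nm-InD : ∀ {x} → x ≢ 0# → InD (Nm x)
    Nm-InD {x} ne = real-InD (Nm-bar x) (Nm-≢0 ne)

    -- Polynomials are coefficient lists, constant term first, possibly with trailing zeros.

    Poly : Set
    Poly = List Carrier

    eval : Poly → Carrier → Carrier
    eval [] x = 0#
    eval (a ∷ P) x = a + x * eval P x

    -- The value of the formal derivative, by the product rule for a + X P.
    evald : Poly → Carrier → Carrier
    evald [] x = 0#
    evald (a ∷ P) x = eval P x + x * evald P x

    infixl 6 _⊹_
    _⊹_ : Poly → Poly → Poly
    [] ⊹ Q = Q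
    (a ∷ P) ⊹ [] = a ∷ P
    (a ∷ P) ⊹ (b ∷ Q) = (a + b) ∷ (P ⊹ Q)

    scale : Carrier → Poly → Poly
    scale a = map (a *_)

    mulP : Poly → Poly → Poly
    mulP [] Q = []
    mulP (a ∷ P) Q = scale a Q ⊹ (0# ∷ mulP P Q)

    powP : Poly → ℕ → Poly
    powP P zero = 1# ∷ []
    powP P (suc n) = mulP P (powP P n)

    eval-⊹ : ∀ P Q x → eval (P ⊹ Q) x ≡ eval P x + eval Q x
    eval-⊹ [] Q x = sym (+-identityˡ _)
    eval-⊹ (a ∷ P) [] x = sym (+-identityʳ _)
    eval-⊹ (a ∷ P) (b ∷ Q) x = trans (cong (λ t → (a + b) + x * t) (eval-⊹ P Q x))
      (solve 5 (λ a b x s t → (a :+ b) :+ x :* (s :+ t) := (a :+ x :* s) :+ (b :+ x :* t)) refl a b x (eval P x) (eval Q x))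

    eval-scale : ∀ a P x → eval (scale a P) x ≡ a * eval P x
    eval-scale a [] x = sym (zeroʳ a)
    eval-scale a (b ∷ P) x = trans (cong (λ t → a * b + x * t) (eval-scale a P x))
      (solve 4 (λ a b x s → a :* b :+ x :* (a :* s) := a :* (b :+ x :* s)) refl a b x (eval P x))

    eval-mulP : ∀ P Q x → eval (mulP P Q) x ≡ eval P x * eval Q x
    eval-mulP [] Q x = sym (zeroˡ _)
    eval-mulP (a ∷ P) Q x = trans (eval-⊹ (scale a Q) (0# ∷ mulP P Q) x) (trans (cong₂ (λ s t → s + (0# + x * t)) (eval-scale a Q x) (eval-mulP P Q x))
      (solve 4 (λ a s x t → a :* s :+ (:0 :+ x :* (t :* s)) := (a :+ x :* t) :* s) refl a (eval Q x) x (eval P x)))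

    eval-powP : ∀ P n x → eval (powP P n) x ≡ eval P x ^ n
    eval-powP P zero x = trans (cong (1# +_) (zeroʳ x)) (+-identityʳ 1#)
    eval-powP P (suc n) x = trans (eval-mulP P (powP P n) x) (cong (eval P x *_) (eval-powP P n x))

    evald-⊹ : ∀ P Q x → evald (P ⊹ Q) x ≡ evald P x + evald Q x
    evald-⊹ [] Q x = sym (+-identityˡ _)
    evald-⊹ (a ∷ P) [] x = sym (+-identityʳ _)
    evald-⊹ (a ∷ P) (b ∷ Q) x = trans (cong₂ (λ s t → s + x * t) (eval-⊹ P Q x) (evald-⊹ P Q x))
      (solve 5 (λ s t x u v → (s :+ t) :+ x :* (u :+ v) := (s :+ x :* u) :+ (t :+ x :* v)) refl (eval P x) (eval Q x) x (evald P x) (evald Q x))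

    evald-scale : ∀ a P x → evald (scale a P) x ≡ a * evald P x
    evald-scale a [] x = sym (zeroʳ a)
    evald-scale a (b ∷ P) x = trans (cong₂ (λ s t → s + x * t) (eval-scale a P x) (evald-scale a P x))
      (solve 4 (λ a s x t → a :* s :+ x :* (a :* t) := a :* (s :+ x :* t)) refl a (eval P x) x (evald P x))

    evald-mulP : ∀ P Q x → evald (mulP P Q) x ≡ evald P x * eval Q x + eval P x * evald Q x
    evald-mulP [] Q x = solve 2 (λ s t → :0 := :0 :* s :+ :0 :* t) refl (eval Q x) (evald Q x)
    evald-mulP (a ∷ P) Q x = trans (evald-⊹ (scale a Q) (0# ∷ mulP P Q) x)
      (trans (cong₂ _+_ (evald-scale a Q x) (cong₂ (λ s t → s + x * t) (eval-mulP P Q x) (evald-mulP P Q x)))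
      (solve 6 (λ a x s s' t t' → a :* t' :+ (s :* t :+ x :* (s' :* t :+ s :* t')) := (s :+ x :* s') :* t :+ (a :+ x :* s) :* t') refl a x (eval P x) (evald P x) (eval Q x) (evald Q x)))

    evald-powP : ∀ P n x → evald (powP P (suc n)) x ≡ (suc n · 1#) * (eval P x ^ n * evald P x)
    evald-powP P zero x = trans (evald-mulP P (1# ∷ []) x) (solve 3 (λ s t x → t :* (:1 :+ x :* :0) :+ s :* (:0 :+ x :* :0) := (:1 :+ :0) :* (:1 :* t)) refl (eval P x) (evald P x) x)
    evald-powP P (suc n) x = trans (evald-mulP P (powP P (suc n)) x) (trans (cong₂ (λ u v → evald P x * u + eval P x * v) (eval-powP P (suc n) x) (evald-powP P n x))
      (solve 4 (λ s t e n → t :* (s :* e) :+ s :* (n :* (e :* t)) := (:1 :+ n) :* ((s :* e) :* t)) refl (eval P x) (evald P x) (eval P x ^ n) (suc n · 1#)))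

    length-⊹ : ∀ P Q {n} → length P ≤ n → length Q ≤ n → length (P ⊹ Q) ≤ n
    length-⊹ [] Q a b = b
    length-⊹ (x ∷ P) [] a b = a
    length-⊹ (x ∷ P) (y ∷ Q) (s≤s a) (s≤s b) = s≤s (length-⊹ P Q a b)

    length-mulP : ∀ P Q {m n} → length P ≤ suc m → length Q ≤ suc n → length (mulP P Q) ≤ suc (m +ℕ n)
    length-mulP [] Q a b = z≤n
    length-mulP (x ∷ []) Q {m} {n} a b = length-⊹ (scale x Q) (0# ∷ []) (ℕₚ.≤-trans (subst (_≤ suc n) (sym (Listₚ.length-map (x *_) Q)) b) (s≤s (ℕₚ.m≤n+m n m))) (s≤s z≤n)
    length-mulP (x ∷ y ∷ P) Q {suc m} {n} (s≤s a) b = length-⊹ (scale x Q) (0# ∷ mulP (y ∷ P) Q) (ℕₚ.≤-trans (subst (_≤ suc n) (sym (Listₚ.length-map (x *_) Q)) b) (s≤s (ℕₚ.m≤n+m n (suc m)))) (s≤s (length-mulP (y ∷ P) Q a b))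
    length-mulP (x ∷ y ∷ P) Q {zero} {n} (s≤s ()) b

    length-powP : ∀ P n {m} → length P ≤ suc m → length (powP P n) ≤ suc (n *ℕ m)
    length-powP P zero a = s≤s z≤n
    length-powP P (suc n) {m} a = length-mulP P (powP P n) a (length-powP P n a)

    -- The quotient of P(X) - P(x) by X - x.
    quot : Poly → Carrier → Poly
    quot [] x = []
    quot (a ∷ P) x = P ⊹ scale x (quot P x)

    quot-eval : ∀ P x y → eval P y ≡ eval P x + (y - x) * eval (quot P x) y
    quot-eval [] x y = sym (trans (+-identityˡ _) (zeroʳ _))
    quot-eval (a ∷ P) x y = trans (cong (λ t → a + y * t) (quot-eval P x y)) (sym (trans (cong (λ t → (a + x * eval P x) + (y - x) * t)
        (trans (eval-⊹ P (scale x (quot P x)) y) (cong₂ _+_ (quot-eval P x y) (eval-scale x (quot P x) y))))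
      (solve 5 (λ a x y s t → (a :+ x :* s) :+ (y :- x) :* ((s :+ (y :- x) :* t) :+ x :* t) := a :+ y :* (s :+ (y :- x) :* t)) refl a x y (eval P x) (eval (quot P x) y))))

    quot-length : ∀ a P x → length (quot (a ∷ P) x) ≤ length P
    quot-length a [] x = z≤n
    quot-length a (b ∷ P) x = length-⊹ (b ∷ P) (scale x (quot (b ∷ P) x)) ℕₚ.≤-refl
      (subst (_≤ suc (length P)) (sym (Listₚ.length-map (x *_) (quot (b ∷ P) x))) (ℕₚ.≤-trans (quot-length b P x) (ℕₚ.n≤1+n _)))

    many-roots : ∀ P {xs} → Unique xs → (∀ {x} → x ∈ xs → eval P x ≡ 0#) → length P ≤ length xs → ∀ y → eval P y ≡ 0#
    many-roots [] u rt le y = refl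
    many-roots (a ∷ P) {x ∷ xs} u rt (s≤s le) y = trans (quot-eval (a ∷ P) x y) (trans (cong₂ (λ s t → s + (y - x) * t) (rt (here refl))
        (many-roots (quot (a ∷ P) x) (unique-tail u) rt' (ℕₚ.≤-trans (quot-length a P x) le) y)) (trans (+-identityˡ _) (zeroʳ _)))
      where
      rt' : ∀ {z} → z ∈ xs → eval (quot (a ∷ P) x) z ≡ 0#
      rt' {z} m = domain (trans (sym (+-identityˡ _)) (trans (cong (λ t → t + (z - x) * eval (quot (a ∷ P) x) z) (sym (rt (here refl)))) (trans (sym (quot-eval (a ∷ P) x z)) (rt (there m)))))
        (x≢y⇒x-y≢0 (λ { refl → unique-head∉ u m }))

    -- The value at 0 is the constant term. Once it is gone, the rest has at most q² - 1
    -- coefficients and vanishes at the q² - 1 nonzero points.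
    zero-poly : ∀ P → length P ≤ q² → (∀ y → eval P y ≡ 0#) → All (_≡ 0#) P
    zero-poly [] le h = []
    zero-poly (a ∷ P) le h = a≡0 ∷ zero-poly P (ℕₚ.≤-trans (ℕₚ.n≤1+n _) le)
        (many-roots P nz-unique (λ {x} m → domain (trans (sym (+-identityˡ _)) (trans (cong (_+ x * eval P x) (sym a≡0)) (h x))) (nz∈ m))
          (subst (length P ≤_) (sym nz-length) (ℕₚ.≤-pred (subst (suc (length P) ≤_) q²≡ le))))
      where
      a≡0 : a ≡ 0#
      a≡0 = trans (sym (trans (cong (a +_) (zeroˡ _)) (+-identityʳ a))) (h 0#)

    all-zero-evald : ∀ {P} → All (_≡ 0#) P → ∀ x → evald P x ≡ 0#
    all-zero-eval : ∀ {P} → All (_≡ 0#) P → ∀ x → eval P x ≡ 0#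
    all-zero-eval [] x = refl
    all-zero-eval (refl ∷ a) x = trans (+-identityˡ _) (trans (cong (x *_) (all-zero-eval a x)) (zeroʳ x))
    all-zero-evald [] x = refl
    all-zero-evald (_ ∷ a) x = trans (cong₂ (λ s t → s + x * t) (all-zero-eval a x) (all-zero-evald a x)) (trans (+-identityˡ _) (zeroʳ x))

    -- Below degree q² a polynomial is determined by its values on the field. Derivatives are
    -- inferred from values through this lemma, which is the source of the degree bounds below.
    deriv-unique : ∀ P Q → length P ≤ q² → length Q ≤ q² → (∀ y → eval P y ≡ eval Q y) → ∀ x → evald P x ≡ evald Q x
    deriv-unique P Q lp lq h x = x-y≡0 (trans (cong (evald P x +_) (solve 1 (λ z → :- z := (:- :1) :* z) refl (evald Q x)))
        (trans (sym (trans (evald-⊹ P (scale (- 1#) Q) x) (cong (evald P x +_) (evald-scale (- 1#) Q x))))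
          (all-zero-evald (zero-poly (P ⊹ scale (- 1#) Q) (length-⊹ P _ lp (subst (_≤ q²) (sym (Listₚ.length-map ((- 1#) *_) Q)) lq)) van) x)))
      where
      van : ∀ y → eval (P ⊹ scale (- 1#) Q) y ≡ 0#
      van y = trans (eval-⊹ P (scale (- 1#) Q) y) (trans (cong₂ _+_ (h y) (eval-scale (- 1#) Q y)) (solve 1 (λ z → z :+ (:- :1) :* z := :0) refl (eval Q y)))

    mono : ℕ → Poly
    mono zero = 1# ∷ []
    mono (suc n) = 0# ∷ mono n

    eval-mono : ∀ n x → eval (mono n) x ≡ x ^ n
    eval-mono zero x = trans (cong (1# +_) (zeroʳ x)) (+-identityʳ 1#)
    eval-mono (suc n) x = trans (+-identityˡ _) (cong (x *_) (eval-mono n x))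

    length-mono : ∀ n → length (mono n) ≡ suc n
    length-mono zero = refl
    length-mono (suc n) = cong suc (length-mono n)

    -- With more solutions X^(n+1) - c would vanish everywhere, but at 0 and at 1 this says c = 0
    -- and c = 1.
    roots-bound : ∀ n c {xs} → Unique xs → (∀ {x} → x ∈ xs → x ^ suc n ≡ c) → length xs ≤ suc n
    roots-bound n c {xs} u h with suc (suc n) ℕₚ.≤? length xs
    ... | no nle = ℕₚ.≤-pred (ℕₚ.≰⇒> nle)
    ... | yes le = ⊥-elim (0≢1 (trans (sym (at 0# (zeroˡ _))) (at 1# (1^ (suc n)))))
      where
      P : Poly
      P = - c ∷ mono n
      ev : ∀ x → eval P x ≡ - c + x ^ suc n
      ev x = cong (λ t → - c + x * t) (eval-mono n x)
      van : ∀ y → eval P y ≡ 0#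
      van = many-roots P u (λ {x} m → trans (ev x) (trans (cong (- c +_) (h m)) (-‿inverseˡ c))) (subst (λ l → suc l ≤ length xs) (sym (length-mono n)) le)
      at : ∀ y {z} → y ^ suc n ≡ z → c ≡ z
      at y {z} e = sym (x-y≡0 (trans (+-comm _ _) (trans (cong (- c +_) (sym e)) (trans (sym (ev y)) (van y)))))

    -- The subfield of order q, and the norm

    Dl : List Carrier
    Dl = filter inD? el

    Dl-unique : Unique Dl
    Dl-unique = Uniqₚ.filter⁺ inD? el-unique

    ∈Dl : ∀ {x} → InD x → x ∈ Dl
    ∈Dl {x} d = ∈-filter⁺ inD? (el-complete x) d

    Dl∈ : ∀ {x} → x ∈ Dl → InD x
    Dl∈ m = proj₂ (∈-filter⁻ inD? {xs = el} m)

    private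
      fibre-≤ : ∀ d → length (filter (λ x → Nm x ≟ d) nz) ≤ q+1
      fibre-≤ d = roots-bound q d (Uniqₚ.filter⁺ (λ x → Nm x ≟ d) nz-unique) (λ {x} m → proj₂ (∈-filter⁻ (λ x → Nm x ≟ d) {xs = nz} m))

      total : sumℕ (λ d → length (filter (λ x → Nm x ≟ d) nz)) Dl ≡ q²-1
      total = trans (ℕΣ.big-cong Dl (λ d → trans (count-ind (λ x → Nm x ≟ d) nz) (sym (ℕΣ.big-cong nz (λ x → refl)))))
        (trans (count-fibres yes-dec _≟_ Nm nz Dl-unique (λ m _ → ∈Dl (Nm-InD (nz∈ m)))) (trans (cong length (Listₚ.filter-all yes-dec {xs = nz} (All.tabulate (λ _ → tt)))) nz-length))
        where
        yes-dec : Carrier → Dec ⊤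
        yes-dec x = yes tt

      Dl-≤ : length Dl ≤ q-1
      Dl-≤ = roots-bound r 1# Dl-unique Dl∈

    -- A fibre has at most q + 1 elements and GF(q)* at most q - 1; the q² - 1 nonzero elements of
    -- the field leave no slack in either bound.
    Nm-fibre : ∀ {d} → InD d → length (filter (λ x → Nm x ≟ d) nz) ≡ q+1
    Nm-fibre d = sumℕ-tight (λ d → length (filter (λ x → Nm x ≟ d) nz)) q+1 Dl (λ {d} _ → fibre-≤ d)
      (subst (length Dl *ℕ q+1 ≤_) (sym (trans total q²-1-def)) (ℕₚ.*-monoˡ-≤ q+1 Dl-≤)) (∈Dl d)

    Dl-length : length Dl ≡ q-1
    Dl-length = ℕₚ.*-cancelʳ-≡ (length Dl) q-1 q+1 (trans (sym (sumℕ-const q+1 Dl)) (trans (sym (ℕΣ.big-cong∈ Dl (λ m → Nm-fibre (Dl∈ m)))) (trans total q²-1-def)))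

    count-split : ∀ {P : X → Set} (P? : ∀ x → Dec (P x)) (xs : List X) → length (filter P? xs) +ℕ length (filter (λ x → ¬? (P? x)) xs) ≡ length xs
    count-split P? [] = refl
    count-split P? (x ∷ xs) with P? x
    ... | yes _ = cong suc (count-split P? xs)
    ... | no _ = trans (ℕₚ.+-suc _ _) (cong suc (count-split P? xs))

    Rl Ml : List Carrier
    Rl = filter real? el
    Ml = filter nonreal? el

    ∈Rl : ∀ {x} → Real x → x ∈ Rl
    ∈Rl {x} = ∈-filter⁺ real? (el-complete x)

    Rl∈ : ∀ {x} → x ∈ Rl → Real x
    Rl∈ m = proj₂ (∈-filter⁻ real? {xs = el} m)

    ∈Ml : ∀ {x} → ¬ Real x → x ∈ Ml
    ∈Ml {x} = ∈-filter⁺ nonreal? (el-complete x)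

    Ml∈ : ∀ {x} → x ∈ Ml → ¬ Real x
    Ml∈ m = proj₂ (∈-filter⁻ nonreal? {xs = el} m)

    Rl-unique : Unique Rl
    Rl-unique = Uniqₚ.filter⁺ real? el-unique

    Ml-unique : Unique Ml
    Ml-unique = Uniqₚ.filter⁺ nonreal? el-unique

    Rl-length : length Rl ≡ q
    Rl-length = trans (ℕₚ.≤-antisym (length-⊆ Rl-unique to) (length-⊆ u0 from)) (cong suc Dl-length)
      where
      u0 : Unique (0# ∷ Dl)
      u0 = All.tabulate (λ m e → InD-≢0 (Dl∈ m) (sym e)) ∷ Dl-unique
      to : ∀ {z} → z ∈ Rl → z ∈ 0# ∷ Dl
      to {z} m with z ≟ 0#
      ... | yes refl = here refl
      ... | no ne = there (∈Dl (real-InD (Rl∈ m) ne))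
      from : ∀ {z} → z ∈ 0# ∷ Dl → z ∈ Rl
      from (here refl) = ∈Rl bar-0
      from (there m) = ∈Rl (InD-real (Dl∈ m))

    Ml-length : length Ml ≡ q *ℕ q-1
    Ml-length = ℕₚ.+-cancelˡ-≡ q _ _ (trans (cong (_+ℕ length Ml) (sym Rl-length)) (trans (count-split real? el) (trans el-length (trans (sym q*q≡) (ℕₚ.*-suc q q-1)))))

    nonreal-≢0 : ∀ {x} → ¬ Real x → x ≢ 0#
    nonreal-≢0 nr refl = nr bar-0

    nonreal-bar : ∀ {x} → ¬ Real x → ¬ Real (bar x)
    nonreal-bar nr e = nr (bar-inj e)

    -- Power sums over the field

    ps : ℕ → Carrier
    ps i = ∑ (_^ i) el

    ps-perm : ∀ {g} i → g ≢ 0# → g ^ i * ps i ≡ ps i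
    ps-perm {g} i ne = trans (∑-*ˡ (g ^ i) (_^ i) el) (trans (FΣ.big-cong el (λ x → sym (^-distrib-* g x i)))
      (FΣ.big-perm (_^ i) (g *_) _≟_ el-unique (λ _ → el-complete _) (λ _ _ e → *-cancelˡ ne e)))

    -- For sums and coefficients that a substitution both preserves and multiplies by a factor other
    -- than 1.
    fix⇒0 : ∀ {a x} → a * x ≡ x → a ≢ 1# → x ≡ 0#
    fix⇒0 {a} {x} e ne = domain (trans (solve 2 (λ a x → (a :- :1) :* x := a :* x :- x) refl a x) (trans (cong (_- x) e) (-‿inverseʳ x))) (x≢y⇒x-y≢0 ne)

    non-root : ∀ (xs : List Carrier) → Unique xs → ∀ n → suc n < length xs → ∃ λ g → g ∈ xs × g ^ suc n ≢ 1#
    non-root xs u n lt with All.all? (λ x → x ^ suc n ≟ 1#) xs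
    ... | yes a = ⊥-elim (ℕₚ.<⇒≱ lt (roots-bound n 1# u (All.lookup a)))
    ... | no na with find-no xs na
      where
      find-no : ∀ xs → ¬ All (λ x → x ^ suc n ≡ 1#) xs → ∃ λ g → g ∈ xs × g ^ suc n ≢ 1#
      find-no [] na = ⊥-elim (na [])
      find-no (x ∷ xs) na with x ^ suc n ≟ 1#
      ... | no ne = x , here refl , ne
      ... | yes e with find-no xs (λ a → na (e ∷ a))
      ...   | g , m , ne = g , there m , ne
    ... | res = res

    ps-0 : ∀ i → i < q²-1 → ps i ≡ 0#
    ps-0 zero lt = trans (∑-const 1# el) (trans (*-identityʳ _) (trans (cong (_· 1#) el-length) q²·1≡0))
    ps-0 (suc i) lt with non-root nz nz-unique i (subst (suc i <_) (sym nz-length) lt)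
    ... | g , m , ne = fix⇒0 (ps-perm (suc i) (nz∈ m)) ne

    -- The factor n kills the exponent n - 1 = q² - 1, where the power sum is not zero; larger
    -- exponents are reduced modulo q² - 1, and the bound keeps them below twice that number. It
    -- says that derivatives of powers sum to zero.
    k·ps : ∀ n → n ≤ q² +ℕ q² ∸ 2 → (n · 1#) * ps (n ∸ 1) ≡ 0#
    k·ps zero le = zeroˡ _
    k·ps (suc n) le with suc n ℕₚ.≤? q²-1
    ... | yes lt = trans (cong ((suc n · 1#) *_) (ps-0 n lt)) (zeroʳ _)
    ... | no nlt with ℕₚ.m≤n⇒∃[o]m+o≡n (ℕₚ.≤-pred (ℕₚ.≰⇒> nlt))
    ...   | zero , e = trans (cong (λ t → (t · 1#) * ps n) (trans (cong suc (trans (sym e) (ℕₚ.+-identityʳ _))) (sym q²≡))) (trans (cong (_* ps n) q²·1≡0) (zeroˡ _))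
    ...   | suc i , e = trans (cong ((suc n · 1#) *_) psn) (zeroʳ _)
      where
      sh : ∀ x → x ^ n ≡ x ^ suc i
      sh x with x ≟ 0#
      ... | no ne = trans (cong (x ^_) (sym e)) (trans (^-homo-* x q²-1 (suc i)) (trans (cong (_* x ^ suc i) (fermat ne)) (*-identityˡ _)))
      ... | yes refl = trans (cong (0# ^_) (trans (sym e) (ℕₚ.+-suc q²-1 i))) (trans (zeroˡ _) (sym (zeroˡ _)))
      bd : suc i < q²-1
      bd = ℕₚ.+-cancelˡ-≤ q²-1 _ _ (ℕₚ.≤-trans (ℕₚ.≤-reflexive (trans (ℕₚ.+-suc q²-1 (suc i)) (cong suc e))) (ℕₚ.≤-trans le (ℕₚ.≤-reflexive (trans (cong (λ t → t +ℕ t ∸ 2) q²≡) (trans (cong (_∸ 1) (ℕₚ.+-suc q²-1 q²-1)) refl)))))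
      psn : ps n ≡ 0#
      psn = trans (FΣ.big-cong el sh) (ps-0 (suc i) bd)

  -- Lacunary polynomials attached to the line counts

  module LacunaryPolynomials where
    open FieldArithmetic

    open PowerSeries FR
    private
      module S = CommutativeRing seriesRing
      module SΠ = Big S.*-commutativeMonoid
      module SS = IntegerSolver seriesRing
      open import Algebra.Properties.Semiring.Exp S.semiring using () renaming (_^_ to _^ˢ_; ^-congˡ to ^ˢ-congˡ; ^-homo-* to ^ˢ-homo-*; ^-assocʳ to ^ˢ-assocʳ)
      open import Algebra.Properties.Semiring.Mult S.semiring using () renaming (_×_ to _·ˢ_)

    mon : ℕ → Carrier → Series
    mon zero a = const a
    mon (suc n) a zero = 0#
    mon (suc n) a (suc i) = mon n a i

    lin : Carrier → Series
    lin a = const 1# ⊞ mon 1 a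

    private
      0*+ : ∀ a b → 0# * a + b ≡ b
      0*+ a b = trans (cong (_+ b) (zeroˡ a)) (+-identityˡ b)

    mon-⊠ : ∀ n a s i → (mon n a ⊠ s) (n +ℕ i) ≡ a * s i
    mon-⊠ zero a s i = const-⊠ a s i
    mon-⊠ (suc n) a s i = trans (0*+ _ _) (mon-⊠ n a s i)

    mon-⊠-low : ∀ n a s i → i < n → (mon n a ⊠ s) i ≡ 0#
    mon-⊠-low (suc n) a s zero lt = zeroˡ _
    mon-⊠-low (suc n) a s (suc i) (s≤s lt) = trans (0*+ _ _) (mon-⊠-low n a s i lt)

    mon-* : ∀ m n a b → mon m a ⊠ mon n b ≋ mon (m +ℕ n) (a * b)
    mon-* zero n a b i = trans (const-⊠ a (mon n b) i) (go n i)
      where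
      go : ∀ n i → a * mon n b i ≡ mon n (a * b) i
      go zero zero = refl
      go zero (suc i) = zeroʳ a
      go (suc n) zero = zeroʳ a
      go (suc n) (suc i) = go n i
    mon-* (suc m) n a b zero = zeroˡ _
    mon-* (suc m) n a b (suc i) = trans (0*+ _ _) (mon-* m n a b i)

    mon-cong : ∀ n {a b} → a ≡ b → mon n a ≋ mon n b
    mon-cong n refl i = refl

    lin-⊠ : ∀ a s n → (lin a ⊠ s) (suc n) ≡ s (suc n) + a * s n
    lin-⊠ a s n = trans (cong₂ _+_ (trans (cong (_* s (suc n)) (+-identityʳ 1#)) (*-identityˡ _)) (S.*-cong (λ i → +-identityˡ (const a i)) (λ i → refl {x = s i}) n)) (cong (s (suc n) +_) (const-⊠ a s n))

    lin-⊠0 : ∀ a s → (lin a ⊠ s) 0 ≡ s 0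
    lin-⊠0 a s = trans (cong (_* s 0) (+-identityʳ 1#)) (*-identityˡ _)

    mon1-^ : ∀ n a → mon 1 a ^ˢ n ≋ mon n (a ^ n)
    mon1-^ zero a i = refl
    mon1-^ (suc n) a = S.trans (S.*-congˡ (mon1-^ n a)) (mon-* 1 n a (a ^ n))

    series-char : (p ·ˢ const 1#) ≋ (λ _ → 0#)
    series-char zero = trans (go p) char-p
      where
      go : ∀ n → (n ·ˢ const 1#) 0 ≡ n · 1#
      go zero = refl
      go (suc n) = cong (1# +_) (go n)
    series-char (suc i) = go p
      where
      go : ∀ n → (n ·ˢ const 1#) (suc i) ≡ 0#
      go zero = refl
      go (suc n) = trans (+-identityˡ _) (go n)

    1ˢ^ : ∀ n → const 1# ^ˢ n ≋ const 1#
    1ˢ^ zero = S.refl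
    1ˢ^ (suc n) = S.trans (S.*-identityˡ _) (1ˢ^ n)

    lin-^q : ∀ a → lin a ^ˢ q ≋ const 1# ⊞ mon q (bar a)
    lin-^q a = S.trans (subst (λ n → lin a ^ˢ n ≋ (const 1# ^ˢ n) ⊞ (mon 1 a ^ˢ n)) (sym q≡p^k) (Frobenius.frobenius^-+ seriesRing pp series-char (suc k) (const 1#) (mon 1 a)))
      (S.+-cong (1ˢ^ q) (mon1-^ q a))

    -- This and the next two lemmas: if Y^n divides `t`, the product has no terms below Y^n, and its
    -- next two coefficients involve only two coefficients of each factor.
    prefix0 : ∀ n (t z : Series) → (∀ j → j < n → t j ≡ 0#) → ∀ i → i < n → (t ⊠ z) i ≡ 0#
    prefix0 (suc n) t z h zero lt = trans (cong (_* z 0) (h 0 (s≤s z≤n))) (zeroˡ _)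
    prefix0 (suc n) t z h (suc i) (s≤s lt) = trans (cong₂ _+_ (trans (cong (_* z (suc i)) (h 0 (s≤s z≤n))) (zeroˡ _)) (prefix0 n (tail t) z (λ j l → h (suc j) (s≤s l)) i lt)) (+-identityˡ _)

    prefix1 : ∀ n (t z : Series) → (∀ j → j < n → t j ≡ 0#) → (t ⊠ z) n ≡ t n * z 0
    prefix1 zero t z h = refl
    prefix1 (suc n) t z h = trans (cong₂ _+_ (trans (cong (_* z (suc n)) (h 0 (s≤s z≤n))) (zeroˡ _)) (prefix1 n (tail t) z (λ j l → h (suc j) (s≤s l)))) (+-identityˡ _)

    prefix2 : ∀ n (t z : Series) → (∀ j → j < n → t j ≡ 0#) → (t ⊠ z) (suc n) ≡ t n * z 1 + t (suc n) * z 0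
    prefix2 zero t z h = refl
    prefix2 (suc n) t z h = trans (cong₂ _+_ (trans (cong (_* z (suc (suc n))) (h 0 (s≤s z≤n))) (zeroˡ _)) (prefix2 n (tail t) z (λ j l → h (suc j) (s≤s l)))) (+-identityˡ _)

    private
      variable
        X : Set

    count : (X → Carrier) → List X → Carrier → ℕ
    count h ms u = length (filter (λ m → h m ≟ u) ms)

    -- Equal factors are collected, so that a product over m depends only on how often each value is
    -- taken. Here the line counts enter.
    group : (g : Carrier → Series) (h : X → Carrier) (ms : List X) → SΠ.big (λ m → g (h m)) ms ≋ SΠ.big (λ u → g u ^ˢ count h ms u) el
    group g h [] = S.sym (SΠ.big-ε el (λ _ → S.refl))
    group g h (m ∷ ms) = S.trans (S.*-cong (S.sym first) (group g h ms)) (S.trans (S.sym (SΠ.big-∙ _ _ el)) (SΠ.big-cong el step))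
      where
      first : SΠ.big (λ u → SΠ.guard (h m ≟ u) (g u)) el ≋ g (h m)
      first = S.trans (SΠ.big-single _ el-unique (el-complete (h m)) off) diag
        where
        off : ∀ {u} → u ∈ el → u ≢ h m → SΠ.guard (h m ≟ u) (g u) ≋ const 1#
        off {u} _ ne with h m ≟ u
        ... | yes e = ⊥-elim (ne (sym e))
        ... | no _ = S.refl
        diag : SΠ.guard (h m ≟ h m) (g (h m)) ≋ g (h m)
        diag with h m ≟ h m
        ... | yes _ = S.refl
        ... | no ne = ⊥-elim (ne refl)
      step : ∀ u → SΠ.guard (h m ≟ u) (g u) ⊠ (g u ^ˢ count h ms u) ≋ g u ^ˢ count h (m ∷ ms) u
      step u with h m ≟ u
      ... | yes _ = S.refl
      ... | no _ = S.*-identityˡ _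

    lin0 : lin (- 0#) ≋ const 1#
    lin0 zero = +-identityʳ 1#
    lin0 (suc zero) = trans (+-identityˡ _) -0#≈0#
    lin0 (suc (suc i)) = +-identityˡ _

    linq : Carrier → Series
    linq a = const 1# ⊞ mon q (- a)

    lin-^q-D : ∀ {u} → InD u → lin (- u) ^ˢ q ≋ linq u
    lin-^q-D {u} d = S.trans (lin-^q (- u)) (S.+-congˡ (mon-cong q (trans (bar-neg u) (cong -_ (InD-real d)))))

    -- Two nonconstant terms of factors 1 - u Y^q meet only in degree 2q, so up to degree q the
    -- product shows nothing but the sum of the u.
    linq-prod : ∀ us → (SΠ.big linq us 0 ≡ 1#) × (∀ j → j < q-1 → SΠ.big linq us (suc j) ≡ 0#) × (SΠ.big linq us q ≡ - ∑ (λ u → u) us)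
    linq-prod [] = refl , (λ j _ → refl) , sym -0#≈0#
    linq-prod (u ∷ us) with linq-prod us
    ... | h0 , h1 , hq = z0 , z1 , zq
      where
      s : Series
      s = SΠ.big linq us
      split : ∀ i → (linq u ⊠ s) i ≡ s i + (mon q (- u) ⊠ s) i
      split i = trans (S.distribʳ s (const 1#) (mon q (- u)) i) (cong (_+ (mon q (- u) ⊠ s) i) (S.*-identityˡ s i))
      z0 : (linq u ⊠ s) 0 ≡ 1#
      z0 = trans (split 0) (trans (cong₂ _+_ h0 (mon-⊠-low q (- u) s 0 (s≤s z≤n))) (+-identityʳ 1#))
      z1 : ∀ j → j < q-1 → (linq u ⊠ s) (suc j) ≡ 0#
      z1 j lt = trans (split (suc j)) (trans (cong₂ _+_ (h1 j lt) (mon-⊠-low q (- u) s (suc j) (s≤s lt))) (+-identityʳ 0#))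
      zq : (linq u ⊠ s) q ≡ - ∑ (λ u → u) (u ∷ us)
      zq = trans (split q) (trans (cong₂ _+_ hq (trans (cong (mon q (- u) ⊠ s) (sym (ℕₚ.+-identityʳ q))) (trans (mon-⊠ q (- u) s 0) (cong (- u *_) h0))))
        (solve 2 (λ a b → :- a :+ (:- b) :* :1 := :- (b :+ a)) refl (∑ (λ u → u) us) u))

    -- This is 1 - Y^(q-1); the lemmas below establish its coefficients up to Y^q.
    ΛD : Series
    ΛD = SΠ.big (λ u → lin (- u)) Dl

    dil : Carrier → Series → Series
    dil d s i = d ^ i * s i

    dil-⊠ : ∀ d f g → dil d (f ⊠ g) ≋ dil d f ⊠ dil d g
    dil-⊠ d f g zero = solve 2 (λ a b → :1 :* (a :* b) := (:1 :* a) :* (:1 :* b)) refl (f 0) (g 0)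
    dil-⊠ d f g (suc n) = trans (solve 4 (λ d a b c → (d :* a) :* (b :+ c) := (a :* d) :* b :+ d :* (a :* c)) refl d (d ^ n) (f 0 * g (suc n)) ((tail f ⊠ g) n))
      (cong₂ _+_ (solve 4 (λ d a b c → (a :* d) :* (b :* c) := (:1 :* b) :* ((d :* a) :* c)) refl d (d ^ n) (f 0) (g (suc n)))
        (trans (cong (d *_) (dil-⊠ d (tail f) g n)) (trans (sym (scl d (dil d (tail f)) (dil d g) n)) (S.*-cong (λ i → sym (*-assoc d (d ^ i) (f (suc i)))) (λ i → refl {x = dil d g i}) n))))
      where
      scl : ∀ a f g n → ((λ i → a * f i) ⊠ g) n ≡ a * (f ⊠ g) n
      scl a f g zero = *-assoc _ _ _
      scl a f g (suc n) = trans (cong₂ _+_ (*-assoc _ _ _) (scl a (tail f) g n)) (sym (distribˡ _ _ _))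

    dil-lin : ∀ d u → dil d (lin (- u)) ≋ lin (- (d * u))
    dil-lin d u zero = *-identityˡ _
    dil-lin d u (suc zero) = solve 2 (λ d u → (d :* :1) :* (:0 :+ :- u) := :0 :+ :- (d :* u)) refl d u
    dil-lin d u (suc (suc i)) = trans (cong (d ^ suc (suc i) *_) (+-identityˡ 0#)) (trans (zeroʳ _) (sym (+-identityˡ 0#)))

    dil-prod : ∀ d us → dil d (SΠ.big (λ u → lin (- u)) us) ≋ SΠ.big (λ u → lin (- (d * u))) us
    dil-prod d [] zero = *-identityˡ _
    dil-prod d [] (suc i) = zeroʳ _
    dil-prod d (u ∷ us) = S.trans (dil-⊠ d (lin (- u)) _) (S.*-cong (dil-lin d u) (dil-prod d us))

    -- Replacing Y by d Y permutes the factors. A coefficient therefore vanishes in every degree i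
    -- for which some d^i differs from 1.
    ΛD-dil : ∀ {d} → InD d → ∀ i → d ^ i * ΛD i ≡ ΛD i
    ΛD-dil {d} dd i = trans (dil-prod d Dl i) (SΠ.big-perm (λ u → lin (- u)) (d *_) _≟_ Dl-unique (λ m → ∈Dl (InD-* dd (Dl∈ m))) (λ _ _ e → *-cancelˡ (InD-≢0 dd) e) i)

    -- The upper limit is included, so `sumTo n` has n + 1 terms.
    sumTo : ℕ → Series → Carrier
    sumTo zero s = s 0
    sumTo (suc n) s = sumTo n s + s (suc n)

    sumTo-∑ : ∀ n (h : ℕ → Carrier → Carrier) xs → sumTo n (λ j → ∑ (h j) xs) ≡ ∑ (λ x → sumTo n (λ j → h j x)) xs
    sumTo-∑ zero h xs = refl
    sumTo-∑ (suc n) h xs = trans (cong (_+ ∑ (h (suc n)) xs) (sumTo-∑ n h xs)) (sym (FΣ.big-∙ _ _ xs))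

    sumTo-cong : ∀ n {s t : Series} → s ≋ t → sumTo n s ≡ sumTo n t
    sumTo-cong zero h = h 0
    sumTo-cong (suc n) h = cong₂ _+_ (sumTo-cong n h) (h (suc n))

    sumTo-* : ∀ n a s → sumTo n (λ j → a * s j) ≡ a * sumTo n s
    sumTo-* zero a s = refl
    sumTo-* (suc n) a s = trans (cong (_+ a * s (suc n)) (sumTo-* n a s)) (sym (distribˡ _ _ _))

    sumTo-top : ∀ n (s : Series) → (∀ i → i < n → s i ≡ 0#) → sumTo n s ≡ s n
    sumTo-top zero s h = refl
    sumTo-top (suc n) s h = trans (cong (_+ s (suc n)) (trans (sumTo-top n s (λ i l → h i (ℕₚ.m≤n⇒m≤1+n l))) (h n ℕₚ.≤-refl))) (+-identityˡ _)

    -- For q > 2 there is an element other than 1 in GF(q)*; it makes the sum of GF(q)* and the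
    -- coefficient in degree q vanish.
    module _ (1≤r : 1 ≤ r) where

      private
        moving : ∃ λ g → g ∈ Dl × g ^ 1 ≢ 1#
        moving = non-root Dl Dl-unique 0 (subst (1 <_) (sym Dl-length) (s≤s 1≤r))

        g₁ : Carrier
        g₁ = proj₁ moving

        g₁-D : InD g₁
        g₁-D = Dl∈ (proj₁ (proj₂ moving))

        g₁≢1 : g₁ ≢ 1#
        g₁≢1 e = proj₂ (proj₂ moving) (trans (*-identityʳ g₁) e)

      ΛD-mid : ∀ i → i < r → ΛD (suc i) ≡ 0#
      ΛD-mid i lt = go (non-root Dl Dl-unique i (subst (suc i <_) (sym Dl-length) (s≤s lt)))
        where
        go : ∃ (λ g → g ∈ Dl × g ^ suc i ≢ 1#) → ΛD (suc i) ≡ 0#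
        go (g , m , ne) = fix⇒0 (ΛD-dil (Dl∈ m) (suc i)) ne

      ΛD-q : ΛD q ≡ 0#
      ΛD-q = fix⇒0 (ΛD-dil g₁-D q) (λ e → g₁≢1 (trans (sym (InD-real g₁-D)) e))

      ∑D : ∑ (λ u → u) Dl ≡ 0#
      ∑D = fix⇒0 (trans (∑-*ˡ g₁ (λ u → u) Dl) (FΣ.big-perm (λ u → u) (g₁ *_) _≟_ Dl-unique (λ n → ∈Dl (InD-* g₁-D (Dl∈ n))) (λ _ _ e → *-cancelˡ (InD-≢0 g₁-D) e))) g₁≢1

      private
        lin-0 : ∀ us → SΠ.big (λ u → lin (- u)) us 0 ≡ 1#
        lin-0 [] = refl
        lin-0 (u ∷ us) = trans (lin-⊠0 (- u) (SΠ.big (λ u → lin (- u)) us)) (lin-0 us)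

        degree : ∀ us i → length us < i → SΠ.big (λ u → lin (- u)) us i ≡ 0#
        degree [] (suc i) lt = refl
        degree (u ∷ us) (suc i) (s≤s lt) = trans (lin-⊠ (- u) (SΠ.big (λ u → lin (- u)) us) i) (trans (cong₂ (λ s t → s + - u * t) (degree us (suc i) (ℕₚ.m≤n⇒m≤1+n lt)) (degree us i lt)) (trans (+-identityˡ _) (zeroʳ _)))

        sum-lin : ∀ a s n → sumTo (suc n) (lin a ⊠ s) ≡ sumTo (suc n) s + a * sumTo n s
        sum-lin a s zero = trans (cong₂ _+_ (lin-⊠0 a s) (lin-⊠ a s 0)) (sym (+-assoc _ _ _))
        sum-lin a s (suc n) = trans (cong₂ _+_ (sum-lin a s n) (lin-⊠ a s (suc n)))
          (solve 5 (λ x a y z w → (x :+ a :* y) :+ (z :+ a :* w) := (x :+ z) :+ a :* (y :+ w)) refl (sumTo (suc n) s) a (sumTo n s) (s (suc (suc n))) (s (suc n)))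

        eval-at-1 : ∀ us → sumTo (length us) (SΠ.big (λ u → lin (- u)) us) ≡ ∏ (λ u → 1# - u) us
        eval-at-1 [] = refl
        eval-at-1 (u ∷ us) = trans (sum-lin (- u) s (length us)) (trans (cong (λ t → (sumTo (length us) s + t) + - u * sumTo (length us) s) (degree us _ ℕₚ.≤-refl))
            (trans (solve 2 (λ x u → (x :+ :0) :+ (:- u) :* x := (:1 :- u) :* x) refl (sumTo (length us) s) u) (cong ((1# - u) *_) (eval-at-1 us))))
          where
          s : Series
          s = SΠ.big (λ u → lin (- u)) us

        ∏-0 : (f : Carrier → Carrier) {xs : List Carrier} {x : Carrier} → x ∈ xs → f x ≡ 0# → ∏ f xs ≡ 0#
        ∏-0 f {x ∷ xs} (here refl) e = trans (cong (_* ∏ f xs) e) (zeroˡ _)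
        ∏-0 f {y ∷ xs} (there m) e = trans (cong (f y *_) (∏-0 f m e)) (zeroʳ _)

        sum-mid : ∀ n (s : Series) → (∀ i → i < n → s (suc i) ≡ 0#) → sumTo (suc n) s ≡ s 0 + s (suc n)
        sum-mid n s h = cong (_+ s (suc n)) (go n h)
          where
          go : ∀ m → (∀ i → i < m → s (suc i) ≡ 0#) → sumTo m s ≡ s 0
          go zero h = refl
          go (suc m) h = trans (cong₂ _+_ (go m (λ i l → h i (ℕₚ.m≤n⇒m≤1+n l))) (h m ℕₚ.≤-refl)) (+-identityʳ _)

      ΛD-0 : ΛD 0 ≡ 1#
      ΛD-0 = lin-0 Dl

      -- At Y = 1 the factor for u = 1 is zero. The coefficients strictly between degrees 0 and q -
      -- 1 being zero, the outer two must cancel.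
      ΛD-q-1 : ΛD q-1 ≡ - 1#
      ΛD-q-1 = x-y≡0 (begin
        ΛD q-1 - - 1# ≡⟨ solve 1 (λ x → x :- (:- :1) := :1 :+ x) refl (ΛD q-1) ⟩
        1# + ΛD q-1 ≡⟨ cong (_+ ΛD q-1) ΛD-0 ⟨
        ΛD 0 + ΛD q-1 ≡⟨ sum-mid r ΛD ΛD-mid ⟨
        sumTo q-1 ΛD ≡⟨ cong (λ n → sumTo n ΛD) (sym Dl-length) ⟩
        sumTo (length Dl) ΛD ≡⟨ eval-at-1 Dl ⟩
        ∏ (λ u → 1# - u) Dl ≡⟨ ∏-0 (λ u → 1# - u) (∈Dl (1^ q-1)) (-‿inverseʳ 1#) ⟩
        0# ∎)
        where open ≡-Reasoning

    cnt : (Carrier → Carrier) → Carrier → ℕ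
    cnt f u = count f Ml u

    -- The line counts of the set N(x) = c(y/x): the fields say how often m ↦ c m * Nm (m - α) takes each value on
    -- the slopes m outside GF(q). For α outside GF(q), v α is the value that belongs to a tangent.
    record Hyp (c v : Carrier → Carrier) : Set where
      field
        c-D : ∀ {m} → ¬ Real m → InD (c m)
        v-D : ∀ {α} → ¬ Real α → InD (v α)
        at-∞ : ∀ {u} → InD u → cnt c u ≡ q
        at-real : ∀ {s u} → Real s → InD u → cnt (λ m → c m * Nm (m - s)) u ≡ q
        at-tangent : ∀ {α} → ¬ Real α → cnt (λ m → c m * Nm (m - α)) (v α) ≡ 1
        at-secant : ∀ {α u} → ¬ Real α → InD u → u ≢ v α → cnt (λ m → c m * Nm (m - α)) u ≡ q+1

    module Lacunary (1≤r : 1 ≤ r) {c v : Carrier → Carrier} (H : Hyp c v) where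
      open Hyp H

      -- As a polynomial in α, `f` has derivative - g, because α^q has derivative zero.
      f g : Carrier → Carrier → Carrier
      f α m = c m * Nm (m - α)
      g α m = c m * (bar m - bar α)

      g*≡f : ∀ α m → g α m * (m - α) ≡ f α m
      g*≡f α m = trans (solve 3 (λ c b d → (c :* b) :* d := c :* (d :* b)) refl (c m) (bar m - bar α) (m - α)) (cong (λ t → c m * ((m - α) * t)) (sym (bar-sub m α)))

      f-InD : ∀ α {m} → ¬ Real m → m ≢ α → InD (f α m)
      f-InD α nr ne = InD-* (c-D nr) (Nm-InD (x≢y⇒x-y≢0 ne))

      g-0 : ∀ α → g α α ≡ 0#
      g-0 α = trans (cong (c α *_) (-‿inverseʳ _)) (zeroʳ _)

      f-0 : ∀ α → f α α ≡ 0#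
      f-0 α = trans (cong (λ t → c α * Nm t) (-‿inverseʳ α)) (trans (cong (c α *_) Nm-0) (zeroʳ _))

      -- Coefficients in z of the product of 1 - c(m)(m - z)(m^q - z^q) Y.

      φ : Carrier → Poly
      φ m = mulP (- (c m * m) ∷ c m ∷ []) ((bar m ∷ []) ⊹ scale (- 1#) (mono q))

      E : List Carrier → ℕ → Poly
      E ms zero = 1# ∷ []
      E [] (suc i) = []
      E (m ∷ ms) (suc i) = E ms (suc i) ⊹ mulP (φ m) (E ms i)

      evald-mono : ∀ n x → evald (mono (suc n)) x ≡ (suc n · 1#) * x ^ n
      evald-mono zero x = solve 1 (λ x → (:1 :+ x :* :0) :+ x :* (:0 :+ x :* :0) := (:1 :+ :0) :* :1) refl x
      evald-mono (suc n) x = trans (cong₂ (λ s t → s + x * t) (eval-mono (suc n) x) (evald-mono n x))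
        (solve 3 (λ x y n → x :* y :+ x :* (n :* y) := (:1 :+ n) :* (x :* y)) refl x (x ^ n) (suc n · 1#))

      evald-mono-q : ∀ x → evald (mono q) x ≡ 0#
      evald-mono-q x = trans (evald-mono q-1 x) (trans (cong (_* x ^ q-1) q·1≡0) (zeroˡ _))

      eval-φ : ∀ m x → eval (φ m) x ≡ - f x m
      eval-φ m x = trans (eval-mulP (- (c m * m) ∷ c m ∷ []) ((bar m ∷ []) ⊹ scale (- 1#) (mono q)) x)
        (trans (cong (eval (- (c m * m) ∷ c m ∷ []) x *_) (trans (eval-⊹ (bar m ∷ []) (scale (- 1#) (mono q)) x)
          (cong (eval (bar m ∷ []) x +_) (trans (eval-scale (- 1#) (mono q) x) (cong (- 1# *_) (eval-mono q x))))))
        (trans (solve 5 (λ c m x b y → (:- (c :* m) :+ x :* (c :+ x :* :0)) :* ((b :+ x :* :0) :+ (:- :1) :* y) := :- (c :* ((m :- x) :* (b :- y)))) refl (c m) m x (bar m) (bar x))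
          (cong (λ t → - (c m * ((m - x) * t))) (sym (bar-sub m x)))))

      evald-φ : ∀ m x → evald (φ m) x ≡ g x m
      evald-φ m x = trans (evald-mulP A B x) (trans (cong₂ (λ s t → evald A x * s + eval A x * t)
          (trans (eval-⊹ (bar m ∷ []) (scale (- 1#) (mono q)) x) (cong (eval (bar m ∷ []) x +_) (trans (eval-scale (- 1#) (mono q) x) (cong (- 1# *_) (eval-mono q x)))))
          (trans (evald-⊹ (bar m ∷ []) (scale (- 1#) (mono q)) x) (cong (evald (bar m ∷ []) x +_) (trans (evald-scale (- 1#) (mono q) x) (cong (- 1# *_) (evald-mono-q x))))))
        (solve 5 (λ c m x b y → ((c :+ x :* :0) :+ x :* (:0 :+ x :* :0)) :* ((b :+ x :* :0) :+ (:- :1) :* y) :+ (:- (c :* m) :+ x :* (c :+ x :* :0)) :* ((:0 :+ x :* :0) :+ (:- :1) :* :0) := c :* (b :- y)) refl (c m) m x (bar m) (bar x)))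
        where
        A B : Poly
        A = - (c m * m) ∷ c m ∷ []
        B = (bar m ∷ []) ⊹ scale (- 1#) (mono q)

      length-φ : ∀ m → length (φ m) ≤ suc q+1
      length-φ m = length-mulP (- (c m * m) ∷ c m ∷ []) ((bar m ∷ []) ⊹ scale (- 1#) (mono q)) {m = 1} {n = q} (s≤s (s≤s z≤n))
        (length-⊹ (bar m ∷ []) (scale (- 1#) (mono q)) (s≤s z≤n) (ℕₚ.≤-reflexive (trans (Listₚ.length-map (- 1# *_) (mono q)) (length-mono q))))

      -- The degree bound i (q + 1) is below q² exactly for i ≤ q - 1, which is the range in which
      -- `deriv-unique` can be used.
      length-E : ∀ ms i → length (E ms i) ≤ suc (i *ℕ q+1)
      length-E ms zero = s≤s z≤n
      length-E [] (suc i) = z≤n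
      length-E (m ∷ ms) (suc i) = length-⊹ (E ms (suc i)) (mulP (φ m) (E ms i)) (length-E ms (suc i)) (length-mulP (φ m) (E ms i) (length-φ m) (length-E ms i))

      Λ : List Carrier → Carrier → Series
      Λ ms α = SΠ.big (λ m → lin (- f α m)) ms

      -- The derivative of `Λ` with respect to z at z = α, by the product rule; `mon 1 (g α m)` is
      -- the derivative of the factor 1 - f Y.
      Λ' : List Carrier → Carrier → Series
      Λ' [] α = λ _ → 0#
      Λ' (m ∷ ms) α = lin (- f α m) ⊠ Λ' ms α ⊞ mon 1 (g α m) ⊠ Λ ms α

      eval-E : ∀ ms i α → eval (E ms i) α ≡ Λ ms α i
      eval-E [] zero α = trans (cong (1# +_) (zeroʳ α)) (+-identityʳ 1#)
      eval-E (m ∷ ms) zero α = trans (eval-E ms zero α) (sym (lin-⊠0 (- f α m) (Λ ms α)))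
      eval-E [] (suc i) α = refl
      eval-E (m ∷ ms) (suc i) α = trans (eval-⊹ (E ms (suc i)) (mulP (φ m) (E ms i)) α)
        (trans (cong₂ _+_ (eval-E ms (suc i) α) (trans (eval-mulP (φ m) (E ms i) α) (cong₂ _*_ (eval-φ m α) (eval-E ms i α)))) (sym (lin-⊠ (- f α m) (Λ ms α) i)))

      evald-E : ∀ ms i α → evald (E ms i) α ≡ Λ' ms α i
      evald-E [] zero α = trans (+-identityˡ _) (zeroʳ α)
      evald-E (m ∷ ms) zero α = trans (evald-E ms zero α) (sym (trans (cong₂ _+_ (lin-⊠0 (- f α m) (Λ' ms α)) (mon-⊠-low 1 (g α m) (Λ ms α) 0 (s≤s z≤n))) (+-identityʳ _)))
      evald-E [] (suc i) α = refl
      evald-E (m ∷ ms) (suc i) α = trans (evald-⊹ (E ms (suc i)) (mulP (φ m) (E ms i)) α)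
        (trans (cong₂ _+_ (evald-E ms (suc i) α) (trans (evald-mulP (φ m) (E ms i) α) (cong₂ _+_ (cong₂ _*_ (evald-φ m α) (eval-E ms i α)) (cong₂ _*_ (eval-φ m α) (evald-E ms i α)))))
        (trans (solve 3 (λ a b d → a :+ (b :+ d) := (a :+ d) :+ b) refl (Λ' ms α (suc i)) (g α m * Λ ms α i) (- f α m * Λ' ms α i))
          (sym (cong₂ _+_ (lin-⊠ (- f α m) (Λ' ms α) i) (mon-⊠ 1 (g α m) (Λ ms α) i)))))

      -- Logarithmic derivative: Λ' = Λ Z, where Z collects the sums of g f^j.

      geo : Carrier → Series
      geo a i = a ^ i

      lin-geo : ∀ a → lin (- a) ⊠ geo a ≋ const 1#
      lin-geo a zero = lin-⊠0 (- a) (geo a)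
      lin-geo a (suc n) = trans (lin-⊠ (- a) (geo a) n) (solve 2 (λ a b → a :* b :+ (:- a) :* b := :0) refl a (a ^ n))

      Z : List Carrier → Carrier → Series
      Z [] α = λ _ → 0#
      Z (m ∷ ms) α = mon 1 (g α m) ⊠ geo (f α m) ⊞ Z ms α

      Λ'-Z : ∀ ms α → Λ' ms α ≋ Λ ms α ⊠ Z ms α
      Λ'-Z [] α = S.sym (S.zeroʳ (const 1#))
      Λ'-Z (m ∷ ms) α = S.trans (S.+-congʳ (S.*-congˡ (Λ'-Z ms α)))
        (S.trans (S.+-congˡ (S.sym (S.trans (S.*-congˡ (lin-geo (f α m))) (S.*-identityʳ _))))
          (SS.solve 5 (λ l s z y e → l SS.:* (s SS.:* z) SS.:+ (y SS.:* s) SS.:* (l SS.:* e) SS.:= (l SS.:* s) SS.:* (y SS.:* e SS.:+ z)) S.refl (lin (- f α m)) (Λ ms α) (Z ms α) (mon 1 (g α m)) (geo (f α m))))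

      -- The coefficient of Y^(j+1) in the logarithmic derivative.
      ph : Carrier → ℕ → Carrier
      ph α j = ∑ (λ m → g α m * f α m ^ j) Ml

      Z-0 : ∀ ms α → Z ms α 0 ≡ 0#
      Z-0 [] α = refl
      Z-0 (m ∷ ms) α = trans (cong₂ _+_ (mon-⊠-low 1 (g α m) (geo (f α m)) 0 (s≤s z≤n)) (Z-0 ms α)) (+-identityʳ 0#)

      Z-suc : ∀ ms α j → Z ms α (suc j) ≡ ∑ (λ m → g α m * f α m ^ j) ms
      Z-suc [] α j = refl
      Z-suc (m ∷ ms) α j = cong₂ _+_ (mon-⊠ 1 (g α m) (geo (f α m)) j) (Z-suc ms α j)

      -- The shape 1 + x Y^(q-1) + y Y^q + ..., with a gap between.
      record Low (s : Series) (x y : Carrier) : Set where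
        field
          low0 : s 0 ≡ 1#
          low : ∀ i → i < r → s (suc i) ≡ 0#
          low-q-1 : s q-1 ≡ x
          low-q : s q ≡ y

      private
        no-f : ∀ α u → ¬ InD u → u ≢ 0# → count (f α) Ml u ≡ 0
        no-f α u nd nz0 = empty (filter (λ m → f α m ≟ u) Ml) (λ m∈ → bad (∈-filter⁻ (λ m → f α m ≟ u) {xs = Ml} m∈))
          where
          empty : ∀ (xs : List Carrier) → (∀ {x} → x ∈ xs → ⊥) → length xs ≡ 0
          empty [] h = refl
          empty (x ∷ xs) h = ⊥-elim (h (here refl))
          bad : ∀ {m} → m ∈ Ml × f α m ≡ u → ⊥
          bad {m} (m∈ , e) with m ≟ α
          ... | yes refl = nz0 (trans (sym e) (f-0 α))
          ... | no ne = nd (subst InD e (f-InD α (Ml∈ m∈) ne))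

        triv : ∀ α u → ¬ InD u → lin (- u) ^ˢ count (f α) Ml u ≋ const 1#
        triv α u nd with u ≟ 0#
        ... | yes refl = S.trans (^ˢ-congˡ (count (f α) Ml 0#) lin0) (1ˢ^ (count (f α) Ml 0#))
        ... | no ne = subst (λ n → lin (- u) ^ˢ n ≋ const 1#) (sym (no-f α u nd ne)) S.refl

      -- Each u in GF(q)* is taken q times and contributes (1 - u Y)^q = 1 - u Y^q. The coefficient
      -- of Y^q is minus the sum of GF(q)*, which is zero.
      low-real : ∀ {α} → Real α → Low (Λ Ml α) 0# 0#
      low-real {α} ra = record
        { low0 = trans (eq 0) (proj₁ lp) ; low = λ i lt → trans (eq (suc i)) (proj₁ (proj₂ lp) i (ℕₚ.m≤n⇒m≤1+n lt))
        ; low-q-1 = trans (eq q-1) (proj₁ (proj₂ lp) r ℕₚ.≤-refl)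
        ; low-q = trans (eq q) (trans (proj₂ (proj₂ lp)) (trans (cong -_ (∑D 1≤r)) -0#≈0#)) }
        where
        lp = linq-prod Dl
        factor : ∀ u → lin (- u) ^ˢ count (f α) Ml u ≋ SΠ.guard (inD? u) (linq u)
        factor u with inD? u
        ... | yes d = subst (λ n → lin (- u) ^ˢ n ≋ linq u) (sym (at-real ra d)) (lin-^q-D d)
        ... | no nd = triv α u nd
        eq : Λ Ml α ≋ SΠ.big linq Dl
        eq = S.trans (group (λ u → lin (- u)) (f α) Ml) (S.trans (SΠ.big-cong el factor) (S.sym (SΠ.big-filter inD? linq el)))

      -- One copy of every factor makes up `ΛD`, that is 1 - Y^(q-1). The remaining q-th powers omit
      -- v(α), and since GF(q)* sums to zero, what they leave in degree q is v(α).
      low-nonreal : ∀ {α} → ¬ Real α → Low (Λ Ml α) (- 1#) (v α)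
      low-nonreal {α} nr = record
        { low0 = trans (eq 0) (trans (cong₂ _*_ T0 (ΛD-0 1≤r)) (*-identityˡ 1#))
        ; low = λ i lt → trans (low' i (ℕₚ.m≤n⇒m≤1+n lt)) (ΛD-mid 1≤r i lt)
        ; low-q-1 = trans (low' r ℕₚ.≤-refl) (ΛD-q-1 1≤r)
        ; low-q = trans (eq q) (trans (cong₂ _+_ (trans (cong₂ _*_ T0 (ΛD-q 1≤r)) (zeroʳ _)) (trans (prefix1 q-1 (tail T) ΛD T1) (trans (cong₂ _*_ Tq (ΛD-0 1≤r)) (*-identityʳ _)))) (+-identityˡ _)) }
        where
        D' : List Carrier
        D' = filter (λ u → ¬? (u ≟ v α)) Dl
        T : Series
        T = SΠ.big linq D'
        lp = linq-prod D'
        T0 : T 0 ≡ 1#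
        T0 = proj₁ lp
        T1 : ∀ j → j < q-1 → tail T j ≡ 0#
        T1 = proj₁ (proj₂ lp)
        factor : ∀ u → lin (- u) ^ˢ count (f α) Ml u ≋ SΠ.guard (inD? u) (SΠ.guard (¬? (u ≟ v α)) (linq u)) ⊠ SΠ.guard (inD? u) (lin (- u))
        factor u with inD? u
        ... | no nd = S.trans (triv α u nd) (S.sym (S.*-identityˡ _))
        ... | yes d with u ≟ v α
        ...   | yes refl = subst (λ n → lin (- u) ^ˢ n ≋ const 1# ⊠ lin (- u)) (sym (at-tangent nr)) (S.*-comm _ _)
        ...   | no ne = subst (λ n → lin (- u) ^ˢ n ≋ linq u ⊠ lin (- u)) (sym (at-secant nr d ne)) (S.trans (S.*-congˡ (lin-^q-D d)) (S.*-comm _ _))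
        eq : Λ Ml α ≋ T ⊠ ΛD
        eq = S.trans (group (λ u → lin (- u)) (f α) Ml) (S.trans (SΠ.big-cong el factor) (S.trans (SΠ.big-∙ _ _ el)
          (S.*-cong (S.sym (S.trans (SΠ.big-filter (λ u → ¬? (u ≟ v α)) linq Dl) (SΠ.big-filter inD? _ el))) (S.sym (SΠ.big-filter inD? (λ u → lin (- u)) el)))))
        low' : ∀ i → i < q-1 → Λ Ml α (suc i) ≡ ΛD (suc i)
        low' i lt = trans (eq (suc i)) (trans (cong₂ _+_ (trans (cong (_* ΛD (suc i)) T0) (*-identityˡ _)) (prefix0 q-1 (tail T) ΛD T1 i lt)) (+-identityʳ _))
        split : ∀ u → u ≡ FΣ.guard (u ≟ v α) u + FΣ.guard (¬? (u ≟ v α)) u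
        split u with u ≟ v α
        ... | yes _ = sym (+-identityʳ u)
        ... | no _ = sym (+-identityˡ u)
        single : ∑ (λ u → FΣ.guard (u ≟ v α) u) Dl ≡ v α
        single = trans (FΣ.big-single _ Dl-unique (∈Dl (v-D nr)) off) diag
          where
          off : ∀ {u} → u ∈ Dl → u ≢ v α → FΣ.guard (u ≟ v α) u ≡ 0#
          off {u} _ ne with u ≟ v α
          ... | yes e = ⊥-elim (ne e)
          ... | no _ = refl
          diag : FΣ.guard (v α ≟ v α) (v α) ≡ v α
          diag with v α ≟ v α
          ... | yes _ = refl
          ... | no ne = ⊥-elim (ne refl)
        Tq : T q ≡ v α
        Tq = trans (proj₂ (proj₂ lp)) (x-y≡0 (begin
          - ∑ (λ u → u) D' - v α ≡⟨ solve 2 (λ a b → :- a :- b := :- (b :+ a)) refl (∑ (λ u → u) D') (v α) ⟩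
          - (v α + ∑ (λ u → u) D') ≡⟨ cong -_ (cong₂ _+_ (sym single) (FΣ.big-filter (λ u → ¬? (u ≟ v α)) (λ u → u) Dl)) ⟩
          - (∑ (λ u → FΣ.guard (u ≟ v α) u) Dl + ∑ (λ u → FΣ.guard (¬? (u ≟ v α)) u) Dl) ≡⟨ cong -_ (FΣ.big-∙ _ _ Dl) ⟨
          - ∑ (λ u → FΣ.guard (u ≟ v α) u + FΣ.guard (¬? (u ≟ v α)) u) Dl ≡⟨ cong -_ (FΣ.big-cong Dl split) ⟨
          - ∑ (λ u → u) Dl ≡⟨ cong -_ (∑D 1≤r) ⟩
          - 0# ≡⟨ -0#≈0# ⟩
          0# ∎))
          where open ≡-Reasoning

      private
        low-any : ∀ α → ∃ λ x → ∃ λ y → Low (Λ Ml α) x y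
        low-any α with real? α
        ... | yes ra = _ , _ , low-real ra
        ... | no nr = _ , _ , low-nonreal nr

        length-E-q² : ∀ i → i ≤ q-1 → length (E Ml i) ≤ q²
        length-E-q² i le = ℕₚ.≤-trans (length-E Ml i) (ℕₚ.≤-trans (s≤s (ℕₚ.*-monoˡ-≤ q+1 le)) (ℕₚ.≤-reflexive (trans (cong suc (sym q²-1-def)) (sym q²≡))))

        deriv : ∀ α i → Λ' Ml α (suc i) ≡ Λ Ml α 0 * Z Ml α (suc i) + (tail (Λ Ml α) ⊠ Z Ml α) i
        deriv α i = Λ'-Z Ml α (suc i)

        -- `Λ` is 1 followed by zeros up to degree q - 2, and `Z` has no constant term; so up to
        -- degree q - 1 the derivative and the logarithmic derivative coincide.
        deriv-low : ∀ α i → i ≤ r → evald (E Ml (suc i)) α ≡ ph α i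
        deriv-low α i le = trans (evald-E Ml (suc i) α) (trans (deriv α i) (trans (cong₂ _+_ (trans (cong (_* Z Ml α (suc i)) (Low.low0 lw)) (*-identityˡ _)) (rest (ℕₚ.m≤n⇒m<n∨m≡n le))) (trans (+-identityʳ _) (Z-suc Ml α i))))
          where
          lw = proj₂ (proj₂ (low-any α))
          rest : i < r ⊎ i ≡ r → (tail (Λ Ml α) ⊠ Z Ml α) i ≡ 0#
          rest (inj₁ lt) = prefix0 r (tail (Λ Ml α)) (Z Ml α) (Low.low lw) i lt
          rest (inj₂ refl) = trans (prefix1 r (tail (Λ Ml α)) (Z Ml α) (Low.low lw)) (trans (cong (Λ Ml α (suc r) *_) (Z-0 Ml α)) (zeroʳ _))

        deriv-q : ∀ α → evald (E Ml q) α ≡ ph α q-1 + Λ Ml α q-1 * ph α 0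
        deriv-q α = trans (evald-E Ml q α) (trans (deriv α q-1) (cong₂ _+_ (trans (cong (_* Z Ml α q) (Low.low0 lw)) (trans (*-identityˡ _) (Z-suc Ml α q-1)))
            (trans (prefix2 r (tail (Λ Ml α)) (Z Ml α) (Low.low lw)) (trans (cong₂ _+_ (cong (Λ Ml α q-1 *_) (Z-suc Ml α 0)) (trans (cong (Λ Ml α q *_) (Z-0 Ml α)) (zeroʳ _))) (+-identityʳ _)))))
          where
          lw = proj₂ (proj₂ (low-any α))

      -- The low coefficients vanish on the whole field and have small degree, so they vanish identically.
      ph-0 : ∀ α i → i < r → ph α i ≡ 0#
      ph-0 α i lt = trans (sym (deriv-low α i (ℕₚ.<⇒≤ lt))) (deriv-unique (E Ml (suc i)) [] (length-E-q² (suc i) (s≤s (ℕₚ.<⇒≤ lt))) z≤n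
        (λ y → trans (eval-E Ml (suc i) y) (Low.low (proj₂ (proj₂ (low-any y))) i lt)) α)

      private
        zq : Poly
        zq = mono q ⊹ scale (- 1#) (mono 1)

        eval-zq : ∀ x → eval zq x ≡ bar x - x
        eval-zq x = trans (eval-⊹ (mono q) (scale (- 1#) (mono 1)) x) (cong₂ _+_ (eval-mono q x) (trans (eval-scale (- 1#) (mono 1) x) (trans (cong (- 1# *_) (eval-mono 1 x)) (solve 1 (λ x → (:- :1) :* (x :* :1) := :- x) refl x))))

        evald-zq : ∀ x → evald zq x ≡ - 1#
        evald-zq x = trans (evald-⊹ (mono q) (scale (- 1#) (mono 1)) x) (trans (cong₂ _+_ (evald-mono-q x) (trans (evald-scale (- 1#) (mono 1) x) (cong (- 1# *_) (evald-mono 0 x)))) (solve 0 (:0 :+ (:- :1) :* ((:1 :+ :0) :* :1) := :- :1) refl))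

        length-zq : length zq ≤ suc q
        length-zq = length-⊹ (mono q) (scale (- 1#) (mono 1)) (ℕₚ.≤-reflexive (length-mono q)) (s≤s (s≤s z≤n))

      anti-^q-1 : ∀ {w} → w ≢ 0# → bar w ≡ - w → w ^ q-1 ≡ - 1#
      anti-^q-1 {w} ne e = *-cancelˡ ne (trans e (solve 1 (λ w → :- w := w :* (:- :1)) refl w))

      bar-anti : ∀ x → bar (bar x - x) ≡ - (bar x - x)
      bar-anti x = trans (bar-sub (bar x) x) (trans (cong (_- bar x) (bar-bar x)) (solve 2 (λ a b → a :- b := :- (b :- a)) refl x (bar x)))

      -- The coefficient of Y^(q-1) is 0 on GF(q) and -1 elsewhere, just like (z^q - z)^(q-1). Both
      -- have degree below q², so their derivatives agree.
      ph-r : ∀ α → ph α r ≡ (bar α - α) ^ r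
      ph-r α = trans (sym (deriv-low α r ℕₚ.≤-refl)) (trans (deriv-unique (E Ml q-1) (powP zq q-1) (length-E-q² q-1 ℕₚ.≤-refl)
          (ℕₚ.≤-trans (length-powP zq q-1 length-zq) (ℕₚ.≤-trans (s≤s (ℕₚ.*-monoʳ-≤ q-1 (ℕₚ.n≤1+n q))) (ℕₚ.≤-reflexive (trans (cong suc (sym q²-1-def)) (sym q²≡)))))
          same α) (trans (evald-powP zq r α) (trans (cong₂ (λ a b → (q-1 · 1#) * (a ^ r * b)) (eval-zq α) (evald-zq α)) (trans (cong (_* ((bar α - α) ^ r * - 1#)) q-1·1)
            (solve 1 (λ x → (:- :1) :* (x :* (:- :1)) := x) refl ((bar α - α) ^ r))))))
        where
        same : ∀ y → eval (E Ml q-1) y ≡ eval (powP zq q-1) y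
        same y = trans (eval-E Ml q-1 y) (trans (val (real? y)) (sym (trans (eval-powP zq q-1 y) (cong (_^ q-1) (eval-zq y)))))
          where
          val : Dec (Real y) → Λ Ml y q-1 ≡ (bar y - y) ^ q-1
          val (yes ry) = trans (Low.low-q-1 (low-real ry)) (sym (trans (cong (λ t → t ^ q-1) (trans (cong (_- y) ry) (-‿inverseʳ y))) (zeroˡ _)))
          val (no nr) = trans (Low.low-q-1 (low-nonreal nr)) (sym (anti-^q-1 (x≢y⇒x-y≢0 nr) (bar-anti y)))

      ph-q-1 : ∀ α → ph α q-1 ≡ ph α 0
      ph-q-1 α = FΣ.big-cong∈ Ml step
        where
        step : ∀ {m} → m ∈ Ml → g α m * f α m ^ q-1 ≡ g α m * f α m ^ 0
        step {m} m∈ with m ≟ α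
        ... | yes refl = trans (cong (_* f α α ^ q-1) (g-0 α)) (trans (zeroˡ _) (sym (trans (cong (_* 1#) (g-0 α)) (zeroˡ _))))
        ... | no ne = cong (g α m *_) (f-InD α (Ml∈ m∈) ne)

      -- This degree is out of reach of `deriv-unique`. The logarithmic derivative expresses the
      -- value by `ph α q-1` and `ph α 0`, which coincide because f^(q-1) = 1 for m ≠ α and g = 0
      -- for m = α; the latter sum is already known to vanish.
      evald-E-q : ∀ α → evald (E Ml q) α ≡ 0#
      evald-E-q α = trans (deriv-q α) (trans (cong₂ (λ a b → a + Λ Ml α q-1 * b) (trans (ph-q-1 α) (ph-0 α 0 1≤r)) (ph-0 α 0 1≤r)) (trans (+-identityˡ _) (zeroʳ _)))

      -- Extended by zero to GF(q), in agreement with the coefficient of Y^q there.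
      V : Carrier → Carrier
      V α = FΣ.guard (nonreal? α) (v α)

      V-real : ∀ {α} → Real α → V α ≡ 0#
      V-real {α} ra with real? α
      ... | yes _ = refl
      ... | no nr = ⊥-elim (nr ra)

      V-nonreal : ∀ {α} → ¬ Real α → V α ≡ v α
      V-nonreal {α} nr with real? α
      ... | yes ra = ⊥-elim (nr ra)
      ... | no _ = refl

      eval-E-q : ∀ α → eval (E Ml q) α ≡ V α
      eval-E-q α = trans (eval-E Ml q α) (go (real? α))
        where
        go : Dec (Real α) → Λ Ml α q ≡ V α
        go (yes ra) = trans (Low.low-q (low-real ra)) (sym (V-real ra))
        go (no nr) = trans (Low.low-q (low-nonreal nr)) (sym (V-nonreal nr))

      private
        geom : ∀ ρ → InD ρ → ρ ≢ 1# → sumTo r (geo ρ) ≡ 0#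
        geom ρ d ne = domain (trans (tele r) (trans (cong (_- 1#) d) (-‿inverseʳ 1#))) (x≢y⇒x-y≢0 ne)
          where
          tele : ∀ n → (ρ - 1#) * sumTo n (geo ρ) ≡ ρ ^ suc n - 1#
          tele zero = solve 1 (λ a → (a :- :1) :* :1 := a :* :1 :- :1) refl ρ
          tele (suc n) = trans (distribˡ _ _ _) (trans (cong (_+ (ρ - 1#) * ρ ^ suc n) (tele n)) (solve 2 (λ a b → (b :- :1) :+ (a :- :1) :* b := a :* b :- :1) refl ρ (ρ ^ suc n)))

        geom1 : sumTo r (geo 1#) ≡ - 1#
        geom1 = trans (go r) q-1·1
          where
          go : ∀ n → sumTo n (geo 1#) ≡ suc n · 1#
          go zero = sym (+-identityʳ 1#)
          go (suc n) = trans (cong₂ _+_ (go n) (1^ (suc n))) (+-comm _ _)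

      module _ {α : Carrier} (nr : ¬ Real α) where
        private
          w vi : Carrier
          w = bar α - α
          vi = v α ⁻¹

          v≢0 : v α ≢ 0#
          v≢0 = InD-≢0 (v-D nr)

          vi-r : vi ^ r ≡ v α
          vi-r = *-cancelˡ (inv≢0 v≢0) (trans (InD-inv (v-D nr)) (sym (inv-l v≢0)))

          inner : ∀ {m} → m ∈ Ml → sumTo r (λ j → (g α m * f α m ^ j) * vi ^ j) ≡ - FΣ.guard (f α m ≟ v α) (g α m)
          inner {m} m∈ = trans (sumTo-cong r (λ j → trans (*-assoc _ _ _) (cong (g α m *_) (sym (^-distrib-* (f α m) vi j))))) (trans (sumTo-* r (g α m) (geo (f α m * vi))) (go (m ≟ α) (f α m ≟ v α)))
            where
            go : Dec (m ≡ α) → (d : Dec (f α m ≡ v α)) → g α m * sumTo r (geo (f α m * vi)) ≡ - FΣ.guard d (g α m)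
            go _ (yes e) = trans (cong (λ t → g α m * sumTo r (geo t)) (trans (cong (_* vi) e) (inv-r v≢0))) (trans (cong (g α m *_) geom1) (solve 1 (λ x → x :* (:- :1) := :- x) refl (g α m)))
            go (yes refl) (no _) = trans (cong (_* sumTo r (geo (f α α * vi))) (g-0 α)) (trans (zeroˡ _) (sym -0#≈0#))
            go (no ne) (no nv) = trans (cong (g α m *_) (geom (f α m * vi) (InD-* (f-InD α (Ml∈ m∈) ne) (InD-inv (v-D nr)))
               (λ e → nv (trans (sym (*-identityʳ _)) (trans (cong (f α m *_) (sym (inv-l v≢0))) (trans (sym (*-assoc _ _ _)) (trans (cong (_* v α) e) (*-identityˡ _)))))))) (trans (zeroʳ _) (sym -0#≈0#))

          total : w ^ r * v α ≡ - ∑ (g α) (filter (λ m → f α m ≟ v α) Ml)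
          total = begin
            w ^ r * v α ≡⟨ cong₂ _*_ (ph-r α) vi-r ⟨
            ph α r * vi ^ r ≡⟨ sumTo-top r (λ j → ph α j * vi ^ j) (λ i lt → trans (cong (_* vi ^ i) (ph-0 α i lt)) (zeroˡ _)) ⟨
            sumTo r (λ j → ph α j * vi ^ j) ≡⟨ sumTo-cong r (λ j → ∑-*ʳ (vi ^ j) (λ m → g α m * f α m ^ j) Ml) ⟩
            sumTo r (λ j → ∑ (λ m → (g α m * f α m ^ j) * vi ^ j) Ml) ≡⟨ sumTo-∑ r (λ j m → (g α m * f α m ^ j) * vi ^ j) Ml ⟩
            ∑ (λ m → sumTo r (λ j → (g α m * f α m ^ j) * vi ^ j)) Ml ≡⟨ FΣ.big-cong∈ Ml inner ⟩
            ∑ (λ m → - FΣ.guard (f α m ≟ v α) (g α m)) Ml ≡⟨ ∑-neg _ Ml ⟨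
            - ∑ (λ m → FΣ.guard (f α m ≟ v α) (g α m)) Ml ≡⟨ cong -_ (FΣ.big-filter (λ m → f α m ≟ v α) (g α) Ml) ⟨
            - ∑ (g α) (filter (λ m → f α m ≟ v α) Ml) ∎
            where open ≡-Reasoning

          foot : ∀ τ → f α τ ≡ v α → w ^ r * v α ≡ - (g α τ + 0#) → τ ≡ bar α
          foot τ fe e = trans (solve 2 (λ t a → t := (t :- a) :+ a) refl τ α) (trans (cong (_+ α) (*-cancelˡ (^-≢0 r w≢0) w*)) (solve 2 (λ b a → (b :- a) :+ a := b) refl (bar α) α))
            where
            w≢0 : w ≢ 0#
            w≢0 = x≢y⇒x-y≢0 nr
            w* : w ^ r * (τ - α) ≡ w ^ r * w
            -- Multiplying by τ - α turns g(τ) into f(τ) = v(α); on the other side w^(q-1) = -1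
            -- because conjugation negates w.
            w* = trans (*-cancelˡ v≢0 (begin
              v α * (w ^ r * (τ - α)) ≡⟨ solve 3 (λ a b c → a :* (b :* c) := (b :* a) :* c) refl (v α) (w ^ r) (τ - α) ⟩
              (w ^ r * v α) * (τ - α) ≡⟨ cong (_* (τ - α)) e ⟩
              - (g α τ + 0#) * (τ - α) ≡⟨ solve 2 (λ a b → :- (a :+ :0) :* b := :- (a :* b)) refl (g α τ) (τ - α) ⟩
              - (g α τ * (τ - α)) ≡⟨ cong -_ (trans (g*≡f α τ) fe) ⟩
              - v α ≡⟨ solve 1 (λ a → :- a := a :* (:- :1)) refl (v α) ⟩
              v α * - 1# ∎)) (trans (sym (anti-^q-1 w≢0 (bar-anti α))) (*-comm _ _))
              where open ≡-Reasoning

          extract : (xs : List Carrier) → length xs ≡ 1 → (∀ {m} → m ∈ xs → f α m ≡ v α) → w ^ r * v α ≡ - ∑ (g α) xs → v α ≡ f α (bar α)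
          extract (τ ∷ []) _ h e = trans (sym (h (here refl))) (cong (f α) (foot τ (h (here refl)) e))

        -- The sum of `ph α j` v^(-j) over j ≤ q - 2 reduces to its last term. Summed over j first,
        -- it is a family of geometric series that isolates the m with f(m) = v(α). There is one
        -- such m = τ, and the comparison forces τ - α = ᾱ - α.
        tangent-conj : v α ≡ c (bar α) * Nm (bar α - α)
        tangent-conj = extract (filter (λ m → f α m ≟ v α) Ml) (at-tangent nr) (λ m∈ → proj₂ (∈-filter⁻ (λ m → f α m ≟ v α) {xs = Ml} m∈)) total

      -- The sum over the field of the derivative of a polynomial of degree at most 2q²-2 vanishes.

      private
        M-sum : ∀ P j → j +ℕ length P ≤ q² +ℕ q² ∸ 1 → ∑ (λ x → ((j · 1#) * x ^ (j ∸ 1)) * eval P x + x ^ j * evald P x) el ≡ 0#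
        M-sum [] j le = FΣ.big-ε el (λ _ → trans (cong₂ _+_ (zeroʳ _) (zeroʳ _)) (+-identityʳ 0#))
        M-sum (a ∷ P) j le = trans (FΣ.big-cong el step) (trans (FΣ.big-∙ _ _ el) (trans (cong₂ _+_ fst (M-sum P (suc j) (subst (_≤ q² +ℕ q² ∸ 1) (ℕₚ.+-suc j (length P)) le))) (+-identityʳ 0#)))
          where
          pow-j : ∀ j x → (j · 1#) * (x ^ (j ∸ 1) * x) ≡ (j · 1#) * x ^ j
          pow-j zero x = trans (zeroˡ _) (sym (zeroˡ _))
          pow-j (suc j) x = cong ((suc j · 1#) *_) (*-comm _ _)
          step : ∀ x → ((j · 1#) * x ^ (j ∸ 1)) * (a + x * eval P x) + x ^ j * (eval P x + x * evald P x)
            ≡ ((j · 1#) * x ^ (j ∸ 1)) * a + (((suc j · 1#) * x ^ j) * eval P x + x ^ suc j * evald P x)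
          step x = trans (solve 7 (λ n y a x e p d → (n :* y) :* (a :+ x :* e) :+ p :* (e :+ x :* d) := (n :* y) :* a :+ ((n :* (y :* x)) :* e :+ (p :* e :+ (x :* p) :* d))) refl (j · 1#) (x ^ (j ∸ 1)) a x (eval P x) (x ^ j) (evald P x))
            (cong (((j · 1#) * x ^ (j ∸ 1)) * a +_) (trans (cong (λ t → t * eval P x + (x ^ j * eval P x + x ^ suc j * evald P x)) (pow-j j x))
              (solve 5 (λ n p e z d → (n :* p) :* e :+ (p :* e :+ z) := ((:1 :+ n) :* p) :* e :+ z) refl (j · 1#) (x ^ j) (eval P x) (x ^ suc j * evald P x) 0#)))
          fst : ∑ (λ x → ((j · 1#) * x ^ (j ∸ 1)) * a) el ≡ 0#
          fst = trans (sym (∑-*ʳ a (λ x → (j · 1#) * x ^ (j ∸ 1)) el)) (trans (cong (_* a) (trans (sym (∑-*ˡ (j · 1#) (_^ (j ∸ 1)) el)) (k·ps j bd))) (zeroˡ a))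
            where
            bd : j ≤ q² +ℕ q² ∸ 2
            bd = ℕₚ.≤-trans (ℕₚ.≤-reflexive (sym (ℕₚ.m+n∸n≡m j 1))) (ℕₚ.≤-trans (ℕₚ.∸-monoˡ-≤ 1 (ℕₚ.≤-trans (ℕₚ.+-monoʳ-≤ j (s≤s z≤n)) le)) (ℕₚ.≤-reflexive (ℕₚ.∸-+-assoc (q² +ℕ q²) 1 1)))

        bound : ∀ l₁ l₂ → l₁ +ℕ q *ℕ l₂ < r +ℕ q *ℕ r → suc (l₁ +ℕ q *ℕ l₂) +ℕ length (E Ml q) ≤ q² +ℕ q² ∸ 1
        bound l₁ l₂ lt = ℕₚ.≤-trans (ℕₚ.+-mono-≤ lt (length-E Ml q)) (ℕₚ.≤-reflexive (trans arith (cong (λ t → t +ℕ t ∸ 1) (sym q²-def))))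
          where
          arith : (r +ℕ q *ℕ r) +ℕ suc (q *ℕ q+1) ≡ q ^ℕ 2 +ℕ q ^ℕ 2 ∸ 1
          arith = cong (_∸ 1) (solve' 1 (λ r → con' 1 :+' ((r :+' (con' 2 :+' r) :*' r) :+' (con' 1 :+' (con' 2 :+' r) :*' (con' 3 :+' r))) :=' (con' 2 :+' r) :*' ((con' 2 :+' r) :*' con' 1) :+' (con' 2 :+' r) :*' ((con' 2 :+' r) :*' con' 1)) refl r)
            where open ℕSolver.+-*-Solver renaming (solve to solve'; con to con'; _:+_ to _:+'_; _:*_ to _:*'_; _:=_ to _:='_)

      -- Sum the derivative of z^(n+1) E_q over the field, where n = l₁ + q l₂: E_q has derivative
      -- zero on the field, and n + 1 equals l₁ + 1 there. The strict inequality is exactly degree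
      -- at most 2q² - 2; among exponents up to q - 2 it leaves out only l₁ = l₂ = q - 2.
      moment : ∀ l₁ l₂ → l₁ +ℕ q *ℕ l₂ < r +ℕ q *ℕ r → (suc l₁ · 1#) * ∑ (λ α → V α * (α ^ l₁ * bar α ^ l₂)) el ≡ 0#
      moment l₁ l₂ lt = trans (∑-*ˡ (suc l₁ · 1#) _ el) (trans (FΣ.big-cong el step) (M-sum (E Ml q) (suc (l₁ +ℕ q *ℕ l₂)) (bound l₁ l₂ lt)))
        where
        n : ℕ
        n = l₁ +ℕ q *ℕ l₂
        char : suc n · 1# ≡ suc l₁ · 1#
        char = trans (·-homo-+ 1# (suc l₁) (q *ℕ l₂)) (trans (cong ((suc l₁ · 1#) +_) (trans (×1-homo-* q l₂) (trans (cong (_* (l₂ · 1#)) q·1≡0) (zeroˡ _)))) (+-identityʳ _))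
        step : ∀ x → (suc l₁ · 1#) * (V x * (x ^ l₁ * bar x ^ l₂)) ≡ ((suc n · 1#) * x ^ n) * eval (E Ml q) x + x ^ suc n * evald (E Ml q) x
        step x = sym (trans (cong₂ _+_ (cong₂ _*_ (cong₂ _*_ char (trans (^-homo-* x l₁ (q *ℕ l₂)) (cong (x ^ l₁ *_) (sym (^-assocʳ x q l₂))))) (eval-E-q x)) (trans (cong (x ^ suc n *_) (evald-E-q x)) (zeroʳ _)))
          (trans (+-identityʳ _) (solve 3 (λ a b c → (a :* b) :* c := a :* (c :* b)) refl (suc l₁ · 1#) (x ^ l₁ * bar x ^ l₂) (V x))))

  -- Duality between points and tangents

  module Duality where
    open FieldArithmetic
    open LacunaryPolynomials

    private
      variable
        X : Set

    count-cong : {P Q : X → Set} (P? : ∀ x → Dec (P x)) (Q? : ∀ x → Dec (Q x)) (xs : List X)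
      → (∀ {x} → x ∈ xs → P x → Q x) → (∀ {x} → x ∈ xs → Q x → P x) → length (filter P? xs) ≡ length (filter Q? xs)
    count-cong P? Q? [] f g = refl
    count-cong P? Q? (x ∷ xs) f g with P? x | Q? x
    ... | yes _ | yes _ = cong suc (count-cong P? Q? xs (λ m → f (there m)) (λ m → g (there m)))
    ... | no _ | no _ = count-cong P? Q? xs (λ m → f (there m)) (λ m → g (there m))
    ... | yes a | no b = ⊥-elim (b (f (here refl) a))
    ... | no a | yes b = ⊥-elim (a (g (here refl) b))

    count-none : {P : X → Set} (P? : ∀ x → Dec (P x)) (xs : List X) → (∀ {x} → x ∈ xs → ¬ P x) → length (filter P? xs) ≡ 0
    count-none P? [] f = refl
    count-none P? (x ∷ xs) f with P? x
    ... | yes a = ⊥-elim (f (here refl) a)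
    ... | no _ = count-none P? xs (λ m → f (there m))

    count-all : {P : X → Set} (P? : ∀ x → Dec (P x)) (xs : List X) → (∀ {x} → x ∈ xs → P x) → length (filter P? xs) ≡ length xs
    count-all P? [] f = refl
    count-all P? (x ∷ xs) f with P? x
    ... | yes a = cong suc (count-all P? xs (λ m → f (there m)))
    ... | no b = ⊥-elim (b (f (here refl)))

    ind-yes : {A : Set} (d : Dec A) → A → ind d ≡ 1
    ind-yes (yes _) a = refl
    ind-yes (no b) a = ⊥-elim (b a)

    ind-no : {A : Set} (d : Dec A) → ¬ A → ind d ≡ 0
    ind-no (yes a) b = ⊥-elim (b a)
    ind-no (no _) b = refl

    ≢? : (x : Carrier) → ∀ y → Dec (y ≢ x)
    ≢? x y = ¬? (y ≟ x)

    filter-≢-∉ : ∀ {x} (xs : List Carrier) → x ∉ xs → filter (≢? x) xs ≡ xs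
    filter-≢-∉ [] h = refl
    filter-≢-∉ {x} (y ∷ xs) h with y ≟ x
    ... | yes refl = ⊥-elim (h (here refl))
    ... | no _ = cong (y ∷_) (filter-≢-∉ xs (λ m → h (there m)))

    sum-remove : ∀ (f : Carrier → ℕ) {x} {xs : List Carrier} → Unique xs → x ∈ xs → sumℕ f xs ≡ sumℕ f (filter (≢? x) xs) +ℕ f x
    sum-remove f {x} {y ∷ xs} u m with y ≟ x
    ... | yes refl = trans (ℕₚ.+-comm (f y) _) (cong (λ l → sumℕ f l +ℕ f y) (sym (filter-≢-∉ xs (unique-head∉ u))))
    sum-remove f {x} {y ∷ xs} u (here e) | no ne = ⊥-elim (ne (sym e))
    sum-remove f {x} {y ∷ xs} u (there m) | no ne = trans (cong (f y +ℕ_) (sum-remove f (unique-tail u) m)) (sym (ℕₚ.+-assoc (f y) _ _))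

    count-remove : ∀ {P : Carrier → Set} (P? : ∀ x → Dec (P x)) {x} {xs : List Carrier} → Unique xs → x ∈ xs
      → length (filter P? xs) ≡ length (filter P? (filter (≢? x) xs)) +ℕ ind (P? x)
    count-remove P? {x} {xs} u m = trans (count-ind P? xs) (trans (sum-remove _ u m) (cong (_+ℕ ind (P? x)) (sym (count-ind P? (filter (≢? x) xs)))))

    length-remove : ∀ {x} {xs : List Carrier} → Unique xs → x ∈ xs → length xs ≡ suc (length (filter (≢? x) xs))
    length-remove {x} {xs} u m = trans (sym (trans (sumℕ-const 1 xs) (ℕₚ.*-identityʳ _))) (trans (sum-remove (λ _ → 1) u m) (trans (ℕₚ.+-comm _ 1) (cong suc (trans (sumℕ-const 1 (filter (≢? x) xs)) (ℕₚ.*-identityʳ _)))))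

    Nm-neg : ∀ x → Nm (- x) ≡ Nm x
    Nm-neg x = trans (cong (- x *_) (bar-neg x)) (solve 2 (λ a b → (:- a) :* (:- b) := a :* b) refl x (bar x))

    Nm-swap : ∀ x y → Nm (x - y) ≡ Nm (y - x)
    Nm-swap x y = trans (cong Nm (solve 2 (λ x y → x :- y := :- (y :- x)) refl x y)) (Nm-neg (y - x))

    Nm-1 : Nm 1# ≡ 1#
    Nm-1 = 1^ q+1

    div-eq : ∀ {a b d} → a ≢ 0# → a * d ≡ b → d ≡ b * a ⁻¹
    div-eq {a} {b} {d} ne e = *-cancelˡ ne (trans e (sym (trans (solve 3 (λ a b i → a :* (b :* i) := b :* (a :* i)) refl a b (a ⁻¹)) (trans (cong (b *_) (inv-r ne)) (*-identityʳ b)))))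

    *-/ : ∀ {a} b → a ≢ 0# → (b * a ⁻¹) * a ≡ b
    *-/ {a} b ne = trans (*-assoc _ _ _) (trans (cong (b *_) (inv-l ne)) (*-identityʳ b))

    -- The tangents of a unital form a unital in the dual plane, which exchanges c with 1/v. Here
    -- this is obtained directly by double counting pairs (m, α).
    module Dualise {c v : Carrier → Carrier} (H : Hyp c v) where
      open Hyp H

      private
        n : Carrier → Carrier → ℕ
        n α u = cnt (λ m → c m * Nm (m - α)) u

        B : Carrier → ℕ
        B α with real? α
        ... | yes _ = q
        ... | no _ = q+1

        T : (Carrier → Carrier) → Carrier → ℕ
        T w α = ℕΣ.guard (nonreal? α) (ind (v α ≟ w α))

        -- Weighted by q, the tangency indicator makes up the difference between 1 and q + 1, so
        -- that the total depends on α alone.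
        line : ∀ (w : Carrier → Carrier) α → InD (w α) → n α (w α) +ℕ q *ℕ T w α ≡ B α
        line w α d with real? α
        ... | yes ra = trans (cong₂ _+ℕ_ (at-real ra d) (ℕₚ.*-zeroʳ q)) (ℕₚ.+-identityʳ q)
        ... | no nr with v α ≟ w α
        ...   | yes e = trans (cong₂ _+ℕ_ (trans (cong (n α) (sym e)) (at-tangent nr)) (ℕₚ.*-identityʳ q)) refl
        ...   | no ne = trans (cong₂ _+ℕ_ (at-secant nr d (λ e → ne (sym e))) (ℕₚ.*-zeroʳ q)) (ℕₚ.+-identityʳ q+1)

        ∑T : ∀ w → sumℕ (T w) el ≡ length (filter (λ α → v α ≟ w α) Ml)
        ∑T w = trans (sym (ℕΣ.big-filter nonreal? (λ α → ind (v α ≟ w α)) el)) (sym (count-ind (λ α → v α ≟ w α) Ml))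

        ∑B : sumℕ B el ≡ q *ℕ q +ℕ length Ml *ℕ q+1
        ∑B = trans (ℕΣ.big-cong el split) (trans (ℕΣ.big-∙ _ _ el) (cong₂ _+ℕ_
            (trans (sym (ℕΣ.big-filter real? (λ _ → q) el)) (trans (sumℕ-const q Rl) (cong (_*ℕ q) Rl-length)))
            (trans (sym (ℕΣ.big-filter nonreal? (λ _ → q+1) el)) (sumℕ-const q+1 Ml))))
          where
          split : ∀ α → B α ≡ ℕΣ.guard (real? α) q +ℕ ℕΣ.guard (nonreal? α) q+1
          split α with real? α
          ... | yes _ = sym (ℕₚ.+-identityʳ q)
          ... | no _ = refl

        c≢0 : ∀ {m} → ¬ Real m → c m ≢ 0#
        c≢0 nr = InD-≢0 (c-D nr)

        fib : ∀ {m X} → ¬ Real m → InD X → length (filter (λ ζ → Nm ζ ≟ X * c m ⁻¹) nz) ≡ q+1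
        fib nr d = Nm-fibre (InD-* d (InD-inv (c-D nr)))

        fibre-∞ : ∀ {m X} → ¬ Real m → InD X → length (filter (λ α → c m * Nm (m - α) ≟ X) el) ≡ q+1
        fibre-∞ {m} {X} nr d = trans (count-bij (λ α → c m * Nm (m - α) ≟ X) (λ ζ → Nm ζ ≟ X * c m ⁻¹) el-unique nz-unique (λ x → m - x) (λ x → m - x)
            (λ {α} _ e → ∈nz (λ z → InD-≢0 d (trans (sym e) (trans (cong (λ t → c m * Nm t) z) (trans (cong (c m *_) Nm-0) (zeroʳ _))))) , div-eq (c≢0 nr) e , invol α)
            (λ {ζ} _ e → el-complete _ , trans (cong (c m *_) (trans (cong Nm (invol ζ)) e)) (trans (*-comm _ _) (*-/ X (c≢0 nr))) , invol ζ)) (fib nr d)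
          where
          invol : ∀ x → m - (m - x) ≡ x
          invol x = solve 2 (λ m x → m :- (m :- x) := x) refl m x

        -- The Möbius map ζ = (m - α) / (m₀ - α) turns the equation into N(ζ) = X / c(m). It misses
        -- ζ = 1, the image of α = ∞, which is a solution exactly when c(m) = X.
        fibre : ∀ {m m₀ X} → ¬ Real m → InD X → m ≢ m₀
          → length (filter (λ α → c m * Nm (m - α) ≟ X * Nm (m₀ - α)) (filter (≢? m₀) el)) +ℕ ind (c m ≟ X) ≡ q+1
        fibre {m} {m₀} {X} nr d ne = trans (cong₂ _+ℕ_ bij indeq) (trans (sym (count-remove (λ ζ → Nm ζ ≟ X * c m ⁻¹) nz-unique (∈nz 1≢0))) (fib nr d))
          where
          cm : c m ≢ 0#
          cm = c≢0 nr
          to fro : Carrier → Carrier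
          to α = (m - α) * (m₀ - α) ⁻¹
          fro ζ = (m - ζ * m₀) * (1# - ζ) ⁻¹
          indeq : ind (c m ≟ X) ≡ ind (Nm 1# ≟ X * c m ⁻¹)
          indeq with c m ≟ X
          ... | yes refl = sym (ind-yes (Nm 1# ≟ X * c m ⁻¹) (trans Nm-1 (sym (inv-r cm))))
          ... | no nx = sym (ind-no (Nm 1# ≟ X * c m ⁻¹) (λ e → nx (trans (sym (*-identityˡ _)) (trans (cong (_* c m) (trans (sym Nm-1) e)) (*-/ X cm)))))
          m₀-α : ∀ {α} → α ∈ filter (≢? m₀) el → m₀ - α ≢ 0#
          m₀-α m∈ = x≢y⇒x-y≢0 (λ e → proj₂ (∈-filter⁻ (≢? m₀) {xs = el} m∈) (sym e))
          1-ζ : ∀ {ζ} → ζ ∈ filter (≢? 1#) nz → 1# - ζ ≢ 0#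
          1-ζ m∈ = x≢y⇒x-y≢0 (λ e → proj₂ (∈-filter⁻ (≢? 1#) {xs = nz} m∈) (sym e))
          -- 1 - to α = (m₀ - m)/(m₀ - α), and m₀ - fro ζ = (m₀ - m)/(1 - ζ)
          1-to : ∀ {α} → m₀ - α ≢ 0# → (1# - to α) * (m₀ - α) ≡ m₀ - m
          1-to {α} z = trans (solve 4 (λ m α d i → (:1 :- (m :- α) :* i) :* d := d :- (m :- α) :* (i :* d)) refl m α (m₀ - α) ((m₀ - α) ⁻¹)) (trans (cong (λ t → (m₀ - α) - (m - α) * t) (inv-l z)) (solve 3 (λ m₀ m α → (m₀ :- α) :- (m :- α) :* :1 := m₀ :- m) refl m₀ m α))
          m₀-fro : ∀ {ζ} → 1# - ζ ≢ 0# → (m₀ - fro ζ) * (1# - ζ) ≡ m₀ - m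
          m₀-fro {ζ} z = trans (solve 4 (λ m₀ n d i → (m₀ :- n :* i) :* d := m₀ :* d :- n :* (i :* d)) refl m₀ (m - ζ * m₀) (1# - ζ) ((1# - ζ) ⁻¹)) (trans (cong (λ t → m₀ * (1# - ζ) - (m - ζ * m₀) * t) (inv-l z)) (solve 3 (λ m₀ m z → m₀ :* (:1 :- z) :- (m :- z :* m₀) :* :1 := m₀ :- m) refl m₀ m ζ))
          m₀-m : m₀ - m ≢ 0#
          m₀-m = x≢y⇒x-y≢0 (λ e → ne (sym e))
          nonz : ∀ {a b e} → a * b ≡ e → e ≢ 0# → a ≢ 0#
          nonz {a} {b} ab ez refl = ez (trans (sym ab) (zeroˡ b))
          bij : length (filter (λ α → c m * Nm (m - α) ≟ X * Nm (m₀ - α)) (filter (≢? m₀) el)) ≡ length (filter (λ ζ → Nm ζ ≟ X * c m ⁻¹) (filter (≢? 1#) nz))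
          bij = count-bij _ _ (Uniqₚ.filter⁺ (≢? m₀) el-unique) (Uniqₚ.filter⁺ (≢? 1#) nz-unique) to fro fw bw
            where
            fw : ∀ {α} → α ∈ filter (≢? m₀) el → c m * Nm (m - α) ≡ X * Nm (m₀ - α) → to α ∈ filter (≢? 1#) nz × Nm (to α) ≡ X * c m ⁻¹ × fro (to α) ≡ α
            fw {α} α∈ e = ∈-filter⁺ (≢? 1#) (∈nz ζ≢0) (λ e1 → x≢y⇒x-y≢0 (λ e2 → ne1 (sym e2)) (trans (cong (λ t → 1# - t) e1) (-‿inverseʳ 1#)) ) , div-eq cm nmζ , *-cancelˡ z1 eqf
              where
              z0 : m₀ - α ≢ 0#
              z0 = m₀-α α∈
              z1 : 1# - to α ≢ 0#
              z1 = nonz (1-to z0) m₀-m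
              ne1 : to α ≢ 1#
              ne1 e1 = z1 (trans (cong (λ t → 1# - t) e1) (-‿inverseʳ 1#))
              back : to α * (m₀ - α) ≡ m - α
              back = *-/ (m - α) z0
              nmζ : c m * Nm (to α) ≡ X
              nmζ = *-cancelˡ (Nm-≢0 z0) (trans (solve 3 (λ a b d → d :* (a :* b) := a :* (b :* d)) refl (c m) (Nm (to α)) (Nm (m₀ - α))) (trans (cong (c m *_) (trans (sym (Nm-* (to α) (m₀ - α))) (cong Nm back))) (trans e (*-comm _ _))))
              ζ≢0 : to α ≢ 0#
              ζ≢0 z = InD-≢0 d (trans (sym nmζ) (trans (cong (λ t → c m * Nm t) z) (trans (cong (c m *_) Nm-0) (zeroʳ _))))
              eqf : (1# - to α) * fro (to α) ≡ (1# - to α) * α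
              eqf = trans (trans (*-comm _ _) (*-/ _ z1)) (x-y≡0 (trans (solve 4 (λ m z m₀ α → (m :- z :* m₀) :- (:1 :- z) :* α := (m :- α) :- z :* (m₀ :- α)) refl m (to α) m₀ α) (trans (cong (λ t → (m - α) - t) back) (-‿inverseʳ _))))
            bw : ∀ {ζ} → ζ ∈ filter (≢? 1#) nz → Nm ζ ≡ X * c m ⁻¹ → fro ζ ∈ filter (≢? m₀) el × c m * Nm (m - fro ζ) ≡ X * Nm (m₀ - fro ζ) × to (fro ζ) ≡ ζ
            bw {ζ} ζ∈ e = ∈-filter⁺ (≢? m₀) (el-complete _) (λ e1 → z0 (trans (cong (λ t → m₀ - t) e1) (-‿inverseʳ m₀))) , eq1 , sym (div-eq z0 (trans (*-comm _ _) (sym back)))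
              where
              z1 : 1# - ζ ≢ 0#
              z1 = 1-ζ ζ∈
              z0 : m₀ - fro ζ ≢ 0#
              z0 = nonz (m₀-fro z1) m₀-m
              fz : fro ζ * (1# - ζ) ≡ m - ζ * m₀
              fz = *-/ _ z1
              back : m - fro ζ ≡ ζ * (m₀ - fro ζ)
              back = x-y≡0 (trans (solve 4 (λ m f z m₀ → (m :- f) :- z :* (m₀ :- f) := (m :- z :* m₀) :- f :* (:1 :- z)) refl m (fro ζ) ζ m₀) (trans (cong (λ t → (m - ζ * m₀) - t) fz) (-‿inverseʳ _)))
              eq1 : c m * Nm (m - fro ζ) ≡ X * Nm (m₀ - fro ζ)
              eq1 = trans (cong (λ t → c m * t) (trans (cong Nm back) (Nm-* ζ (m₀ - fro ζ)))) (trans (sym (*-assoc _ _ _)) (cong (_* Nm (m₀ - fro ζ)) (trans (cong (c m *_) e) (trans (*-comm _ _) (*-/ X cm)))))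

        cancelℕ : ∀ {a b} → q *ℕ a ≡ q *ℕ b → a ≡ b
        cancelℕ {a} {b} = ℕₚ.*-cancelˡ-≡ a b q

        open ℕSolver.+-*-Solver using () renaming (solve to solveℕ; con to conℕ; _:+_ to _⊹ℕ_; _:*_ to _⊛ℕ_; _:=_ to _⩵ℕ_)

      tangents-∞ : ∀ {X} → InD X → length (filter (λ α → v α ≟ X) Ml) ≡ q
      tangents-∞ {X} d = cancelℕ (ℕₚ.+-cancelˡ-≡ (length Ml *ℕ q+1) _ _ (begin
        length Ml *ℕ q+1 +ℕ q *ℕ t ≡⟨ cong₂ _+ℕ_ (sym nsum) (cong (q *ℕ_) (sym (∑T (λ _ → X)))) ⟩
        sumℕ (λ α → n α X) el +ℕ q *ℕ sumℕ (T (λ _ → X)) el ≡⟨ cong (sumℕ (λ α → n α X) el +ℕ_) (sym (sumℕ-*ˡ q (T (λ _ → X)) el)) ⟩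
        sumℕ (λ α → n α X) el +ℕ sumℕ (λ α → q *ℕ T (λ _ → X) α) el ≡⟨ ℕΣ.big-∙ _ _ el ⟨
        sumℕ (λ α → n α X +ℕ q *ℕ T (λ _ → X) α) el ≡⟨ ℕΣ.big-cong el (λ α → line (λ _ → X) α d) ⟩
        sumℕ B el ≡⟨ ∑B ⟩
        q *ℕ q +ℕ length Ml *ℕ q+1 ≡⟨ ℕₚ.+-comm (q *ℕ q) _ ⟩
        length Ml *ℕ q+1 +ℕ q *ℕ q ∎))
        where
        open ≡-Reasoning
        t : ℕ
        t = length (filter (λ α → v α ≟ X) Ml)
        nsum : sumℕ (λ α → n α X) el ≡ length Ml *ℕ q+1
        nsum = trans (ℕΣ.big-cong el (λ α → count-ind (λ m → c m * Nm (m - α) ≟ X) Ml)) (trans (ℕΣ.big-swap (λ α m → ind (c m * Nm (m - α) ≟ X)) el Ml)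
          (trans (ℕΣ.big-cong∈ Ml (λ {m} m∈ → trans (sym (count-ind (λ α → c m * Nm (m - α) ≟ X) el)) (fibre-∞ (Ml∈ m∈) d))) (sumℕ-const q+1 Ml)))

      -- The same double count with the value X N(m₀ - α), which varies with α; α = m₀ is left out
      -- because the value is zero there.
      module _ (m₀ : Carrier) {X : Carrier} (d : InD X) where
        private
          t : ℕ
          t = length (filter (λ α → v α ≟ X * Nm (m₀ - α)) Ml)
          el' : List Carrier
          el' = filter (≢? m₀) el
          w : Carrier → Carrier
          w α = X * Nm (m₀ - α)
          K : Carrier → ℕ
          K m = length (filter (λ α → c m * Nm (m - α) ≟ w α) el')
          s : ℕ
          s = sumℕ K Ml

          w-D : ∀ {α} → α ∈ el' → InD (w α)
          w-D m∈ = InD-* d (Nm-InD (x≢y⇒x-y≢0 (λ e → proj₂ (∈-filter⁻ (≢? m₀) {xs = el} m∈) (sym e))))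

          T-m₀ : T w m₀ ≡ 0
          T-m₀ with real? m₀
          ... | yes _ = refl
          ... | no nr = ind-no (v m₀ ≟ w m₀) (λ e → InD-≢0 (v-D nr) (trans e (trans (cong (λ t → X * Nm t) (-‿inverseʳ m₀)) (trans (cong (X *_) Nm-0) (zeroʳ X)))))

          ∑T' : sumℕ (T w) el' ≡ t
          ∑T' = trans (trans (sym (ℕₚ.+-identityʳ _)) (trans (cong (sumℕ (T w) el' +ℕ_) (sym T-m₀)) (sym (sum-remove (T w) el-unique (el-complete m₀))))) (∑T w)

          eq1 : s +ℕ q *ℕ t ≡ sumℕ B el'
          eq1 = begin
            s +ℕ q *ℕ t ≡⟨ cong₂ _+ℕ_ (ℕΣ.big-cong Ml (λ m → count-ind (λ α → c m * Nm (m - α) ≟ w α) el')) (cong (q *ℕ_) (sym ∑T')) ⟩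
            sumℕ (λ m → sumℕ (λ α → ind (c m * Nm (m - α) ≟ w α)) el') Ml +ℕ q *ℕ sumℕ (T w) el' ≡⟨ cong₂ _+ℕ_ (trans (ℕΣ.big-swap (λ m α → ind (c m * Nm (m - α) ≟ w α)) Ml el') (ℕΣ.big-cong el' (λ α → sym (count-ind (λ m → c m * Nm (m - α) ≟ w α) Ml)))) (sym (sumℕ-*ˡ q (T w) el')) ⟩
            sumℕ (λ α → n α (w α)) el' +ℕ sumℕ (λ α → q *ℕ T w α) el' ≡⟨ ℕΣ.big-∙ _ _ el' ⟨
            sumℕ (λ α → n α (w α) +ℕ q *ℕ T w α) el' ≡⟨ ℕΣ.big-cong∈ el' (λ {α} m∈ → line w α (w-D m∈)) ⟩
            sumℕ B el' ∎
            where open ≡-Reasoning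

          eq2 : sumℕ B el' +ℕ B m₀ ≡ q *ℕ q +ℕ length Ml *ℕ q+1
          eq2 = trans (sym (sum-remove B el-unique (el-complete m₀))) ∑B

          ∑ind : sumℕ (λ m → ind (c m ≟ X)) Ml ≡ q
          ∑ind = trans (sym (count-ind (λ m → c m ≟ X) Ml)) (at-∞ d)

          B-real : Real m₀ → B m₀ ≡ q
          B-real ra with real? m₀
          ... | yes _ = refl
          ... | no nr = ⊥-elim (nr ra)

          B-nonreal : ¬ Real m₀ → B m₀ ≡ q+1
          B-nonreal nr with real? m₀
          ... | yes ra = ⊥-elim (nr ra)
          ... | no _ = refl

        tangents-real : Real m₀ → length (filter (λ α → v α ≟ X * Nm (m₀ - α)) Ml) ≡ q
        tangents-real ra = cancelℕ (ℕₚ.+-cancelʳ-≡ (s +ℕ q) _ _ (begin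
          q *ℕ t +ℕ (s +ℕ q) ≡⟨ solveℕ 3 (λ a s q → a ⊹ℕ (s ⊹ℕ q) ⩵ℕ (s ⊹ℕ a) ⊹ℕ q) refl (q *ℕ t) s q ⟩
          (s +ℕ q *ℕ t) +ℕ q ≡⟨ cong₂ _+ℕ_ eq1 (sym (B-real ra)) ⟩
          sumℕ B el' +ℕ B m₀ ≡⟨ eq2 ⟩
          q *ℕ q +ℕ length Ml *ℕ q+1 ≡⟨ cong (q *ℕ q +ℕ_) (trans (sym (sumℕ-const q+1 Ml)) (trans (ℕΣ.big-cong∈ Ml (λ {m} m∈ → sym (fibre (Ml∈ m∈) d (λ { refl → Ml∈ m∈ ra })))) (trans (ℕΣ.big-∙ _ _ Ml) (cong (s +ℕ_) ∑ind)))) ⟩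
          q *ℕ q +ℕ (s +ℕ q) ∎))
          where open ≡-Reasoning

        private
          Ml' : List Carrier
          Ml' = filter (≢? m₀) Ml

          -- The summand m = m₀ escapes `fibre`. Its contribution κ is 0 or q², according to whether
          -- X differs from c(m₀), and this decides between q + 1 and 1.
          main : ¬ Real m₀ → ∀ κ → K m₀ +ℕ ind (c m₀ ≟ X) ≡ κ → q *ℕ t +ℕ κ ≡ q *ℕ q +ℕ q
          main nr κ κe = ℕₚ.+-cancelʳ-≡ (length Ml' *ℕ q+1 +ℕ q+1) _ _ (begin
            (q *ℕ t +ℕ κ) +ℕ (L' +ℕ q+1) ≡⟨ solveℕ 4 (λ a k l b → (a ⊹ℕ k) ⊹ℕ (l ⊹ℕ b) ⩵ℕ a ⊹ℕ (l ⊹ℕ k) ⊹ℕ b) refl (q *ℕ t) κ L' q+1 ⟩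
            q *ℕ t +ℕ (L' +ℕ κ) +ℕ q+1 ≡⟨ cong (λ z → q *ℕ t +ℕ z +ℕ q+1) (sym ssum) ⟩
            q *ℕ t +ℕ (s +ℕ q) +ℕ q+1 ≡⟨ solveℕ 4 (λ a s q b → a ⊹ℕ (s ⊹ℕ q) ⊹ℕ b ⩵ℕ ((s ⊹ℕ a) ⊹ℕ b) ⊹ℕ q) refl (q *ℕ t) s q q+1 ⟩
            ((s +ℕ q *ℕ t) +ℕ q+1) +ℕ q ≡⟨ cong (_+ℕ q) (trans (cong₂ _+ℕ_ eq1 (sym (B-nonreal nr))) eq2) ⟩
            (q *ℕ q +ℕ length Ml *ℕ q+1) +ℕ q ≡⟨ cong (λ z → (q *ℕ q +ℕ z *ℕ q+1) +ℕ q) (length-remove Ml-unique (∈Ml nr)) ⟩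
            (q *ℕ q +ℕ (q+1 +ℕ L')) +ℕ q ≡⟨ solveℕ 4 (λ a b l x → (a ⊹ℕ (b ⊹ℕ l)) ⊹ℕ x ⩵ℕ (a ⊹ℕ x) ⊹ℕ (l ⊹ℕ b)) refl (q *ℕ q) q+1 L' q ⟩
            (q *ℕ q +ℕ q) +ℕ (L' +ℕ q+1) ∎)
            where
            open ≡-Reasoning
            L' : ℕ
            L' = length Ml' *ℕ q+1
            ssum : s +ℕ q ≡ L' +ℕ κ
            ssum = trans (cong (s +ℕ_) (sym ∑ind)) (trans (sym (ℕΣ.big-∙ _ _ Ml)) (trans (sum-remove (λ m → K m +ℕ ind (c m ≟ X)) Ml-unique (∈Ml nr))
              (cong₂ _+ℕ_ (trans (ℕΣ.big-cong∈ Ml' (λ {m} m∈ → let (a , b) = ∈-filter⁻ (≢? m₀) {xs = Ml} m∈ in fibre (Ml∈ a) d b)) (sumℕ-const q+1 Ml')) κe)))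

        tangents-off : ¬ Real m₀ → X ≢ c m₀ → length (filter (λ α → v α ≟ X * Nm (m₀ - α)) Ml) ≡ q+1
        tangents-off nr ne = cancelℕ (trans (sym (ℕₚ.+-identityʳ _)) (trans (main nr 0 K0) (trans (ℕₚ.+-comm (q *ℕ q) q) (sym (ℕₚ.*-suc q q)))))
          where
          K0 : K m₀ +ℕ ind (c m₀ ≟ X) ≡ 0
          K0 = cong₂ _+ℕ_ (count-none _ el' (λ {α} m∈ e → ne (sym (*-cancelˡ (Nm-≢0 (x≢y⇒x-y≢0 (λ e' → proj₂ (∈-filter⁻ (≢? m₀) {xs = el} m∈) (sym e')))) (trans (*-comm _ _) (trans e (*-comm _ _))))))) (ind-no (c m₀ ≟ X) (λ e → ne (sym e)))

        tangents-on : ¬ Real m₀ → X ≡ c m₀ → length (filter (λ α → v α ≟ X * Nm (m₀ - α)) Ml) ≡ 1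
        tangents-on nr e = cancelℕ (ℕₚ.+-cancelʳ-≡ (q *ℕ q) _ _ (trans (main nr (q *ℕ q) K1) (trans (ℕₚ.+-comm (q *ℕ q) q) (cong (_+ℕ q *ℕ q) (sym (ℕₚ.*-identityʳ q))))))
          where
          K1 : K m₀ +ℕ ind (c m₀ ≟ X) ≡ q *ℕ q
          K1 = trans (cong₂ _+ℕ_ (count-all _ el' (λ {α} _ → cong (_* Nm (m₀ - α)) (sym e))) (ind-yes (c m₀ ≟ X) (sym e))) (trans (ℕₚ.+-comm (length el') 1) (trans (sym (length-remove el-unique (el-complete m₀))) (trans el-length (sym q*q≡))))

      dual : Hyp (λ α → v α ⁻¹) (λ m → c m ⁻¹)
      dual = record
        { c-D = λ nr → InD-inv (v-D nr)
        ; v-D = λ nr → InD-inv (c-D nr)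
        ; at-∞ = λ {u} d → trans (count-cong _ (λ α → v α ≟ u ⁻¹) Ml (λ m∈ e → trans (inv-inv (InD-≢0 (v-D (Ml∈ m∈)))) (cong _⁻¹ e)) (λ m∈ e → trans (cong _⁻¹ e) (sym (inv-inv (InD-≢0 d))))) (tangents-∞ (InD-inv d))
        ; at-real = λ {s} {u} ra d → trans (conv s d) (tangents-real s (InD-inv d) ra)
        ; at-tangent = λ {m} nr → trans (conv m (InD-inv (c-D nr))) (tangents-on m (InD-inv (InD-inv (c-D nr))) nr (sym (inv-inv (InD-≢0 (c-D nr)))))
        ; at-secant = λ {m} {u} nr d ne → trans (conv m d) (tangents-off m (InD-inv d) nr (λ e → ne (trans (inv-inv (InD-≢0 d)) (cong _⁻¹ e)))) }
        where
        inv-inv : ∀ {x} → x ≢ 0# → x ≡ (x ⁻¹) ⁻¹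
        inv-inv ne = inv-unique (inv-l ne)
        conv : ∀ m {u} → InD u → length (filter (λ α → v α ⁻¹ * Nm (α - m) ≟ u) Ml) ≡ length (filter (λ α → v α ≟ u ⁻¹ * Nm (m - α)) Ml)
        conv m {u} d = count-cong _ _ Ml
          (λ {α} m∈ e → *-cancelˡ (InD-≢0 d) (trans (trans (cong (_* v α) (sym e)) (trans (solve 3 (λ i n v → (i :* n) :* v := n :* (i :* v)) refl (v α ⁻¹) (Nm (α - m)) (v α)) (trans (cong (Nm (α - m) *_) (inv-l (InD-≢0 (v-D (Ml∈ m∈))))) (*-identityʳ _))))
             (trans (Nm-swap α m) (sym (trans (sym (*-assoc _ _ _)) (trans (cong (_* Nm (m - α)) (inv-r (InD-≢0 d))) (*-identityˡ _)))))))
          (λ {α} m∈ e → *-cancelˡ (InD-≢0 (v-D (Ml∈ m∈))) (trans (trans (sym (*-assoc _ _ _)) (trans (cong (_* Nm (α - m)) (inv-r (InD-≢0 (v-D (Ml∈ m∈))))) (*-identityˡ _)))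
             (sym (trans (cong (_* u) e) (trans (solve 3 (λ i n v → (i :* n) :* v := n :* (i :* v)) refl (u ⁻¹) (Nm (m - α)) u) (trans (cong (Nm (m - α) *_) (inv-l (InD-≢0 d))) (trans (*-identityʳ _) (Nm-swap m α))))))))

  -- Fourier coefficients of sparse functions

  module FourierCoefficients where
    open FieldArithmetic
    open LacunaryPolynomials
    open Duality

    -- This is q / p.
    Q : ℕ
    Q = p ^ℕ k

    q≡p*Q : q ≡ p *ℕ Q
    q≡p*Q = q≡p^k

    2Q≤q : Q +ℕ Q ≤ q
    2Q≤q = ℕₚ.≤-trans (ℕₚ.≤-reflexive (cong (Q +ℕ_) (sym (ℕₚ.+-identityʳ Q)))) (ℕₚ.≤-trans (ℕₚ.*-monoˡ-≤ Q (nonTrivial⇒n>1 p {{prime⇒nonTrivial pp}})) (ℕₚ.≤-reflexive (sym q≡p*Q)))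

    ∑-group : (h f : Carrier → Carrier) (ms : List Carrier) → ∑ (λ m → h (f m)) ms ≡ ∑ (λ u → (count f ms u · 1#) * h u) el
    ∑-group h f [] = sym (FΣ.big-ε el (λ _ → zeroˡ _))
    ∑-group h f (m ∷ ms) = trans (cong₂ _+_ (sym first) (∑-group h f ms)) (trans (sym (FΣ.big-∙ _ _ el)) (FΣ.big-cong el step))
      where
      first : ∑ (λ u → FΣ.guard (f m ≟ u) (h u)) el ≡ h (f m)
      first = trans (FΣ.big-single _ el-unique (el-complete (f m)) off) diag
        where
        off : ∀ {u} → u ∈ el → u ≢ f m → FΣ.guard (f m ≟ u) (h u) ≡ 0#
        off {u} _ ne with f m ≟ u
        ... | yes e = ⊥-elim (ne (sym e))
        ... | no _ = refl
        diag : FΣ.guard (f m ≟ f m) (h (f m)) ≡ h (f m)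
        diag with f m ≟ f m
        ... | yes _ = refl
        ... | no ne = ⊥-elim (ne refl)
      step : ∀ u → FΣ.guard (f m ≟ u) (h u) + (count f ms u · 1#) * h u ≡ (count f (m ∷ ms) u · 1#) * h u
      step u with f m ≟ u
      ... | yes _ = sym (trans (distribʳ _ _ _) (cong (_+ (count f ms u · 1#) * h u) (*-identityˡ _)))
      ... | no _ = +-identityˡ _

    -- Every term occurs q times, and q is zero in the field.
    equidistributed-∑ : (h f : Carrier → Carrier) → (∀ {m} → ¬ Real m → InD (f m)) → (∀ {u} → InD u → cnt f u ≡ q) → ∑ (λ m → h (f m)) Ml ≡ 0#
    equidistributed-∑ h f fd eq = trans (∑-group h f Ml) (FΣ.big-ε el (λ {u} _ → go u (inD? u)))
      where
      go : ∀ u → Dec (InD u) → (cnt f u · 1#) * h u ≡ 0#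
      go u (yes d) = trans (cong (λ n → (n · 1#) * h u) (eq d)) (trans (cong (_* h u) q·1≡0) (zeroˡ _))
      go u (no nd) = trans (cong (λ n → (n · 1#) * h u) (count-none (λ m → f m ≟ u) Ml (λ m∈ e → nd (subst InD e (fd (Ml∈ m∈)))))) (zeroˡ _)

    bar-∑ : {X : Set} (f : X → Carrier) (xs : List X) → bar (∑ f xs) ≡ ∑ (λ x → bar (f x)) xs
    bar-∑ f [] = bar-0
    bar-∑ f (x ∷ xs) = trans (bar-+ _ _) (cong (bar (f x) +_) (bar-∑ f xs))

    bzi : Carrier → Carrier
    bzi z = bar (z ⁻¹)

    bar-bzi : ∀ {z} → z ≢ 0# → bar z * bzi z ≡ 1#
    bar-bzi {z} ne = trans (sym (bar-* z (z ⁻¹))) (trans (cong bar (inv-r ne)) bar-1)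

    pow-cancel : ∀ x y n → x * y ≡ 1# → x ^ n * y ^ n ≡ 1#
    pow-cancel x y n e = trans (sym (^-distrib-* x y n)) (trans (cong (_^ n) e) (1^ n))

    Nm-q-1 : ∀ {z} → z ≢ 0# → z ^ q-1 * bar z ^ q-1 ≡ 1#
    Nm-q-1 {z} ne = trans (sym (^-distrib-* z (bar z) q-1)) (Nm-InD ne)

    -- The Fourier coefficient at the character z^(e₁ + q e₂), with the exponent split into its two
    -- digits in base q because divisibility by p matters for both digits.
    Tm : (Carrier → Carrier) → ℕ → ℕ → Carrier
    Tm G e₁ e₂ = ∑ (λ z → G z * ((z ⁻¹) ^ e₁ * bzi z ^ e₂)) nz

    neg-pow : ∀ {z} → z ≢ 0# → ∀ {l₁ l₂ e₁ e₂} → l₁ +ℕ e₁ ≡ q-1 → l₂ +ℕ e₂ ≡ q-1 → z ^ l₁ * bar z ^ l₂ ≡ (z ⁻¹) ^ e₁ * bzi z ^ e₂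
    neg-pow {z} ne {l₁} {l₂} {e₁} {e₂} a b = *-cancelˡ (*-≢0 (^-≢0 e₁ ne) (^-≢0 e₂ (bar-≢0 ne))) (trans
      (trans (solve 4 (λ x y u w → (x :* y) :* (u :* w) := (u :* x) :* (w :* y)) refl (z ^ e₁) (bar z ^ e₂) (z ^ l₁) (bar z ^ l₂))
        (trans (cong₂ _*_ (trans (sym (^-homo-* z l₁ e₁)) (cong (z ^_) a)) (trans (sym (^-homo-* (bar z) l₂ e₂)) (cong (bar z ^_) b))) (Nm-q-1 ne)))
      (sym (trans (solve 4 (λ x y u w → (x :* y) :* (u :* w) := (x :* u) :* (y :* w)) refl (z ^ e₁) (bar z ^ e₂) ((z ⁻¹) ^ e₁) (bzi z ^ e₂))
        (trans (cong₂ _*_ (pow-cancel z (z ⁻¹) e₁ (inv-r ne)) (pow-cancel (bar z) (bzi z) e₂ (bar-bzi ne))) (*-identityˡ 1#)))))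

    record Sparse (G : Carrier → Carrier) : Set where
      field
        G-real : ∀ {z} → Real z → G z ≡ 0#
        G-bar : ∀ z → bar (G z) ≡ G z
        sum-0 : Tm G 0 0 ≡ 0#
        vanish : ∀ {e₁ e₂} → 1 ≤ e₁ → e₁ < q → 1 ≤ e₂ → e₂ < q → e₁ · 1# ≢ 0# ⊎ e₂ · 1# ≢ 0# → Tm G e₁ e₂ ≡ 0#

    bar-Tm : ∀ G → (∀ z → bar (G z) ≡ G z) → ∀ e₁ e₂ → bar (Tm G e₁ e₂) ≡ Tm G e₂ e₁
    bar-Tm G h e₁ e₂ = trans (bar-∑ _ nz) (FΣ.big-cong nz (λ z → trans (bar-* _ _) (cong₂ _*_ (h z) (trans (bar-* _ _) (trans (cong₂ _*_ (bar-^ (z ⁻¹) e₁) (trans (bar-^ (bzi z) e₂) (cong (_^ e₂) (bar-bar (z ⁻¹))))) (*-comm _ _))))))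

    module _ (1≤r : 1 ≤ r) {c v : Carrier → Carrier} (H : Hyp c v) where
      private
        module A = Lacunary 1≤r H
        module B = Hyp (Dualise.dual H)
      open A using (V; V-real; V-nonreal)
      open Hyp H

      private
        inv-inv : ∀ {x} → x ≢ 0# → (x ⁻¹) ⁻¹ ≡ x
        inv-inv ne = sym (inv-unique (inv-l ne))

        V-nz : ∀ (h : Carrier → Carrier) → ∑ (λ z → V z * h z) nz ≡ ∑ (λ z → v z * h z) Ml
        V-nz h = trans (sym (∑el-0 (λ z → V z * h z) (trans (cong (_* h 0#) (V-real bar-0)) (zeroˡ _))))
          (sym (trans (FΣ.big-filter nonreal? (λ z → v z * h z) el) (FΣ.big-cong el g)))
          where
          g : ∀ z → FΣ.guard (nonreal? z) (v z * h z) ≡ V z * h z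
          g z with real? z
          ... | yes _ = sym (zeroˡ _)
          ... | no _ = refl

        -- This index is just beyond the bound in `moment`. The terms v(z) / N(z) are the inverses
        -- of v(z)⁻¹ N(z - 0), whose values are equidistributed by the dual counts at the real point
        -- 0.
        one-one : Tm V 1 1 ≡ 0#
        one-one = trans (V-nz (λ z → (z ⁻¹) ^ 1 * bzi z ^ 1)) (trans (FΣ.big-cong∈ Ml (λ {z} m∈ → sym (step (Ml∈ m∈))))
          (equidistributed-∑ _⁻¹ (λ z → v z ⁻¹ * Nm (z - 0#)) (λ {z} nr → InD-* (InD-inv (v-D nr)) (Nm-InD (λ e → nonreal-≢0 nr (x-y≡0 e)))) (λ d → B.at-real bar-0 d)))
          where
          step : ∀ {z} → ¬ Real z → (v z ⁻¹ * Nm (z - 0#)) ⁻¹ ≡ v z * ((z ⁻¹) ^ 1 * bzi z ^ 1)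
          step {z} nr = sym (inv-unique (begin
            (v z ⁻¹ * Nm (z - 0#)) * (v z * ((z ⁻¹) ^ 1 * bzi z ^ 1)) ≡⟨ cong (λ t → (v z ⁻¹ * Nm t) * (v z * ((z ⁻¹) ^ 1 * bzi z ^ 1))) (solve 1 (λ z → z :- :0 := z) refl z) ⟩
            (v z ⁻¹ * (z * bar z)) * (v z * ((z ⁻¹) ^ 1 * bzi z ^ 1)) ≡⟨ solve 6 (λ vi z b v zi bi → (vi :* (z :* b)) :* (v :* ((zi :* :1) :* (bi :* :1))) := (vi :* v) :* ((z :* zi) :* (b :* bi))) refl (v z ⁻¹) z (bar z) (v z) (z ⁻¹) (bzi z) ⟩
            (v z ⁻¹ * v z) * ((z * z ⁻¹) * (bar z * bzi z)) ≡⟨ cong₂ _*_ (inv-l (InD-≢0 (v-D nr))) (cong₂ _*_ (inv-r (nonreal-≢0 nr)) (bar-bzi (nonreal-≢0 nr))) ⟩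
            1# * (1# * 1#) ≡⟨ solve 0 (:1 :* (:1 :* :1) := :1) refl ⟩
            1# ∎))
            where open ≡-Reasoning

        V-bar : ∀ z → bar (V z) ≡ V z
        V-bar z with real? z
        ... | yes _ = bar-0
        ... | no nr = InD-real (v-D nr)

        -- As N(z)^(q-1) = 1, the negative exponents can be replaced by l = q - 1 - e. The factor l₁
        -- + 1 = q - e₁ of `moment` is then nonzero in the field because e₁ is.
        van₁ : ∀ {e₁ e₂} → 1 ≤ e₁ → e₁ < q → 1 ≤ e₂ → e₂ < q → e₁ · 1# ≢ 0# → Tm V e₁ e₂ ≡ 0#
        van₁ {suc e₁} {suc e₂} _ (s≤s (s≤s a)) _ (s≤s (s≤s b)) ne with ℕₚ.m≤n⇒∃[o]m+o≡n a | ℕₚ.m≤n⇒∃[o]m+o≡n b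
        ... | l₁ , a' | l₂ , b' = go (ℕₚ.m≤n⇒m<n∨m≡n l₁≤) (ℕₚ.m≤n⇒m<n∨m≡n l₂≤)
          where
          sa : l₁ +ℕ suc e₁ ≡ q-1
          sa = trans (ℕₚ.+-suc l₁ e₁) (cong suc (trans (ℕₚ.+-comm l₁ e₁) a'))
          sb : l₂ +ℕ suc e₂ ≡ q-1
          sb = trans (ℕₚ.+-suc l₂ e₂) (cong suc (trans (ℕₚ.+-comm l₂ e₂) b'))
          l₁≤ : l₁ ≤ r
          l₁≤ = ℕₚ.≤-trans (ℕₚ.m≤n+m l₁ e₁) (ℕₚ.≤-reflexive a')
          l₂≤ : l₂ ≤ r
          l₂≤ = ℕₚ.≤-trans (ℕₚ.m≤n+m l₂ e₂) (ℕₚ.≤-reflexive b')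
          char : suc l₁ · 1# ≢ 0#
          char e = ne (trans (sym (+-identityˡ _)) (trans (cong (_+ (suc e₁ · 1#)) (sym e)) (trans (sym (·-homo-+ 1# (suc l₁) (suc e₁))) (trans (cong (λ n → suc n · 1#) sa) q·1≡0))))
          use : l₁ +ℕ q *ℕ l₂ < r +ℕ q *ℕ r → Tm V (suc e₁) (suc e₂) ≡ 0#
          use lt = trans (FΣ.big-cong∈ nz (λ {z} m∈ → cong (V z *_) (sym (neg-pow (nz∈ m∈) {l₁} {l₂} {suc e₁} {suc e₂} sa sb)))) (trans (sym (∑el-0 (λ z → V z * (z ^ l₁ * bar z ^ l₂)) (trans (cong (_* (0# ^ l₁ * bar 0# ^ l₂)) (V-real bar-0)) (zeroˡ _)))) (domain (A.moment l₁ l₂ lt) char))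
          go : l₁ < r ⊎ l₁ ≡ r → l₂ < r ⊎ l₂ ≡ r → Tm V (suc e₁) (suc e₂) ≡ 0#
          go (inj₁ x) _ = use (ℕₚ.+-mono-<-≤ x (ℕₚ.*-monoʳ-≤ q l₂≤))
          go (inj₂ _) (inj₁ y) = use (ℕₚ.+-mono-≤-< l₁≤ (ℕₚ.*-monoʳ-< q y))
          go (inj₂ x) (inj₂ y) = subst (λ e → Tm V (suc e) (suc e₂) ≡ 0#) (sym (zero-of a' x)) (subst (λ e → Tm V 1 (suc e) ≡ 0#) (sym (zero-of b' y)) one-one)
            where
            zero-of : ∀ {e l} → e +ℕ l ≡ r → l ≡ r → e ≡ 0
            zero-of {e} {l} s t = ℕₚ.+-cancelʳ-≡ l e 0 (trans s (sym t))

      -- V has values in GF(q), so conjugation exchanges the two exponents and one of them can be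
      -- assumed prime to p. The mean value is that of the inverses of 1/v, equidistributed by
      -- duality.
      sparse : Sparse V
      sparse = record
        { G-real = V-real
        ; G-bar = V-bar
        ; sum-0 = trans (FΣ.big-cong nz (λ z → cong (V z *_) refl)) (trans (V-nz (λ z → (z ⁻¹) ^ 0 * bzi z ^ 0)) (trans (FΣ.big-cong∈ Ml (λ {z} m∈ → trans (solve 1 (λ x → x :* (:1 :* :1) := x) refl (v z)) (sym (inv-inv (InD-≢0 (v-D (Ml∈ m∈))))))) (equidistributed-∑ _⁻¹ (λ z → v z ⁻¹) (λ nr → InD-inv (v-D nr)) B.at-∞)))
        ; vanish = λ { a b c d (inj₁ ne) → van₁ a b c d ne
                     ; {e₁} {e₂} a b c d (inj₂ ne) → bar-inj (trans (bar-Tm V V-bar e₁ e₂) (trans (van₁ c d a b ne) (sym bar-0))) } }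

    -- Fourier inversion and the pairing of two sparse functions

    private
      -1≢0 : - 1# ≢ 0#
      -1≢0 = neg≢0 1≢0

      tele : ∀ ρ n → (ρ - 1#) * sumTo n (λ e → ρ ^ e) ≡ ρ ^ suc n - 1#
      tele ρ zero = solve 1 (λ a → (a :- :1) :* :1 := a :* :1 :- :1) refl ρ
      tele ρ (suc n) = trans (distribˡ _ _ _) (trans (cong (_+ (ρ - 1#) * ρ ^ suc n) (tele ρ n)) (solve 2 (λ a b → (b :- :1) :+ (a :- :1) :* b := a :* b :- :1) refl ρ (ρ ^ suc n)))

      ones : ∀ n → sumTo n (λ e → 1# ^ e) ≡ suc n · 1#
      ones zero = sym (+-identityʳ 1#)
      ones (suc n) = trans (cong₂ _+_ (ones n) (1^ (suc n))) (+-comm _ _)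

      sumTo-*ʳ : ∀ n (s : ℕ → Carrier) a → sumTo n s * a ≡ sumTo n (λ j → s j * a)
      sumTo-*ʳ zero s a = refl
      sumTo-*ʳ (suc n) s a = trans (distribʳ _ _ _) (cong (_+ s (suc n) * a) (sumTo-*ʳ n s a))

      sumTo-single : ∀ n (s : ℕ → Carrier) {j} → j ≤ n → (∀ i → i ≤ n → i ≢ j → s i ≡ 0#) → sumTo n s ≡ s j
      sumTo-single zero s z≤n h = refl
      sumTo-single (suc n) s {j} le h with ℕₚ.m≤n⇒m<n∨m≡n le
      ... | inj₁ (s≤s lt) = trans (cong₂ _+_ (sumTo-single n s lt (λ i l → h i (ℕₚ.m≤n⇒m≤1+n l))) (h (suc n) ℕₚ.≤-refl (λ { refl → ℕₚ.<-irrefl refl (s≤s lt) }))) (+-identityʳ _)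
      ... | inj₂ refl = trans (cong (_+ s (suc n)) (trans (sumTo-top n s (λ i l → h i (ℕₚ.m≤n⇒m≤1+n (ℕₚ.<⇒≤ l)) (λ { refl → ℕₚ.<-irrefl refl (ℕₚ.m≤n⇒m≤1+n l) }))) (h n (ℕₚ.n≤1+n n) (λ ())))) (+-identityˡ _)

      sumTo-0 : ∀ n (s : ℕ → Carrier) → (∀ i → i ≤ n → s i ≡ 0#) → sumTo n s ≡ 0#
      sumTo-0 zero s h = h 0 z≤n
      sumTo-0 (suc n) s h = trans (cong₂ _+_ (sumTo-0 n s (λ i l → h i (ℕₚ.m≤n⇒m≤1+n l))) (h (suc n) ℕₚ.≤-refl)) (+-identityʳ 0#)

      Gs : Carrier → Carrier
      Gs ρ = sumTo q-1 (λ e → ρ ^ e)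

      -- Gs ρ is (ρ̄ - 1) / (ρ - 1), and conjugation inverts this quotient.
      Gs-bar : ∀ {ρ} → ρ ≢ 1# → Gs ρ * Gs (bar ρ) ≡ 1#
      Gs-bar {ρ} ne = *-cancelˡ (*-≢0 n1 n2) (trans (solve 4 (λ a b s t → (a :* b) :* (s :* t) := (a :* s) :* (b :* t)) refl (ρ - 1#) (bar ρ - 1#) (Gs ρ) (Gs (bar ρ)))
          (trans (cong₂ _*_ (tele ρ q-1) (trans (tele (bar ρ) q-1) (cong (_- 1#) (bar-bar ρ)))) (solve 2 (λ a b → b :* a := (a :* b) :* :1) refl (ρ - 1#) (bar ρ - 1#))))
        where
        n1 : ρ - 1# ≢ 0#
        n1 = x≢y⇒x-y≢0 ne
        n2 : bar ρ - 1# ≢ 0#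
        n2 = x≢y⇒x-y≢0 (λ e → ne (bar-inj (trans e (sym bar-1))))

      Gs-1 : Gs 1# ≡ 0#
      Gs-1 = trans (ones q-1) q·1≡0

    module Invert {G : Carrier → Carrier} (S : Sparse G) where
      open Sparse S

      -- The double sum runs over q² exponent pairs for q² - 1 characters: (0, 0) and (q - 1, q - 1)
      -- give the same one. The surplus is the mean value, which vanishes.
      inversion : ∀ {z} → z ≢ 0# → G z ≡ - sumTo q-1 (λ e₁ → sumTo q-1 (λ e₂ → Tm G e₁ e₂ * (z ^ e₁ * bar z ^ e₂)))
      inversion {z} ne = sym (trans (cong -_ expand) (trans (cong -_ (FΣ.big-cong∈ nz term)) (begin
          - ∑ (λ x → G x * ((x ⁻¹) ^ 0 * bzi x ^ 0) + - FΣ.guard (x ≟ z) (G x)) nz ≡⟨ cong -_ (FΣ.big-∙ _ _ nz) ⟩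
          - (Tm G 0 0 + ∑ (λ x → - FΣ.guard (x ≟ z) (G x)) nz) ≡⟨ cong₂ (λ a b → - (a + b)) sum-0 (trans (sym (∑-neg _ nz)) (cong -_ single)) ⟩
          - (0# + - G z) ≡⟨ solve 1 (λ g → :- (:0 :+ :- g) := g) refl (G z) ⟩
          G z ∎)))
        where
        open ≡-Reasoning
        expand : sumTo q-1 (λ e₁ → sumTo q-1 (λ e₂ → Tm G e₁ e₂ * (z ^ e₁ * bar z ^ e₂))) ≡ ∑ (λ x → G x * (Gs (x ⁻¹ * z) * Gs (bar (x ⁻¹ * z)))) nz
        expand = trans (sumTo-cong q-1 (λ e₁ → trans (sumTo-cong q-1 (λ e₂ → ∑-*ʳ (z ^ e₁ * bar z ^ e₂) (λ x → G x * ((x ⁻¹) ^ e₁ * bzi x ^ e₂)) nz)) (sumTo-∑ q-1 (λ e₂ x → (G x * ((x ⁻¹) ^ e₁ * bzi x ^ e₂)) * (z ^ e₁ * bar z ^ e₂)) nz)))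
          (trans (sumTo-∑ q-1 (λ e₁ x → sumTo q-1 (λ e₂ → (G x * ((x ⁻¹) ^ e₁ * bzi x ^ e₂)) * (z ^ e₁ * bar z ^ e₂))) nz) (FΣ.big-cong nz fac))
          where
          fac : ∀ x → sumTo q-1 (λ e₁ → sumTo q-1 (λ e₂ → (G x * ((x ⁻¹) ^ e₁ * bzi x ^ e₂)) * (z ^ e₁ * bar z ^ e₂))) ≡ G x * (Gs (x ⁻¹ * z) * Gs (bar (x ⁻¹ * z)))
          fac x = trans (sumTo-cong q-1 (λ e₁ → trans (sumTo-cong q-1 (λ e₂ → trans (solve 5 (λ g a b d e → (g :* (a :* b)) :* (d :* e) := (g :* (a :* d)) :* (b :* e)) refl (G x) ((x ⁻¹) ^ e₁) (bzi x ^ e₂) (z ^ e₁) (bar z ^ e₂))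
                (cong₂ (λ s t → (G x * s) * t) (sym (^-distrib-* (x ⁻¹) z e₁)) (trans (sym (^-distrib-* (bzi x) (bar z) e₂)) (cong (_^ e₂) (sym (bar-* (x ⁻¹) z))))))) (sumTo-* q-1 (G x * (x ⁻¹ * z) ^ e₁) (λ e₂ → bar (x ⁻¹ * z) ^ e₂))))
            (trans (sym (sumTo-*ʳ q-1 (λ e₁ → G x * (x ⁻¹ * z) ^ e₁) (Gs (bar (x ⁻¹ * z))))) (trans (cong (_* Gs (bar (x ⁻¹ * z))) (sumTo-* q-1 (G x) (λ e₁ → (x ⁻¹ * z) ^ e₁))) (*-assoc _ _ _)))
        term : ∀ {x} → x ∈ nz → G x * (Gs (x ⁻¹ * z) * Gs (bar (x ⁻¹ * z))) ≡ G x * ((x ⁻¹) ^ 0 * bzi x ^ 0) + - FΣ.guard (x ≟ z) (G x)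
        term {x} x∈ with x ≟ z
        ... | yes refl = trans (cong (λ t → G x * (Gs t * Gs (bar t))) (inv-l (nz∈ x∈))) (trans (cong (λ t → G x * (t * Gs (bar 1#))) Gs-1) (solve 2 (λ g y → g :* (:0 :* y) := g :* (:1 :* :1) :+ :- g) refl (G x) (Gs (bar 1#))))
        ... | no nx = trans (cong (G x *_) (Gs-bar {x ⁻¹ * z} (λ e → nx (sym (*-cancelˡ (inv≢0 (nz∈ x∈)) (trans e (sym (inv-l (nz∈ x∈))))))))) (solve 1 (λ g → g :* :1 := g :* (:1 :* :1) :+ :- :0) refl (G x))
        single : ∑ (λ x → FΣ.guard (x ≟ z) (G x)) nz ≡ G z
        single = trans (FΣ.big-single _ nz-unique (∈nz ne) off) diag
          where
          off : ∀ {u} → u ∈ nz → u ≢ z → FΣ.guard (u ≟ z) (G u) ≡ 0#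
          off {u} _ nu with u ≟ z
          ... | yes e = ⊥-elim (nu e)
          ... | no _ = refl
          diag : FΣ.guard (z ≟ z) (G z) ≡ G z
          diag with z ≟ z
          ... | yes _ = refl
          ... | no nn = ⊥-elim (nn refl)

    module Pair {V W : Carrier → Carrier} (SV : Sparse V) (SW : Sparse W)
      (VW : ∀ z → V (bar z) * W z ≡ - ((z - bar z) * (z - bar z))) where

      private
        module SV = Sparse SV
        module SW = Sparse SW

        -- What meets `Tm V e₁ e₂` when V(z̄) W(z) is weighted by z^(-2). With this weight the
        -- product becomes - (1 - z̄/z)², whose constant term survives summation.
        U : ℕ → ℕ → Carrier
        U e₁ e₂ = ∑ (λ z → W z * ((bar z ^ e₁ * z ^ e₂) * (z ⁻¹ * z ⁻¹))) nz

        U-shift : ∀ {e₁ e₂ e₁' e₂'} → e₂ +ℕ e₁' ≡ q+1 → e₁ +ℕ e₂' ≡ q-1 → U e₁ e₂ ≡ Tm W e₁' e₂'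
        U-shift {e₁} {e₂} {e₁'} {e₂'} a b = FΣ.big-cong∈ nz (λ {z} m∈ → cong (W z *_) (pt (nz∈ m∈)))
          where
          pt : ∀ {z} → z ≢ 0# → (bar z ^ e₁ * z ^ e₂) * (z ⁻¹ * z ⁻¹) ≡ (z ⁻¹) ^ e₁' * bzi z ^ e₂'
          pt {z} ne = *-cancelˡ (*-≢0 (^-≢0 e₁' ne) (^-≢0 e₂' (bar-≢0 ne))) (trans
            (trans (solve 6 (λ x y i u w _ → (x :* y) :* ((u :* w) :* (i :* i)) := ((w :* x) :* (i :* i)) :* (u :* y)) refl (z ^ e₁') (bar z ^ e₂') (z ⁻¹) (bar z ^ e₁) (z ^ e₂) 0#)
              (trans (cong₂ (λ s t → (s * (z ⁻¹ * z ⁻¹)) * t) (trans (sym (^-homo-* z e₂ e₁')) (cong (z ^_) a)) (trans (sym (^-homo-* (bar z) e₁ e₂')) (cong (bar z ^_) b)))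
              (trans (cong (_* bar z ^ q-1) (trans (solve 3 (λ z y i → (z :* (z :* y)) :* (i :* i) := ((z :* i) :* (z :* i)) :* y) refl z (z ^ q-1) (z ⁻¹)) (trans (cong (λ t → (t * t) * z ^ q-1) (inv-r ne)) (solve 1 (λ y → (:1 :* :1) :* y := y) refl (z ^ q-1))))) (Nm-q-1 ne))))
            (sym (trans (solve 4 (λ x y u w → (x :* y) :* (u :* w) := (x :* u) :* (y :* w)) refl (z ^ e₁') (bar z ^ e₂') ((z ⁻¹) ^ e₁') (bzi z ^ e₂'))
              (trans (cong₂ _*_ (pow-cancel z (z ⁻¹) e₁' (inv-r ne)) (pow-cancel (bar z) (bzi z) e₂' (bar-bzi ne))) (*-identityˡ 1#)))))

        U-01 : U 0 1 ≡ Tm W 1 0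
        U-01 = FΣ.big-cong∈ nz (λ {z} m∈ → cong (W z *_) (trans (solve 2 (λ z i → (:1 :* (z :* :1)) :* (i :* i) := (z :* i) :* i) refl z (z ⁻¹)) (trans (cong (_* z ⁻¹) (inv-r (nz∈ m∈))) (solve 1 (λ i → :1 :* i := (i :* :1) :* :1) refl (z ⁻¹)))))

        -- One factor z^(-1) is rewritten as z̄^(-q), which brings both exponents into the range
        -- covered by `vanish`.
        U-e0 : ∀ e → suc e < q → U (suc e) 0 ≡ 0#
        U-e0 e (s≤s (s≤s lt)) with ℕₚ.m≤n⇒∃[o]m+o≡n lt
        ... | o , oe = trans (FΣ.big-cong∈ nz (λ {z} m∈ → cong (W z *_) (pt (nz∈ m∈)))) (SW.vanish {1} {suc o} (s≤s z≤n) (s≤s (s≤s z≤n)) (s≤s z≤n) (s≤s (s≤s (ℕₚ.≤-trans (ℕₚ.m≤n+m o e) (ℕₚ.≤-reflexive oe)))) (inj₁ (λ e → 1≢0 (trans (sym (+-identityʳ 1#)) e))))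
          where
          sum : suc e +ℕ suc o ≡ q
          sum = cong suc (trans (ℕₚ.+-suc e o) (cong suc oe))
          pt : ∀ {z} → z ≢ 0# → (bar z ^ suc e * z ^ 0) * (z ⁻¹ * z ⁻¹) ≡ (z ⁻¹) ^ 1 * bzi z ^ suc o
          pt {z} ne = *-cancelˡ (^-≢0 (suc o) (bar-≢0 ne)) (trans
            (trans (solve 3 (λ y x i → y :* ((x :* :1) :* (i :* i)) := (x :* y) :* (i :* i)) refl (bar z ^ suc o) (bar z ^ suc e) (z ⁻¹)) (trans (cong (_* (z ⁻¹ * z ⁻¹)) (trans (sym (^-homo-* (bar z) (suc e) (suc o))) (trans (cong (bar z ^_) sum) (bar-bar z)))) (trans (sym (*-assoc _ _ _)) (trans (cong (_* z ⁻¹) (inv-r ne)) (*-identityˡ _)))))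
            (sym (trans (solve 3 (λ y i w → y :* ((i :* :1) :* w) := i :* (y :* w)) refl (bar z ^ suc o) (z ⁻¹) (bzi z ^ suc o)) (trans (cong (z ⁻¹ *_) (pow-cancel (bar z) (bzi z) (suc o) (bar-bzi ne))) (*-identityʳ _)))))

        one : ∀ n → n · 1# ≡ 0# → suc n · 1# ≢ 0#
        one n e e' = 1≢0 (trans (sym (+-identityʳ 1#)) (trans (cong (1# +_) (sym e)) e'))

        -- If p does not divide both positive exponents, V contributes zero. If it does, the first
        -- exponent q + 1 - e₂ at W is 1 modulo p, so W contributes zero. On the borders, W has
        -- second exponent q - 1 for e₁ = 0 and first exponent 1 for e₂ = 0, and (0, 0) is the mean
        -- value of V.
        term-0 : ∀ e₁ e₂ → e₁ ≤ q-1 → e₂ ≤ q-1 → ¬ (e₁ ≡ 0 × e₂ ≡ 1) → Tm V e₁ e₂ * U e₁ e₂ ≡ 0#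
        term-0 zero zero _ _ _ = trans (cong (_* U 0 0) SV.sum-0) (zeroˡ _)
        term-0 zero (suc zero) _ _ nn = ⊥-elim (nn (refl , refl))
        term-0 zero (suc (suc e)) _ (s≤s le) _ with ℕₚ.m≤n⇒∃[o]m+o≡n le
        ... | o , oe = trans (cong (Tm V 0 (suc (suc e)) *_) (trans (U-shift {0} {suc (suc e)} {suc (suc o)} {q-1} (cong suc (cong suc (trans (ℕₚ.+-suc e (suc o)) (cong suc (trans (ℕₚ.+-suc e o) oe))) )) refl)
            (SW.vanish (s≤s z≤n) (s≤s (s≤s (ℕₚ.≤-trans (s≤s (ℕₚ.m≤n+m o e)) (ℕₚ.≤-reflexive oe)))) (s≤s z≤n) ℕₚ.≤-refl (inj₂ (λ z → -1≢0 (trans (sym q-1·1) z)))))) (zeroʳ _)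
        term-0 (suc e₁) zero a _ _ = trans (cong (Tm V (suc e₁) 0 *_) (U-e0 e₁ (s≤s a))) (zeroʳ _)
        term-0 (suc e₁) (suc e₂) a b _ with (suc e₁ · 1#) ≟ 0# | (suc e₂ · 1#) ≟ 0#
        ... | no n1 | _ = trans (cong (_* U (suc e₁) (suc e₂)) (SV.vanish (s≤s z≤n) (s≤s a) (s≤s z≤n) (s≤s b) (inj₁ n1))) (zeroˡ _)
        ... | yes _ | no n2 = trans (cong (_* U (suc e₁) (suc e₂)) (SV.vanish (s≤s z≤n) (s≤s a) (s≤s z≤n) (s≤s b) (inj₂ n2))) (zeroˡ _)
        term-0 (suc e₁) (suc zero) a b _ | yes _ | yes z2 = ⊥-elim (1≢0 (trans (sym (+-identityʳ 1#)) z2))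
        term-0 (suc e₁) (suc (suc e₂)) (s≤s a) (s≤s b) _ | yes z1 | yes z2 with ℕₚ.m≤n⇒∃[o]m+o≡n a | ℕₚ.m≤n⇒∃[o]m+o≡n b
        ... | o₁ , oe₁ | o₂ , oe₂ = trans (cong (Tm V (suc e₁) (suc (suc e₂)) *_) (trans (U-shift {suc e₁} {suc (suc e₂)} {suc (suc o₂)} {o₁} s2 (cong suc oe₁))
            (SW.vanish (s≤s z≤n) (s≤s (s≤s (ℕₚ.≤-trans (s≤s (ℕₚ.m≤n+m o₂ e₂)) (ℕₚ.≤-reflexive oe₂)))) (pos o₁ oe₁) (s≤s (ℕₚ.m≤n⇒m≤1+n (ℕₚ.≤-trans (ℕₚ.m≤n+m o₁ e₁) (ℕₚ.≤-reflexive oe₁)))) (inj₁ nz2)))) (zeroʳ _)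
          where
          s2 : suc (suc e₂) +ℕ suc (suc o₂) ≡ q+1
          s2 = cong suc (cong suc (trans (ℕₚ.+-suc e₂ (suc o₂)) (cong suc (trans (ℕₚ.+-suc e₂ o₂) oe₂))))
          pos : ∀ o → e₁ +ℕ o ≡ r → 1 ≤ o
          pos zero e = ⊥-elim (-1≢0 (trans (sym q-1·1) (trans (cong (λ n → suc n · 1#) (trans (sym e) (ℕₚ.+-identityʳ e₁))) z1)))
          pos (suc o) e = s≤s z≤n
          nz2 : suc (suc o₂) · 1# ≢ 0#
          nz2 e = one q q·1≡0 (trans (cong (_· 1#) (sym s2)) (trans (·-homo-+ 1# (suc (suc e₂)) (suc (suc o₂))) (trans (cong₂ _+_ z2 e) (+-identityʳ 0#))))

        -- - (1 - z^(q-1))² expands into powers with exponents below q² - 1, of which only the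
        -- constant -1 has a nonzero sum, namely - (q² - 1) = 1.
        lhs : ∑ (λ z → (V (bar z) * W z) * (z ⁻¹ * z ⁻¹)) nz ≡ 1#
        lhs = begin
          ∑ (λ z → (V (bar z) * W z) * (z ⁻¹ * z ⁻¹)) nz ≡⟨ FΣ.big-cong∈ nz (λ {z} m∈ → pt (nz∈ m∈)) ⟩
          ∑ (λ z → - (z ^ 0) + ((1# + 1#) * z ^ q-1 + - 1# * z ^ (q-1 +ℕ q-1))) nz ≡⟨ trans (FΣ.big-∙ _ _ nz) (cong (∑ (λ z → - (z ^ 0)) nz +_) (FΣ.big-∙ _ _ nz)) ⟩
          ∑ (λ z → - (z ^ 0)) nz + (∑ (λ z → (1# + 1#) * z ^ q-1) nz + ∑ (λ z → - 1# * z ^ (q-1 +ℕ q-1)) nz) ≡⟨ cong₂ _+_ s0 (cong₂ _+_ (sk (1# + 1#) q-1 (s≤s z≤n) (ℕₚ.≤-trans (ℕₚ.m≤m+n q q-1) lt2)) (sk (- 1#) (q-1 +ℕ q-1) (s≤s z≤n) lt2)) ⟩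
          1# + (0# + 0#) ≡⟨ solve 0 (:1 :+ (:0 :+ :0) := :1) refl ⟩
          1# ∎
          where
          open ≡-Reasoning
          lt2 : q-1 +ℕ q-1 < q²-1
          lt2 = subst (q-1 +ℕ q-1 <_) (sym q²-1-def) (ℕₚ.≤-trans (ℕₚ.≤-reflexive (cong suc (trans (cong (q-1 +ℕ_) (sym (ℕₚ.+-identityʳ q-1))) (ℕₚ.*-comm 2 q-1)))) (ℕₚ.*-monoʳ-< q-1 {2} {q+1} (s≤s (s≤s (s≤s z≤n)))))
          pt : ∀ {z} → z ≢ 0# → (V (bar z) * W z) * (z ⁻¹ * z ⁻¹) ≡ - (z ^ 0) + ((1# + 1#) * z ^ q-1 + - 1# * z ^ (q-1 +ℕ q-1))
          pt {z} ne = trans (cong (_* (z ⁻¹ * z ⁻¹)) (VW z)) (trans (solve 3 (λ z y i → :- ((z :- z :* y) :* (z :- z :* y)) :* (i :* i) := ((z :* i) :* (z :* i)) :* (:- :1 :+ ((:1 :+ :1) :* y :+ (:- :1) :* (y :* y)))) refl z (z ^ q-1) (z ⁻¹))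
            (trans (cong₂ (λ s t → (s * s) * (- 1# + ((1# + 1#) * z ^ q-1 + - 1# * t))) (inv-r ne) (sym (^-homo-* z q-1 q-1))) (solve 1 (λ x → (:1 :* :1) :* x := x) refl _)))
          s0 : ∑ (λ z → - (z ^ 0)) nz ≡ 1#
          s0 = trans (sym (∑-neg (_^ 0) nz)) (trans (cong -_ (trans (∑-const 1# nz) (trans (*-identityʳ _) (trans (cong (_· 1#) nz-length) (x-y≡0 (trans (solve 1 (λ n → n :- (:- :1) := :1 :+ n) refl (q²-1 · 1#)) (trans (cong (_· 1#) (sym q²≡)) q²·1≡0))))))) (solve 0 (:- (:- :1) := :1) refl))
          sk : ∀ a i → 1 ≤ i → i < q²-1 → ∑ (λ z → a * z ^ i) nz ≡ 0#
          sk a (suc i) _ lt = trans (sym (∑el-0 (λ z → a * z ^ suc i) (trans (cong (a *_) (zeroˡ _)) (zeroʳ a)))) (trans (sym (∑-*ˡ a (_^ suc i) el)) (trans (cong (a *_) (ps-0 (suc i) lt)) (zeroʳ a)))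

        rhs : ∑ (λ z → (V (bar z) * W z) * (z ⁻¹ * z ⁻¹)) nz ≡ - (Tm V 0 1 * Tm W 1 0)
        rhs = begin
          ∑ (λ z → (V (bar z) * W z) * (z ⁻¹ * z ⁻¹)) nz ≡⟨ FΣ.big-cong∈ nz (λ {z} m∈ → pt (nz∈ m∈)) ⟩
          ∑ (λ z → - sumTo q-1 (λ e₁ → sumTo q-1 (λ e₂ → Tm V e₁ e₂ * (W z * ((bar z ^ e₁ * z ^ e₂) * (z ⁻¹ * z ⁻¹)))))) nz ≡⟨ ∑-neg _ nz ⟨
          - ∑ (λ z → sumTo q-1 (λ e₁ → sumTo q-1 (λ e₂ → Tm V e₁ e₂ * (W z * ((bar z ^ e₁ * z ^ e₂) * (z ⁻¹ * z ⁻¹)))))) nz ≡⟨ cong -_ (sym (sumTo-∑ q-1 (λ e₁ z → sumTo q-1 (λ e₂ → Tm V e₁ e₂ * (W z * ((bar z ^ e₁ * z ^ e₂) * (z ⁻¹ * z ⁻¹))))) nz)) ⟩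
          - sumTo q-1 (λ e₁ → ∑ (λ z → sumTo q-1 (λ e₂ → Tm V e₁ e₂ * (W z * ((bar z ^ e₁ * z ^ e₂) * (z ⁻¹ * z ⁻¹))))) nz) ≡⟨ cong -_ (sumTo-cong q-1 (λ e₁ → trans (sym (sumTo-∑ q-1 (λ e₂ z → Tm V e₁ e₂ * (W z * ((bar z ^ e₁ * z ^ e₂) * (z ⁻¹ * z ⁻¹)))) nz)) (sumTo-cong q-1 (λ e₂ → sym (∑-*ˡ (Tm V e₁ e₂) _ nz))))) ⟩
          - sumTo q-1 (λ e₁ → sumTo q-1 (λ e₂ → Tm V e₁ e₂ * U e₁ e₂)) ≡⟨ cong -_ (sumTo-single q-1 (λ e₁ → sumTo q-1 (λ e₂ → Tm V e₁ e₂ * U e₁ e₂)) {0} z≤n (λ i l ni → sumTo-0 q-1 _ (λ e₂ l2 → term-0 i e₂ l l2 (λ x → ni (proj₁ x))))) ⟩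
          - sumTo q-1 (λ e₂ → Tm V 0 e₂ * U 0 e₂) ≡⟨ cong -_ (sumTo-single q-1 (λ e₂ → Tm V 0 e₂ * U 0 e₂) {1} (s≤s z≤n) (λ i l ni → term-0 0 i z≤n l (λ x → ni (proj₂ x)))) ⟩
          - (Tm V 0 1 * U 0 1) ≡⟨ cong (λ t → - (Tm V 0 1 * t)) U-01 ⟩
          - (Tm V 0 1 * Tm W 1 0) ∎
          where
          open ≡-Reasoning
          pt : ∀ {z} → z ≢ 0# → (V (bar z) * W z) * (z ⁻¹ * z ⁻¹) ≡ - sumTo q-1 (λ e₁ → sumTo q-1 (λ e₂ → Tm V e₁ e₂ * (W z * ((bar z ^ e₁ * z ^ e₂) * (z ⁻¹ * z ⁻¹)))))
          pt {z} ne = trans (cong (λ t → (t * W z) * (z ⁻¹ * z ⁻¹)) (Invert.inversion SV (bar-≢0 ne))) (trans (solve 3 (λ s w i → ((:- s) :* w) :* i := :- (s :* (w :* i))) refl (sumTo q-1 (λ e₁ → sumTo q-1 (λ e₂ → Tm V e₁ e₂ * (bar z ^ e₁ * bar (bar z) ^ e₂)))) (W z) (z ⁻¹ * z ⁻¹))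
            (cong -_ (trans (sumTo-*ʳ q-1 _ (W z * (z ⁻¹ * z ⁻¹))) (sumTo-cong q-1 (λ e₁ → trans (sumTo-*ʳ q-1 _ (W z * (z ⁻¹ * z ⁻¹))) (sumTo-cong q-1 (λ e₂ → trans (cong (λ t → (Tm V e₁ e₂ * (bar z ^ e₁ * t ^ e₂)) * (W z * (z ⁻¹ * z ⁻¹))) (bar-bar z))
              (solve 4 (λ t m w i → (t :* m) :* (w :* i) := t :* (w :* (m :* i))) refl (Tm V e₁ e₂) (bar z ^ e₁ * z ^ e₂) (W z) (z ⁻¹ * z ⁻¹)))))))))

      -- The two evaluations of the weighted sum. What matters is that neither coefficient is zero.
      pairing : Tm V 0 1 * Tm W 1 0 ≡ - 1#
      pairing = trans (solve 1 (λ x → x := :- (:- x)) refl _) (cong -_ (trans (sym rhs) lhs))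

      TmW≢0 : Tm W 1 0 ≢ 0#
      TmW≢0 e = -1≢0 (trans (sym pairing) (trans (cong (Tm V 0 1 *_) e) (zeroʳ _)))

    -- Factors of a power of 1 - x

    1-x : Poly
    1-x = 1# ∷ - 1# ∷ []

    eval-1-x : ∀ x → eval 1-x x ≡ 1# - x
    eval-1-x x = solve 1 (λ x → :1 :+ x :* (:- :1 :+ x :* :0) := :1 :- x) refl x

    eval-pow : ∀ n x → eval (powP 1-x n) x ≡ (1# - x) ^ n
    eval-pow n x = trans (eval-powP 1-x n x) (cong (_^ n) (eval-1-x x))

    length-scale : ∀ a P {n} → length P ≤ n → length (scale a P) ≤ n
    length-scale a P le = ℕₚ.≤-trans (ℕₚ.≤-reflexive (Listₚ.length-map (a *_) P)) le

    deflate : ∀ P {a} → length P ≤ suc (suc a) → eval P 1# ≡ 0# → ∃ λ P₁ → length P₁ ≤ suc a × (∀ x → eval P x ≡ (1# - x) * eval P₁ x)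
    deflate [] le e = [] , z≤n , (λ x → sym (zeroʳ _))
    deflate (b ∷ P) (s≤s le) e = scale (- 1#) (quot (b ∷ P) 1#) , length-scale (- 1#) (quot (b ∷ P) 1#) (ℕₚ.≤-trans (quot-length b P 1#) le) ,
      (λ x → trans (quot-eval (b ∷ P) 1# x) (trans (cong (_+ (x - 1#) * eval (quot (b ∷ P) 1#) x) e) (trans (solve 2 (λ x y → :0 :+ (x :- :1) :* y := (:1 :- x) :* ((:- :1) :* y)) refl x (eval (quot (b ∷ P) 1#) x)) (cong ((1# - x) *_) (sym (eval-scale (- 1#) (quot (b ∷ P) 1#) x))))))

    const-poly : ∀ P → length P ≤ 1 → ∃ λ a → ∀ x → eval P x ≡ a
    const-poly [] _ = 0# , λ x → refl
    const-poly (a ∷ []) _ = a , λ x → trans (cong (a +_) (zeroʳ x)) (+-identityʳ a)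
    const-poly (a ∷ b ∷ P) (s≤s ())

    -- Division is possible only at x ≠ 1. The q² - 1 remaining points still determine polynomials
    -- with no more coefficients than that.
    cancel-1-x : ∀ P R c n → length (mulP P R) ≤ suc n → suc n ≤ q²-1 → (∀ x → (1# - x) * (eval P x * eval R x) ≡ c * (1# - x) ^ suc n) → ∀ x → eval P x * eval R x ≡ c * (1# - x) ^ n
    cancel-1-x P R c n lm bd h x = x-y≡0 (trans (sym (ev x)) (many-roots B (Uniqₚ.filter⁺ (≢? 1#) el-unique) (λ {y} m∈ → root (proj₂ (∈-filter⁻ (≢? 1#) {xs = el} m∈))) lenB x))
      where
      B : Poly
      B = mulP P R ⊹ scale (- c) (powP 1-x n)
      ev : ∀ x → eval B x ≡ eval P x * eval R x - c * (1# - x) ^ n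
      ev x = trans (eval-⊹ (mulP P R) (scale (- c) (powP 1-x n)) x) (cong₂ _+_ (eval-mulP P R x) (trans (eval-scale (- c) (powP 1-x n) x) (trans (cong (- c *_) (eval-pow n x)) (sym (-‿distribˡ-* c _)))))
      root : ∀ {y} → y ≢ 1# → eval B y ≡ 0#
      root {y} ne = domain {1# - y} (trans (cong ((1# - y) *_) (ev y)) (trans (solve 4 (λ u a c w → u :* (a :- c :* w) := u :* a :- c :* (u :* w)) refl (1# - y) (eval P y * eval R y) c ((1# - y) ^ n)) (trans (cong (_- c * (1# - y) ^ suc n) (h y)) (-‿inverseʳ _)))) (x≢y⇒x-y≢0 (λ e → ne (sym e)))
      lenB : length B ≤ length (filter (≢? 1#) el)
      lenB = ℕₚ.≤-trans (length-⊹ (mulP P R) (scale (- c) (powP 1-x n)) lm (length-scale (- c) (powP 1-x n) (ℕₚ.≤-trans (length-powP 1-x n {1} ℕₚ.≤-refl) (s≤s (ℕₚ.≤-reflexive (ℕₚ.*-identityʳ n))))))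
        (ℕₚ.≤-trans bd (ℕₚ.≤-reflexive (ℕₚ.suc-injective (trans (sym q²≡) (trans (sym el-length) (length-remove el-unique (el-complete 1#)))))))

    -- 1 - x is prime: at x = 1 one of the two polynomials vanishes, and 1 - x is split off from
    -- that one. A constant cannot be the one, since the product is c ≠ 0 at x = 0.
    factor : ∀ n P R a b c → c ≢ 0# → length P ≤ suc a → length R ≤ suc b → a +ℕ b ≤ n → n ≤ q²-1 → (∀ x → eval P x * eval R x ≡ c * (1# - x) ^ n)
      → (∃ λ c₁ → ∀ x → eval P x ≡ c₁ * (1# - x) ^ a) × (∃ λ c₂ → ∀ x → eval R x ≡ c₂ * (1# - x) ^ b)
    factor zero P R zero zero c c≢0 lp lr z≤n _ h = let (x , ex) = const-poly P lp ; (y , ey) = const-poly R lr in (x , λ t → trans (ex t) (sym (*-identityʳ x))) , (y , λ t → trans (ey t) (sym (*-identityʳ y)))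
    factor (suc n) P R a b c c≢0 lp lr ab bd h with eval P 1# ≟ 0#
    factor (suc n) P R zero b c c≢0 lp lr ab bd h | yes e = ⊥-elim (c≢0 (begin
        c ≡⟨ trans (sym (*-identityʳ c)) (cong (c *_) (sym (trans (cong (_^ suc n) (solve 0 (:1 :- :0 := :1) refl)) (1^ (suc n))))) ⟩
        c * (1# - 0#) ^ suc n ≡⟨ h 0# ⟨
        eval P 0# * eval R 0# ≡⟨ cong (_* eval R 0#) (trans (proj₂ (const-poly P lp) 0#) (trans (sym (proj₂ (const-poly P lp) 1#)) e)) ⟩
        0# * eval R 0# ≡⟨ zeroˡ _ ⟩
        0# ∎))
      where open ≡-Reasoning
    factor (suc n) P R (suc a) b c c≢0 lp lr (s≤s ab) bd h | yes e with deflate P lp e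
    ... | P₁ , l₁ , e₁ with factor n P₁ R a b c c≢0 l₁ lr ab (ℕₚ.<⇒≤ bd) (cancel-1-x P₁ R c n (ℕₚ.≤-trans (length-mulP P₁ R l₁ lr) (s≤s ab)) bd (λ x → trans (sym (*-assoc _ _ _)) (trans (cong (_* eval R x) (sym (e₁ x))) (h x))))
    ...   | (c₁ , f₁) , res = (c₁ , λ x → trans (e₁ x) (trans (cong ((1# - x) *_) (f₁ x)) (solve 3 (λ u c w → u :* (c :* w) := c :* (u :* w)) refl (1# - x) c₁ ((1# - x) ^ a)))) , res
    factor (suc n) P R a b c c≢0 lp lr ab bd h | no ne = go b lr ab
      where
      R1 : eval R 1# ≡ 0#
      R1 = domain (trans (h 1#) (trans (cong (c *_) (trans (cong (_* (1# - 1#) ^ n) (-‿inverseʳ 1#)) (zeroˡ _))) (zeroʳ c))) ne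
      go : ∀ b → length R ≤ suc b → a +ℕ b ≤ suc n → (∃ λ c₁ → ∀ x → eval P x ≡ c₁ * (1# - x) ^ a) × (∃ λ c₂ → ∀ x → eval R x ≡ c₂ * (1# - x) ^ b)
      go zero lr ab = ⊥-elim (c≢0 (begin
        c ≡⟨ trans (sym (*-identityʳ c)) (cong (c *_) (sym (trans (cong (_^ suc n) (solve 0 (:1 :- :0 := :1) refl)) (1^ (suc n))))) ⟩
        c * (1# - 0#) ^ suc n ≡⟨ h 0# ⟨
        eval P 0# * eval R 0# ≡⟨ cong (eval P 0# *_) (trans (proj₂ (const-poly R lr) 0#) (trans (sym (proj₂ (const-poly R lr) 1#)) R1)) ⟩
        eval P 0# * 0# ≡⟨ zeroʳ _ ⟩
        0# ∎))
        where open ≡-Reasoning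
      go (suc b) lr ab with deflate R lr R1
      ... | R₁ , l₁ , e₁ with factor n P R₁ a b c c≢0 lp l₁ ab' (ℕₚ.<⇒≤ bd) (cancel-1-x P R₁ c n (ℕₚ.≤-trans (length-mulP P R₁ lp l₁) (s≤s ab')) bd
           (λ x → trans (solve 3 (λ u p r → u :* (p :* r) := p :* (u :* r)) refl (1# - x) (eval P x) (eval R₁ x)) (trans (cong (eval P x *_) (sym (e₁ x))) (h x))))
        where
        ab' : a +ℕ b ≤ n
        ab' = ℕₚ.≤-pred (ℕₚ.≤-trans (ℕₚ.≤-reflexive (sym (ℕₚ.+-suc a b))) ab)
      ...   | res , (c₂ , f₂) = res , (c₂ , λ x → trans (e₁ x) (trans (cong ((1# - x) *_) (f₂ x)) (solve 3 (λ u c w → u :* (c :* w) := c :* (u :* w)) refl (1# - x) c₂ ((1# - x) ^ b))))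

    -- Expansion of a homogeneous sparse function in powers of (z / z^q)^p

    -- j is prime to p, so by Bézout j · 1 = 0 together with p · 1 = 0 would give 1 = 0.
    small-char : ∀ j → 1 ≤ j → j < p → j · 1# ≢ 0#
    small-char j@(suc _) 1≤j j<p e = bez (coprime-Bézout (prime⇒coprime pp j<p))
      where
      kill : ∀ a b → b · 1# ≡ 0# → (a *ℕ b) · 1# ≡ 0#
      kill a b z = trans (×1-homo-* a b) (trans (cong ((a · 1#) *_) z) (zeroʳ _))
      bez : Bézout.Identity 1 p j → ⊥
      bez (Bézout.+- x y eq) = 1≢0 (trans (sym (trans (cong (1# +_) (kill y j e)) (+-identityʳ 1#))) (trans (cong (_· 1#) eq) (kill x p char-p)))
      bez (Bézout.-+ x y eq) = 1≢0 (trans (sym (trans (cong (1# +_) (kill x p char-p)) (+-identityʳ 1#))) (trans (cong (_· 1#) eq) (kill y j e)))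

    private
      skip : ∀ n m (h : ℕ → Carrier) → (∀ j → 1 ≤ j → j ≤ m → h (n +ℕ j) ≡ 0#) → sumTo (n +ℕ m) h ≡ sumTo n h
      skip n zero h z = cong (λ t → sumTo t h) (ℕₚ.+-identityʳ n)
      skip n (suc m) h z = trans (cong (λ t → sumTo t h) (ℕₚ.+-suc n m)) (trans (cong₂ _+_ (skip n m h (λ j a b → z j a (ℕₚ.m≤n⇒m≤1+n b))) (trans (cong h (sym (ℕₚ.+-suc n m))) (z (suc m) (s≤s z≤n) ℕₚ.≤-refl))) (+-identityʳ _))

      -- With m + 1 = p it turns a polynomial in y, whose other coefficients vanish, into one in
      -- y^p.
      collapse : ∀ b m (h : ℕ → Carrier) → (∀ a j → 1 ≤ j → j ≤ m → h (a *ℕ suc m +ℕ j) ≡ 0#) → sumTo (b *ℕ suc m) h ≡ sumTo b (λ a → h (a *ℕ suc m))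
      collapse zero m h z = refl
      collapse (suc b) m h z = trans (cong (λ t → sumTo t h) (trans (ℕₚ.+-comm (suc m) (b *ℕ suc m)) (ℕₚ.+-suc (b *ℕ suc m) m)))
        (cong₂ _+_ (trans (skip (b *ℕ suc m) m h (z b)) (collapse b m h z)) (cong h (sym (trans (ℕₚ.+-comm (suc m) (b *ℕ suc m)) (ℕₚ.+-suc (b *ℕ suc m) m)))))

      polyOf : (ℕ → Carrier) → ℕ → Poly
      polyOf f zero = f 0 ∷ []
      polyOf f (suc n) = f 0 ∷ polyOf (λ i → f (suc i)) n

      length-polyOf : ∀ f n → length (polyOf f n) ≡ suc n
      length-polyOf f zero = refl
      length-polyOf f (suc n) = cong suc (length-polyOf (λ i → f (suc i)) n)

      sumTo-front : ∀ n (s : ℕ → Carrier) → sumTo (suc n) s ≡ s 0 + sumTo n (λ i → s (suc i))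
      sumTo-front zero s = refl
      sumTo-front (suc n) s = trans (cong (_+ s (suc (suc n))) (sumTo-front n s)) (+-assoc _ _ _)

      eval-polyOf : ∀ n f x → eval (polyOf f n) x ≡ sumTo n (λ i → f i * x ^ i)
      eval-polyOf zero f x = trans (cong (f 0 +_) (zeroʳ x)) (trans (+-identityʳ _) (sym (*-identityʳ _)))
      eval-polyOf (suc n) f x = trans (cong₂ (λ s t → s + x * t) (sym (*-identityʳ (f 0))) (eval-polyOf n (λ i → f (suc i)) x))
        (trans (cong (f 0 * 1# +_) (trans (sym (sumTo-* n x _)) (sumTo-cong n (λ i → solve 3 (λ x f w → x :* (f :* w) := f :* (x :* w)) refl x (f (suc i)) (x ^ i))))) (sym (sumTo-front n (λ i → f i * x ^ i))))

    -- z / z̄, an element of norm 1 that does not change when z is multiplied by an element of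
    -- GF(q)*.
    yq : Carrier → Carrier
    yq z = z * bzi z

    -- G(z) / z depends on z / z̄ only. It is thus a function on the q + 1 elements of norm 1, where
    -- Fourier inversion has a single index.
    module Homogeneous {G : Carrier → Carrier} (S : Sparse G) (hom : ∀ {d} → InD d → ∀ z → G (d * z) ≡ d * G z) where
      open Sparse S

      private
        -- The sign is there because the sum runs over z, not over z / z̄: each class under GF(q)*
        -- is counted q - 1 = -1 times.
        ω : ℕ → Carrier
        ω i = - ∑ (λ x → G x * (x ⁻¹ * (bar x * x ⁻¹) ^ i)) nz

        -- Since x̄^q = x, the weight x^(-1) (x̄/x)^i equals x^(-i) x̄^(-(q-i)), and the coefficient
        -- (i, q - i) vanishes.
        ω-0 : ∀ i → i ≤ q → i · 1# ≢ 0# → ω i ≡ 0#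
        ω-0 zero _ ne = ⊥-elim (ne refl)
        ω-0 (suc i) (s≤s le) ne with ℕₚ.m≤n⇒∃[o]m+o≡n le
        ... | zero , oe = ⊥-elim (ne (trans (cong (λ n → suc n · 1#) (trans (sym (ℕₚ.+-identityʳ i)) oe)) q·1≡0))
        ... | suc o , oe = trans (cong -_ (trans (FΣ.big-cong∈ nz (λ {x} m∈ → cong (G x *_) (pt (nz∈ m∈)))) (vanish {suc i} {suc o} (s≤s z≤n) (lt i o oe) (s≤s z≤n) (lt o i (trans (trans (ℕₚ.+-suc o i) (cong suc (ℕₚ.+-comm o i))) (trans (sym (ℕₚ.+-suc i o)) oe))) (inj₁ ne)))) -0#≈0#
          where
          lt : ∀ i o → i +ℕ suc o ≡ q-1 → suc i < q
          lt i o e = s≤s (ℕₚ.≤-trans (ℕₚ.≤-trans (ℕₚ.m≤m+n (suc i) o) (ℕₚ.≤-reflexive (sym (ℕₚ.+-suc i o)))) (ℕₚ.≤-reflexive e))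
          pt : ∀ {x} → x ≢ 0# → x ⁻¹ * (bar x * x ⁻¹) ^ suc i ≡ (x ⁻¹) ^ suc i * bzi x ^ suc o
          pt {x} xe = *-cancelˡ (^-≢0 (suc o) (bar-≢0 xe)) (trans
            (trans (cong (λ t → bar x ^ suc o * (x ⁻¹ * t)) (^-distrib-* (bar x) (x ⁻¹) (suc i))) (trans (solve 4 (λ b xi u w → b :* (xi :* (u :* w)) := ((u :* b) :* xi) :* w) refl (bar x ^ suc o) (x ⁻¹) (bar x ^ suc i) ((x ⁻¹) ^ suc i))
              (trans (cong (λ t → (t * x ⁻¹) * (x ⁻¹) ^ suc i) (trans (sym (^-homo-* (bar x) (suc i) (suc o))) (trans (cong (λ n → bar x ^ suc n) oe) (bar-bar x)))) (trans (cong (_* (x ⁻¹) ^ suc i) (inv-r xe)) (*-identityˡ _)))))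
            (sym (trans (solve 3 (λ b u w → b :* (u :* w) := u :* (b :* w)) refl (bar x ^ suc o) ((x ⁻¹) ^ suc i) (bzi x ^ suc o)) (trans (cong ((x ⁻¹) ^ suc i *_) (pow-cancel (bar x) (bzi x) (suc o) (bar-bzi xe))) (*-identityʳ _)))))

        Sq : Carrier → Carrier
        Sq ρ = sumTo q (λ i → ρ ^ i)

        module _ {z : Carrier} (ne : z ≢ 0#) where
          ρ : Carrier → Carrier
          ρ x = (bar x * x ⁻¹) * yq z

          -- ρ has norm 1, so the sum of its first q + 1 powers vanishes unless ρ = 1, which happens
          -- when x / z lies in GF(q); then the sum is q + 1 = 1.
          term : ∀ {x} → x ∈ nz → (G x * x ⁻¹) * Sq (ρ x) ≡ FΣ.guard (inD? (x * z ⁻¹)) (G z * z ⁻¹)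
          term {x} x∈ with inD? (x * z ⁻¹)
          ... | yes dd = trans (cong₂ _*_ Gx (trans (cong Sq ρ1) (trans (ones q) (trans (cong (1# +_) q·1≡0) (+-identityʳ 1#))))) (*-identityʳ _)
            where
            xe : x ≢ 0#
            xe = nz∈ x∈
            d : Carrier
            d = x * z ⁻¹
            dz : d * z ≡ x
            dz = *-/ x ne
            bd : bar x ≡ d * bar z
            bd = trans (cong bar (sym dz)) (trans (bar-* d z) (cong (_* bar z) (InD-real dd)))
            ρ1 : ρ x ≡ 1#
            ρ1 = begin
              (bar x * x ⁻¹) * (z * bzi z) ≡⟨ cong (λ t → (t * x ⁻¹) * (z * bzi z)) bd ⟩
              ((d * bar z) * x ⁻¹) * (z * bzi z) ≡⟨ solve 5 (λ d b i z w → ((d :* b) :* i) :* (z :* w) := ((d :* z) :* i) :* (b :* w)) refl d (bar z) (x ⁻¹) z (bzi z) ⟩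
              ((d * z) * x ⁻¹) * (bar z * bzi z) ≡⟨ cong₂ (λ s t → (s * x ⁻¹) * t) dz (bar-bzi ne) ⟩
              (x * x ⁻¹) * 1# ≡⟨ trans (*-identityʳ _) (inv-r xe) ⟩
              1# ∎
              where open ≡-Reasoning
            Gx : G x * x ⁻¹ ≡ G z * z ⁻¹
            Gx = *-cancelˡ xe (begin
              x * (G x * x ⁻¹) ≡⟨ solve 3 (λ x g i → x :* (g :* i) := g :* (x :* i)) refl x (G x) (x ⁻¹) ⟩
              G x * (x * x ⁻¹) ≡⟨ trans (cong (G x *_) (inv-r xe)) (*-identityʳ _) ⟩
              G x ≡⟨ cong G dz ⟨
              G (d * z) ≡⟨ hom dd z ⟩
              (x * z ⁻¹) * G z ≡⟨ solve 3 (λ x i g → (x :* i) :* g := x :* (g :* i)) refl x (z ⁻¹) (G z) ⟩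
              x * (G z * z ⁻¹) ∎)
              where open ≡-Reasoning
          ... | no nd = trans (cong ((G x * x ⁻¹) *_) S0) (zeroʳ _)
            where
            xe : x ≢ 0#
            xe = nz∈ x∈
            nm : ∀ {x} → x ≢ 0# → Nm (bar x * x ⁻¹) ≡ 1#
            nm {x} xe = trans (Nm-* (bar x) (x ⁻¹)) (trans (cong (_* Nm (x ⁻¹)) (trans (cong (bar x *_) (bar-bar x)) (*-comm _ _))) (trans (sym (Nm-* x (x ⁻¹))) (trans (cong Nm (inv-r xe)) (1^ q+1))))
            nmy : Nm (yq z) ≡ 1#
            nmy = trans (Nm-* z (bzi z)) (trans (cong (Nm z *_) (trans (cong (bzi z *_) (bar-bar (z ⁻¹))) (*-comm _ _))) (trans (sym (Nm-* z (z ⁻¹))) (trans (cong Nm (inv-r ne)) (1^ q+1))))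
            ρ≢1 : ρ x ≢ 1#
            ρ≢1 e = nd (real-InD (*-cancelˡ (inv≢0 (*-≢0 xe (inv≢0 ne))) (begin
              (x * z ⁻¹) ⁻¹ * bar (x * z ⁻¹) ≡⟨ cong₂ _*_ (sym (inv-unique (trans (solve 4 (λ x i y z → (x :* i) :* (y :* z) := (x :* y) :* (i :* z)) refl x (z ⁻¹) (x ⁻¹) z) (trans (cong₂ _*_ (inv-r xe) (inv-l ne)) (*-identityˡ 1#))))) (bar-* x (z ⁻¹)) ⟩
              (x ⁻¹ * z) * (bar x * bzi z) ≡⟨ solve 4 (λ i z b w → (i :* z) :* (b :* w) := (b :* i) :* (z :* w)) refl (x ⁻¹) z (bar x) (bzi z) ⟩
              ρ x ≡⟨ e ⟩
              1# ≡⟨ inv-l (*-≢0 xe (inv≢0 ne)) ⟨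
              (x * z ⁻¹) ⁻¹ * (x * z ⁻¹) ∎)) (*-≢0 xe (inv≢0 ne)))
              where open ≡-Reasoning
            S0 : Sq (ρ x) ≡ 0#
            S0 = domain (trans (tele (ρ x) q) (trans (cong (_- 1#) (trans (Nm-* (bar x * x ⁻¹) (yq z)) (trans (cong₂ _*_ (nm xe) nmy) (*-identityˡ 1#)))) (-‿inverseʳ 1#))) (x≢y⇒x-y≢0 ρ≢1)

          guardsum : ∑ (λ x → FΣ.guard (inD? (x * z ⁻¹)) (G z * z ⁻¹)) nz ≡ - (G z * z ⁻¹)
          guardsum = trans (FΣ.big-perm (λ d → FΣ.guard (inD? d) (G z * z ⁻¹)) (_* z ⁻¹) _≟_ nz-unique (λ m∈ → ∈nz (*-≢0 (nz∈ m∈) (inv≢0 ne))) (λ _ _ e → *-cancelˡ (inv≢0 ne) (trans (*-comm _ _) (trans e (*-comm _ _)))))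
            (trans (sym (∑el-0 (λ d → FΣ.guard (inD? d) (G z * z ⁻¹)) z0)) (trans (sym (FΣ.big-filter inD? (λ _ → G z * z ⁻¹) el)) (trans (∑-const _ Dl) (trans (cong (λ n → (n · 1#) * (G z * z ⁻¹)) Dl-length) (trans (cong (_* (G z * z ⁻¹)) q-1·1) (solve 1 (λ x → (:- :1) :* x := :- x) refl _))))))
            where
            z0 : FΣ.guard (inD? 0#) (G z * z ⁻¹) ≡ 0#
            z0 with inD? 0#
            ... | yes d = ⊥-elim (InD-≢0 d refl)
            ... | no _ = refl

          mu-inversion : G z ≡ z * sumTo q (λ i → ω i * yq z ^ i)
          mu-inversion = begin
            G z ≡⟨ solve 2 (λ g i → g := g :* i :+ g :* (:1 :- i)) refl (G z) (z * z ⁻¹) ⟩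
            G z * (z * z ⁻¹) + G z * (1# - z * z ⁻¹) ≡⟨ cong₂ _+_ (solve 3 (λ g z i → g :* (z :* i) := z :* (:- (:- (g :* i)))) refl (G z) z (z ⁻¹)) (trans (cong (λ t → G z * (1# - t)) (inv-r ne)) (trans (cong (G z *_) (-‿inverseʳ 1#)) (zeroʳ _))) ⟩
            z * - - (G z * z ⁻¹) + 0# ≡⟨ +-identityʳ _ ⟩
            z * - - (G z * z ⁻¹) ≡⟨ cong (λ t → z * - t) (sym guardsum) ⟩
            z * - ∑ (λ x → FΣ.guard (inD? (x * z ⁻¹)) (G z * z ⁻¹)) nz ≡⟨ cong (λ t → z * - t) (FΣ.big-cong∈ nz (λ m∈ → sym (term m∈))) ⟩
            z * - ∑ (λ x → (G x * x ⁻¹) * Sq (ρ x)) nz ≡⟨ cong (λ t → z * - t) (FΣ.big-cong nz (λ x → trans (sym (sumTo-* q (G x * x ⁻¹) (λ i → ρ x ^ i))) (sumTo-cong q (λ i → trans (cong ((G x * x ⁻¹) *_) (^-distrib-* (bar x * x ⁻¹) (yq z) i)) (solve 4 (λ g i u w → (g :* i) :* (u :* w) := (g :* (i :* u)) :* w) refl (G x) (x ⁻¹) ((bar x * x ⁻¹) ^ i) (yq z ^ i)))))) ⟩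
            z * - ∑ (λ x → sumTo q (λ i → (G x * (x ⁻¹ * (bar x * x ⁻¹) ^ i)) * yq z ^ i)) nz ≡⟨ cong (λ t → z * - t) (sym (sumTo-∑ q (λ i x → (G x * (x ⁻¹ * (bar x * x ⁻¹) ^ i)) * yq z ^ i) nz)) ⟩
            z * - sumTo q (λ i → ∑ (λ x → (G x * (x ⁻¹ * (bar x * x ⁻¹) ^ i)) * yq z ^ i) nz) ≡⟨ cong (z *_) (trans (solve 1 (λ x → :- x := (:- :1) :* x) refl _) (trans (sym (sumTo-* q (- 1#) _)) (sumTo-cong q (λ i → trans (cong (- 1# *_) (sym (∑-*ʳ (yq z ^ i) _ nz))) (solve 2 (λ s w → (:- :1) :* (s :* w) := (:- s) :* w) refl (∑ (λ x → G x * (x ⁻¹ * (bar x * x ⁻¹) ^ i)) nz) (yq z ^ i)))))) ⟩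
            z * sumTo q (λ i → ω i * yq z ^ i) ∎
            where open ≡-Reasoning

        p₁ : ∃ λ m → p ≡ suc m
        p₁ = go p refl
          where
          go : ∀ n → n ≡ p → ∃ λ m → p ≡ suc m
          go zero e = ⊥-elim (ℕₚ.n≮0 (ℕₚ.≤-trans (nonTrivial⇒n>1 p {{prime⇒nonTrivial pp}}) (ℕₚ.≤-reflexive (sym e))))
          go (suc m) e = m , sym e

      -- Only indices divisible by p remain, so the degree in t = (z / z̄)^p is at most Q instead of
      -- q.
      series : Poly
      series = polyOf (λ a → ω (a *ℕ p)) Q

      length-series : length series ≤ suc Q
      length-series = ℕₚ.≤-reflexive (length-polyOf (λ a → ω (a *ℕ p)) Q)

      expansion : ∀ {z} → z ≢ 0# → G z ≡ z * eval series (yq z ^ p)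
      expansion {z} ne = trans (mu-inversion ne) (cong (z *_) (trans (col p₁) (trans (sumTo-cong Q (λ a → cong (ω (a *ℕ p) *_) (trans (cong (yq z ^_) (ℕₚ.*-comm a p)) (sym (^-assocʳ (yq z) p a))))) (sym (eval-polyOf Q (λ a → ω (a *ℕ p)) (yq z ^ p))))))
        where
        h : ℕ → Carrier
        h i = ω' i * yq z ^ i
          where
          -- ω cut off beyond q, where it is irrelevant
          ω' : ℕ → Carrier
          ω' i with i ℕₚ.≤? q
          ... | yes _ = ω i
          ... | no _ = 0#
        h≡ : ∀ i → i ≤ q → h i ≡ ω i * yq z ^ i
        h≡ i le with i ℕₚ.≤? q
        ... | yes _ = refl
        ... | no nle = ⊥-elim (nle le)
        h-0 : ∀ a m j → p ≡ suc m → 1 ≤ j → j ≤ m → h (a *ℕ suc m +ℕ j) ≡ 0#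
        h-0 a m j pe 1≤j j≤m with (a *ℕ suc m +ℕ j) ℕₚ.≤? q
        ... | no _ = zeroˡ _
        ... | yes le = trans (cong (_* yq z ^ (a *ℕ suc m +ℕ j)) (ω-0 _ le (λ e → small-char j 1≤j (ℕₚ.≤-trans (s≤s j≤m) (ℕₚ.≤-reflexive (sym pe))) (trans (sym (trans (·-homo-+ 1# (a *ℕ suc m) j) (trans (cong (_+ (j · 1#)) (trans (×1-homo-* a (suc m)) (trans (cong ((a · 1#) *_) (trans (cong (_· 1#) (sym pe)) char-p)) (zeroʳ _)))) (+-identityˡ _)))) e)))) (zeroˡ _)
        sumTo-cong≤ : ∀ n {s t : ℕ → Carrier} → (∀ i → i ≤ n → s i ≡ t i) → sumTo n s ≡ sumTo n t
        sumTo-cong≤ zero e = e 0 z≤n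
        sumTo-cong≤ (suc n) e = cong₂ _+_ (sumTo-cong≤ n (λ i l → e i (ℕₚ.m≤n⇒m≤1+n l))) (e (suc n) ℕₚ.≤-refl)
        col : (∃ λ m → p ≡ suc m) → sumTo q (λ i → ω i * yq z ^ i) ≡ sumTo Q (λ a → ω (a *ℕ p) * yq z ^ (a *ℕ p))
        col (m , pe) = trans (sumTo-cong≤ q (λ i le → sym (h≡ i le))) (trans (cong (λ n → sumTo n h) (trans q≡p*Q (trans (ℕₚ.*-comm p Q) (cong (Q *ℕ_) pe)))) (trans (collapse Q m h (λ a j → h-0 a m j pe))
          (trans (sumTo-cong Q (λ a → cong (λ t → h (a *ℕ t)) (sym pe))) (sumTo-cong≤ Q (λ a le → h≡ (a *ℕ p) (ℕₚ.≤-trans (ℕₚ.*-monoˡ-≤ p le) (ℕₚ.≤-reflexive (trans (ℕₚ.*-comm Q p) (sym q≡p*Q)))))))))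

  -- Determination of c

  module NormForm where
    open FieldArithmetic
    open LacunaryPolynomials
    open Duality
    open FourierCoefficients

    -- Conjugating z exchanges the two exponents, and the conditions are symmetric in them.
    sparse-bar : ∀ {G} → Sparse G → Sparse (λ z → G (bar z))
    sparse-bar {G} S = record
      { G-real = λ {z} rz → G-real (cong bar rz)
      ; G-bar = λ z → G-bar (bar z)
      ; sum-0 = trans (swap 0 0) sum-0
      ; vanish = λ { {e₁} {e₂} a b c d (inj₁ x) → trans (swap e₁ e₂) (vanish c d a b (inj₂ x)) ; {e₁} {e₂} a b c d (inj₂ x) → trans (swap e₁ e₂) (vanish c d a b (inj₁ x)) } }
      where
      open Sparse S
      swap : ∀ e₁ e₂ → Tm (λ z → G (bar z)) e₁ e₂ ≡ Tm G e₂ e₁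
      swap e₁ e₂ = trans (FΣ.big-cong∈ nz (λ {z} m∈ → cong (G (bar z) *_) (trans (*-comm _ _) (cong₂ _*_ (cong (_^ e₂) (bar-inv (nz∈ m∈))) (cong (_^ e₁) (trans (sym (bar-bar (z ⁻¹))) (cong bar (bar-inv (nz∈ m∈)))))))))
        (FΣ.big-perm (λ x → G x * ((x ⁻¹) ^ e₂ * bzi x ^ e₁)) bar _≟_ nz-unique (λ m∈ → ∈nz (bar-≢0 (nz∈ m∈))) (λ _ _ → bar-inj))

    nonreal-exists : ∃ λ m → ¬ Real m
    nonreal-exists = go Ml Ml-length Ml∈
      where
      go : ∀ xs → length xs ≡ q *ℕ q-1 → (∀ {m} → m ∈ xs → ¬ Real m) → ∃ λ m → ¬ Real m
      go (x ∷ xs) _ h = x , h (here refl)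

    -- For z = 1 + y the relation y ȳ = 1 gives y z̄ = z. At y = -1 this z is zero, and any nonzero
    -- z with z̄ = - z is taken instead.
    hilbert90 : ∀ {y} → Nm y ≡ 1# → ∃ λ z → z ≢ 0# × yq z ≡ y
    hilbert90 {y} e with y ≟ - 1#
    ... | no ne = z , z≢0 , trans (cong (_* bzi z) zb) (trans (*-assoc _ _ _) (trans (cong (y *_) (bar-bzi z≢0)) (*-identityʳ y)))
      where
      z : Carrier
      z = 1# + y
      z≢0 : z ≢ 0#
      z≢0 e0 = ne (x-y≡0 (trans (solve 1 (λ y → y :- (:- :1) := :1 :+ y) refl y) e0))
      zb : z ≡ y * bar z
      zb = sym (trans (cong (y *_) (trans (bar-+ 1# y) (cong (_+ bar y) bar-1))) (trans (solve 2 (λ y b → y :* (:1 :+ b) := y :* b :+ y) refl y (bar y)) (cong (_+ y) e)))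
    ... | yes ye = z , z≢0 , trans (cong (_* bzi z) zb) (trans (solve 2 (λ b i → (:- b) :* i := :- (b :* i)) refl (bar z) (bzi z)) (trans (cong -_ (bar-bzi z≢0)) (sym ye)))
      where
      m : Carrier
      m = proj₁ nonreal-exists
      z : Carrier
      z = bar m - m
      z≢0 : z ≢ 0#
      z≢0 = x≢y⇒x-y≢0 (proj₂ nonreal-exists)
      zb : z ≡ - bar z
      zb = trans (solve 2 (λ a b → a :- b := :- (b :- a)) refl (bar m) m) (cong -_ (sym (trans (bar-sub (bar m) m) (cong (_- bar m) (bar-bar m)))))

    frob-Q : ∀ t → (1# - t) ^ Q ≡ 1# - t ^ Q
    frob-Q t = trans (add 1# (- t)) (cong₂ _+_ (1^ Q) neg)
      where
      add : ∀ x y → (x + y) ^ Q ≡ x ^ Q + y ^ Q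
      add = Frobenius.frobenius^-+ FR pp char-p k
      0^Q : 0# ^ Q ≡ 0#
      0^Q = go Q (λ e → ℕₚ.n≮0 (ℕₚ.≤-trans (s≤s z≤n) (ℕₚ.≤-reflexive (trans q≡p*Q (trans (cong (p *ℕ_) e) (ℕₚ.*-zeroʳ p))))))
        where
        go : ∀ n → n ≢ 0 → 0# ^ n ≡ 0#
        go zero ne = ⊥-elim (ne refl)
        go (suc n) _ = zeroˡ _
      neg : (- t) ^ Q ≡ - t ^ Q
      neg = x-y≡0 (trans (solve 2 (λ a b → a :- (:- b) := b :+ a) refl ((- t) ^ Q) (t ^ Q)) (trans (sym (add t (- t))) (trans (cong (_^ Q) (-‿inverseʳ t)) 0^Q)))

    module _ (1≤r : 1 ≤ r) {c v : Carrier → Carrier} (H : Hyp c v)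
      (hom : ∀ {d} → InD d → ∃ λ χ → χ ≢ 0# × (∀ {m} → ¬ Real m → c (d * m) ≡ χ * c m)) where

      private
        H* : Hyp (λ α → v α ⁻¹) (λ m → c m ⁻¹)
        H* = Dualise.dual H
        module A = Lacunary 1≤r H
        module A* = Lacunary 1≤r H*
        V W : Carrier → Carrier
        V = A.V
        W = A*.V
        open Hyp H

        -- `tangent-conj` at z̄ reads v(z̄) = c(z) N(z - z̄), and the norm of z - z̄ is minus its
        -- square because conjugation negates it.
        VW : ∀ z → V (bar z) * W z ≡ - ((z - bar z) * (z - bar z))
        VW z = go (real? z)
          where
          go : Dec (Real z) → V (bar z) * W z ≡ - ((z - bar z) * (z - bar z))
          go (yes rz) = trans (cong (V (bar z) *_) (A*.V-real rz)) (trans (zeroʳ _) (sym (trans (cong (λ t → - ((z - t) * (z - t))) rz) (solve 1 (λ z → :- ((z :- z) :* (z :- z)) := :0) refl z))))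
          go (no nr) = begin
            V (bar z) * W z ≡⟨ cong₂ _*_ (trans (A.V-nonreal (nonreal-bar nr)) (A.tangent-conj (nonreal-bar nr))) (A*.V-nonreal nr) ⟩
            (c (bar (bar z)) * Nm (bar (bar z) - bar z)) * c z ⁻¹ ≡⟨ cong (λ t → (c t * Nm (t - bar z)) * c z ⁻¹) (bar-bar z) ⟩
            (c z * ((z - bar z) * bar (z - bar z))) * c z ⁻¹ ≡⟨ cong (λ t → (c z * ((z - bar z) * t)) * c z ⁻¹) (trans (bar-sub z (bar z)) (cong (λ t → bar z - t) (bar-bar z))) ⟩
            (c z * ((z - bar z) * (bar z - z))) * c z ⁻¹ ≡⟨ solve 4 (λ c z b i → (c :* ((z :- b) :* (b :- z))) :* i := (c :* i) :* (:- ((z :- b) :* (z :- b)))) refl (c z) z (bar z) (c z ⁻¹) ⟩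
            (c z * c z ⁻¹) * - ((z - bar z) * (z - bar z)) ≡⟨ trans (cong (_* - ((z - bar z) * (z - bar z))) (inv-r (InD-≢0 (c-D nr)))) (*-identityˡ _) ⟩
            - ((z - bar z) * (z - bar z)) ∎
            where open ≡-Reasoning

        SV : Sparse V
        SV = sparse 1≤r H
        SW : Sparse W
        SW = sparse 1≤r H*
        module P = Pair SV SW VW

        nonreal-* : ∀ {d m} → InD d → ¬ Real m → ¬ Real (d * m)
        nonreal-* {d} {m} dd nr e = nr (*-cancelˡ (InD-≢0 dd) (trans (cong (_* bar m) (sym (InD-real dd))) (trans (sym (bar-* d m)) e)))

        real-* : ∀ {d m} → InD d → Real m → Real (d * m)
        real-* {d} {m} dd rm = trans (bar-* d m) (cong₂ _*_ (InD-real dd) rm)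

        -- The multiplier is forced because the coefficient Tm W 1 0 is nonzero.
        W-χ : ∀ {d} (dd : InD d) → let χ = proj₁ (hom dd) in ∀ z → W (d * z) ≡ χ ⁻¹ * W z
        W-χ {d} dd z = go (real? z)
          where
          χ : Carrier
          χ = proj₁ (hom dd)
          χ≢0 : χ ≢ 0#
          χ≢0 = proj₁ (proj₂ (hom dd))
          go : Dec (Real z) → W (d * z) ≡ χ ⁻¹ * W z
          go (yes rz) = trans (A*.V-real (real-* dd rz)) (sym (trans (cong (χ ⁻¹ *_) (A*.V-real rz)) (zeroʳ _)))
          go (no nr) = trans (A*.V-nonreal (nonreal-* dd nr)) (trans (cong _⁻¹ (proj₂ (proj₂ (hom dd)) nr)) (trans (sym (inv-unique (trans (solve 4 (λ x c y i → (x :* c) :* (y :* i) := (x :* y) :* (c :* i)) refl χ (c z) (χ ⁻¹) (c z ⁻¹)) (trans (cong₂ _*_ (inv-r χ≢0) (inv-r (InD-≢0 (c-D nr)))) (*-identityˡ 1#))))) (cong (χ ⁻¹ *_) (sym (A*.V-nonreal nr)))))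

        -- Substituting d z for z multiplies the coefficient (1, 0) by 1 / (d χ) without changing
        -- it. It is not zero, so d χ = 1.
        W-hom : ∀ {d} → InD d → ∀ z → W (d * z) ≡ d * W z
        W-hom {d} dd z = trans (W-χ dd z) (cong (_* W z) (*-cancelˡ (inv≢0 d≢0) (trans d⁻¹χ⁻¹ (sym (inv-l d≢0)))))
          where
          χ : Carrier
          χ = proj₁ (hom dd)
          d≢0 : d ≢ 0#
          d≢0 = InD-≢0 dd
          d⁻¹χ⁻¹ : d ⁻¹ * χ ⁻¹ ≡ 1#
          d⁻¹χ⁻¹ = *-cancelˡ P.TmW≢0 (begin
            Tm W 1 0 * (d ⁻¹ * χ ⁻¹) ≡⟨ *-comm _ _ ⟩
            (d ⁻¹ * χ ⁻¹) * Tm W 1 0 ≡⟨ ∑-*ˡ (d ⁻¹ * χ ⁻¹) _ nz ⟩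
            ∑ (λ z → (d ⁻¹ * χ ⁻¹) * (W z * ((z ⁻¹) ^ 1 * bzi z ^ 0))) nz ≡⟨ FΣ.big-cong∈ nz (λ {z} m∈ → sym (pt (nz∈ m∈))) ⟩
            ∑ (λ z → W (d * z) * (((d * z) ⁻¹) ^ 1 * bzi (d * z) ^ 0)) nz ≡⟨ FΣ.big-perm (λ z → W z * ((z ⁻¹) ^ 1 * bzi z ^ 0)) (d *_) _≟_ nz-unique (λ m∈ → ∈nz (*-≢0 d≢0 (nz∈ m∈))) (λ _ _ → *-cancelˡ d≢0) ⟩
            Tm W 1 0 ≡⟨ *-identityʳ _ ⟨
            Tm W 1 0 * 1# ∎)
            where
            open ≡-Reasoning
            pt : ∀ {z} → z ≢ 0# → W (d * z) * (((d * z) ⁻¹) ^ 1 * bzi (d * z) ^ 0) ≡ (d ⁻¹ * χ ⁻¹) * (W z * ((z ⁻¹) ^ 1 * bzi z ^ 0))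
            pt {z} ze = trans (cong₂ (λ s t → s * (t ^ 1 * 1#)) (W-χ dd z) (sym (inv-unique (trans (solve 4 (λ d z i j → (d :* z) :* (i :* j) := (d :* i) :* (z :* j)) refl d z (d ⁻¹) (z ⁻¹)) (trans (cong₂ _*_ (inv-r d≢0) (inv-r ze)) (*-identityˡ 1#))))))
              (solve 4 (λ x w d i → (x :* w) :* (((d :* i) :* :1) :* :1) := (d :* x) :* (w :* ((i :* :1) :* :1))) refl (χ ⁻¹) (W z) (d ⁻¹) (z ⁻¹))

        -- The product with W has degree two by `VW`, W has degree one, and W has no zeros outside
        -- GF(q).
        V'-hom : ∀ {d} → InD d → ∀ z → V (bar (d * z)) ≡ d * V (bar z)
        V'-hom {d} dd z = go (real? z)
          where
          go : Dec (Real z) → V (bar (d * z)) ≡ d * V (bar z)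
          go (yes rz) = trans (A.V-real (cong bar (real-* dd rz))) (sym (trans (cong (d *_) (A.V-real (cong bar rz))) (zeroʳ d)))
          go (no nr) = *-cancelˡ (*-≢0 (InD-≢0 dd) W≢0) (begin
            (d * W z) * V (bar (d * z)) ≡⟨ trans (*-comm _ _) (cong (V (bar (d * z)) *_) (sym (W-hom dd z))) ⟩
            V (bar (d * z)) * W (d * z) ≡⟨ VW (d * z) ⟩
            - ((d * z - bar (d * z)) * (d * z - bar (d * z))) ≡⟨ cong (λ t → - ((d * z - t) * (d * z - t))) (trans (bar-* d z) (cong (_* bar z) (InD-real dd))) ⟩
            - ((d * z - d * bar z) * (d * z - d * bar z)) ≡⟨ solve 3 (λ d z b → :- ((d :* z :- d :* b) :* (d :* z :- d :* b)) := (d :* d) :* (:- ((z :- b) :* (z :- b)))) refl d z (bar z) ⟩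
            (d * d) * - ((z - bar z) * (z - bar z)) ≡⟨ cong ((d * d) *_) (sym (VW z)) ⟩
            (d * d) * (V (bar z) * W z) ≡⟨ solve 3 (λ d v w → (d :* d) :* (v :* w) := (d :* w) :* (d :* v)) refl d (V (bar z)) (W z) ⟩
            (d * W z) * (d * V (bar z)) ∎)
            where
            open ≡-Reasoning
            W≢0 : W z ≢ 0#
            W≢0 e = inv≢0 (InD-≢0 (c-D nr)) (trans (sym (A*.V-nonreal nr)) e)

        module HW = Homogeneous SW W-hom
        module HV = Homogeneous (sparse-bar SV) V'-hom

        y^q : ∀ {z} → z ≢ 0# → (yq z ^ p) ^ Q ≡ bar z * z ⁻¹
        y^q {z} ne = trans (^-assocʳ (yq z) p Q) (trans (cong (yq z ^_) (sym q≡p*Q)) (trans (bar-* z (bzi z)) (cong (bar z *_) (bar-bar (z ⁻¹)))))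

        sq : ∀ t → (1# - t) ^ (Q +ℕ Q) ≡ (1# - t ^ Q) * (1# - t ^ Q)
        sq t = trans (^-homo-* (1# - t) Q Q) (cong₂ _*_ (frob-Q t) (frob-Q t))

        -- t^Q = (z / z̄)^q = z̄ / z, so `VW` becomes - z² (1 - t^Q)², and Frobenius takes the
        -- exponent Q out of the bracket.
        on-y : ∀ {z} → z ≢ 0# → eval HW.series (yq z ^ p) * eval HV.series (yq z ^ p) ≡ - 1# * (1# - yq z ^ p) ^ (Q +ℕ Q)
        on-y {z} ne = *-cancelˡ (*-≢0 ne ne) (begin
          (z * z) * (eval HW.series t * eval HV.series t) ≡⟨ solve 3 (λ z a b → (z :* z) :* (a :* b) := (z :* b) :* (z :* a)) refl z (eval HW.series t) (eval HV.series t) ⟩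
          (z * eval HV.series t) * (z * eval HW.series t) ≡⟨ cong₂ _*_ (sym (HV.expansion ne)) (sym (HW.expansion ne)) ⟩
          V (bar z) * W z ≡⟨ VW z ⟩
          - ((z - bar z) * (z - bar z)) ≡⟨ cong (λ b → - ((z - b) * (z - b))) bz ⟩
          - ((z - z * t ^ Q) * (z - z * t ^ Q)) ≡⟨ solve 2 (λ z s → :- ((z :- z :* s) :* (z :- z :* s)) := (z :* z) :* ((:- :1) :* ((:1 :- s) :* (:1 :- s)))) refl z (t ^ Q) ⟩
          (z * z) * (- 1# * ((1# - t ^ Q) * (1# - t ^ Q))) ≡⟨ cong (λ s → (z * z) * (- 1# * s)) (sym (sq t)) ⟩
          (z * z) * (- 1# * (1# - t) ^ (Q +ℕ Q)) ∎)
          where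
          open ≡-Reasoning
          t : Carrier
          t = yq z ^ p
          bz : bar z ≡ z * t ^ Q
          bz = sym (trans (cong (z *_) (y^q ne)) (trans (solve 3 (λ z b i → z :* (b :* i) := b :* (z :* i)) refl z (bar z) (z ⁻¹)) (trans (cong (bar z *_) (inv-r ne)) (*-identityʳ _))))

        μs : List Carrier
        μs = filter (λ x → Nm x ≟ 1#) nz

        on-μ : ∀ {t} → t ∈ μs → eval HW.series t * eval HV.series t ≡ - 1# * (1# - t) ^ (Q +ℕ Q)
        on-μ {t} t∈ = via (hilbert90 {y} nmy)
          where
          nt : Nm t ≡ 1#
          nt = proj₂ (∈-filter⁻ (λ x → Nm x ≟ 1#) {xs = nz} t∈)
          y : Carrier
          y = bar t ^ Q
          -- since t^q = 1/t, the p-th power of (t^q)^(q/p) is t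
          yp : y ^ p ≡ t
          yp = trans (^-assocʳ (bar t) Q p) (trans (cong (bar t ^_) (trans (ℕₚ.*-comm Q p) (sym q≡p*Q))) (bar-bar t))
          nmy : Nm y ≡ 1#
          nmy = trans (^-assocʳ (bar t) Q q+1) (trans (cong (bar t ^_) (ℕₚ.*-comm Q q+1)) (trans (sym (^-assocʳ (bar t) q+1 Q)) (trans (cong (_^ Q) (trans (cong (bar t *_) (bar-bar t)) (trans (*-comm _ _) nt))) (1^ Q))))
          via : (∃ λ z → z ≢ 0# × yq z ≡ y) → eval HW.series t * eval HV.series t ≡ - 1# * (1# - t) ^ (Q +ℕ Q)
          via (z , ne , e) = subst (λ t → eval HW.series t * eval HV.series t ≡ - 1# * (1# - t) ^ (Q +ℕ Q)) (trans (cong (_^ p) e) yp) (on-y ne)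

        -- Both sides have at most 2Q + 1 coefficients, no more than the q + 1 elements of norm 1 on
        -- which they agree.
        product : ∀ x → eval HW.series x * eval HV.series x ≡ - 1# * (1# - x) ^ (Q +ℕ Q)
        product x = x-y≡0 (trans (sym (ev x)) (many-roots B (Uniqₚ.filter⁺ (λ x → Nm x ≟ 1#) nz-unique) (λ {t} t∈ → trans (ev t) (trans (cong (_- - 1# * (1# - t) ^ (Q +ℕ Q)) (on-μ t∈)) (-‿inverseʳ _))) len x))
          where
          B : Poly
          B = mulP HW.series HV.series ⊹ powP 1-x (Q +ℕ Q)
          ev : ∀ x → eval B x ≡ eval HW.series x * eval HV.series x - - 1# * (1# - x) ^ (Q +ℕ Q)
          ev x = trans (eval-⊹ (mulP HW.series HV.series) (powP 1-x (Q +ℕ Q)) x) (cong₂ _+_ (eval-mulP HW.series HV.series x) (trans (eval-pow (Q +ℕ Q) x) (solve 1 (λ w → w := :- ((:- :1) :* w)) refl _)))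
          len : length B ≤ length μs
          len = ℕₚ.≤-trans (length-⊹ (mulP HW.series HV.series) (powP 1-x (Q +ℕ Q)) (length-mulP HW.series HV.series HW.length-series HV.length-series) (ℕₚ.≤-trans (length-powP 1-x (Q +ℕ Q) {1} ℕₚ.≤-refl) (s≤s (ℕₚ.≤-reflexive (ℕₚ.*-identityʳ _))))) (ℕₚ.≤-trans (s≤s 2Q≤q) (ℕₚ.≤-reflexive (sym (Nm-fibre (1^ q-1)))))

      -- The factor belonging to W has to be a multiple of (1 - t)^Q = 1 - m̄/m, so 1/c(m) is a
      -- multiple of m - m̄.
      classical-c : ∃ λ λ₀ → ∀ {m} → ¬ Real m → c m * (λ₀ * (m - bar m)) ≡ 1#
      classical-c = fin (factor (Q +ℕ Q) HW.series HV.series Q Q (- 1#) (neg≢0 1≢0) HW.length-series HV.length-series ℕₚ.≤-refl bd product)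
        where
        bd : Q +ℕ Q ≤ q²-1
        bd = ℕₚ.≤-trans 2Q≤q (ℕₚ.≤-trans (ℕₚ.≤-trans (ℕₚ.n≤1+n q) (ℕₚ.m≤m+n q+1 (r *ℕ q+1))) (ℕₚ.≤-reflexive (sym q²-1-def)))
        fin : (∃ λ c₁ → ∀ x → eval HW.series x ≡ c₁ * (1# - x) ^ Q) × _ → ∃ λ λ₀ → ∀ {m} → ¬ Real m → c m * (λ₀ * (m - bar m)) ≡ 1#
        fin ((c₁ , e) , _) = c₁ , λ {m} nr → trans (cong (c m *_) (sym (wm nr))) (inv-r (InD-≢0 (c-D nr)))
          where
          wm : ∀ {m} → ¬ Real m → c m ⁻¹ ≡ c₁ * (m - bar m)
          wm {m} nr = begin
            c m ⁻¹ ≡⟨ A*.V-nonreal nr ⟨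
            W m ≡⟨ HW.expansion m≢0 ⟩
            m * eval HW.series (yq m ^ p) ≡⟨ cong (m *_) (trans (e (yq m ^ p)) (cong (c₁ *_) (trans (frob-Q (yq m ^ p)) (cong (λ t → 1# - t) (y^q m≢0))))) ⟩
            m * (c₁ * (1# - bar m * m ⁻¹)) ≡⟨ solve 4 (λ m c b i → m :* (c :* (:1 :- b :* i)) := c :* (m :- b :* (m :* i))) refl m c₁ (bar m) (m ⁻¹) ⟩
            c₁ * (m - bar m * (m * m ⁻¹)) ≡⟨ cong (λ t → c₁ * (m - t)) (trans (cong (bar m *_) (inv-r m≢0)) (*-identityʳ _)) ⟩
            c₁ * (m - bar m) ∎
            where
            open ≡-Reasoning
            m≢0 : m ≢ 0#
            m≢0 = nonreal-≢0 nr

  -- The unital in coordinates centred at the common point of two tangents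

  module CentredUnital where
    open FieldArithmetic
    open LacunaryPolynomials
    open Duality
    open NormForm

    -- `S` is the affine part and `Sg` the set of slopes of the points at infinity other than the
    -- vertical one. P has slope 0, Q is vertical, and the two axes are their tangents. The
    -- stabiliser is a list of pairs (a, b) acting diagonally.
    record Data : Set₁ where
      field
        S : Carrier → Carrier → Set
        S? : ∀ x y → Dec (S x y)
        Sg : Carrier → Set
        Sg? : ∀ α → Dec (Sg α)
        line : ∀ α β → length (filter (λ x → S? x (α * x + β)) el) +ℕ ind (Sg? α) ≡ 1 ⊎ length (filter (λ x → S? x (α * x + β)) el) +ℕ ind (Sg? α) ≡ q+1
        vertical : ∀ x → length (filter (S? x) el) ≤ q
        Sg-0 : Sg 0#
        Sg-count : length (filter Sg? el) ≡ q
        axis₁ : ∀ x → ¬ S x 0#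
        axis₂ : ∀ y → ¬ S 0# y
        point : ∃₂ S
        gs : List (Carrier × Carrier)
        gs-unique : Unique gs
        gs-length : length gs ≡ q²-1
        gs-≢0 : ∀ {g} → g ∈ gs → proj₁ g ≢ 0# × proj₂ g ≢ 0#
        gs-S : ∀ {g} → g ∈ gs → ∀ {x y} → S x y → S (proj₁ g * x) (proj₂ g * y)
        gs-Sg : ∀ {g} → g ∈ gs → ∀ {α} → Sg α → Sg ((proj₂ g * proj₁ g ⁻¹) * α)

    nonempty : {X : Set} (xs : List X) {n : ℕ} → length xs ≡ suc n → ∃ λ x → x ∈ xs
    nonempty (x ∷ xs) _ = x , here refl

    module _ (D : Data) where
      open Data D

      private
        x₀ y₀ m₀ : Carrier
        x₀ = proj₁ point
        y₀ = proj₁ (proj₂ point)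
        m₀ = y₀ * x₀ ⁻¹

        S₀ : S x₀ y₀
        S₀ = proj₂ (proj₂ point)

        S-x : ∀ {x y} → S x y → x ≢ 0#
        S-x s refl = axis₂ _ s

        Σl : List Carrier
        Σl = filter Sg? nz

        Σl-unique : Unique Σl
        Σl-unique = Uniqₚ.filter⁺ Sg? nz-unique

        ∈Σl : ∀ {α} → Sg α → α ≢ 0# → α ∈ Σl
        ∈Σl s ne = ∈-filter⁺ Sg? (∈nz ne) s

        Σl∈ : ∀ {α} → α ∈ Σl → Sg α × α ≢ 0#
        Σl∈ m = proj₂ (∈-filter⁻ Sg? {xs = nz} m) , nz∈ (proj₁ (∈-filter⁻ Sg? {xs = nz} m))

        Σl-length : length Σl ≡ q-1
        Σl-length = ℕₚ.suc-injective (trans (ℕₚ.+-comm 1 (length Σl)) (trans (cong₂ _+ℕ_ refl (sym (ind-yes (Sg? 0#) Sg-0))) (trans (sym (count-remove Sg? el-unique (el-complete 0#))) Sg-count)))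

        -- The unit of slope: division by it will carry `Sg` to GF(q).
        s₀ : Carrier
        s₀ = proj₁ (nonempty Σl Σl-length)

        s₀∈ : s₀ ∈ Σl
        s₀∈ = proj₂ (nonempty Σl Σl-length)

        s₀≢0 : s₀ ≢ 0#
        s₀≢0 = proj₂ (Σl∈ s₀∈)

        origin : ∀ α → length (filter (λ x → S? x (α * x)) el) +ℕ ind (Sg? α) ≡ 1 ⊎ length (filter (λ x → S? x (α * x)) el) +ℕ ind (Sg? α) ≡ q+1
        origin α = subst (λ n → n +ℕ ind (Sg? α) ≡ 1 ⊎ n +ℕ ind (Sg? α) ≡ q+1) (count-cong (λ x → S? x (α * x + 0#)) (λ x → S? x (α * x)) el (λ {x} _ → subst (S x) (+-identityʳ _)) (λ {x} _ → subst (S x) (sym (+-identityʳ _)))) (line α 0#)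

        two-values-≤ : ∀ {n : ℕ} → n ≡ 1 ⊎ n ≡ q+1 → n ≤ q+1
        two-values-≤ (inj₁ refl) = s≤s z≤n
        two-values-≤ (inj₂ refl) = ℕₚ.≤-refl

        origin-≤ : ∀ α → length (filter (λ x → S? x (α * x)) el) ≤ q+1
        origin-≤ α = ℕₚ.≤-trans (ℕₚ.m≤m+n _ _) (two-values-≤ (origin α))

        ratio : Carrier × Carrier → Carrier
        ratio g = (proj₂ g * proj₁ g ⁻¹) * s₀

        fibre-list : Carrier → List (Carrier × Carrier)
        fibre-list σ = filter (λ g → ratio g ≟ σ) gs

        -- Elements with equal ratio b / a move the chosen point along one line through the origin
        -- and are determined by its image, and that line has at most q + 1 affine points of the
        -- unital.
        fibre-≤ : ∀ σ → length (fibre-list σ) ≤ q+1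
        fibre-≤ σ = ℕₚ.≤-trans (count-inj (λ g → ratio g ≟ σ) (λ x → S? x (m' * x)) gs-unique (λ g → proj₁ g * x₀) to inj) (origin-≤ m')
          where
          m' : Carrier
          m' = (σ * s₀ ⁻¹) * m₀
          b≡ : ∀ {g} → g ∈ gs → ratio g ≡ σ → proj₂ g ≡ (σ * s₀ ⁻¹) * proj₁ g
          b≡ {a , b} g∈ e = sym (trans (cong (λ t → (t * s₀ ⁻¹) * a) (sym e)) (trans (solve 5 (λ b i s j a → (((b :* i) :* s) :* j) :* a := b :* ((i :* a) :* (s :* j))) refl b (a ⁻¹) s₀ (s₀ ⁻¹) a) (trans (cong₂ (λ s t → b * (s * t)) (inv-l (proj₁ (gs-≢0 g∈))) (inv-r s₀≢0)) (solve 1 (λ b → b :* (:1 :* :1) := b) refl b))))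
          to : ∀ {g} → g ∈ gs → ratio g ≡ σ → proj₁ g * x₀ ∈ el × S (proj₁ g * x₀) (m' * (proj₁ g * x₀))
          to {a , b} g∈ e = el-complete _ , subst (S (a * x₀)) (trans (cong (_* y₀) (b≡ g∈ e)) (trans (cong (((σ * s₀ ⁻¹) * a) *_) (sym (*-/ y₀ (S-x S₀)))) (solve 4 (λ t a m x → (t :* a) :* (m :* x) := (t :* m) :* (a :* x)) refl (σ * s₀ ⁻¹) a m₀ x₀))) (gs-S g∈ S₀)
          inj : ∀ {g h} → g ∈ gs → h ∈ gs → ratio g ≡ σ → ratio h ≡ σ → proj₁ g * x₀ ≡ proj₁ h * x₀ → g ≡ h
          inj {a , b} {a' , b'} g∈ h∈ eg eh e = cong₂ _,_ aa (trans (b≡ g∈ eg) (trans (cong ((σ * s₀ ⁻¹) *_) aa) (sym (b≡ h∈ eh))))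
            where
            aa : a ≡ a'
            aa = *-cancelˡ (S-x S₀) (trans (*-comm _ _) (trans e (*-comm _ _)))

        ratio-≢0 : ∀ {g} → g ∈ gs → proj₂ g * proj₁ g ⁻¹ ≢ 0#
        ratio-≢0 g∈ = *-≢0 (proj₂ (gs-≢0 g∈)) (inv≢0 (proj₁ (gs-≢0 g∈)))

        fibre-total : sumℕ (λ σ → length (fibre-list σ)) Σl ≡ q²-1
        fibre-total = trans (ℕΣ.big-cong Σl (λ σ → count-ind (λ g → ratio g ≟ σ) gs))
          (trans (count-fibres (λ _ → yes tt) _≟_ ratio gs Σl-unique (λ g∈ _ → ∈Σl (gs-Sg g∈ (proj₁ (Σl∈ s₀∈))) (*-≢0 (ratio-≢0 g∈) s₀≢0))) (trans (count-all (λ _ → yes tt) gs (λ _ → tt)) gs-length))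

        -- q - 1 slopes, at most q + 1 elements for each, q² - 1 elements in all. So the stabiliser
        -- is transitive on the nonzero slopes and contains exactly q + 1 homotheties.
        fibre-= : ∀ {σ} → σ ∈ Σl → length (fibre-list σ) ≡ q+1
        fibre-= = sumℕ-tight (λ σ → length (fibre-list σ)) q+1 Σl (λ {σ} _ → fibre-≤ σ) (ℕₚ.≤-reflexive (trans (cong (_*ℕ q+1) Σl-length) (trans (sym q²-1-def) (sym fibre-total))))

        Kl : List Carrier
        Kl = map proj₁ (fibre-list s₀)

        K-b : ∀ {g} → g ∈ fibre-list s₀ → proj₂ g ≡ proj₁ g
        K-b {a , b} m = *-cancelˡ (inv≢0 a≢0) (trans (*-comm _ _) (trans (*-cancelˡ s₀≢0 (trans (*-comm _ _) (trans (proj₂ fm) (sym (*-identityʳ s₀))))) (sym (inv-l a≢0))))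
          where
          fm = ∈-filter⁻ (λ g → ratio g ≟ s₀) {xs = gs} m
          a≢0 : a ≢ 0#
          a≢0 = proj₁ (gs-≢0 (proj₁ fm))

        Kl∈ : ∀ {a} → a ∈ Kl → (a , a) ∈ gs
        Kl∈ m = go (∈-map⁻ proj₁ m)
          where
          go : ∀ {a} → (∃ λ g → g ∈ fibre-list s₀ × a ≡ proj₁ g) → (a , a) ∈ gs
          go ((a , b) , g∈ , refl) = subst (λ t → (a , t) ∈ gs) (K-b g∈) (proj₁ (∈-filter⁻ (λ g → ratio g ≟ s₀) {xs = gs} g∈))

        Kl-unique : Unique Kl
        Kl-unique = unique-map (Uniqₚ.filter⁺ (λ g → ratio g ≟ s₀) gs-unique) (λ { {a , b} {a' , b'} g∈ h∈ e → cong₂ _,_ e (trans (K-b g∈) (trans e (sym (K-b h∈)))) })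

        Kl-length : length Kl ≡ q+1
        Kl-length = trans (Listₚ.length-map proj₁ (fibre-list s₀)) (fibre-= s₀∈)

        X₀ : List Carrier
        X₀ = filter (λ x → S? x (m₀ * x)) el

        X₀-length : length X₀ ≡ q+1
        X₀-length = ℕₚ.≤-antisym (origin-≤ m₀) (ℕₚ.≤-trans (ℕₚ.≤-reflexive (sym (trans (Listₚ.length-map (_* x₀) Kl) Kl-length)))
          (length-⊆ (unique-map Kl-unique (λ _ _ e → *-cancelˡ (S-x S₀) (trans (*-comm _ _) (trans e (*-comm _ _))))) sub))
          where
          sub : ∀ {z} → z ∈ map (_* x₀) Kl → z ∈ X₀
          sub m with ∈-map⁻ (_* x₀) m
          ... | a , a∈ , refl = ∈-filter⁺ (λ x → S? x (m₀ * x)) (el-complete _) (subst (S (a * x₀)) (trans (cong (a *_) (sym (*-/ y₀ (S-x S₀)))) (solve 3 (λ a m x → a :* (m :* x) := m :* (a :* x)) refl a m₀ x₀)) (gs-S (Kl∈ a∈) S₀))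

        -- A homothety permutes the q + 1 affine points on the line of slope m₀ through the origin,
        -- so `lagrange` gives a^(q+1) = 1.
        K-norm : ∀ {a} → a ∈ Kl → Nm a ≡ 1#
        K-norm {a} a∈ = trans (cong (a ^_) (sym X₀-length)) (lagrange (proj₁ (gs-≢0 (Kl∈ a∈))) (Uniqₚ.filter⁺ (λ x → S? x (m₀ * x)) el-unique)
          (λ m → S-x (proj₂ (∈-filter⁻ (λ x → S? x (m₀ * x)) {xs = el} m)))
          (λ {x} m → ∈-filter⁺ (λ x → S? x (m₀ * x)) (el-complete _) (subst (S (a * x)) (solve 3 (λ a m x → a :* (m :* x) := m :* (a :* x)) refl a m₀ x) (gs-S (Kl∈ a∈) (proj₂ (∈-filter⁻ (λ x → S? x (m₀ * x)) {xs = el} m))))))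

        norm-1-K : ∀ {a} → Nm a ≡ 1# → a ∈ Kl
        norm-1-K {a} e = ⊆-full _≟_ Kl-unique (λ m → ∈-filter⁺ (λ x → Nm x ≟ 1#) (∈nz (proj₁ (gs-≢0 (Kl∈ m)))) (K-norm m)) (ℕₚ.≤-reflexive (trans (Nm-fibre (1^ q-1)) (sym Kl-length)))
          (∈-filter⁺ (λ x → Nm x ≟ 1#) (∈nz (λ z → 1≢0 (trans (sym e) (trans (cong Nm z) Nm-0)))) e)

        -- The quotient of the two x-coordinates has norm 1 and is therefore the factor of a
        -- homothety in the stabiliser.
        same-norm : ∀ {x x' m} → S x (m * x) → Nm x' ≡ Nm x → S x' (m * x')
        same-norm {x} {x'} {m} s e = subst (λ t → S t (m * t)) ax (subst (S (a * x)) (solve 3 (λ a m x → a :* (m :* x) := m :* (a :* x)) refl a m x) (gs-S (Kl∈ (norm-1-K na)) s))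
          where
          x≢0 : x ≢ 0#
          x≢0 = S-x s
          a : Carrier
          a = x' * x ⁻¹
          ax : a * x ≡ x'
          ax = *-/ x' x≢0
          na : Nm a ≡ 1#
          na = *-cancelˡ (Nm-≢0 x≢0) (trans (*-comm _ _) (trans (sym (Nm-* a x)) (trans (cong Nm ax) (trans e (sym (*-identityʳ _))))))

        move : ∀ {σ} → σ ∈ Σl → ∃ λ g → g ∈ gs × ratio g ≡ σ
        move {σ} σ∈ = go (nonempty (fibre-list σ) (fibre-= σ∈))
          where
          go : (∃ λ g → g ∈ fibre-list σ) → ∃ λ g → g ∈ gs × ratio g ≡ σ
          go (g , g∈) = g , ∈-filter⁻ (λ g → ratio g ≟ σ) {xs = gs} g∈

        -- An element carrying s₀ to σ multiplies the q - 1 nonzero slopes at infinity by σ / s₀, so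
        -- `lagrange` applies to them.
        slope-D : ∀ {σ} → σ ∈ Σl → InD (σ * s₀ ⁻¹)
        slope-D {σ} σ∈ = trans (cong (_^ q-1) (sym d≡)) (trans (cong ((proj₂ g * proj₁ g ⁻¹) ^_) (sym Σl-length)) (lagrange (ratio-≢0 g∈) Σl-unique (λ m → proj₂ (Σl∈ m)) (λ m → ∈Σl (gs-Sg g∈ (proj₁ (Σl∈ m))) (*-≢0 (ratio-≢0 g∈) (proj₂ (Σl∈ m))))))
          where
          g : Carrier × Carrier
          g = proj₁ (move σ∈)
          g∈ : g ∈ gs
          g∈ = proj₁ (proj₂ (move σ∈))
          e : ratio g ≡ σ
          e = proj₂ (proj₂ (move σ∈))
          d≡ : proj₂ g * proj₁ g ⁻¹ ≡ σ * s₀ ⁻¹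
          d≡ = div-eq s₀≢0 (trans (*-comm _ _) e)

        D-slope : ∀ {d} → InD d → d * s₀ ∈ Σl
        D-slope {d} dd = back (∈-map⁻ (_* s₀ ⁻¹) (⊆-full _≟_ um sub (ℕₚ.≤-reflexive (trans Dl-length (sym (trans (Listₚ.length-map (_* s₀ ⁻¹) Σl) Σl-length)))) (∈Dl dd)))
          where
          um : Unique (map (_* s₀ ⁻¹) Σl)
          um = unique-map Σl-unique (λ _ _ e → *-cancelˡ (inv≢0 s₀≢0) (trans (*-comm _ _) (trans e (*-comm _ _))))
          sub : ∀ {z} → z ∈ map (_* s₀ ⁻¹) Σl → z ∈ Dl
          sub m with ∈-map⁻ (_* s₀ ⁻¹) m
          ... | σ , σ∈ , refl = ∈Dl (slope-D σ∈)
          back : (∃ λ σ → σ ∈ Σl × d ≡ σ * s₀ ⁻¹) → d * s₀ ∈ Σl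
          back (σ , σ∈ , refl) = subst (_∈ Σl) (sym (*-/ σ s₀≢0)) σ∈

        Sg-real : ∀ {α} → Sg (s₀ * α) → Real α
        Sg-real {α} s with α ≟ 0#
        ... | yes refl = bar-0
        ... | no ne = subst Real (sym (trans (sym (trans (*-assoc _ _ _) (trans (cong (α *_) (inv-r s₀≢0)) (*-identityʳ α)))) (cong (_* s₀ ⁻¹) (*-comm α s₀)))) (InD-real (slope-D (∈Σl s (*-≢0 s₀≢0 ne))))

        real-Sg : ∀ {α} → Real α → Sg (s₀ * α)
        real-Sg {α} ra with α ≟ 0#
        ... | yes refl = subst Sg (sym (zeroʳ s₀)) Sg-0
        ... | no ne = subst Sg (*-comm α s₀) (proj₁ (Σl∈ (D-slope (real-InD ra ne))))

        count-slope : Carrier → List Carrier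
        count-slope m = filter (λ x → S? x ((s₀ * m) * x)) el

        full : ∀ {m x} → S x ((s₀ * m) * x) → q+1 ≤ length (count-slope m)
        full {m} {x} s = ℕₚ.≤-trans (ℕₚ.≤-reflexive (sym (Nm-fibre (Nm-InD (S-x s))))) (length-⊆ (Uniqₚ.filter⁺ (λ z → Nm z ≟ Nm x) nz-unique)
          (λ {z} z∈ → ∈-filter⁺ (λ x → S? x ((s₀ * m) * x)) (el-complete z) (same-norm s (proj₂ (∈-filter⁻ (λ z → Nm z ≟ Nm x) {xs = nz} z∈)))))

        -- One affine point on this line would bring q + 1 of them by `full`, and the point at
        -- infinity would be one too many.
        no-real : ∀ {m x} → Real m → ¬ S x ((s₀ * m) * x)
        no-real {m} rm s = ℕₚ.<-irrefl refl (ℕₚ.≤-trans (ℕₚ.≤-trans (ℕₚ.≤-reflexive (ℕₚ.+-comm 1 q+1)) (ℕₚ.+-mono-≤ (full s) (ℕₚ.≤-reflexive (sym (ind-yes (Sg? (s₀ * m)) (real-Sg rm)))))) (two-values-≤ (origin (s₀ * m))))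

        some : ∀ {m} → ¬ Real m → ∃ λ x → x ∈ count-slope m
        some {m} nr = go (count-slope m) (subst (λ n → length (count-slope m) +ℕ n ≡ 1 ⊎ length (count-slope m) +ℕ n ≡ q+1) (ind-no (Sg? (s₀ * m)) (λ s → nr (Sg-real s))) (origin (s₀ * m)))
          where
          go : ∀ xs → length xs +ℕ 0 ≡ 1 ⊎ length xs +ℕ 0 ≡ q+1 → ∃ λ x → x ∈ xs
          go [] (inj₁ ())
          go [] (inj₂ ())
          go (x ∷ xs) _ = x , here refl

        cx : Carrier → Carrier
        cx m with real? m
        ... | yes _ = 1#
        ... | no nr = proj₁ (some nr)

        cx-S : ∀ {m} → ¬ Real m → S (cx m) ((s₀ * m) * cx m)
        cx-S {m} nr with real? m
        ... | yes rm = ⊥-elim (nr rm)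
        ... | no nr' = proj₂ (∈-filter⁻ (λ x → S? x ((s₀ * m) * x)) {xs = el} (proj₂ (some nr')))

        -- The choice of the point is immaterial outside GF(q): by `S-c` all affine points of one
        -- such slope have the same norm of x.
        c : Carrier → Carrier
        c m = Nm (cx m)

        S-c : ∀ {m x} → ¬ Real m → S x ((s₀ * m) * x) → Nm x ≡ c m
        S-c {m} {x} nr s = proj₂ (∈-filter⁻ (λ z → Nm z ≟ c m) {xs = nz} (⊆-full _≟_ (Uniqₚ.filter⁺ (λ z → Nm z ≟ c m) nz-unique)
          (λ {z} z∈ → ∈-filter⁺ (λ x → S? x ((s₀ * m) * x)) (el-complete z) (same-norm (cx-S nr) (proj₂ (∈-filter⁻ (λ z → Nm z ≟ c m) {xs = nz} z∈))))
          (ℕₚ.≤-trans (origin-≤ (s₀ * m)) (ℕₚ.≤-reflexive (sym (Nm-fibre (Nm-InD (S-x (cx-S nr))))))) (∈-filter⁺ (λ x → S? x ((s₀ * m) * x)) (el-complete x) s)))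

        c-S : ∀ {m x} → ¬ Real m → Nm x ≡ c m → S x ((s₀ * m) * x)
        c-S nr e = same-norm (cx-S nr) e

        c-D : ∀ {m} → ¬ Real m → InD (c m)
        c-D nr = Nm-InD (S-x (cx-S nr))

        -- A stabiliser element with b / a = d carries slope m to slope d m and multiplies the norm
        -- of x by N(a).
        hom : ∀ {d} → InD d → ∃ λ χ → χ ≢ 0# × (∀ {m} → ¬ Real m → c (d * m) ≡ χ * c m)
        hom {d} dd = Nm a , Nm-≢0 a≢0 , λ {m} nr → trans (sym (S-c (nonreal-*' nr) (shift (cx-S nr)))) (Nm-* a (cx m))
          where
          a b : Carrier
          a = proj₁ (proj₁ (move (D-slope dd)))
          b = proj₂ (proj₁ (move (D-slope dd)))
          g∈ : (a , b) ∈ gs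
          g∈ = proj₁ (proj₂ (move (D-slope dd)))
          e : ratio (a , b) ≡ d * s₀
          e = proj₂ (proj₂ (move (D-slope dd)))
          a≢0 : a ≢ 0#
          a≢0 = proj₁ (gs-≢0 g∈)
          b≡ : b ≡ d * a
          b≡ = trans (sym (trans (*-assoc _ _ _) (trans (cong (b *_) (inv-l a≢0)) (*-identityʳ b)))) (cong (_* a) (*-cancelˡ s₀≢0 (trans (*-comm _ _) (trans e (*-comm _ _)))))
          nonreal-*' : ∀ {m} → ¬ Real m → ¬ Real (d * m)
          nonreal-*' {m} nr e = nr (*-cancelˡ (InD-≢0 dd) (trans (cong (_* bar m) (sym (InD-real dd))) (trans (sym (bar-* d m)) e)))
          shift : ∀ {m x} → S x ((s₀ * m) * x) → S (a * x) ((s₀ * (d * m)) * (a * x))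
          shift {m} {x} s = subst (S (a * x)) (trans (cong (_* ((s₀ * m) * x)) b≡) (solve 5 (λ d a s m x → (d :* a) :* ((s :* m) :* x) := (s :* (d :* m)) :* (a :* x)) refl d a s₀ m x)) (gs-S g∈ s)

        fα : Carrier → Carrier → Carrier
        fα α m = c m * Nm (m - α)

        root-of : ∀ {u} → InD u → ∃ λ β → β ≢ 0# × Nm β ≡ u
        root-of {u} d = go (nonempty (filter (λ x → Nm x ≟ u) nz) (Nm-fibre d))
          where
          go : (∃ λ β → β ∈ filter (λ x → Nm x ≟ u) nz) → ∃ λ β → β ≢ 0# × Nm β ≡ u
          go (β , β∈) = β , nz∈ (proj₁ (∈-filter⁻ (λ x → Nm x ≟ u) {xs = nz} β∈)) , proj₂ (∈-filter⁻ (λ x → Nm x ≟ u) {xs = nz} β∈)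

        -- On y = s₀ (α x + β) the point of slope s₀ m has x = β / (m - α). It lies in `S` when N(x)
        -- = c(m), that is, c(m) N(m - α) = N(β).
        line-cnt : ∀ α {u} (d : InD u) → length (filter (λ x → S? x ((s₀ * α) * x + s₀ * proj₁ (root-of d))) el) ≡ cnt (fα α) u
        line-cnt α {u} d = count-bij (λ x → S? x ((s₀ * α) * x + s₀ * β)) (λ m → fα α m ≟ u) el-unique Ml-unique (λ x → α + β * x ⁻¹) (λ m → β * (m - α) ⁻¹) fw bw
          where
          β : Carrier
          β = proj₁ (root-of d)
          β≢0 : β ≢ 0#
          β≢0 = proj₁ (proj₂ (root-of d))
          Nβ : Nm β ≡ u
          Nβ = proj₂ (proj₂ (root-of d))
          fw : ∀ {x} → x ∈ el → S x ((s₀ * α) * x + s₀ * β) → α + β * x ⁻¹ ∈ Ml × fα α (α + β * x ⁻¹) ≡ u × β * ((α + β * x ⁻¹) - α) ⁻¹ ≡ x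
          fw {x} _ s = ∈Ml nr , val , trans (cong (λ t → β * t ⁻¹) m-α) back
            where
            x≢0 : x ≢ 0#
            x≢0 = S-x s
            m : Carrier
            m = α + β * x ⁻¹
            m-α : m - α ≡ β * x ⁻¹
            m-α = solve 2 (λ a b → (a :+ b) :- a := b) refl α (β * x ⁻¹)
            s' : S x ((s₀ * m) * x)
            s' = subst (S x) (sym (trans (solve 5 (λ s a b i x → (s :* (a :+ b :* i)) :* x := (s :* a) :* x :+ s :* (b :* (i :* x))) refl s₀ α β (x ⁻¹) x) (cong (λ t → (s₀ * α) * x + s₀ * t) (trans (cong (β *_) (inv-l x≢0)) (*-identityʳ β))))) s
            nr : ¬ Real m
            nr rm = no-real rm s'
            val : fα α m ≡ u
            val = trans (cong₂ (λ a b → a * Nm b) (sym (S-c nr s')) m-α) (trans (sym (Nm-* x (β * x ⁻¹))) (trans (cong Nm (trans (solve 3 (λ x b i → x :* (b :* i) := b :* (x :* i)) refl x β (x ⁻¹)) (trans (cong (β *_) (inv-r x≢0)) (*-identityʳ β)))) Nβ))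
            back : β * (β * x ⁻¹) ⁻¹ ≡ x
            back = trans (cong (β *_) (sym (inv-unique {β * x ⁻¹} {x * β ⁻¹} (trans (solve 4 (λ b i x j → (b :* i) :* (x :* j) := (b :* j) :* (x :* i)) refl β (x ⁻¹) x (β ⁻¹)) (trans (cong₂ _*_ (inv-r β≢0) (inv-r x≢0)) (*-identityˡ 1#)))))) (trans (solve 3 (λ b x j → b :* (x :* j) := x :* (b :* j)) refl β x (β ⁻¹)) (trans (cong (x *_) (inv-r β≢0)) (*-identityʳ x)))
          bw : ∀ {m} → m ∈ Ml → fα α m ≡ u → β * (m - α) ⁻¹ ∈ el × S (β * (m - α) ⁻¹) ((s₀ * α) * (β * (m - α) ⁻¹) + s₀ * β) × α + β * (β * (m - α) ⁻¹) ⁻¹ ≡ m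
          bw {m} m∈ e = el-complete _ , subst (S x) eq (c-S nr nx) , trans (cong (α +_) back) (solve 2 (λ a m → a :+ (m :- a) := m) refl α m)
            where
            nr : ¬ Real m
            nr = Ml∈ m∈
            x : Carrier
            x = β * (m - α) ⁻¹
            mα : m - α ≢ 0#
            mα z = InD-≢0 d (trans (sym e) (trans (cong (λ t → c m * Nm t) z) (trans (cong (c m *_) Nm-0) (zeroʳ _))))
            xm : x * (m - α) ≡ β
            xm = *-/ β mα
            nx : Nm x ≡ c m
            nx = *-cancelˡ (Nm-≢0 mα) (trans (*-comm _ _) (trans (sym (Nm-* x (m - α))) (trans (cong Nm xm) (trans Nβ (trans (sym e) (*-comm _ _))))))
            eq : (s₀ * m) * x ≡ (s₀ * α) * x + s₀ * β
            eq = trans (solve 4 (λ s m x a → (s :* m) :* x := (s :* a) :* x :+ s :* (x :* (m :- a))) refl s₀ m x α) (cong (λ t → (s₀ * α) * x + s₀ * t) xm)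
            back : β * x ⁻¹ ≡ m - α
            back = trans (cong (β *_) (sym (inv-unique {x} {(m - α) * β ⁻¹} (trans (sym (*-assoc _ _ _)) (trans (cong (_* β ⁻¹) xm) (inv-r β≢0)))))) (trans (solve 3 (λ b x j → b :* (x :* j) := x :* (b :* j)) refl β (m - α) (β ⁻¹)) (trans (cong ((m - α) *_) (inv-r β≢0)) (*-identityʳ _)))

        line-values : ∀ α {u} → InD u → cnt (fα α) u +ℕ ind (Sg? (s₀ * α)) ≡ 1 ⊎ cnt (fα α) u +ℕ ind (Sg? (s₀ * α)) ≡ q+1
        line-values α d = subst (λ n → n +ℕ ind (Sg? (s₀ * α)) ≡ 1 ⊎ n +ℕ ind (Sg? (s₀ * α)) ≡ q+1) (line-cnt α d) (line (s₀ * α) (s₀ * proj₁ (root-of d)))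

        -- q - 1 values, each taken at most q times, by q (q - 1) elements outside GF(q).
        tight : ∀ (f : Carrier → Carrier) → (∀ {m} → ¬ Real m → InD (f m)) → (∀ {u} → InD u → cnt f u ≤ q) → ∀ {u} → InD u → cnt f u ≡ q
        tight f fd le d = sumℕ-tight (cnt f) q Dl (λ u∈ → le (Dl∈ u∈)) (ℕₚ.≤-reflexive (trans (cong (_*ℕ q) Dl-length) (trans (ℕₚ.*-comm q-1 q) (sym tot)))) (∈Dl d)
          where
          tot : sumℕ (cnt f) Dl ≡ q *ℕ q-1
          tot = trans (ℕΣ.big-cong Dl (λ u → count-ind (λ m → f m ≟ u) Ml)) (trans (count-fibres (λ _ → yes tt) _≟_ f Ml Dl-unique (λ m∈ _ → ∈Dl (fd (Ml∈ m∈)))) (trans (count-all (λ _ → yes tt) Ml (λ _ → tt)) Ml-length))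

        at-∞ : ∀ {u} → InD u → cnt c u ≡ q
        at-∞ = tight c c-D bound
          where
          bound : ∀ {u} → InD u → cnt c u ≤ q
          bound {u} d = ℕₚ.≤-trans (count-inj (λ m → c m ≟ u) (S? x) Ml-unique (λ m → (s₀ * m) * x)
              (λ m∈ e → el-complete _ , c-S (Ml∈ m∈) (trans nx (sym e)))
              (λ _ _ _ _ e → *-cancelˡ s₀≢0 (*-cancelˡ x≢0 (trans (*-comm _ _) (trans e (*-comm _ _)))))) (vertical x)
            where
            x : Carrier
            x = proj₁ (root-of d)
            x≢0 : x ≢ 0#
            x≢0 = proj₁ (proj₂ (root-of d))
            nx : Nm x ≡ u
            nx = proj₂ (proj₂ (root-of d))

        at-real : ∀ {s u} → Real s → InD u → cnt (fα s) u ≡ q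
        at-real {s} rs = tight (fα s) (λ {m} nr → InD-* (c-D nr) (Nm-InD (x≢y⇒x-y≢0 (λ { refl → nr rs })))) bound
          where
          bound : ∀ {u} → InD u → cnt (fα s) u ≤ q
          bound {u} d = ℕₚ.≤-pred (ℕₚ.≤-trans (ℕₚ.≤-reflexive (trans (ℕₚ.+-comm 1 _) (cong (cnt (fα s) u +ℕ_) (sym (ind-yes (Sg? (s₀ * s)) (real-Sg rs)))))) (two-values-≤ (line-values s d)))

        nonreal-values : ∀ {α u} → ¬ Real α → InD u → cnt (fα α) u ≡ 1 ⊎ cnt (fα α) u ≡ q+1
        nonreal-values {α} {u} nr d = subst (λ n → n ≡ 1 ⊎ n ≡ q+1) (trans (cong (cnt (fα α) u +ℕ_) (ind-no (Sg? (s₀ * α)) (λ s → nr (Sg-real s)))) (ℕₚ.+-identityʳ _)) (line-values α d)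

        Vl : Carrier → List Carrier
        Vl α = filter (λ u → cnt (fα α) u ℕₚ.≟ 1) Dl

        -- The q (q - 1) - 1 elements other than α spread over q - 1 values with multiplicities 1 or
        -- q + 1. This falls short of (q - 1)(q + 1) by exactly q, the deficit of a single value.
        Vl-length : ∀ {α} → ¬ Real α → length (Vl α) ≡ 1
        Vl-length {α} nr = ℕₚ.*-cancelˡ-≡ (length (Vl α)) 1 q (ℕₚ.+-cancelˡ-≡ (sumℕ (cnt (fα α)) Dl) _ _ (begin
          sumℕ (cnt (fα α)) Dl +ℕ q *ℕ length (Vl α) ≡⟨ cong (sumℕ (cnt (fα α)) Dl +ℕ_) (trans (cong (q *ℕ_) (count-ind (λ u → cnt (fα α) u ℕₚ.≟ 1) Dl)) (sym (sumℕ-*ˡ q _ Dl))) ⟩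
          sumℕ (cnt (fα α)) Dl +ℕ sumℕ (λ u → q *ℕ ind (cnt (fα α) u ℕₚ.≟ 1)) Dl ≡⟨ ℕΣ.big-∙ _ _ Dl ⟨
          sumℕ (λ u → cnt (fα α) u +ℕ q *ℕ ind (cnt (fα α) u ℕₚ.≟ 1)) Dl ≡⟨ ℕΣ.big-cong∈ Dl (λ u∈ → val (nonreal-values nr (Dl∈ u∈))) ⟩
          sumℕ (λ _ → q+1) Dl ≡⟨ trans (sumℕ-const q+1 Dl) (cong (_*ℕ q+1) Dl-length) ⟩
          q-1 *ℕ q+1 ≡⟨ solveℕ 1 (λ r → (conℕ 1 ⊹ℕ r) ⊛ℕ (conℕ 3 ⊹ℕ r) ⩵ℕ ((conℕ 2 ⊹ℕ r) ⊛ℕ r ⊹ℕ (conℕ 1 ⊹ℕ r)) ⊹ℕ (conℕ 2 ⊹ℕ r) ⊛ℕ conℕ 1) refl r ⟩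
          (q *ℕ r +ℕ q-1) +ℕ q *ℕ 1 ≡⟨ cong (_+ℕ q *ℕ 1) (sym tot) ⟩
          sumℕ (cnt (fα α)) Dl +ℕ q *ℕ 1 ∎))
          where
          open ≡-Reasoning
          open ℕSolver.+-*-Solver using () renaming (solve to solveℕ; con to conℕ; _:+_ to _⊹ℕ_; _:*_ to _⊛ℕ_; _:=_ to _⩵ℕ_)
          val : ∀ {n} → n ≡ 1 ⊎ n ≡ q+1 → n +ℕ q *ℕ ind (n ℕₚ.≟ 1) ≡ q+1
          val (inj₁ refl) = cong suc (ℕₚ.*-identityʳ q)
          val (inj₂ refl) = trans (cong (q+1 +ℕ_) (ℕₚ.*-zeroʳ q)) (ℕₚ.+-identityʳ q+1)
          Ml' : List Carrier
          Ml' = filter (≢? α) Ml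
          drop-α : ∀ {u} → InD u → cnt (fα α) u ≡ length (filter (λ m → fα α m ≟ u) Ml')
          drop-α {u} d = trans (count-remove (λ m → fα α m ≟ u) Ml-unique (∈Ml nr)) (trans (cong (length (filter (λ m → fα α m ≟ u) Ml') +ℕ_) (ind-no (fα α α ≟ u) (λ e → InD-≢0 d (trans (sym e) (trans (cong (λ t → c α * Nm t) (-‿inverseʳ α)) (trans (cong (c α *_) Nm-0) (zeroʳ _))))))) (ℕₚ.+-identityʳ _))
          tot : sumℕ (cnt (fα α)) Dl ≡ q *ℕ r +ℕ q-1
          tot = trans (ℕΣ.big-cong∈ Dl (λ {u} u∈ → trans (drop-α (Dl∈ u∈)) (count-ind (λ m → fα α m ≟ u) Ml')))
            (trans (count-fibres (λ _ → yes tt) _≟_ (fα α) Ml' Dl-unique (λ m∈ _ → let (a , b) = ∈-filter⁻ (≢? α) {xs = Ml} m∈ in ∈Dl (InD-* (c-D (Ml∈ a)) (Nm-InD (x≢y⇒x-y≢0 b)))))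
            (trans (count-all (λ _ → yes tt) Ml' (λ _ → tt)) (ℕₚ.suc-injective (trans (sym (length-remove Ml-unique (∈Ml nr))) (trans Ml-length (trans (ℕₚ.*-suc q r) (trans (ℕₚ.+-comm q (q *ℕ r)) (ℕₚ.+-suc (q *ℕ r) q-1))))))))

        v : Carrier → Carrier
        v α with real? α
        ... | yes _ = 0#
        ... | no nr = proj₁ (nonempty (Vl α) (Vl-length nr))

        v∈ : ∀ {α} → ¬ Real α → v α ∈ Vl α
        v∈ {α} nr with real? α
        ... | yes ra = ⊥-elim (nr ra)
        ... | no nr' = proj₂ (nonempty (Vl α) (Vl-length nr'))

        hyp : Hyp c v
        hyp = record
          { c-D = c-D
          ; v-D = λ {α} nr → Dl∈ (proj₁ (∈-filter⁻ (λ u → cnt (fα α) u ℕₚ.≟ 1) {xs = Dl} (v∈ nr)))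
          ; at-∞ = at-∞
          ; at-real = at-real
          ; at-tangent = λ {α} nr → proj₂ (∈-filter⁻ (λ u → cnt (fα α) u ℕₚ.≟ 1) {xs = Dl} (v∈ nr))
          ; at-secant = λ {α} {u} nr d ne → pick nr d ne (nonreal-values nr d) }
          where
          single : ∀ (xs : List Carrier) {x y} → length xs ≡ 1 → x ∈ xs → y ∈ xs → x ≡ y
          single (_ ∷ []) _ (here refl) (here refl) = refl
          pick : ∀ {α u} → ¬ Real α → InD u → u ≢ v α → cnt (fα α) u ≡ 1 ⊎ cnt (fα α) u ≡ q+1 → cnt (fα α) u ≡ q+1
          pick {α} {u} nr d ne (inj₁ e) = ⊥-elim (ne (single (Vl α) (Vl-length nr) (∈-filter⁺ (λ u → cnt (fα α) u ℕₚ.≟ 1) (∈Dl d) e) (v∈ nr)))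
          pick nr d ne (inj₂ e) = e

        classical : ∃ λ λ₀ → ∀ {m} → ¬ Real m → c m * (λ₀ * (m - bar m)) ≡ 1#
        classical with 1 ℕₚ.≤? r
        ... | yes 1≤r = classical-c 1≤r hyp hom
        -- For q = 2 the group GF(q)* is trivial, so c = 1; and m - m̄ = 1, being nonzero and fixed
        -- by conjugation in characteristic 2.
        ... | no r<1 = 1# , λ {m} nr → trans (cong₂ _*_ (D1 (c-D nr)) (trans (*-identityˡ _) (D1 (real-InD (trans (bar-sub m (bar m)) (trans (cong (λ t → bar m - t) (bar-bar m)) (char2 (m - bar m) (bar m - m) (solve 2 (λ a b → (a :- b) :+ (b :- a) := :0) refl m (bar m))))) (x≢y⇒x-y≢0 (λ e → nr (sym e))))))) (*-identityˡ 1#)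
          where
          r≡0 : r ≡ 0
          r≡0 = ℕₚ.n<1⇒n≡0 (ℕₚ.≰⇒> r<1)
          D1 : ∀ {x} → InD x → x ≡ 1#
          D1 {x} d = trans (sym (*-identityʳ x)) (trans (cong (λ n → x ^ suc n) (sym r≡0)) d)
          1+1 : 1# + 1# ≡ 0#
          1+1 = trans (cong (1# +_) (sym (+-identityʳ 1#))) (trans (cong (λ n → suc (suc n) · 1#) (sym r≡0)) q·1≡0)
          char2 : ∀ x y → x + y ≡ 0# → y ≡ x
          char2 x y e = trans (solve 2 (λ x y → y := (x :+ y) :- x) refl x y) (trans (cong (_- x) e) (trans (+-identityˡ _) (x-y≡0 (trans (solve 1 (λ x → :- x :- x := :- ((:1 :+ :1) :* x)) refl x) (trans (cong (λ t → - (t * x)) 1+1) (trans (cong -_ (zeroˡ x)) -0#≈0#))))))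

      conclusion : ∃₂ λ s λ₀ → s ≢ 0# × λ₀ ≢ 0# × bar λ₀ ≡ - λ₀
        × (∀ α → (Sg (s * α) → Real α) × (Real α → Sg (s * α)))
        × (∀ x y → (S x (s * y) → λ₀ * (bar x * y - x * bar y) ≡ 1#) × (λ₀ * (bar x * y - x * bar y) ≡ 1# → S x (s * y)))
      conclusion = s₀ , l , s₀≢0 , l≢0 , bar-l , (λ α → Sg-real , real-Sg) , λ x y → to , fro x y
        where
        l : Carrier
        l = proj₁ classical
        cl : ∀ {m} → ¬ Real m → c m * (l * (m - bar m)) ≡ 1#
        cl = proj₂ classical
        m : Carrier
        m = proj₁ nonreal-exists
        nr : ¬ Real m
        nr = proj₂ nonreal-exists
        l≢0 : l ≢ 0#
        l≢0 e = 1≢0 (trans (sym (cl nr)) (trans (cong (λ t → c m * (t * (m - bar m))) e) (trans (cong (c m *_) (zeroˡ _)) (zeroʳ _))))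
        -- Conjugate the relation at one m outside GF(q): c(m) is fixed while m - m̄ changes sign.
        bar-l : bar l ≡ - l
        bar-l = *-cancelˡ (*-≢0 (InD-≢0 (c-D nr)) (x≢y⇒x-y≢0 {bar m} {m} nr)) (begin
          (c m * (bar m - m)) * bar l ≡⟨ solve 4 (λ c b m l → (c :* (b :- m)) :* l := c :* (l :* (b :- m))) refl (c m) (bar m) m (bar l) ⟩
          c m * (bar l * (bar m - m)) ≡⟨ trans (cong₂ (λ s t → s * (bar l * t)) (sym (InD-real (c-D nr))) (sym (trans (bar-sub m (bar m)) (cong (λ t → bar m - t) (bar-bar m))))) (trans (cong (bar (c m) *_) (sym (bar-* l (m - bar m)))) (sym (bar-* (c m) _))) ⟩
          bar (c m * (l * (m - bar m))) ≡⟨ trans (cong bar (cl nr)) bar-1 ⟩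
          1# ≡⟨ cl nr ⟨
          c m * (l * (m - bar m)) ≡⟨ solve 4 (λ c l m b → c :* (l :* (m :- b)) := (c :* (b :- m)) :* (:- l)) refl (c m) l m (bar m) ⟩
          (c m * (bar m - m)) * - l ∎)
          where open ≡-Reasoning
        form : ∀ x m → bar x * (m * x) - x * bar (m * x) ≡ Nm x * (m - bar m)
        form x m = trans (cong (λ t → bar x * (m * x) - x * t) (bar-* m x)) (solve 4 (λ b m x n → b :* (m :* x) :- x :* (n :* b) := (x :* b) :* (m :- n)) refl (bar x) m x (bar m))
        to : ∀ {x y} → S x (s₀ * y) → l * (bar x * y - x * bar y) ≡ 1#
        to {x} {y} s = trans (cong (λ t → l * (bar x * t - x * bar t)) (sym mx)) (trans (cong (l *_) (form x μ)) (trans (cong (λ t → l * (t * (μ - bar μ))) (S-c nμ s')) (trans (solve 4 (λ l c m b → l :* (c :* (m :- b)) := c :* (l :* (m :- b))) refl l (c μ) μ (bar μ)) (cl nμ))))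
          where
          x≢0 : x ≢ 0#
          x≢0 = S-x s
          μ : Carrier
          μ = y * x ⁻¹
          mx : μ * x ≡ y
          mx = *-/ y x≢0
          s' : S x ((s₀ * μ) * x)
          s' = subst (S x) (sym (trans (*-assoc _ _ _) (cong (s₀ *_) mx))) s
          nμ : ¬ Real μ
          nμ rμ = no-real rμ s'
        fro : ∀ x y → l * (bar x * y - x * bar y) ≡ 1# → S x (s₀ * y)
        fro x y e with x ≟ 0#
        ... | yes refl = ⊥-elim (1≢0 (trans (sym e) (trans (cong (λ t → l * (t * y - 0# * bar y)) bar-0) (solve 3 (λ l y b → l :* (:0 :* y :- :0 :* b) := :0) refl l y (bar y)))))
        ... | no x≢0 = subst (S x) (trans (*-assoc _ _ _) (cong (s₀ *_) mx)) (c-S nμ nx)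
          where
          μ : Carrier
          μ = y * x ⁻¹
          mx : μ * x ≡ y
          mx = *-/ y x≢0
          e' : Nm x * (l * (μ - bar μ)) ≡ 1#
          e' = trans (solve 4 (λ n l m b → n :* (l :* (m :- b)) := l :* (n :* (m :- b))) refl (Nm x) l μ (bar μ)) (trans (cong (l *_) (sym (form x μ))) (trans (cong (λ t → l * (bar x * t - x * bar t)) mx) e))
          nμ : ¬ Real μ
          nμ rμ = 1≢0 (trans (sym e') (trans (cong (λ t → Nm x * (l * (μ - t))) rμ) (solve 3 (λ n l m → n :* (l :* (m :- m)) := :0) refl (Nm x) l μ)))
          nx : Nm x ≡ c μ
          nx = *-cancelˡ (λ z → 1≢0 (trans (sym e') (trans (cong (Nm x *_) z) (zeroʳ _)))) (trans (*-comm _ _) (trans e' (trans (sym (cl nμ)) (*-comm _ _))))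

  -- Centring: the tangents at P and Q become the axes

  module AffineUnital where
    open FieldArithmetic
    open Duality
    open CentredUnital

    record AffineMap : Set where
      constructor affine
      field
        a b ξ η : Carrier

    -- As `Data`, but before the tangents are known, so the stabiliser still has translation parts.
    -- The converse invariance `gs-S⁻` serves to show that lines without affine points are mapped to
    -- such lines.
    record AffineData : Set₁ where
      field
        S : Carrier → Carrier → Set
        S? : ∀ x y → Dec (S x y)
        Sg : Carrier → Set
        Sg? : ∀ α → Dec (Sg α)
        line : ∀ α β → length (filter (λ x → S? x (α * x + β)) el) +ℕ ind (Sg? α) ≡ 1 ⊎ length (filter (λ x → S? x (α * x + β)) el) +ℕ ind (Sg? α) ≡ q+1
        vertical : ∀ x → length (filter (S? x) el) ≡ 0 ⊎ length (filter (S? x) el) ≡ q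
        Sg-0 : Sg 0#
        Sg-count : length (filter Sg? el) ≡ q
        total : sumℕ (λ x → length (filter (S? x) el)) el ≡ q *ℕ q²-1
        gs : List AffineMap
        gs-unique : Unique gs
        gs-length : length gs ≡ q²-1
      open AffineMap
      field
        gs-≢0 : ∀ {g} → g ∈ gs → a g ≢ 0# × b g ≢ 0#
        gs-S : ∀ {g} → g ∈ gs → ∀ {x y} → S x y → S (a g * x + ξ g) (b g * y + η g)
        gs-S⁻ : ∀ {g} → g ∈ gs → ∀ {x y} → S (a g * x + ξ g) (b g * y + η g) → S x y
        gs-Sg : ∀ {g} → g ∈ gs → ∀ {α} → Sg α → Sg ((b g * a g ⁻¹) * α)

    -- Of the q² values, each 0 or q, exactly q² - 1 must be q. For the lines through P and through
    -- Q this singles out the tangent.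
    unique-zero : (f : Carrier → ℕ) → (∀ x → f x ≡ 0 ⊎ f x ≡ q) → sumℕ f el ≡ q *ℕ q²-1 → ∃ λ x → f x ≡ 0 × (∀ y → f y ≡ 0 → y ≡ x)
    unique-zero f h tot = go (filter (λ x → ¬? (f x ℕₚ.≟ q)) el) zeros (λ x∈ → proj₂ (∈-filter⁻ (λ x → ¬? (f x ℕₚ.≟ q)) {xs = el} x∈)) (λ {x} ne → ∈-filter⁺ (λ x → ¬? (f x ℕₚ.≟ q)) (el-complete x) ne)
      where
      val : ∀ {n} → n ≡ 0 ⊎ n ≡ q → n ≡ q *ℕ ind (n ℕₚ.≟ q)
      val (inj₁ refl) = sym (ℕₚ.*-zeroʳ q)
      val (inj₂ refl) = sym (trans (cong (q *ℕ_) (ind-yes (q ℕₚ.≟ q) refl)) (ℕₚ.*-identityʳ q))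
      full : length (filter (λ x → f x ℕₚ.≟ q) el) ≡ q²-1
      full = ℕₚ.*-cancelˡ-≡ _ _ q (trans (trans (cong (q *ℕ_) (count-ind (λ x → f x ℕₚ.≟ q) el)) (trans (sym (sumℕ-*ˡ q _ el)) (ℕΣ.big-cong el (λ x → sym (val (h x)))))) tot)
      zeros : length (filter (λ x → ¬? (f x ℕₚ.≟ q)) el) ≡ 1
      zeros = ℕₚ.+-cancelˡ-≡ q²-1 _ _ (trans (cong (_+ℕ length (filter (λ x → ¬? (f x ℕₚ.≟ q)) el)) (sym full)) (trans (count-split (λ x → f x ℕₚ.≟ q) el) (trans el-length (trans q²≡ (ℕₚ.+-comm 1 q²-1)))))
      go : ∀ xs → length xs ≡ 1 → (∀ {x} → x ∈ xs → f x ≢ q) → (∀ {x} → f x ≢ q → x ∈ xs) → ∃ λ x → f x ≡ 0 × (∀ y → f y ≡ 0 → y ≡ x)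
      go (x ∷ []) _ out inn = x , zz (h x) , λ y e → uniq (inn (λ e' → ℕₚ.1+n≢0 (trans (sym e') e)))
        where
        zz : f x ≡ 0 ⊎ f x ≡ q → f x ≡ 0
        zz (inj₁ e) = e
        zz (inj₂ e) = ⊥-elim (out (here refl) e)
        uniq : ∀ {y} → y ∈ x ∷ [] → y ≡ x
        uniq (here e) = e

    empty-filter : {X : Set} {P : X → Set} (P? : ∀ x → Dec (P x)) (xs : List X) → length (filter P? xs) ≡ 0 → ∀ {x} → x ∈ xs → ¬ P x
    empty-filter P? xs e {x} x∈ px = no-mem (filter P? xs) e (∈-filter⁺ P? x∈ px)
      where
      no-mem : ∀ ys → length ys ≡ 0 → ¬ (x ∈ ys)
      no-mem [] _ ()

    module _ (A : AffineData) where
      open AffineData A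
      open AffineMap

      private
        row : Carrier → ℕ
        row y = length (filter (λ x → S? x y) el)

        row-values : ∀ y → row y ≡ 0 ⊎ row y ≡ q
        row-values y = conv (line 0# y)
          where
          same : length (filter (λ x → S? x (0# * x + y)) el) +ℕ ind (Sg? 0#) ≡ suc (row y)
          same = trans (cong₂ _+ℕ_ (count-cong (λ x → S? x (0# * x + y)) (λ x → S? x y) el (λ {x} _ → subst (S x) (eq x)) (λ {x} _ → subst (S x) (sym (eq x)))) (ind-yes (Sg? 0#) Sg-0)) (ℕₚ.+-comm (row y) 1)
            where
            eq : ∀ x → 0# * x + y ≡ y
            eq x = trans (cong (_+ y) (zeroˡ x)) (+-identityˡ y)
          conv : _ ⊎ _ → row y ≡ 0 ⊎ row y ≡ q
          conv (inj₁ e) = inj₁ (ℕₚ.suc-injective (trans (sym same) e))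
          conv (inj₂ e) = inj₂ (ℕₚ.suc-injective (trans (sym same) e))

        row-total : sumℕ row el ≡ q *ℕ q²-1
        row-total = trans (ℕΣ.big-cong el (λ y → count-ind (λ x → S? x y) el)) (trans (ℕΣ.big-swap (λ y x → ind (S? x y)) el el) (trans (ℕΣ.big-cong el (λ x → sym (count-ind (S? x) el))) total))

        tangent₁ : ∃ λ y → row y ≡ 0 × (∀ y' → row y' ≡ 0 → y' ≡ y)
        tangent₁ = unique-zero row row-values row-total

        tangent₂ : ∃ λ x → length (filter (S? x) el) ≡ 0 × (∀ x' → length (filter (S? x') el) ≡ 0 → x' ≡ x)
        tangent₂ = unique-zero (λ x → length (filter (S? x) el)) vertical total

        μ ν : Carrier
        μ = proj₁ tangent₁
        ν = proj₁ tangent₂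

        no-μ : ∀ x → ¬ S x μ
        no-μ x = empty-filter (λ x → S? x μ) el (proj₁ (proj₂ tangent₁)) (el-complete x)

        no-ν : ∀ y → ¬ S ν y
        no-ν y = empty-filter (S? ν) el (proj₁ (proj₂ tangent₂)) (el-complete y)

        solve-affine : ∀ {a} → a ≢ 0# → ∀ x ξ → a * ((x - ξ) * a ⁻¹) + ξ ≡ x
        solve-affine {a} ne x ξ = trans (cong (_+ ξ) (trans (*-comm _ _) (*-/ (x - ξ) ne))) (solve 2 (λ x t → (x :- t) :+ t := x) refl x ξ)

        -- The image of the horizontal line without affine points is again such a line, and there is
        -- only one.
        fix-μ : ∀ {g} → g ∈ gs → b g * μ + η g ≡ μ
        fix-μ {g} g∈ = proj₂ (proj₂ tangent₁) (b g * μ + η g) (count-none (λ x → S? x (b g * μ + η g)) el (λ {x} _ s → no-μ _ (gs-S⁻ g∈ (subst (λ t → S t (b g * μ + η g)) (sym (solve-affine (proj₁ (gs-≢0 g∈)) x (ξ g))) s))))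

        fix-ν : ∀ {g} → g ∈ gs → a g * ν + ξ g ≡ ν
        fix-ν {g} g∈ = proj₂ (proj₂ tangent₂) (a g * ν + ξ g) (count-none (S? (a g * ν + ξ g)) el (λ {y} _ s → no-ν _ (gs-S⁻ g∈ (subst (S (a g * ν + ξ g)) (sym (solve-affine (proj₂ (gs-≢0 g∈)) y (η g))) s))))

        pairOf : AffineMap → Carrier × Carrier
        pairOf g = a g , b g

        centre : ∀ {a x₀ t} x → a * x₀ + t ≡ x₀ → a * (x + x₀) + t ≡ a * x + x₀
        centre {a} {x₀} {t} x e = trans (solve 4 (λ a x x₀ t → a :* (x :+ x₀) :+ t := a :* x :+ (a :* x₀ :+ t)) refl a x x₀ t) (cong (a * x +_) e)

        shift-of : ∀ {a x₀ t} → a * x₀ + t ≡ x₀ → t ≡ x₀ - a * x₀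
        shift-of {a} {x₀} {t} e = trans (solve 2 (λ s t → t := (s :+ t) :- s) refl (a * x₀) t) (cong (_- a * x₀) e)

        some-point : ∃₂ S
        some-point = go el total'
          where
          total' : sumℕ (λ x → length (filter (S? x) el)) el ≢ 0
          total' e = ℕₚ.1+n≢0 (trans (sym (trans total (cong (q *ℕ_) q²-1-def))) e)
          find : ∀ x ys → length (filter (S? x) ys) ≢ 0 → ∃₂ S
          find x [] ne = ⊥-elim (ne refl)
          find x (y ∷ ys) ne with S? x y
          ... | yes s = x , y , s
          ... | no _ = find x ys ne
          go : ∀ xs → sumℕ (λ x → length (filter (S? x) el)) xs ≢ 0 → ∃₂ S
          go [] ne = ⊥-elim (ne refl)
          go (x ∷ xs) ne = dec (length (filter (S? x) el) ℕₚ.≟ 0)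
            where
            dec : Dec (length (filter (S? x) el) ≡ 0) → ∃₂ S
            dec (yes e) = go xs (λ z → ne (trans (cong₂ _+ℕ_ e z) refl))
            dec (no n0) = find x el n0

        data' : Data
        data' = record
          { S = λ x y → S (x + ν) (y + μ)
          ; S? = λ x y → S? (x + ν) (y + μ)
          ; Sg = Sg ; Sg? = Sg?
          ; line = λ α β → subst (λ n → n +ℕ ind (Sg? α) ≡ 1 ⊎ n +ℕ ind (Sg? α) ≡ q+1) (sym (line-shift α β)) (line α ((β + μ) - α * ν))
          ; vertical = λ x → ℕₚ.≤-trans (count-inj (λ y → S? (x + ν) (y + μ)) (S? (x + ν)) el-unique (_+ μ) (λ _ s → el-complete _ , s) (λ {y} {y'} _ _ _ _ e → add-inj e)) (le (vertical (x + ν)))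
          ; Sg-0 = Sg-0 ; Sg-count = Sg-count
          ; axis₁ = λ x s → no-μ (x + ν) (subst (S (x + ν)) (+-identityˡ μ) s)
          ; axis₂ = λ y s → no-ν (y + μ) (subst (λ t → S t (y + μ)) (+-identityˡ ν) s)
          ; point = let (x , y , s) = some-point in x - ν , y - μ , subst₂ S (sym (sub-add x ν)) (sym (sub-add y μ)) s
          ; gs = map pairOf gs
          -- The centre (ν, μ) is fixed, so the translation part is determined by the linear part
          -- and dropping it creates no duplicates.
          ; gs-unique = unique-map gs-unique (λ { {affine a b ξ η} {affine a' b' ξ' η'} g∈ h∈ refl → cong₂ (affine a b) (trans (shift-of (fix-ν g∈)) (sym (shift-of (fix-ν h∈)))) (trans (shift-of (fix-μ g∈)) (sym (shift-of (fix-μ h∈)))) })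
          ; gs-length = trans (Listₚ.length-map pairOf gs) gs-length
          ; gs-≢0 = λ m → nz' (∈-map⁻ pairOf m)
          ; gs-S = λ m s → act' (∈-map⁻ pairOf m) s
          ; gs-Sg = λ m s → sg' (∈-map⁻ pairOf m) s }
          where
          le : ∀ {n} → n ≡ 0 ⊎ n ≡ q → n ≤ q
          le (inj₁ refl) = z≤n
          le (inj₂ refl) = ℕₚ.≤-refl
          add-inj : ∀ {x y z} → x + z ≡ y + z → x ≡ y
          add-inj {x} {y} {z} e = trans (solve 2 (λ x z → x := (x :+ z) :- z) refl x z) (trans (cong (_- z) e) (solve 2 (λ x z → (x :+ z) :- z := x) refl y z))
          sub-add : ∀ x z → (x - z) + z ≡ x
          sub-add x z = solve 2 (λ x z → (x :- z) :+ z := x) refl x z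
          line-shift : ∀ α β → length (filter (λ x → S? (x + ν) ((α * x + β) + μ)) el) ≡ length (filter (λ x → S? x (α * x + ((β + μ) - α * ν))) el)
          line-shift α β = count-bij (λ x → S? (x + ν) ((α * x + β) + μ)) (λ x → S? x (α * x + ((β + μ) - α * ν))) el-unique el-unique (_+ ν) (λ x → x - ν)
            (λ {x} _ s → el-complete _ , subst (S (x + ν)) (solve 5 (λ a x b m n → (a :* x :+ b) :+ m := a :* (x :+ n) :+ ((b :+ m) :- a :* n)) refl α x β μ ν) s , solve 2 (λ x n → (x :+ n) :- n := x) refl x ν)
            (λ {x} _ s → el-complete _ , subst₂ S (sym (sub-add x ν)) (solve 5 (λ a x b m n → a :* x :+ ((b :+ m) :- a :* n) := (a :* (x :- n) :+ b) :+ m) refl α x β μ ν) s , sub-add x ν)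
          nz' : ∀ {g} → (∃ λ h → h ∈ gs × g ≡ pairOf h) → proj₁ g ≢ 0# × proj₂ g ≢ 0#
          nz' (h , h∈ , refl) = gs-≢0 h∈
          act' : ∀ {g} → (∃ λ h → h ∈ gs × g ≡ pairOf h) → ∀ {x y} → S (x + ν) (y + μ) → S (proj₁ g * x + ν) (proj₂ g * y + μ)
          act' (h , h∈ , refl) {x} {y} s = subst₂ S (centre x (fix-ν h∈)) (centre y (fix-μ h∈)) (gs-S h∈ s)
          sg' : ∀ {g} → (∃ λ h → h ∈ gs × g ≡ pairOf h) → ∀ {α} → Sg α → Sg ((proj₂ g * proj₁ g ⁻¹) * α)
          sg' (h , h∈ , refl) = gs-Sg h∈

      record Hermitian : Set where
        field
          ν₀ μ₀ s λ₀ : Carrier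
          s≢0 : s ≢ 0#
          λ≢0 : λ₀ ≢ 0#
          λ-anti : bar λ₀ ≡ - λ₀
          Sg⇒ : ∀ α → Sg α → Real (α * s ⁻¹)
          ⇒Sg : ∀ α → Real (α * s ⁻¹) → Sg α
        X : Carrier → Carrier
        X = λ x → x - ν₀
        Y : Carrier → Carrier
        Y = λ y → (y - μ₀) * s ⁻¹
        field
          S⇒ : ∀ x y → S x y → λ₀ * (bar (X x) * Y y - X x * bar (Y y)) ≡ 1#
          ⇒S : ∀ x y → λ₀ * (bar (X x) * Y y - X x * bar (Y y)) ≡ 1# → S x y

      hermitian : Hermitian
      hermitian = go (conclusion data')
        where
        go : (∃₂ λ s λ₀ → s ≢ 0# × λ₀ ≢ 0# × bar λ₀ ≡ - λ₀
          × (∀ α → (Sg (s * α) → Real α) × (Real α → Sg (s * α)))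
          × (∀ x y → (S (x + ν) ((s * y) + μ) → λ₀ * (bar x * y - x * bar y) ≡ 1#) × (λ₀ * (bar x * y - x * bar y) ≡ 1# → S (x + ν) ((s * y) + μ)))) → Hermitian
        go (s , l , s≢0 , l≢0 , anti , sg , st) = record
          { ν₀ = ν ; μ₀ = μ ; s = s ; λ₀ = l ; s≢0 = s≢0 ; λ≢0 = l≢0 ; λ-anti = anti
          ; Sg⇒ = λ α x → proj₁ (sg (α * s ⁻¹)) (subst Sg (sym (back α)) x)
          ; ⇒Sg = λ α x → subst Sg (back α) (proj₂ (sg (α * s ⁻¹)) x)
          ; S⇒ = λ x y z → proj₁ (st (x - ν) ((y - μ) * s ⁻¹)) (subst₂ S (sym (sub-add x ν)) (sym (trans (cong (_+ μ) (back (y - μ))) (sub-add y μ))) z)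
          ; ⇒S = λ x y z → subst₂ S (sub-add x ν) (trans (cong (_+ μ) (back (y - μ))) (sub-add y μ)) (proj₂ (st (x - ν) ((y - μ) * s ⁻¹)) z) }
          where
          sub-add : ∀ x z → (x - z) + z ≡ x
          sub-add x z = solve 2 (λ x z → (x :- z) :+ z := x) refl x z
          back : ∀ α → s * (α * s ⁻¹) ≡ α
          back α = trans (*-comm _ _) (*-/ α s≢0)

  -- Homogeneous coordinates with respect to a basis

  module ProjectivePlane where
    open FieldArithmetic
    open Duality

    open Determinants FR hiding (dot-scale; dot-comb)
    private
      module Dt = Determinants FR

    Pt : Set
    Pt = Point F

    ∀3 : {P : Fin 3 → Set} → P i0 → P i1 → P i2 → ∀ i → P i
    ∀3 a b c i0 = a
    ∀3 a b c i1 = b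
    ∀3 a b c i2 = c

    NonZero3 : Vec3 → Set
    NonZero3 v = ¬ (∀ i → v i ≡ 0#)

    cds : Pt → Vec3
    cds = coords F

    normalise : Vec3 → Pt
    normalise = normalize F

    Represents : Pt → Vec3 → Set
    Represents X v = ∃ λ s → s ≢ 0# × (∀ i → v i ≡ s * cds X i)

    cds-nonzero : ∀ X → NonZero3 (cds X)
    cds-nonzero (pt₁ x y) h = 1≢0 (h i0)
    cds-nonzero (pt₂ x) h = 1≢0 (h i1)
    cds-nonzero pt₃ h = 1≢0 (h i2)

    normalise-represents : ∀ v → NonZero3 v → Represents (normalise v) v
    normalise-represents v nz with v i0 ≟ 0#
    ... | no n0 = v i0 , n0 , ∀3 (sym (*-identityʳ _)) (lem (v i1)) (lem (v i2))
      where
      lem : ∀ x → x ≡ v i0 * (x * v i0 ⁻¹)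
      lem x = sym (trans (*-comm _ _) (*-/ x n0))
    ... | yes z0 with v i1 ≟ 0#
    ...   | no n1 = v i1 , n1 , ∀3 (trans z0 (sym (zeroʳ _))) (sym (*-identityʳ _)) (sym (trans (*-comm _ _) (*-/ (v i2) n1)))
    ...   | yes z1 = v i2 , (λ z2 → nz (∀3 z0 z1 z2)) , ∀3 (trans z0 (sym (zeroʳ _))) (trans z1 (sym (zeroʳ _))) (sym (*-identityʳ _))

    cds-unique : ∀ X Y {s t} → s ≢ 0# → t ≢ 0# → (∀ i → s * cds X i ≡ t * cds Y i) → X ≡ Y
    cds-unique (pt₁ x y) (pt₁ x' y') {s} {t} sn tn h = cong₂ pt₁ (*-cancelˡ sn (trans (h i1) (cong (_* x') (sym st)))) (*-cancelˡ sn (trans (h i2) (cong (_* y') (sym st))))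
      where
      st : s ≡ t
      st = trans (sym (*-identityʳ s)) (trans (h i0) (*-identityʳ t))
    cds-unique (pt₁ x y) (pt₂ x') {s} {t} sn tn h = ⊥-elim (sn (trans (sym (*-identityʳ s)) (trans (h i0) (zeroʳ t))))
    cds-unique (pt₁ x y) pt₃ {s} {t} sn tn h = ⊥-elim (sn (trans (sym (*-identityʳ s)) (trans (h i0) (zeroʳ t))))
    cds-unique (pt₂ x) (pt₁ x' y') {s} {t} sn tn h = ⊥-elim (tn (trans (sym (*-identityʳ t)) (trans (sym (h i0)) (zeroʳ s))))
    cds-unique (pt₂ x) (pt₂ x') {s} {t} sn tn h = cong pt₂ (*-cancelˡ sn (trans (h i2) (cong (_* x') (sym st))))
      where
      st : s ≡ t
      st = trans (sym (*-identityʳ s)) (trans (h i1) (*-identityʳ t))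
    cds-unique (pt₂ x) pt₃ {s} {t} sn tn h = ⊥-elim (sn (trans (sym (*-identityʳ s)) (trans (h i1) (zeroʳ t))))
    cds-unique pt₃ (pt₁ x' y') {s} {t} sn tn h = ⊥-elim (tn (trans (sym (*-identityʳ t)) (trans (sym (h i0)) (zeroʳ s))))
    cds-unique pt₃ (pt₂ x') {s} {t} sn tn h = ⊥-elim (tn (trans (sym (*-identityʳ t)) (trans (sym (h i1)) (zeroʳ s))))
    cds-unique pt₃ pt₃ sn tn h = refl

    represents-unique : ∀ {X Y v} → Represents X v → Represents Y v → X ≡ Y
    represents-unique {X} {Y} (s , sn , h) (t , tn , h') = cds-unique X Y sn tn (λ i → trans (sym (h i)) (h' i))

    represents-nonzero : ∀ {X v} → Represents X v → NonZero3 v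
    represents-nonzero {X} {v} (s , sn , h) z = cds-nonzero X (λ i → domain (trans (sym (h i)) (z i)) sn)

    normalise-≡ : ∀ {X v} → Represents X v → normalise v ≡ X
    normalise-≡ {X} {v} rp = represents-unique {normalise v} {X} {v} (normalise-represents v (represents-nonzero {X} {v} rp)) rp

    represents-scale : ∀ {X v w t} → t ≢ 0# → (∀ i → w i ≡ t * v i) → Represents X v → Represents X w
    represents-scale {t = t} tn e (s , sn , h) = t * s , *-≢0 tn sn , λ i → trans (e i) (trans (cong (t *_) (h i)) (sym (*-assoc _ _ _)))

    dot-scale : ∀ l {v w t} → (∀ i → w i ≡ t * v i) → dot l w ≡ t * dot l v
    dot-scale l {v} {w} {t} e = trans (cong₂ _+_ (cong₂ _+_ (cong (l i0 *_) (e i0)) (cong (l i1 *_) (e i1))) (cong (l i2 *_) (e i2)))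
      (Dt.dot-scale l v t)

    dot-0 : ∀ l {v} → (∀ i → v i ≡ 0#) → dot l v ≡ 0#
    dot-0 l {v} h = trans (dot-scale l {v} {v} {0#} (λ i → trans (h i) (sym (zeroˡ _)))) (zeroˡ _)

    pts : List Pt
    pts = points F

    private
      ∈elems : ∀ x → x ∈ elems F
      ∈elems x = subst (x ∈_) el≡elems (el-complete x)

      elems-unique : Unique (elems F)
      elems-unique = subst Unique el≡elems el-unique

      concatMap-cp : ∀ {A B C : Set} (f : A → B → C) (xs : List A) (ys : List B) → concatMap (λ x → map (f x) ys) xs ≡ cartesianProductWith f xs ys
      concatMap-cp f [] ys = refl
      concatMap-cp f (x ∷ xs) ys = cong (map (f x) ys ++_) (concatMap-cp f xs ys)

    pts-complete : ∀ X → X ∈ pts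
    pts-complete (pt₁ x y) = ∈-++⁺ˡ (subst (pt₁ x y ∈_) (sym (concatMap-cp pt₁ (elems F) (elems F))) (∈-cartesianProductWith⁺ pt₁ (∈elems x) (∈elems y)))
    pts-complete (pt₂ x) = ∈-++⁺ʳ (concatMap (λ x → map (pt₁ x) (elems F)) (elems F)) (∈-++⁺ˡ (∈-map⁺ pt₂ (∈elems x)))
    pts-complete pt₃ = ∈-++⁺ʳ (concatMap (λ x → map (pt₁ x) (elems F)) (elems F)) (∈-++⁺ʳ (map pt₂ (elems F)) (here refl))

    pts-unique : Unique pts
    pts-unique = Uniqₚ.++⁺ (subst Unique (sym (concatMap-cp pt₁ (elems F) (elems F))) (Uniqₚ.cartesianProductWith⁺ pt₁ (λ { refl → refl , refl }) elems-unique elems-unique))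
        (Uniqₚ.++⁺ (Uniqₚ.map⁺ (λ { refl → refl }) elems-unique) ([] ∷ []) (λ { (a , here refl) → no₃ (∈-map⁻ pt₂ a) }))
        (λ { {X} (a , b) → dis (subst (X ∈_) (concatMap-cp pt₁ (elems F) (elems F)) a) (∈-++⁻ (map pt₂ (elems F)) b) })
      where
      no₃ : ¬ (∃ λ x → x ∈ elems F × pt₃ ≡ pt₂ x)
      no₃ (_ , _ , ())
      dis : ∀ {X : Pt} → X ∈ cartesianProductWith pt₁ (elems F) (elems F) → X ∈ map pt₂ (elems F) ⊎ X ∈ pt₃ ∷ [] → ⊥
      dis a b with ∈-cartesianProductWith⁻ pt₁ (elems F) (elems F) a
      dis a (inj₁ b) | x , y , _ , _ , refl with ∈-map⁻ pt₂ b
      ... | _ , _ , ()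
      dis a (inj₂ (here ())) | x , y , _ , _ , refl

    vecsOver-unique : ∀ {X : Set} {xs : List X} → Unique xs → ∀ n → Unique (vecsOver xs n)
    vecsOver-unique u zero = [] ∷ []
    vecsOver-unique {xs = xs} u (suc n) = subst Unique (sym (concatMap-cp _∷_ xs (vecsOver xs n))) (Uniqₚ.cartesianProductWith⁺ _∷_ (λ { refl → refl , refl }) u (vecsOver-unique u n))

    mats-unique : Unique (allMats F)
    mats-unique = vecsOver-unique (vecsOver-unique elems-unique 3) 3

    count-points : {P Q : Pt → Set} (P? : ∀ X → Dec (P X)) (Q? : ∀ X → Dec (Q X)) {B : List Pt} → Unique B
      → (∀ {X} → P X → X ∈ B × Q X) → (∀ {X} → X ∈ B → Q X → P X) → length (filter P? pts) ≡ length (filter Q? B)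
    count-points P? Q? u to fro = count-bij P? Q? pts-unique u (λ X → X) (λ X → X) (λ _ pX → proj₁ (to pX) , proj₂ (to pX) , refl) (λ {X} X∈ qX → pts-complete X , fro X∈ qX , refl)

    dot-comm : ∀ u w → dot u w ≡ dot w u
    dot-comm u w = cong₂ _+_ (cong₂ _+_ (*-comm _ _) (*-comm _ _)) (*-comm _ _)

    line-incidence : ∀ {l} → NonZero3 l → ∀ X → (Incident F (normalise l) X → dot l (cds X) ≡ 0#) × (dot l (cds X) ≡ 0# → Incident F (normalise l) X)
    line-incidence {l} nl X = go (normalise-represents l nl)
      where
      L : Pt
      L = normalise l
      go : Represents L l → (Incident F L X → dot l (cds X) ≡ 0#) × (dot l (cds X) ≡ 0# → Incident F L X)
      go (s , sn , h) = (λ e → trans eq (trans (cong (s *_) e) (zeroʳ s))) , (λ e → domain (trans (sym eq) e) sn)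
        where
        eq : dot l (cds X) ≡ s * dot (cds L) (cds X)
        eq = trans (dot-comm l (cds X)) (trans (dot-scale (cds X) {cds L} {l} {s} h) (cong (s *_) (dot-comm (cds X) (cds L))))

    -- A basis with its dual basis; `xs`, `ys`, `zs` are the coordinate functionals. The first two
    -- vectors will be P and Q, which puts both on the line at infinity z = 0.
    record Basis : Set where
      field
        pv qv ev xs ys zs : Vec3
        xp : dot xs pv ≡ 1#
        xq : dot xs qv ≡ 0#
        xe : dot xs ev ≡ 0#
        yp : dot ys pv ≡ 0#
        yq : dot ys qv ≡ 1#
        ye : dot ys ev ≡ 0#
        zp : dot zs pv ≡ 0#
        zq : dot zs qv ≡ 0#
        ze : dot zs ev ≡ 1#
        decompose : ∀ v i → v i ≡ (dot xs v * pv i + dot ys v * qv i) + dot zs v * ev i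

    module Coordinates (B : Basis) where
      open Basis B

      comb : Carrier → Carrier → Carrier → Vec3
      comb x y z i = (x * pv i + y * qv i) + z * ev i

      dot-comb : ∀ l x y z → dot l (comb x y z) ≡ (x * dot l pv + y * dot l qv) + z * dot l ev
      dot-comb l x y z = Dt.dot-comb l pv qv ev x y z

      x-comb : ∀ x y z → dot xs (comb x y z) ≡ x
      x-comb x y z = trans (dot-comb xs x y z) (trans (cong₂ _+_ (cong₂ _+_ (cong (x *_) xp) (cong (y *_) xq)) (cong (z *_) xe)) (solve 3 (λ x y z → (x :* :1 :+ y :* :0) :+ z :* :0 := x) refl x y z))

      y-comb : ∀ x y z → dot ys (comb x y z) ≡ y
      y-comb x y z = trans (dot-comb ys x y z) (trans (cong₂ _+_ (cong₂ _+_ (cong (x *_) yp) (cong (y *_) yq)) (cong (z *_) ye)) (solve 3 (λ x y z → (x :* :0 :+ y :* :1) :+ z :* :0 := y) refl x y z))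

      z-comb : ∀ x y z → dot zs (comb x y z) ≡ z
      z-comb x y z = trans (dot-comb zs x y z) (trans (cong₂ _+_ (cong₂ _+_ (cong (x *_) zp) (cong (y *_) zq)) (cong (z *_) ze)) (solve 3 (λ x y z → (x :* :0 :+ y :* :0) :+ z :* :1 := z) refl x y z))

      mk : Carrier → Carrier → Carrier → Pt
      mk x y z = normalise (comb x y z)

      Nontrivial : Carrier → Carrier → Carrier → Set
      Nontrivial x y z = ¬ (x ≡ 0# × y ≡ 0# × z ≡ 0#)

      comb-nonzero : ∀ {x y z} → Nontrivial x y z → NonZero3 (comb x y z)
      comb-nonzero {x} {y} {z} nt h = nt (trans (sym (x-comb x y z)) (dot-0 xs h) , trans (sym (y-comb x y z)) (dot-0 ys h) , trans (sym (z-comb x y z)) (dot-0 zs h))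

      mk-represents : ∀ {x y z} → Nontrivial x y z → Represents (mk x y z) (comb x y z)
      mk-represents nt = normalise-represents _ (comb-nonzero nt)

      HasCoords : Pt → Carrier → Carrier → Carrier → Set
      HasCoords X x y z = ∃ λ s → s ≢ 0# × x ≡ s * dot xs (cds X) × y ≡ s * dot ys (cds X) × z ≡ s * dot zs (cds X)

      mk-coords : ∀ {x y z} → Nontrivial x y z → HasCoords (mk x y z) x y z
      mk-coords {x} {y} {z} nt = go (mk-represents nt)
        where
        X : Pt
        X = mk x y z
        go : Represents X (comb x y z) → HasCoords X x y z
        go (s , sn , h) = s , sn , trans (sym (x-comb x y z)) (dot-scale xs {cds X} {comb x y z} {s} h)
          , trans (sym (y-comb x y z)) (dot-scale ys {cds X} {comb x y z} {s} h) , trans (sym (z-comb x y z)) (dot-scale zs {cds X} {comb x y z} {s} h)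

      comb-scale : ∀ s x y z i → comb (s * x) (s * y) (s * z) i ≡ s * comb x y z i
      comb-scale s x y z i = Dt.factor₃ s x y z (pv i) (qv i) (ev i)

      mk-of : ∀ X {x y z} → HasCoords X x y z → mk x y z ≡ X
      mk-of X {x} {y} {z} (s , sn , ex , ey , ez) = normalise-≡ {X} {comb x y z} (s , sn , eq)
        where
        eq : ∀ i → comb x y z i ≡ s * cds X i
        eq i = trans (cong₂ _+_ (cong₂ _+_ (cong (_* pv i) ex) (cong (_* qv i) ey)) (cong (_* ev i) ez))
          (trans (comb-scale s (dot xs (cds X)) (dot ys (cds X)) (dot zs (cds X)) i) (cong (s *_) (sym (decompose (cds X) i))))

      coords-nontrivial : ∀ X → Nontrivial (dot xs (cds X)) (dot ys (cds X)) (dot zs (cds X))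
      coords-nontrivial X (a , b , c) = cds-nonzero X (λ i → trans (decompose (cds X) i) (trans (cong₂ _+_ (cong₂ _+_ (cong (_* pv i) a) (cong (_* qv i) b)) (cong (_* ev i) c)) (solve 3 (λ p q e → (:0 :* p :+ :0 :* q) :+ :0 :* e := :0) refl (pv i) (qv i) (ev i))))

      nt-z : ∀ {x y} → Nontrivial x y 1#
      nt-z (_ , _ , e) = 1≢0 e

      nt-x : ∀ {y z} → Nontrivial 1# y z
      nt-x (e , _) = 1≢0 e

      nt-y : ∀ {x z} → Nontrivial x 1# z
      nt-y (_ , e , _) = 1≢0 e

      affinePt : Carrier → Carrier → Pt
      affinePt x y = mk x y 1#

      slopePt : Carrier → Pt
      slopePt α = mk 1# α 0#

      vertPt : Pt
      vertPt = mk 0# 1# 0#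

      private
        times-0 : ∀ {s w} → w ≡ 0# → 0# ≡ s * w
        times-0 {s} refl = sym (zeroʳ s)

      slope-z : ∀ α → dot zs (cds (slopePt α)) ≡ 0#
      slope-z α = let (s , sn , _ , _ , e) = mk-coords (nt-x {α} {0#}) in domain (sym e) sn

      vert-z : dot zs (cds vertPt) ≡ 0#
      vert-z = let (s , sn , _ , _ , e) = mk-coords (nt-y {0#} {0#}) in domain (sym e) sn

      vert-x : dot xs (cds vertPt) ≡ 0#
      vert-x = let (s , sn , e , _ , _) = mk-coords (nt-y {0#} {0#}) in domain (sym e) sn

      affine-z : ∀ x y → dot zs (cds (affinePt x y)) ≢ 0#
      affine-z x y z0 = let (s , sn , _ , _ , e) = mk-coords (nt-z {x} {y}) in 1≢0 (trans e (trans (cong (s *_) z0) (zeroʳ s)))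

      slope-x : ∀ α → dot xs (cds (slopePt α)) ≢ 0#
      slope-x α x0 = let (s , sn , e , _ , _) = mk-coords (nt-x {α} {0#}) in 1≢0 (trans e (trans (cong (s *_) x0) (zeroʳ s)))

      private
        same-s : ∀ {s t w} → 1# ≡ s * w → 1# ≡ t * w → s ≡ t
        same-s {s} {t} {w} e f = *-cancelˡ w≢0 (trans (*-comm _ _) (trans (sym e) (trans f (*-comm _ _))))
          where
          w≢0 : w ≢ 0#
          w≢0 refl = 1≢0 (trans e (zeroʳ s))

      affine-inj : ∀ {x y x' y'} → affinePt x y ≡ affinePt x' y' → x ≡ x' × y ≡ y'
      affine-inj {x} {y} {x'} {y'} e = let (s , _ , ex , ey , ez) = mk-coords (nt-z {x} {y}) ; (t , _ , ex' , ey' , ez') = mk-coords (nt-z {x'} {y'})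
                                           st = same-s ez (trans ez' (cong (λ X → t * dot zs (cds X)) (sym e))) in
        trans ex (trans (cong₂ (λ u X → u * dot xs (cds X)) st e) (sym ex')) , trans ey (trans (cong₂ (λ u X → u * dot ys (cds X)) st e) (sym ey'))

      slope-inj : ∀ {α α'} → slopePt α ≡ slopePt α' → α ≡ α'
      slope-inj {α} {α'} e = let (s , _ , ex , ey , _) = mk-coords (nt-x {α} {0#}) ; (t , _ , ex' , ey' , _) = mk-coords (nt-x {α'} {0#})
                                 st = same-s ex (trans ex' (cong (λ X → t * dot xs (cds X)) (sym e))) in
        trans ey (trans (cong₂ (λ u X → u * dot ys (cds X)) st e) (sym ey'))

      as-affine : ∀ X → dot zs (cds X) ≢ 0# → let zi = dot zs (cds X) ⁻¹ in affinePt (zi * dot xs (cds X)) (zi * dot ys (cds X)) ≡ X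
      as-affine X nz = mk-of X (dot zs (cds X) ⁻¹ , inv≢0 nz , refl , refl , sym (inv-l nz))

      as-slope : ∀ X → dot zs (cds X) ≡ 0# → dot xs (cds X) ≢ 0# → slopePt (dot xs (cds X) ⁻¹ * dot ys (cds X)) ≡ X
      as-slope X z0 nx = mk-of X (dot xs (cds X) ⁻¹ , inv≢0 nx , sym (inv-l nx) , refl , times-0 z0)

      as-vert : ∀ X → dot zs (cds X) ≡ 0# → dot xs (cds X) ≡ 0# → vertPt ≡ X
      as-vert X z0 x0 = mk-of X (dot ys (cds X) ⁻¹ , inv≢0 ny , times-0 x0 , sym (inv-l ny) , times-0 z0)
        where
        ny : dot ys (cds X) ≢ 0#
        ny y0 = coords-nontrivial X (x0 , y0 , z0)

  -- Line counts of the unital in affine coordinates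

  module LineCounts where
    open FieldArithmetic
    open Duality
    open ProjectivePlane
    open AffineUnital using (empty-filter)

    open Determinants FR hiding (dot-scale; dot-comb)

    count-∷ : {X : Set} {P : X → Set} (P? : ∀ x → Dec (P x)) (x : X) (xs : List X) → length (filter P? (x ∷ xs)) ≡ ind (P? x) +ℕ length (filter P? xs)
    count-∷ P? x xs = trans (count-ind P? (x ∷ xs)) (cong (ind (P? x) +ℕ_) (sym (count-ind P? xs)))

    count-map : {X Y : Set} {P : Y → Set} (P? : ∀ y → Dec (P y)) (f : X → Y) (xs : List X) → length (filter P? (map f xs)) ≡ length (filter (λ x → P? (f x)) xs)
    count-map P? f xs = trans (count-ind P? (map f xs)) (trans (ℕΣ.big-map (λ y → ind (P? y)) f xs) (sym (count-ind (λ x → P? (f x)) xs)))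

    count-product : {X Y Z : Set} {P : Z → Set} (P? : ∀ z → Dec (P z)) (f : X → Y → Z) (xs : List X) (ys : List Y)
      → length (filter P? (cartesianProductWith f xs ys)) ≡ sumℕ (λ x → length (filter (λ y → P? (f x y)) ys)) xs
    count-product P? f [] ys = refl
    count-product P? f (x ∷ xs) ys = trans (count-++ P? (map (f x) ys) (cartesianProductWith f xs ys)) (cong₂ _+ℕ_ (count-map P? (f x) ys) (count-product P? f xs ys))

    module Lines (B : Basis) where
      open Basis B
      open Coordinates B

      -- The covector of the line a x + b y + c z = 0 in the coordinates of the basis.
      lin : Carrier → Carrier → Carrier → Vec3
      lin a b c i = (a * xs i + b * ys i) + c * zs i

      value : Carrier → Carrier → Carrier → Pt → Carrier
      value a b c X = (a * dot xs (cds X) + b * dot ys (cds X)) + c * dot zs (cds X)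

      dot-lin : ∀ a b c v → dot (lin a b c) v ≡ (a * dot xs v + b * dot ys v) + c * dot zs v
      dot-lin a b c v = trans (dot-comm (lin a b c) v) (trans (Determinants.dot-comb FR v xs ys zs a b c)
        (cong₂ _+_ (cong₂ _+_ (cong (a *_) (dot-comm v xs)) (cong (b *_) (dot-comm v ys))) (cong (c *_) (dot-comm v zs))))

      lin-nonzero : ∀ {a b c} → Nontrivial a b c → NonZero3 (lin a b c)
      lin-nonzero {a} {b} {c} nt h = nt (at pv (first xp yp zp) , at qv (second xq yq zq) , at ev (third xe ye ze))
        where
        at : ∀ v {x} → (a * dot xs v + b * dot ys v) + c * dot zs v ≡ x → x ≡ 0#
        at v e = trans (sym e) (trans (sym (dot-lin a b c v)) (trans (dot-comm (lin a b c) v) (dot-0 v {lin a b c} h)))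
        first : ∀ {x y z} → x ≡ 1# → y ≡ 0# → z ≡ 0# → (a * x + b * y) + c * z ≡ a
        first refl refl refl = solve 3 (λ a b c → (a :* :1 :+ b :* :0) :+ c :* :0 := a) refl a b c
        second : ∀ {x y z} → x ≡ 0# → y ≡ 1# → z ≡ 0# → (a * x + b * y) + c * z ≡ b
        second refl refl refl = solve 3 (λ a b c → (a :* :0 :+ b :* :1) :+ c :* :0 := b) refl a b c
        third : ∀ {x y z} → x ≡ 0# → y ≡ 0# → z ≡ 1# → (a * x + b * y) + c * z ≡ c
        third refl refl refl = solve 3 (λ a b c → (a :* :0 :+ b :* :0) :+ c :* :1 := c) refl a b c

      private
        pull : ∀ a b c s x y z → (a * (s * x) + b * (s * y)) + c * (s * z) ≡ s * ((a * x + b * y) + c * z)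
        pull = solve 7 (λ a b c s x y z → (a :* (s :* x) :+ b :* (s :* y)) :+ c :* (s :* z) := s :* ((a :* x :+ b :* y) :+ c :* z)) refl

      value-scale : ∀ a b c X {x y z} → HasCoords X x y z → (a * x + b * y) + c * z ≡ 0# → value a b c X ≡ 0#
      value-scale a b c X (s , sn , refl , refl , refl) e = domain (trans (sym (pull a b c s (dot xs (cds X)) (dot ys (cds X)) (dot zs (cds X)))) e) sn

      value-of : ∀ a b c X {x y z} → HasCoords X x y z → value a b c X ≡ 0# → (a * x + b * y) + c * z ≡ 0#
      value-of a b c X (s , _ , refl , refl , refl) e = trans (pull a b c s (dot xs (cds X)) (dot ys (cds X)) (dot zs (cds X))) (trans (cong (s *_) e) (zeroʳ s))

      affine-coords : ∀ x y → HasCoords (affinePt x y) x y 1#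
      affine-coords x y = mk-coords nt-z

      slope-coords : ∀ α → HasCoords (slopePt α) 1# α 0#
      slope-coords α = mk-coords nt-x

      vert-coords : HasCoords vertPt 0# 1# 0#
      vert-coords = mk-coords nt-y

      affine≢slope : ∀ {x y α} → affinePt x y ≢ slopePt α
      affine≢slope {x} {y} {α} e = affine-z x y (trans (cong (λ X → dot zs (cds X)) e) (slope-z α))

      affine≢vert : ∀ {x y} → affinePt x y ≢ vertPt
      affine≢vert {x} {y} e = affine-z x y (trans (cong (λ X → dot zs (cds X)) e) vert-z)

      slope≢vert : ∀ {α} → slopePt α ≢ vertPt
      slope≢vert {α} e = slope-x α (trans (cong (λ X → dot xs (cds X)) e) vert-x)

      data Kind (X : Pt) : Set where
        is-affine : ∀ x y → affinePt x y ≡ X → Kind X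
        is-slope : ∀ α → slopePt α ≡ X → Kind X
        is-vert : vertPt ≡ X → Kind X

      kind : ∀ X → Kind X
      kind X = go (dot zs (cds X) ≟ 0#) (dot xs (cds X) ≟ 0#)
        where
        go : Dec (dot zs (cds X) ≡ 0#) → Dec (dot xs (cds X) ≡ 0#) → Kind X
        go (no nz) _ = is-affine _ _ (as-affine X nz)
        go (yes z0) (no nx) = is-slope _ (as-slope X z0 nx)
        go (yes z0) (yes x0) = is-vert (as-vert X z0 x0)

      module Counting (U : Pt → Set) (U? : ∀ X → Dec (U X)) (unital : IsUnital F q U U?) (P∈ : U (slopePt 0#)) (Q∈ : U vertPt) where

        -- It carries the defining property of a unital from canonical line representatives to any
        -- explicit duplicate-free list of the points on a line.
        line-count : ∀ a b c → Nontrivial a b c → {L : List Pt} → Unique L → (∀ {X} → value a b c X ≡ 0# → X ∈ L) → (∀ {X} → X ∈ L → value a b c X ≡ 0#)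
          → length (filter U? L) ≡ 1 ⊎ length (filter U? L) ≡ q+1
        line-count a b c nt {L} u to fro = go (IsUnital.secant unital ℓ)
          where
          ℓ : Pt
          ℓ = normalise (lin a b c)
          on : ∀ X → (Incident F ℓ X → dot (lin a b c) (cds X) ≡ 0#) × (dot (lin a b c) (cds X) ≡ 0# → Incident F ℓ X)
          on X = line-incidence {lin a b c} (lin-nonzero nt) X
          eq : lineCount F U U? ℓ ≡ length (filter U? L)
          eq = count-points (λ X → incident? F ℓ X ×-dec U? X) U? u
            (λ {X} (i , uX) → to (trans (sym (dot-lin a b c (cds X))) (proj₁ (on X) i)) , uX)
            (λ {X} X∈ uX → proj₂ (on X) (trans (dot-lin a b c (cds X)) (fro X∈)) , uX)
          go : lineCount F U U? ℓ ≡ 1 ⊎ lineCount F U U? ℓ ≡ q +ℕ 1 → length (filter U? L) ≡ 1 ⊎ length (filter U? L) ≡ q+1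
          go (inj₁ e) = inj₁ (trans (sym eq) e)
          go (inj₂ e) = inj₂ (trans (sym eq) (trans e (ℕₚ.+-comm q 1)))

        S : Carrier → Carrier → Set
        S x y = U (affinePt x y)

        S? : ∀ x y → Dec (S x y)
        S? x y = U? (affinePt x y)

        Sg : Carrier → Set
        Sg α = U (slopePt α)

        Sg? : ∀ α → Dec (Sg α)
        Sg? α = U? (slopePt α)

        line : ∀ α β → length (filter (λ x → S? x (α * x + β)) el) +ℕ ind (Sg? α) ≡ 1 ⊎ length (filter (λ x → S? x (α * x + β)) el) +ℕ ind (Sg? α) ≡ q+1
        line α β = go (line-count (- α) 1# (- β) (λ (_ , e , _) → 1≢0 e) u to fro)
          where
          f : Carrier → Pt
          f x = affinePt x (α * x + β)
          L : List Pt
          L = slopePt α ∷ map f el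
          u : Unique L
          u = All.tabulate (λ X∈ e → case (∈-map⁻ f X∈) e) ∷ Uniqₚ.map⁺ (λ e → proj₁ (affine-inj e)) el-unique
            where
            case : ∀ {X} → (∃ λ x → x ∈ el × X ≡ f x) → slopePt α ≢ X
            case (x , _ , refl) e = affine≢slope (sym e)
          to : ∀ {X} → value (- α) 1# (- β) X ≡ 0# → X ∈ L
          to {X} e = at (kind X)
            where
            at : Kind X → X ∈ L
            at (is-affine x y refl) = there (subst (_∈ map f el) (cong (affinePt x) (sym y≡)) (∈-map⁺ f (el-complete x)))
              where
              y≡ : y ≡ α * x + β
              y≡ = x-y≡0 (trans (solve 4 (λ a b x y → y :- (a :* x :+ b) := (:- a :* x :+ :1 :* y) :+ :- b :* :1) refl α β x y) (value-of (- α) 1# (- β) (affinePt x y) (affine-coords x y) e))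
            at (is-slope α' refl) = here (cong slopePt (x-y≡0 (trans (solve 3 (λ a b a' → a' :- a := (:- a :* :1 :+ :1 :* a') :+ :- b :* :0) refl α β α') (value-of (- α) 1# (- β) (slopePt α') (slope-coords α') e))))
            at (is-vert refl) = ⊥-elim (1≢0 (trans (solve 2 (λ a b → :1 := (:- a :* :0 :+ :1 :* :1) :+ :- b :* :0) refl α β) (value-of (- α) 1# (- β) vertPt vert-coords e)))
          fro : ∀ {X} → X ∈ L → value (- α) 1# (- β) X ≡ 0#
          fro (here refl) = value-scale (- α) 1# (- β) (slopePt α) (slope-coords α) (solve 2 (λ a b → (:- a :* :1 :+ :1 :* a) :+ :- b :* :0 := :0) refl α β)
          fro (there X∈) = at (∈-map⁻ f X∈)
            where
            at : ∀ {X} → (∃ λ x → x ∈ el × X ≡ f x) → value (- α) 1# (- β) X ≡ 0#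
            at (x , _ , refl) = value-scale (- α) 1# (- β) (f x) (affine-coords x _) (solve 3 (λ a b x → (:- a :* x :+ :1 :* (a :* x :+ b)) :+ :- b :* :1 := :0) refl α β x)
          eq : length (filter U? L) ≡ length (filter (λ x → S? x (α * x + β)) el) +ℕ ind (Sg? α)
          eq = trans (count-∷ U? (slopePt α) (map f el)) (trans (cong (ind (Sg? α) +ℕ_) (count-map U? f el)) (ℕₚ.+-comm (ind (Sg? α)) _))
          go : length (filter U? L) ≡ 1 ⊎ length (filter U? L) ≡ q+1 → _
          go (inj₁ e) = inj₁ (trans (sym eq) e)
          go (inj₂ e) = inj₂ (trans (sym eq) e)

        -- A line whose equation lacks y contains Q, which uses up one of the 1 or q + 1 points.
        -- Vertical lines and the line at infinity are of this kind.
        through-Q : ∀ a c → Nontrivial a 0# c → (f : Carrier → Pt) → (∀ {x y} → f x ≡ f y → x ≡ y) → (∀ {x} → f x ≢ vertPt)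
          → (∀ {X} → value a 0# c X ≡ 0# → X ≡ vertPt ⊎ (∃ λ x → X ≡ f x)) → (∀ x → value a 0# c (f x) ≡ 0#)
          → length (filter (λ x → U? (f x)) el) ≡ 0 ⊎ length (filter (λ x → U? (f x)) el) ≡ q
        through-Q a c nt f inj ne to fro = go (line-count a 0# c nt u (λ e → mem (to e)) fro')
          where
          L : List Pt
          L = vertPt ∷ map f el
          u : Unique L
          u = All.tabulate (λ X∈ e → case (∈-map⁻ f X∈) e) ∷ Uniqₚ.map⁺ inj el-unique
            where
            case : ∀ {X} → (∃ λ x → x ∈ el × X ≡ f x) → vertPt ≢ X
            case (x , _ , refl) e = ne (sym e)
          mem : ∀ {X} → X ≡ vertPt ⊎ (∃ λ x → X ≡ f x) → X ∈ L
          mem (inj₁ refl) = here refl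
          mem (inj₂ (x , refl)) = there (∈-map⁺ f (el-complete x))
          fro' : ∀ {X} → X ∈ L → value a 0# c X ≡ 0#
          fro' (here refl) = value-scale a 0# c vertPt vert-coords (solve 2 (λ a c → (a :* :0 :+ :0 :* :1) :+ c :* :0 := :0) refl a c)
          fro' (there X∈) = at (∈-map⁻ f X∈)
            where
            at : ∀ {X} → (∃ λ x → x ∈ el × X ≡ f x) → value a 0# c X ≡ 0#
            at (x , _ , refl) = fro x
          eq : length (filter U? L) ≡ suc (length (filter (λ x → U? (f x)) el))
          eq = trans (count-∷ U? vertPt (map f el)) (cong₂ _+ℕ_ (ind-yes (U? vertPt) Q∈) (count-map U? f el))
          go : length (filter U? L) ≡ 1 ⊎ length (filter U? L) ≡ q+1 → length (filter (λ x → U? (f x)) el) ≡ 0 ⊎ length (filter (λ x → U? (f x)) el) ≡ q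
          go (inj₁ e) = inj₁ (ℕₚ.suc-injective (trans (sym eq) e))
          go (inj₂ e) = inj₂ (ℕₚ.suc-injective (trans (sym eq) e))

        vertical : ∀ x → length (filter (S? x) el) ≡ 0 ⊎ length (filter (S? x) el) ≡ q
        vertical x = through-Q 1# (- x) (λ (e , _) → 1≢0 e) (affinePt x) (λ e → proj₂ (affine-inj e)) affine≢vert (λ {X} e → at e (kind X))
            (λ y → value-scale 1# 0# (- x) (affinePt x y) (affine-coords x y) (solve 2 (λ x y → (:1 :* x :+ :0 :* y) :+ :- x :* :1 := :0) refl x y))
          where
          at : ∀ {X} → value 1# 0# (- x) X ≡ 0# → Kind X → X ≡ vertPt ⊎ (∃ λ y → X ≡ affinePt x y)
          at e (is-affine x' y refl) = inj₂ (y , cong (λ z → affinePt z y) (x-y≡0 (trans (solve 3 (λ x x' y → x' :- x := (:1 :* x' :+ :0 :* y) :+ :- x :* :1) refl x x' y) (value-of 1# 0# (- x) (affinePt x' y) (affine-coords x' y) e))))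
          at e (is-slope α refl) = ⊥-elim (1≢0 (trans (solve 2 (λ x α → :1 := (:1 :* :1 :+ :0 :* α) :+ :- x :* :0) refl x α) (value-of 1# 0# (- x) (slopePt α) (slope-coords α) e)))
          at e (is-vert refl) = inj₁ refl

        -- The line at infinity contains P as well as Q, so it is not a tangent.
        Sg-count : length (filter Sg? el) ≡ q
        Sg-count = go (through-Q 0# 1# (λ (_ , _ , e) → 1≢0 e) slopePt slope-inj slope≢vert (λ {X} e → at e (kind X))
            (λ α → value-scale 0# 0# 1# (slopePt α) (slope-coords α) (solve 1 (λ α → (:0 :* :1 :+ :0 :* α) :+ :1 :* :0 := :0) refl α)))
          where
          at : ∀ {X} → value 0# 0# 1# X ≡ 0# → Kind X → X ≡ vertPt ⊎ (∃ λ α → X ≡ slopePt α)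
          at e (is-affine x y refl) = ⊥-elim (1≢0 (trans (solve 2 (λ x y → :1 := (:0 :* x :+ :0 :* y) :+ :1 :* :1) refl x y) (value-of 0# 0# 1# (affinePt x y) (affine-coords x y) e)))
          at e (is-slope α refl) = inj₂ (α , refl)
          at e (is-vert refl) = inj₁ refl
          go : length (filter Sg? el) ≡ 0 ⊎ length (filter Sg? el) ≡ q → length (filter Sg? el) ≡ q
          go (inj₁ e) = ⊥-elim (empty-filter Sg? el e (el-complete 0#) P∈)
          go (inj₂ e) = e

        -- Of the q³ + 1 points q + 1 are at infinity.
        total : sumℕ (λ x → length (filter (S? x) el)) el ≡ q *ℕ q²-1
        total = ℕₚ.+-cancelˡ-≡ q+1 _ _ (trans (sym eq) (trans (sym all) (trans (IsUnital.size unital) arith)))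
          where
          W : List Pt
          W = cartesianProductWith affinePt el el
          L : List Pt
          L = (vertPt ∷ map slopePt el) ++ W
          isAffine : ∀ {X} → X ∈ W → ∃₂ λ x y → X ≡ affinePt x y
          isAffine X∈ = let (x , y , _ , _ , e) = ∈-cartesianProductWith⁻ affinePt el el X∈ in x , y , e
          u : Unique L
          u = Uniqₚ.++⁺ (All.tabulate (λ X∈ e → case (∈-map⁻ slopePt X∈) e) ∷ Uniqₚ.map⁺ slope-inj el-unique) (Uniqₚ.cartesianProductWith⁺ affinePt affine-inj el-unique el-unique) (λ (a , b) → dis a (isAffine b))
            where
            case : ∀ {X} → (∃ λ x → x ∈ el × X ≡ slopePt x) → vertPt ≢ X
            case (x , _ , refl) e = slope≢vert (sym e)
            dis : ∀ {X} → X ∈ vertPt ∷ map slopePt el → ¬ (∃₂ λ x y → X ≡ affinePt x y)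
            dis (here refl) (x , y , e) = affine≢vert (sym e)
            dis (there m) (x , y , refl) = let (_ , _ , e) = ∈-map⁻ slopePt m in affine≢slope e
          cover : ∀ {X} → Kind X → X ∈ L
          cover (is-affine x y refl) = ∈-++⁺ʳ (vertPt ∷ map slopePt el) (∈-cartesianProductWith⁺ affinePt (el-complete x) (el-complete y))
          cover (is-slope α refl) = there (∈-++⁺ˡ (∈-map⁺ slopePt (el-complete α)))
          cover (is-vert refl) = here refl
          all : length (filter U? pts) ≡ length (filter U? L)
          all = count-points U? U? u (λ {X} uX → cover (kind X) , uX) (λ _ uX → uX)
          eq : length (filter U? L) ≡ q+1 +ℕ sumℕ (λ x → length (filter (S? x) el)) el
          eq = trans (count-++ U? (vertPt ∷ map slopePt el) W) (cong₂ _+ℕ_ (trans (count-∷ U? vertPt (map slopePt el)) (cong₂ _+ℕ_ (ind-yes (U? vertPt) Q∈) (trans (count-map U? slopePt el) Sg-count))) (count-product U? affinePt el el))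
          arith : q ^ℕ 3 +ℕ 1 ≡ q+1 +ℕ q *ℕ q²-1
          arith = trans (ℕₚ.+-comm (q ^ℕ 3) 1) (cong suc (trans (cong (q *ℕ_) (trans (sym q²-def) q²≡)) (ℕₚ.*-suc q q²-1)))

  -- The stabiliser of P and Q as a group of affine maps

  module StabiliserAction where
    open FieldArithmetic
    open Duality
    open ProjectivePlane
    open AffineUnital using (AffineMap; affine; AffineData)
    open LineCounts

    open Determinants FR hiding (dot-scale; dot-comb)

    MatF : Set
    MatF = Mat F

    row : MatF → Fin 3 → Vec3
    row M i j = entry F M i j

    apply : MatF → Vec3 → Vec3
    apply M v i = dot (row M i) v

    lead-scale : ∀ {κ} → κ ≢ 0# → ∀ l → lead F (map (κ *_) l) ≡ κ * lead F l
    lead-scale {κ} κn [] = sym (zeroʳ κ)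
    lead-scale {κ} κn (x ∷ l) with x ≟ 0# | κ * x ≟ 0#
    ... | yes _ | yes _ = lead-scale κn l
    ... | yes refl | no ne = ⊥-elim (ne (zeroʳ κ))
    ... | no ne | yes e = ⊥-elim (ne (domain e κn))
    ... | no _ | no _ = refl

    vec-ext : ∀ {X : Set} {n} {u v : Vec X n} → (∀ i → lookup u i ≡ lookup v i) → u ≡ v
    vec-ext {u = u} {v} h = trans (sym (Vecₚ.tabulate∘lookup u)) (trans (Vecₚ.tabulate-cong h) (Vecₚ.tabulate∘lookup v))

    -- The leading entry scales with the matrix and is 1 for both.
    normalized-unique : ∀ {M N : MatF} {κ} → κ ≢ 0# → (∀ i j → entry F M i j ≡ κ * entry F N i j) → Normalized F M → Normalized F N → M ≡ N
    normalized-unique {M} {N} {κ} κn h nM nN = vec-ext (λ i → vec-ext (λ j → trans (h i j) (trans (cong (_* entry F N i j) κ≡1) (*-identityˡ _))))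
      where
      κN : MatF
      κN = Vec.map (Vec.map (κ *_)) N
      M≡κN : M ≡ κN
      M≡κN = vec-ext (λ i → vec-ext (λ j → trans (h i j) (sym (trans (cong (λ w → lookup w j) (Vecₚ.lookup-map i (Vec.map (κ *_)) N)) (Vecₚ.lookup-map j (κ *_) (lookup N i))))))
      scaled : ∀ (N : MatF) → entries F (Vec.map (Vec.map (κ *_)) N) ≡ map (κ *_) (entries F N)
      scaled ((_ ∷ _ ∷ _ ∷ []) ∷ (_ ∷ _ ∷ _ ∷ []) ∷ (_ ∷ _ ∷ _ ∷ []) ∷ []) = refl
      κ≡1 : κ ≡ 1#
      κ≡1 = trans (sym (*-identityʳ κ)) (trans (cong (κ *_) (sym nN)) (trans (sym (lead-scale κn (entries F N))) (trans (cong (lead F) (sym (scaled N))) (trans (cong (λ m → lead F (entries F m)) (sym M≡κN)) nM))))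

    unit : Fin 3 → Vec3
    unit i0 i0 = 1#
    unit i0 i1 = 0#
    unit i0 i2 = 0#
    unit i1 i0 = 0#
    unit i1 i1 = 1#
    unit i1 i2 = 0#
    unit i2 i0 = 0#
    unit i2 i1 = 0#
    unit i2 i2 = 1#

    dot-unit : ∀ l j → dot l (unit j) ≡ l j
    dot-unit l i0 = solve 3 (λ a b c → (a :* :1 :+ b :* :0) :+ c :* :0 := a) refl (l i0) (l i1) (l i2)
    dot-unit l i1 = solve 3 (λ a b c → (a :* :0 :+ b :* :1) :+ c :* :0 := b) refl (l i0) (l i1) (l i2)
    dot-unit l i2 = solve 3 (λ a b c → (a :* :0 :+ b :* :0) :+ c :* :1 := c) refl (l i0) (l i1) (l i2)

    kernel : ∀ M → det F M ≢ 0# → ∀ v → (∀ i → apply M v i ≡ 0#) → ∀ i → v i ≡ 0#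
    kernel M dn v h i = domain (trans (sym (adjugate (row M i0) (row M i1) (row M i2) v i)) (zero-comb (cross (row M i1) (row M i2) i) (cross (row M i2) (row M i0) i) (cross (row M i0) (row M i1) i) (h i0) (h i1) (h i2))) dn
      where
      zero-comb : ∀ {x y z} a b c → x ≡ 0# → y ≡ 0# → z ≡ 0# → (x * a + y * b) + z * c ≡ 0#
      zero-comb a b c refl refl refl = solve 3 (λ a b c → (:0 :* a :+ :0 :* b) :+ :0 :* c := :0) refl a b c

    act-represents : ∀ M → det F M ≢ 0# → ∀ X v → Represents X v → Represents (act F M X) (apply M v)
    act-represents M dn X v (t , tn , h) = represents-scale {act F M X} {apply M (cds X)} {apply M v} {t} tn (λ i → dot-scale (row M i) {cds X} {v} {t} h)
      (normalise-represents (apply M (cds X)) (λ z → cds-nonzero X (kernel M dn (cds X) z)))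

    represents-ratio : ∀ X v w → Represents X v → Represents X w → ∃ λ κ → κ ≢ 0# × (∀ i → w i ≡ κ * v i)
    represents-ratio X v w (s , sn , h) (t , tn , h') = t * s ⁻¹ , *-≢0 tn (inv≢0 sn) , λ i → trans (h' i) (sym (trans (cong ((t * s ⁻¹) *_) (h i)) (trans (sym (*-assoc _ _ _)) (cong (_* cds X i) (*-/ t sn)))))

    module Stabiliser (B : Basis) where
      open Basis B
      open Coordinates B
      open Lines B

      P Q : Pt
      P = slopePt 0#
      Q = vertPt

      P-represents : Represents P pv
      P-represents = subst-rep (mk-represents nt-x)
        where
        subst-rep : Represents P (comb 1# 0# 0#) → Represents P pv
        subst-rep (s , sn , h) = s , sn , λ i → trans (solve 3 (λ p q e → p := (:1 :* p :+ :0 :* q) :+ :0 :* e) refl (pv i) (qv i) (ev i)) (h i)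

      Q-represents : Represents Q qv
      Q-represents = subst-rep (mk-represents nt-y)
        where
        subst-rep : Represents Q (comb 0# 1# 0#) → Represents Q qv
        subst-rep (s , sn , h) = s , sn , λ i → trans (solve 3 (λ p q e → q := (:0 :* p :+ :1 :* q) :+ :0 :* e) refl (pv i) (qv i) (ev i)) (h i)

      -- The factor by which M multiplies z; dividing by it keeps the affine plane z = 1.
      scaleOf : MatF → Carrier
      scaleOf M = dot zs (apply M ev)

      affineOf : MatF → AffineMap
      affineOf M = affine (dot xs (apply M pv) * scaleOf M ⁻¹) (dot ys (apply M qv) * scaleOf M ⁻¹) (dot xs (apply M ev) * scaleOf M ⁻¹) (dot ys (apply M ev) * scaleOf M ⁻¹)

      -- Fixing P and Q makes the first two basis vectors eigenvectors. M is then triangular in the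
      -- basis and induces (x, y) ↦ (a x + ξ, b y + η).
      module Fixing (M : MatF) (dn : det F M ≢ 0#) (fP : act F M P ≡ P) (fQ : act F M Q ≡ Q) where
        γ α β : Carrier
        γ = scaleOf M
        α = dot xs (apply M pv)
        β = dot ys (apply M qv)
        open AffineMap (affineOf M)

        eigenP : ∃ λ κ → κ ≢ 0# × (∀ i → apply M pv i ≡ κ * pv i)
        eigenP = represents-ratio P pv (apply M pv) P-represents (subst (λ X → Represents X (apply M pv)) fP (act-represents M dn P pv P-represents))

        eigenQ : ∃ λ κ → κ ≢ 0# × (∀ i → apply M qv i ≡ κ * qv i)
        eigenQ = represents-ratio Q qv (apply M qv) Q-represents (subst (λ X → Represents X (apply M qv)) fQ (act-represents M dn Q qv Q-represents))

        α-eigen : α ≢ 0# × (∀ i → apply M pv i ≡ α * pv i)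
        α-eigen = go eigenP
          where
          go : (∃ λ κ → κ ≢ 0# × (∀ i → apply M pv i ≡ κ * pv i)) → α ≢ 0# × (∀ i → apply M pv i ≡ α * pv i)
          go (κ , κn , h) = subst (λ c → c ≢ 0# × (∀ i → apply M pv i ≡ c * pv i)) (sym (trans (dot-scale xs {pv} {apply M pv} {κ} h) (trans (cong (κ *_) xp) (*-identityʳ κ)))) (κn , h)

        β-eigen : β ≢ 0# × (∀ i → apply M qv i ≡ β * qv i)
        β-eigen = go eigenQ
          where
          go : (∃ λ κ → κ ≢ 0# × (∀ i → apply M qv i ≡ κ * qv i)) → β ≢ 0# × (∀ i → apply M qv i ≡ β * qv i)
          go (κ , κn , h) = subst (λ c → c ≢ 0# × (∀ i → apply M qv i ≡ c * qv i)) (sym (trans (dot-scale ys {qv} {apply M qv} {κ} h) (trans (cong (κ *_) yq) (*-identityʳ κ)))) (κn , h)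

        α≢0 : α ≢ 0#
        α≢0 = proj₁ α-eigen

        β≢0 : β ≢ 0#
        β≢0 = proj₁ β-eigen

        apply-comb : ∀ x y z i → apply M (comb x y z) i ≡ (x * (α * pv i) + y * (β * qv i)) + z * ((dot xs (apply M ev) * pv i + dot ys (apply M ev) * qv i) + γ * ev i)
        apply-comb x y z i = trans (dot-comb (row M i) x y z) (cong₂ _+_ (cong₂ _+_ (cong (x *_) (proj₂ α-eigen i)) (cong (y *_) (proj₂ β-eigen i))) (cong (z *_) (decompose (apply M ev) i)))

        -- Otherwise M would kill e - (ξ/α) p - (η/β) q.
        γ≢0 : γ ≢ 0#
        γ≢0 γ0 = 1≢0 (trans (sym (z-comb x y 1#)) (dot-0 zs {comb x y 1#} (kernel M dn (comb x y 1#) killed)))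
          where
          ξ' η' x y : Carrier
          ξ' = dot xs (apply M ev)
          η' = dot ys (apply M ev)
          x = - (ξ' * α ⁻¹)
          y = - (η' * β ⁻¹)
          killed : ∀ i → apply M (comb x y 1#) i ≡ 0#
          killed i = trans (apply-comb x y 1# i)
            (trans (cong (λ g → (x * (α * pv i) + y * (β * qv i)) + 1# * ((ξ' * pv i + η' * qv i) + g * ev i)) γ0)
            (trans (solve 9 (λ ξ η a b u v p q e → (:- (ξ :* a) :* (u :* p) :+ :- (η :* b) :* (v :* q)) :+ :1 :* ((ξ :* p :+ η :* q) :+ :0 :* e) := (ξ :- ξ :* a :* u) :* p :+ (η :- η :* b :* v) :* q) refl ξ' η' (α ⁻¹) (β ⁻¹) α β (pv i) (qv i) (ev i))
            (trans (cong₂ _+_ (cong (λ w → (ξ' - w) * pv i) (*-/ ξ' α≢0)) (cong (λ w → (η' - w) * qv i) (*-/ η' β≢0)))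
              (solve 4 (λ ξ η p q → (ξ :- ξ) :* p :+ (η :- η) :* q := :0) refl ξ' η' (pv i) (qv i)))))

        a≢0 : a ≢ 0#
        a≢0 = *-≢0 α≢0 (inv≢0 γ≢0)

        b≢0 : b ≢ 0#
        b≢0 = *-≢0 β≢0 (inv≢0 γ≢0)

        apply-affine : ∀ x y z i → apply M (comb x y z) i ≡ γ * comb (a * x + ξ * z) (b * y + η * z) z i
        apply-affine x y z i = trans (apply-comb x y z i) (trans (rescale (*-/ α γ≢0) (*-/ β γ≢0) (*-/ (dot xs (apply M ev)) γ≢0) (*-/ (dot ys (apply M ev)) γ≢0))
          (solve 11 (λ x y z g a b ξ η p q e → (x :* (a :* g :* p) :+ y :* (b :* g :* q)) :+ z :* ((ξ :* g :* p :+ η :* g :* q) :+ g :* e) := g :* (((a :* x :+ ξ :* z) :* p :+ (b :* y :+ η :* z) :* q) :+ z :* e)) refl x y z γ a b ξ η (pv i) (qv i) (ev i)))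
          where
          rescale : ∀ {α α' β β' ξ ξ' η η'} → α' ≡ α → β' ≡ β → ξ' ≡ ξ → η' ≡ η
            → (x * (α * pv i) + y * (β * qv i)) + z * ((ξ * pv i + η * qv i) + γ * ev i) ≡ (x * (α' * pv i) + y * (β' * qv i)) + z * ((ξ' * pv i + η' * qv i) + γ * ev i)
          rescale refl refl refl refl = refl

        act-affine : ∀ x y → act F M (affinePt x y) ≡ affinePt (a * x + ξ) (b * y + η)
        act-affine x y = represents-unique {act F M (affinePt x y)} {affinePt (a * x + ξ) (b * y + η)} {apply M (comb x y 1#)}
          (act-represents M dn (affinePt x y) (comb x y 1#) (mk-represents nt-z))
          (represents-scale {affinePt (a * x + ξ) (b * y + η)} {comb (a * x + ξ) (b * y + η) 1#} {apply M (comb x y 1#)} {γ} γ≢0 eq (mk-represents nt-z))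
          where
          eq : ∀ i → apply M (comb x y 1#) i ≡ γ * comb (a * x + ξ) (b * y + η) 1# i
          eq i = trans (apply-affine x y 1# i) (cong₂ (λ u w → γ * comb (a * x + u) (b * y + w) 1# i) (*-identityʳ ξ) (*-identityʳ η))

        act-slope : ∀ m → act F M (slopePt m) ≡ slopePt ((b * a ⁻¹) * m)
        act-slope m = represents-unique {act F M (slopePt m)} {slopePt ((b * a ⁻¹) * m)} {apply M (comb 1# m 0#)}
          (act-represents M dn (slopePt m) (comb 1# m 0#) (mk-represents nt-x))
          (represents-scale {slopePt ((b * a ⁻¹) * m)} {comb 1# ((b * a ⁻¹) * m) 0#} {apply M (comb 1# m 0#)} {γ * a} (*-≢0 γ≢0 a≢0) eq (mk-represents nt-x))
          where
          eq : ∀ i → apply M (comb 1# m 0#) i ≡ (γ * a) * comb 1# ((b * a ⁻¹) * m) 0# i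
          eq i = trans (apply-affine 1# m 0# i) (trans (cong (λ w → γ * comb (a * 1# + ξ * 0#) (w * m + η * 0#) 0# i) (sym (*-/ b a≢0)))
            (solve 10 (λ g a b c ξ η m p q e → g :* (((a :* :1 :+ ξ :* :0) :* p :+ ((b :* c) :* a :* m :+ η :* :0) :* q) :+ :0 :* e) := (g :* a) :* ((:1 :* p :+ ((b :* c) :* m) :* q) :+ :0 :* e)) refl γ a b (a ⁻¹) ξ η m (pv i) (qv i) (ev i)))

      -- The affine map determines M up to a scalar, which normalisation fixes. Hence the list of
      -- affine maps has the order of the stabiliser as its length.
      affineOf-injective : ∀ {M N} → (mM : Normalized F M) (dM : det F M ≢ 0#) (pM : act F M P ≡ P) (qM : act F M Q ≡ Q)
        → (mN : Normalized F N) (dN : det F N ≢ 0#) (pN : act F N P ≡ P) (qN : act F N Q ≡ Q) → affineOf M ≡ affineOf N → M ≡ N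
      affineOf-injective {M} {N} mM dM pM qM mN dN pN qN e = normalized-unique {M} {N} {FM.γ * FN.γ ⁻¹} (*-≢0 FM.γ≢0 (inv≢0 FN.γ≢0)) same mM mN
        where
        module FM = Fixing M dM pM qM
        module FN = Fixing N dN pN qN
        img : AffineMap → Vec3 → Vec3
        img g v = comb (a * dot xs v + ξ * dot zs v) (b * dot ys v + η * dot zs v) (dot zs v)
          where open AffineMap g
        dot-cong : ∀ l {v w : Vec3} → (∀ i → v i ≡ w i) → dot l v ≡ dot l w
        dot-cong l h = cong₂ _+_ (cong₂ _+_ (cong (l i0 *_) (h i0)) (cong (l i1 *_) (h i1))) (cong (l i2 *_) (h i2))
        atM : ∀ v i → apply M v i ≡ FM.γ * img (affineOf M) v i
        atM v i = trans (dot-cong (row M i) (decompose v)) (FM.apply-affine (dot xs v) (dot ys v) (dot zs v) i)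
        atN : ∀ v i → apply N v i ≡ FN.γ * img (affineOf N) v i
        atN v i = trans (dot-cong (row N i) (decompose v)) (FN.apply-affine (dot xs v) (dot ys v) (dot zs v) i)
        same : ∀ i j → entry F M i j ≡ (FM.γ * FN.γ ⁻¹) * entry F N i j
        same i j = trans (sym (dot-unit (row M i) j)) (trans (atM (unit j) i) (trans (cong (λ g → FM.γ * img g (unit j) i) e)
          (trans (cong (_* img (affineOf N) (unit j) i) (sym (*-/ FM.γ FN.γ≢0))) (trans (*-assoc _ _ _) (cong ((FM.γ * FN.γ ⁻¹) *_) (trans (sym (atN (unit j) i)) (dot-unit (row N i) j)))))))

      module Action (U : Pt → Set) (U? : ∀ X → Dec (U X)) (unital : IsUnital F q U U?) (P∈ : U P) (Q∈ : U Q) (order : stabOrder F U U? P Q ≡ q ^ℕ 2 ∸ 1) where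
        open Counting U U? unital P∈ Q∈
        open AffineMap

        stab : List MatF
        stab = filter (inStab? F U U? P Q) (allMats F)

        in-stab : ∀ {M} → M ∈ stab → InStab F U U? P Q M
        in-stab M∈ = proj₂ (∈-filter⁻ (inStab? F U U? P Q) {xs = allMats F} M∈)

        gs : List AffineMap
        gs = map affineOf stab

        from-gs : ∀ {g} → g ∈ gs → ∃ λ M → InStab F U U? P Q M × g ≡ affineOf M
        from-gs g∈ = let (M , M∈ , e) = ∈-map⁻ affineOf g∈ in M , in-stab M∈ , e

        gs-unique : Unique gs
        gs-unique = unique-map (Uniqₚ.filter⁺ (inStab? F U U? P Q) mats-unique) (λ M∈ N∈ → inj (in-stab M∈) (in-stab N∈))
          where
          inj : ∀ {M N} → InStab F U U? P Q M → InStab F U U? P Q N → affineOf M ≡ affineOf N → M ≡ N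
          inj (mM , dM , _ , pM , qM) (mN , dN , _ , pN , qN) = affineOf-injective mM dM pM qM mN dN pN qN

        gs-length : length gs ≡ q²-1
        gs-length = trans (Listₚ.length-map affineOf stab) (trans order (cong (_∸ 1) (trans (sym q²-def) q²≡)))

        gs-≢0 : ∀ {g} → g ∈ gs → a g ≢ 0# × b g ≢ 0#
        gs-≢0 g∈ = go (from-gs g∈)
          where
          go : ∀ {g} → (∃ λ M → InStab F U U? P Q M × g ≡ affineOf M) → a g ≢ 0# × b g ≢ 0#
          go (M , (_ , d , _ , fP , fQ) , refl) = Fixing.a≢0 M d fP fQ , Fixing.b≢0 M d fP fQ

        preserves : ∀ {M} → InStab F U U? P Q M → ∀ X → U X ⇔ U (act F M X)
        preserves (_ , _ , h , _) X = All.lookup h (pts-complete X)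

        gs-S : ∀ {g} → g ∈ gs → ∀ {x y} → S x y → S (a g * x + ξ g) (b g * y + η g)
        gs-S g∈ = go (from-gs g∈)
          where
          go : ∀ {g} → (∃ λ M → InStab F U U? P Q M × g ≡ affineOf M) → ∀ {x y} → S x y → S (a g * x + ξ g) (b g * y + η g)
          go (M , st@(_ , d , _ , fP , fQ) , refl) {x} {y} s = subst U (Fixing.act-affine M d fP fQ x y) (Equivalence.to (preserves {M} st (affinePt x y)) s)

        gs-S⁻ : ∀ {g} → g ∈ gs → ∀ {x y} → S (a g * x + ξ g) (b g * y + η g) → S x y
        gs-S⁻ g∈ = go (from-gs g∈)
          where
          go : ∀ {g} → (∃ λ M → InStab F U U? P Q M × g ≡ affineOf M) → ∀ {x y} → S (a g * x + ξ g) (b g * y + η g) → S x y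
          go (M , st@(_ , d , _ , fP , fQ) , refl) {x} {y} s = Equivalence.from (preserves {M} st (affinePt x y)) (subst U (sym (Fixing.act-affine M d fP fQ x y)) s)

        gs-Sg : ∀ {g} → g ∈ gs → ∀ {m} → Sg m → Sg ((b g * a g ⁻¹) * m)
        gs-Sg g∈ = go (from-gs g∈)
          where
          go : ∀ {g} → (∃ λ M → InStab F U U? P Q M × g ≡ affineOf M) → ∀ {m} → Sg m → Sg ((b g * a g ⁻¹) * m)
          go (M , st@(_ , d , _ , fP , fQ) , refl) {m} s = subst U (Fixing.act-slope M d fP fQ m) (Equivalence.to (preserves {M} st (slopePt m)) s)

        affineData : AffineData
        affineData = record
          { S = S ; S? = S? ; Sg = Sg ; Sg? = Sg? ; line = line ; vertical = vertical ; Sg-0 = P∈ ; Sg-count = Sg-count ; total = total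
          ; gs = gs ; gs-unique = gs-unique ; gs-length = gs-length ; gs-≢0 = gs-≢0
          ; gs-S = λ {g} g∈ → gs-S {g} g∈ ; gs-S⁻ = λ {g} g∈ → gs-S⁻ {g} g∈ ; gs-Sg = λ {g} g∈ → gs-Sg {g} g∈ }

  -- The Hermitian matrix and the conclusion

  module HermitianCurve where
    open FieldArithmetic
    open Duality
    open ProjectivePlane
    open AffineUnital using (AffineData; Hermitian; hermitian)
    open LineCounts
    open StabiliserAction

    open Determinants FR hiding (dot-scale; dot-comb)
    private
      module Dt = Determinants FR

    pow≡bar : ∀ x → pow F x q ≡ bar x
    pow≡bar x = go q
      where
      go : ∀ n → pow F x n ≡ x ^ n
      go zero = refl
      go (suc n) = cong (x *_) (go n)

    bar-dot : ∀ l v → dot (λ i → bar (l i)) (λ i → bar (v i)) ≡ bar (dot l v)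
    bar-dot l v = sym (trans (bar-+ _ _) (cong₂ _+_ (trans (bar-+ _ _) (cong₂ _+_ (bar-* _ _) (bar-* _ _))) (bar-* _ _)))

    bar-det : ∀ p q e → det₃ (λ i → bar (p i)) (λ i → bar (q i)) (λ i → bar (e i)) ≡ bar (det₃ p q e)
    bar-det p q e = sym (trans (bar-+ _ _) (cong₂ _+_ (trans (bar-sub _ _) (cong₂ _-_ (term (p i0) (q i1) (e i2) (q i2) (e i1)) (term (p i1) (q i0) (e i2) (q i2) (e i0)))) (term (p i2) (q i0) (e i1) (q i1) (e i0))))
      where
      term : ∀ a b c d e → bar (a * (b * c - d * e)) ≡ bar a * (bar b * bar c - bar d * bar e)
      term a b c d e = trans (bar-* _ _) (cong (bar a *_) (trans (bar-sub _ _) (cong₂ _-_ (bar-* _ _) (bar-* _ _))))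

    matrix : (Fin 3 → Fin 3 → Carrier) → MatF
    matrix f = (f i0 i0 ∷ f i0 i1 ∷ f i0 i2 ∷ []) ∷ (f i1 i0 ∷ f i1 i1 ∷ f i1 i2 ∷ []) ∷ (f i2 i0 ∷ f i2 i1 ∷ f i2 i2 ∷ []) ∷ []

    entry-matrix : ∀ f i j → entry F (matrix f) i j ≡ f i j
    entry-matrix f i0 i0 = refl
    entry-matrix f i0 i1 = refl
    entry-matrix f i0 i2 = refl
    entry-matrix f i1 i0 = refl
    entry-matrix f i1 i1 = refl
    entry-matrix f i1 i2 = refl
    entry-matrix f i2 i0 = refl
    entry-matrix f i2 i1 = refl
    entry-matrix f i2 i2 = refl

    herm-matrix : ∀ f v → herm F q (matrix f) v ≡ dot v (λ i → dot (f i) (λ j → bar (v j)))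
    herm-matrix f v = cong₂ _+_ (cong₂ _+_ (row-sum i0) (row-sum i1)) (row-sum i2)
      where
      regroup : ∀ v a b c x y z → (v * a * x + v * b * y) + v * c * z ≡ v * ((a * x + b * y) + c * z)
      regroup = solve 7 (λ v a b c x y z → (v :* a :* x :+ v :* b :* y) :+ v :* c :* z := v :* ((a :* x :+ b :* y) :+ c :* z)) refl
      row-sum : ∀ i → sum3 F (λ j → v i * entry F (matrix f) i j * pow F (v j) q) ≡ v i * dot (f i) (λ j → bar (v j))
      row-sum i = trans (cong₂ _+_ (cong₂ _+_ (cell i0) (cell i1)) (cell i2)) (regroup (v i) (f i i0) (f i i1) (f i i2) (bar (v i0)) (bar (v i1)) (bar (v i2)))
        where
        cell : ∀ j → v i * entry F (matrix f) i j * pow F (v j) q ≡ v i * f i j * bar (v j)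
        cell j = cong₂ (λ h w → v i * h * w) (entry-matrix f i j) (pow≡bar (v j))

    -- The form λ (Y X̄ - X Ȳ) - Z Z̄ for λ̄ = - λ.
    module HermitianForm (d : Carrier) (anti : bar d ≡ - d) (d≢0 : d ≢ 0#) (X Y Z : Vec3) (independent : det₃ X Y Z ≢ 0#) where

      conj : Vec3 → Vec3
      conj v i = bar (v i)

      H : Fin 3 → Fin 3 → Carrier
      H = form d X Y Z (conj X) (conj Y) (conj Z)

      hval : Carrier → Carrier → Carrier → Carrier
      hval x y z = (d * y * bar x - d * x * bar y) - z * bar z

      H-hermitian : IsHermitian F q (matrix H)
      H-hermitian i j = trans (entry-matrix H j i) (sym (trans (pow≡bar (entry F (matrix H) i j)) (trans (cong bar (entry-matrix H i j)) conjugate)))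
        where
        triple : ∀ y x → bar (d * y * bar x) ≡ - d * bar y * x
        triple y x = trans (bar-* _ _) (cong₂ _*_ (trans (bar-* d y) (cong (_* bar y) anti)) (bar-bar x))
        conjugate : bar (H i j) ≡ H j i
        conjugate = trans (bar-sub _ _) (trans (cong₂ _-_ (trans (bar-sub _ _) (cong₂ _-_ (triple (Y i) (X j)) (triple (X i) (Y j)))) (trans (bar-* _ _) (cong (bar (Z i) *_) (bar-bar (Z j)))))
          (solve 7 (λ d yi xj xi yj zi zj → (:- d :* yi :* xj :- :- d :* xi :* yj) :- zi :* zj := (d :* yj :* xi :- d :* xj :* yi) :- zj :* zi) refl d (bar (Y i)) (X j) (bar (X i)) (Y j) (bar (Z i)) (Z j)))

      H-det : det F (matrix H) ≢ 0#
      H-det e = *-≢0 (neg≢0 (*-≢0 (*-≢0 d≢0 d≢0) independent)) (λ z → bar-≢0 independent (trans (sym (bar-det X Y Z)) z)) (trans (sym (form-det d X Y Z (conj X) (conj Y) (conj Z))) e)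

      H-value : ∀ v → herm F q (matrix H) v ≡ hval (dot X v) (dot Y v) (dot Z v)
      H-value v = trans (herm-matrix H v) (trans (form-value d X Y Z (conj X) (conj Y) (conj Z) v (conj v))
        (cong₂ _-_ (cong₂ _-_ (cong (d * dot Y v *_) (bar-dot X v)) (cong (d * dot X v *_) (bar-dot Y v))) (cong (dot Z v *_) (bar-dot Z v))))

      hval-scale : ∀ s x y z → hval (s * x) (s * y) (s * z) ≡ (s * bar s) * hval x y z
      hval-scale s x y z = trans (cong₂ _-_ (cong₂ _-_ (cong (d * (s * y) *_) (bar-* s x)) (cong (d * (s * x) *_) (bar-* s y))) (cong (s * z *_) (bar-* s z)))
        (solve 9 (λ d s s' x y z x' y' z' → (d :* (s :* y) :* (s' :* x') :- d :* (s :* x) :* (s' :* y')) :- (s :* z) :* (s' :* z') := (s :* s') :* ((d :* y :* x' :- d :* x :* y') :- z :* z')) refl d s (bar s) x y z (bar x) (bar y) (bar z))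

    module Conclusion (B : Basis) (U : Pt → Set) (U? : ∀ X → Dec (U X)) (unital : IsUnital F q U U?)
        (P∈ : U (Coordinates.slopePt B 0#)) (Q∈ : U (Coordinates.vertPt B))
        (order : stabOrder F U U? (Coordinates.slopePt B 0#) (Coordinates.vertPt B) ≡ q ^ℕ 2 ∸ 1) where
      open Basis B
      open Coordinates B
      open Lines B
      open Stabiliser.Action B U U? unital P∈ Q∈ order using (affineData)
      open Hermitian (hermitian affineData) using (ν₀; μ₀; s; λ₀; s≢0; λ≢0; λ-anti; Sg⇒; ⇒Sg; S⇒; ⇒S)

      -- The centred and rescaled coordinates as covectors; the factor 1 puts both in the shape
      -- required by `det-shear`.
      Xf Yf : Vec3
      Xf i = (xs i - ν₀ * zs i) * 1#
      Yf i = (ys i - μ₀ * zs i) * s ⁻¹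

      -- Its product with the determinant of the basis is the determinant of the identity matrix.
      dual-independent : det₃ xs ys zs ≢ 0#
      dual-independent e = 1≢0 (trans (sym (identity xp xq xe yp yq ye zp zq ze)) (trans (det-product xs ys zs pv qv ev) (trans (cong (_* det₉ (pv i0) (qv i0) (ev i0) (pv i1) (qv i1) (ev i1) (pv i2) (qv i2) (ev i2)) e) (zeroˡ _))))
        where
        identity : ∀ {a b c d e f g h i} → a ≡ 1# → b ≡ 0# → c ≡ 0# → d ≡ 0# → e ≡ 1# → f ≡ 0# → g ≡ 0# → h ≡ 0# → i ≡ 1# → det₉ a b c d e f g h i ≡ 1#
        identity refl refl refl refl refl refl refl refl refl = solve 0 ((:1 :* (:1 :* :1 :- :0 :* :0) :- :0 :* (:0 :* :1 :- :0 :* :0)) :+ :0 :* (:0 :* :0 :- :1 :* :0) := :1) refl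

      independent : det₃ Xf Yf zs ≢ 0#
      independent e = *-≢0 (*-≢0 1≢0 (inv≢0 s≢0)) dual-independent (trans (sym (det-shear 1# (s ⁻¹) ν₀ μ₀ xs ys zs)) e)

      open HermitianForm λ₀ λ-anti λ≢0 Xf Yf zs independent

      h : Carrier → Carrier → Carrier → Carrier
      h x y z = hval ((x - ν₀ * z) * 1#) ((y - μ₀ * z) * s ⁻¹) z

      herm-h : ∀ X → herm F q (matrix H) (cds X) ≡ h (dot xs (cds X)) (dot ys (cds X)) (dot zs (cds X))
      herm-h X = trans (H-value (cds X)) (cong₂ (λ x y → hval x y (dot zs (cds X))) (dot-shear xs zs ν₀ 1# (cds X)) (dot-shear ys zs μ₀ (s ⁻¹) (cds X)))

      h-scale : ∀ t x y z → h (t * x) (t * y) (t * z) ≡ (t * bar t) * h x y z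
      h-scale t x y z = trans (cong₂ (λ u w → hval u w (t * z)) (pull t x ν₀ z 1#) (pull t y μ₀ z (s ⁻¹))) (hval-scale t _ _ _)
        where
        pull : ∀ t x m z c → (t * x - m * (t * z)) * c ≡ t * ((x - m * z) * c)
        pull = solve 5 (λ t x m z c → (t :* x :- m :* (t :* z)) :* c := t :* ((x :- m :* z) :* c)) refl

      -- Rescaling multiplies the form by a nonzero norm, so its vanishing can be tested on any
      -- homogeneous coordinates of the point.
      h-coords : ∀ X {x y z} → HasCoords X x y z → ∃ λ c → c ≢ 0# × h x y z ≡ c * herm F q (matrix H) (cds X)
      h-coords X (t , tn , refl , refl , refl) = t * bar t , *-≢0 tn (bar-≢0 tn) , trans (h-scale t _ _ _) (cong ((t * bar t) *_) (sym (herm-h X)))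

      h⇒herm : ∀ X {x y z} → HasCoords X x y z → h x y z ≡ 0# → herm F q (matrix H) (cds X) ≡ 0#
      h⇒herm X hc e = let (c , cn , eq) = h-coords X hc in domain (trans (sym eq) e) cn

      herm⇒h : ∀ X {x y z} → HasCoords X x y z → herm F q (matrix H) (cds X) ≡ 0# → h x y z ≡ 0#
      herm⇒h X hc e = let (c , cn , eq) = h-coords X hc in trans eq (trans (cong (c *_) e) (zeroʳ c))

      h-affine : ∀ x y → h x y 1# ≡ λ₀ * (bar (x - ν₀) * ((y - μ₀) * s ⁻¹) - (x - ν₀) * bar ((y - μ₀) * s ⁻¹)) - 1#
      h-affine x y = trans (cong₂ (λ u w → hval u w 1#) (trans (*-identityʳ _) (cong (λ w → x - w) (*-identityʳ ν₀))) (cong (λ w → (y - w) * s ⁻¹) (*-identityʳ μ₀)))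
        (trans (cong (λ w → (λ₀ * Y * bar X - λ₀ * X * bar Y) - 1# * w) bar-1)
          (solve 5 (λ d x y x' y' → (d :* y :* x' :- d :* x :* y') :- :1 :* :1 := d :* (x' :* y :- x :* y') :- :1) refl λ₀ X Y (bar X) (bar Y)))
        where
        X Y : Carrier
        X = x - ν₀
        Y = (y - μ₀) * s ⁻¹

      h-slope : ∀ m → h 1# m 0# ≡ λ₀ * (m * s ⁻¹ - bar (m * s ⁻¹))
      h-slope m = trans (cong₂ (λ u w → hval u w 0#) (solve 1 (λ n → (:1 :- n :* :0) :* :1 := :1) refl ν₀) (cong (_* s ⁻¹) (solve 2 (λ m n → m :- n :* :0 := m) refl m μ₀)))
        (trans (cong (λ u → (λ₀ * (m * s ⁻¹) * u - λ₀ * 1# * bar (m * s ⁻¹)) - 0# * bar 0#) bar-1)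
          (solve 4 (λ d y y' z → (d :* y :* :1 :- d :* :1 :* y') :- :0 :* z := d :* (y :- y')) refl λ₀ (m * s ⁻¹) (bar (m * s ⁻¹)) (bar 0#)))

      h-vert : h 0# 1# 0# ≡ 0#
      h-vert = trans (cong (λ u → hval u Y 0#) (solve 1 (λ n → (:0 :- n :* :0) :* :1 := :0) refl ν₀))
        (trans (cong (λ u → (λ₀ * Y * u - λ₀ * 0# * bar Y) - 0# * u) bar-0) (solve 3 (λ d y y' → (d :* y :* :0 :- d :* :0 :* y') :- :0 :* :0 := :0) refl λ₀ Y (bar Y)))
        where
        Y : Carrier
        Y = (1# - μ₀ * 0#) * s ⁻¹

      -- For z = 1 the form is the affine equation of the unital. At slope m it is λ₀ times m/s
      -- minus its conjugate, which vanishes exactly when m/s is real. It also vanishes at the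
      -- vertical point, which is Q.
      absolute : ∀ X → U X ⇔ herm F q (matrix H) (cds X) ≡ 0#
      absolute X = go (kind X)
        where
        go : Kind X → U X ⇔ herm F q (matrix H) (cds X) ≡ 0#
        go (is-affine x y refl) = mk⇔
          (λ u → h⇒herm X (affine-coords x y) (trans (h-affine x y) (trans (cong (_- 1#) (S⇒ x y u)) (-‿inverseʳ 1#))))
          (λ e → ⇒S x y (x-y≡0 (trans (sym (h-affine x y)) (herm⇒h X (affine-coords x y) e))))
        go (is-slope m refl) = mk⇔
          (λ u → h⇒herm X (slope-coords m) (trans (h-slope m) (trans (cong (λ w → λ₀ * (m * s ⁻¹ - w)) (Sg⇒ m u)) (trans (cong (λ₀ *_) (-‿inverseʳ (m * s ⁻¹))) (zeroʳ λ₀)))))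
          (λ e → ⇒Sg m (sym (x-y≡0 (domain (trans (sym (h-slope m)) (herm⇒h X (slope-coords m) e)) λ≢0))))
        go (is-vert refl) = mk⇔ (λ _ → h⇒herm X vert-coords h-vert) (λ _ → Q∈)

      classical : IsClassical F q U
      classical = matrix H , H-hermitian , H-det , absolute

    cross-nonzero : ∀ P Q → P ≢ Q → NonZero3 (cross (cds P) (cds Q))
    cross-nonzero (pt₁ x y) (pt₁ x' y') ne h = ne (cong₂ pt₁ (sym (x-y≡0 (trans (solve 2 (λ x x' → x' :- x := :1 :* x' :- x :* :1) refl x x') (h i2)))) (x-y≡0 (trans (solve 2 (λ y y' → y :- y' := y :* :1 :- :1 :* y') refl y y') (h i1))))
    cross-nonzero (pt₁ x y) (pt₂ x') ne h = 1≢0 (trans (solve 1 (λ x → :1 := :1 :* :1 :- x :* :0) refl x) (h i2))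
    cross-nonzero (pt₁ x y) pt₃ ne h = neg≢0 1≢0 (trans (solve 1 (λ y → :- :1 := y :* :0 :- :1 :* :1) refl y) (h i1))
    cross-nonzero (pt₂ x) (pt₁ x' y') ne h = neg≢0 1≢0 (trans (solve 1 (λ x → :- :1 := :0 :* x :- :1 :* :1) refl x') (h i2))
    cross-nonzero (pt₂ x) (pt₂ x') ne h = ne (cong pt₂ (sym (x-y≡0 (trans (solve 2 (λ x x' → x' :- x := :1 :* x' :- x :* :1) refl x x') (h i0)))))
    cross-nonzero (pt₂ x) pt₃ ne h = 1≢0 (trans (solve 1 (λ x → :1 := :1 :* :1 :- x :* :0) refl x) (h i0))
    cross-nonzero pt₃ (pt₁ x' y') ne h = 1≢0 (trans (solve 1 (λ y → :1 := :1 :* :1 :- :0 :* y) refl y') (h i1))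
    cross-nonzero pt₃ (pt₂ x') ne h = neg≢0 1≢0 (trans (solve 1 (λ x → :- :1 := :0 :* x :- :1 :* :1) refl x') (h i0))
    cross-nonzero pt₃ pt₃ ne h = ne refl

    nonzero-entry : ∀ {v} → NonZero3 v → ∃ λ i → v i ≢ 0#
    nonzero-entry {v} nv with v i0 ≟ 0# | v i1 ≟ 0# | v i2 ≟ 0#
    ... | no n0 | _ | _ = i0 , n0
    ... | yes _ | no n1 | _ = i1 , n1
    ... | yes _ | yes _ | no n2 = i2 , n2
    ... | yes z0 | yes z1 | yes z2 = ⊥-elim (nv (∀3 z0 z1 z2))

    module FromVectors (pv qv ev : Vec3) (Δ≢0 : det₃ pv qv ev ≢ 0#) where
      Δ : Carrier
      Δ = det₃ pv qv ev

      dual : Vec3 → Vec3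
      dual l i = l i * Δ ⁻¹

      dual-1 : ∀ l v → dot l v ≡ Δ → dot (dual l) v ≡ 1#
      dual-1 l v e = trans (Dt.dot-scaleˡ l v (Δ ⁻¹)) (trans (cong (_* Δ ⁻¹) e) (inv-r Δ≢0))

      dual-0 : ∀ l v → dot l v ≡ 0# → dot (dual l) v ≡ 0#
      dual-0 l v e = trans (Dt.dot-scaleˡ l v (Δ ⁻¹)) (trans (cong (_* Δ ⁻¹) e) (zeroˡ _))

      expand : ∀ v i → v i ≡ (dot (dual (cross qv ev)) v * pv i + dot (dual (cross ev pv)) v * qv i) + dot (dual (cross pv qv)) v * ev i
      expand v i = sym (trans (cong₂ _+_ (cong₂ _+_ (cong (_* pv i) (Dt.dot-scaleˡ (cross qv ev) v (Δ ⁻¹))) (cong (_* qv i) (Dt.dot-scaleˡ (cross ev pv) v (Δ ⁻¹)))) (cong (_* ev i) (Dt.dot-scaleˡ (cross pv qv) v (Δ ⁻¹))))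
        (trans (regroup (dot (cross qv ev) v) (dot (cross ev pv) v) (dot (cross pv qv) v) (Δ ⁻¹) (pv i) (qv i) (ev i))
        (trans (cong (Δ ⁻¹ *_) (cramer pv qv ev v i)) (trans (sym (*-assoc _ _ _)) (trans (cong (_* v i) (inv-l Δ≢0)) (*-identityˡ _))))))
        where
        regroup : ∀ x y z t p q e → (x * t * p + y * t * q) + z * t * e ≡ t * ((x * p + y * q) + z * e)
        regroup = solve 7 (λ x y z t p q e → (x :* t :* p :+ y :* t :* q) :+ z :* t :* e := t :* ((x :* p :+ y :* q) :+ z :* e)) refl

      basis : Basis
      basis = record
        { pv = pv ; qv = qv ; ev = ev ; xs = dual (cross qv ev) ; ys = dual (cross ev pv) ; zs = dual (cross pv qv)
        ; xp = dual-1 (cross qv ev) pv (dot-cross pv qv ev)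
        ; xq = dual-0 (cross qv ev) qv (dot-crossˡ qv ev)
        ; xe = dual-0 (cross qv ev) ev (dot-crossʳ qv ev)
        ; yp = dual-0 (cross ev pv) pv (dot-crossʳ ev pv)
        ; yq = dual-1 (cross ev pv) qv (trans (dot-cross qv ev pv) (det-cycle pv qv ev))
        ; ye = dual-0 (cross ev pv) ev (dot-crossˡ ev pv)
        ; zp = dual-0 (cross pv qv) pv (dot-crossˡ pv qv)
        ; zq = dual-0 (cross pv qv) qv (dot-crossʳ pv qv)
        ; ze = dual-1 (cross pv qv) ev (trans (dot-cross ev pv qv) (sym (det-cycle ev pv qv)))
        ; decompose = expand }

    -- Some coordinate of the cross product of P and Q is nonzero; the unit vector of that index
    -- completes P and Q to a basis.
    basis-through : ∀ P Q → P ≢ Q → ∃ λ B → Coordinates.slopePt B 0# ≡ P × Coordinates.vertPt B ≡ Q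
    basis-through P Q ne = go (nonzero-entry {cross (cds P) (cds Q)} (cross-nonzero P Q ne))
      where
      go : (∃ λ i → cross (cds P) (cds Q) i ≢ 0#) → ∃ λ B → Coordinates.slopePt B 0# ≡ P × Coordinates.vertPt B ≡ Q
      go (i , n) = FV.basis , normalise-≡ {P} {C.comb 1# 0# 0#} (1# , 1≢0 , λ i → solve 3 (λ p q e → (:1 :* p :+ :0 :* q) :+ :0 :* e := :1 :* p) refl (cds P i) (cds Q i) (e i))
          , normalise-≡ {Q} {C.comb 0# 1# 0#} (1# , 1≢0 , λ i → solve 3 (λ p q e → (:0 :* p :+ :1 :* q) :+ :0 :* e := :1 :* q) refl (cds P i) (cds Q i) (e i))
        where
        e : Vec3
        e = unit i
        module FV = FromVectors (cds P) (cds Q) e (λ z → n (trans (sym (dot-unit (cross (cds P) (cds Q)) i)) (trans (dot-cross e (cds P) (cds Q)) (trans (sym (det-cycle e (cds P) (cds Q))) z))))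
        module C = Coordinates FV.basis

    unital-classical : (U : Pt → Set) (U? : ∀ X → Dec (U X)) → IsUnital F q U U? → ∀ P Q → U P → U Q → P ≢ Q → stabOrder F U U? P Q ≡ q ^ℕ 2 ∸ 1 → IsClassical F q U
    unital-classical U U? unital P Q P∈ Q∈ ne order = go (basis-through P Q ne) P∈ Q∈ order
      where
      go : ∀ {P Q} → (∃ λ B → Coordinates.slopePt B 0# ≡ P × Coordinates.vertPt B ≡ Q) → U P → U Q → stabOrder F U U? P Q ≡ q ^ℕ 2 ∸ 1 → IsClassical F q U
      go (B , refl , refl) P∈ Q∈ order = Conclusion.classical B U U? unital P∈ Q∈ order

  open HermitianCurve public using (unital-classical)

open import Data.Nat using (_^_)
open import Relation.Unary using (Decidable)

-- Excludes q = 0 and q = 1, so that q can be written as r + 2.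
prime-power≥2 : ∀ {p} → Prime p → ∀ k → 2 ≤ p ^ suc k
prime-power≥2 {p} pp k = ℕₚ.≤-trans p≥2 (ℕₚ.m≤m*n p (p ^ k) ⦃ ℕₚ.m^n≢0 p k ⦃ Data.Nat.>-nonZero (ℕₚ.≤-trans (s≤s z≤n) p≥2) ⦄ ⦄)
  where
  p≥2 : 2 ≤ p
  p≥2 = nonTrivial⇒n>1 p ⦃ prime⇒nonTrivial pp ⦄

theorem3p1 : (q : ℕ) → IsPrimePower q → (F : FiniteField (q ^ 2))
    → (U : PointSet F) (U? : Decidable U) → IsUnital F q U U?
    → (P Q : Point F) → U P → U Q → P ≢ Q
    → stabOrder F U U? P Q ≡ q ^ 2 ∸ 1
    → IsClassical F q U
theorem3p1 (suc (suc r)) (p , suc k , pp , _ , q≡p^k) F = unital-classical r p k pp q≡p^k F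
theorem3p1 zero (p , suc k , pp , _ , e) = ⊥-elim (ℕₚ.n≮0 (subst (2 ≤_) (sym e) (prime-power≥2 pp k)))
theorem3p1 (suc zero) (p , suc k , pp , _ , e) = ⊥-elim (ℕₚ.<-irrefl refl (subst (2 ≤_) (sym e) (prime-power≥2 pp k)))
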